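{- Let $\mathbb{F}_q$ be a fixed finite field. There is a constant $C\geq 1$ (depending only on $q$) such that the following holds. Let $K_1,K_2\geq 2$. If $A\subseteq\mathbb{F}_q[t]$ is a finite set such that \[|A+\lambda A|\leq K_1|A| \text{ for all } \lambda\in\mathbb{F}_q \quad\text{and}\quad |A+tA|\leq K_2|A|,\] then there is a generalised $\mathbb{F}_q[t]$-progression $P\subseteq\langle A\rangle$ of rank at most $C\log(K_1K_2)$ and size \[(K_1K_2)^{ -C}|A|\leq |P|\leq K_1^{C}|A|\] such that (1) $A\subseteq P+X$ for some finite set $X\subseteq\mathbb{F}_q[t]$ with $|X|\leq (K_1K_2)^{C}$, and (2) $P\subseteq A-A+X'$ for some finite set $X'\subseteq P$ with $|X'|\leq K_1^{C}$.
   Context: For sets $A,B$ and an element $\lambda$, $A+B=\{a+b:a\in A,b\in B\}$, $A-B=\{a-b:a\in A,b\in B\}$, and $\lambda A=\{\lambda a:a\in A\}$. For a finite set $A\subseteq\mathbb{F}_q[t]$, $\langle A\rangle$ is the $\mathbb{F}_q$-vector space spanned by $A$. For $n\geq1$ let $[n]=\{x\in\mathbb{F}_q[t]:\deg x<n\}$. A generalised $\mathbb{F}_q[t]$-progression of rank at most $d$ is a set of the form $x_0+[n_1]\cdot x_1+\cdots+[n_d]\cdot x_d=\{x_0+a_1x_1+\cdots+a_dx_d:a_i\in[n_i]\}$ for some integers $n_1,\ldots,n_d\geq1$ and $x_0,\ldots,x_d\in\mathbb{F}_q[t]$. The implicit constants may depend on $q$ and its characteristic. -}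

module Defs where

open import Level using (Level; suc; zero)
open import Data.Bool using (Bool; true; false)
open import Data.Nat as ℕ using (ℕ; _≤_)
open import Data.Integer using (+_)
open import Data.Rational as ℚ using (ℚ; 1ℚ; _/_)
open import Data.Product using (Σ; ∃; ∃-syntax; _×_; _,_)
open import Data.Unit using (⊤; tt)
open import Data.List using (List; []; _∷_; length; deduplicate; cartesianProductWith)
open import Data.List.Properties using (≡-dec)
open import Data.List.Membership.Propositional using (_∈_)
open import Relation.Nullary using (¬_; Dec; yes; no)
open import Relation.Binary.PropositionalEquality using (_≡_; refl; cong)
open import Relation.Binary.Definitions using (DecidableEquality)
open import Algebra.Structures using (IsCommutativeRing)

ℕ→ℚ : ℕ → ℚ
ℕ→ℚ n = + n / 1

_^ℚ_ : ℚ → ℕ → ℚ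
x ^ℚ ℕ.zero = 1ℚ
x ^ℚ ℕ.suc n = x ℚ.* (x ^ℚ n)

record FiniteField : Set₁ where
  infixl 6 _+_
  infixl 7 _*_
  field
    F      : Set
    _+_    : F → F → F
    _*_    : F → F → F
    -_     : F → F
    0#     : F
    1#     : F
    isCommutativeRing : IsCommutativeRing _≡_ _+_ _*_ -_ 0# 1#
    0≢1    : ¬ (0# ≡ 1#)
    inverse : ∀ x → ¬ (x ≡ 0#) → ∃[ y ] (x * y ≡ 1#)
    _≟_    : DecidableEquality F
    elements : List F
    complete : ∀ x → x ∈ elements

-- The polynomial ring 𝔽[t], elements stored as little-endian coefficient
-- lists with nonzero last (= leading) coefficient.  The zero polynomial is [].

module PolyRing (𝔽 : FiniteField) where
  open FiniteField 𝔽

  Normal : List F → Set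
  Normal []           = ⊤
  Normal (x ∷ [])     = ¬ (x ≡ 0#)
  Normal (_ ∷ y ∷ ys) = Normal (y ∷ ys)

  record Poly : Set where
    constructor mkPoly
    field
      coeffs  : List F
      .normal : Normal coeffs
  open Poly public

  _≟P_ : DecidableEquality Poly
  mkPoly xs _ ≟P mkPoly ys _ with ≡-dec _≟_ xs ys
  ... | yes refl = yes refl
  ... | no ne    = no (λ e → ne (cong coeffs e))

  private
    single : (x : F) → Dec (x ≡ 0#) → Poly
    single x (yes _) = mkPoly [] tt
    single x (no nz) = mkPoly (x ∷ []) nz

    cons : F → Poly → Poly
    cons x (mkPoly [] _)       = single x (x ≟ 0#)
    cons x (mkPoly (y ∷ ys) p) = mkPoly (x ∷ y ∷ ys) p

  norm : List F → Poly
  norm []       = mkPoly [] tt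
  norm (x ∷ xs) = cons x (norm xs)

  addL : List F → List F → List F
  addL []       ys       = ys
  addL (x ∷ xs) []       = x ∷ xs
  addL (x ∷ xs) (y ∷ ys) = (x + y) ∷ addL xs ys

  scaleL : F → List F → List F
  scaleL c []       = []
  scaleL c (x ∷ xs) = (c * x) ∷ scaleL c xs

  mulL : List F → List F → List F
  mulL []       ys = []
  mulL (x ∷ xs) ys = addL (scaleL x ys) (0# ∷ mulL xs ys)

  0P : Poly
  0P = mkPoly [] tt

  tP : Poly
  tP = norm (0# ∷ 1# ∷ [])

  _+P_ : Poly → Poly → Poly
  p +P q = norm (addL (coeffs p) (coeffs q))

  -P_ : Poly → Poly
  -P p = norm (scaleL (- 1#) (coeffs p))

  _-P_ : Poly → Poly → Poly
  p -P q = p +P (-P q)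

  _*P_ : Poly → Poly → Poly
  p *P q = norm (mulL (coeffs p) (coeffs q))

  _·P_ : F → Poly → Poly
  c ·P p = norm (scaleL c (coeffs p))

  -- deg p < n   (with deg 0 = -∞)
  DegLt : Poly → ℕ → Set
  DegLt p n = length (coeffs p) ≤ n

  -- finite sets of polynomials are given as lists; cardinality = number of
  -- distinct entries.

  card : List Poly → ℕ
  card xs = length (deduplicate _≟P_ xs)

  sumDil : List Poly → F → List Poly → List Poly
  sumDil A c B = cartesianProductWith (λ a b → a +P (c ·P b)) A B

  sumTDil : List Poly → List Poly → List Poly
  sumTDil A B = cartesianProductWith (λ a b → a +P (tP *P b)) A B

  InSpan : List Poly → Poly → Set
  InSpan []       y = y ≡ 0P
  InSpan (a ∷ as) y = ∃[ c ] InSpan as (y -P (c ·P a))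

  -- generalised 𝔽[t]-progressions  x₀ + [n₁]·x₁ + ⋯ + [n_d]·x_d

  record GenProg : Set where
    constructor genProg
    field
      base : Poly
      gens : List (ℕ × Poly)
      pos  : ∀ {n x} → (n , x) ∈ gens → 1 ≤ n
  open GenProg public

  rank : GenProg → ℕ
  rank P = length (gens P)

  private
    InGP' : Poly → List (ℕ × Poly) → Poly → Set
    InGP' x₀ []             y = y ≡ x₀
    InGP' x₀ ((n , x) ∷ gs) y = ∃[ a ] (DegLt a n × InGP' x₀ gs (y -P (a *P x)))

  _∈GP_ : Poly → GenProg → Set
  y ∈GP P = InGP' (base P) (gens P) y

  HasCard : GenProg → ℕ → Set
  HasCard P m = Σ (List Poly) λ L →
      length L ≡ m
    × (∀ y → y ∈ L → y ∈GP P)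
    × (∀ y → y ∈GP P → y ∈ L)
    × card L ≡ length L

{-# OPTIONS --safe #-}
module Submission where

-- The core is Marton's conjecture for the group F_q[t], whose torsion is bounded, by the entropy
-- method of Gowers, Green, Manners and Tao.  The doubling of a random variable X is measured by
-- H(X₁ + ⋯ + Xₙ) − H(X) for independent copies of X, where n annihilates the group.  If it is large,
-- an n × n array of copies contains a sum which, conditioned on other sums, has doubling smaller by a
-- constant factor and is still close to X; if it is bounded, a level set of a conditioned copy of X has
-- bounded doubling and lies near a subgroup by Freiman's theorem.  Iterating, a large piece A₀ of A lies
-- in a coset of a subgroup H of comparable size, with losses polynomial in K₁.
--
-- Since |A + λA| is small, λH is covered by few translates of H, so that the F_q-span V of A₀ − A₀ is
-- not much larger than H, and Ruzsa's covering lemma relates A and V.  Finally V is a progression: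
-- V' = {v ∈ V : tv ∈ V} is smaller than V, so V' = Σ [nᵢ]·xᵢ by induction, V' + tV' = Σ [nᵢ + 1]·xᵢ ⊆ V, and
-- each further generator needed to fill V doubles the size.  With |V|² ≤ |V + tV| |V'| this yields
-- 2^rank |V| ≤ |V + tV|.

-- Logarithms are not rational, so the information of a probability is the integer part of a binary
-- logarithm. Every entropy inequality then carries an additive constant, and this shapes the proof:
-- the doubling can be lowered only while it exceeds a threshold, 1300 n², below which the
-- combinatorial argument takes over; in the end the constants are absorbed because K₁ ≥ 2. The loss
-- stays polynomial because a round that starts from doubling D moves X by a multiple of D and
-- lowers D by at least D / (100 n²). The movements telescope to a multiple of the first D, itself
-- of order log K₁. In the array, U = Σ i X_ij, V = Σ j X_ij and U + V have the same law jointly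
-- with the total Σ X_ij: the array may be transposed, and by torsion adding i to the coefficients
-- 0, ..., n - 1 of row i permutes them. U depends on the row sums and V on the column sums. If
-- neither a conditioned copy nor the n-fold sum has smaller doubling, row and column sums are
-- nearly independent given the total. U, V and U + V then have equal entropy and are nearly
-- independent in pairs, and U conditioned on U + V and the total has small doubling.

open import Defs
open import Data.Nat as ℕ using (ℕ; zero; suc; z≤n; s≤s)
import Data.Nat.Properties as ℕP
import Data.Nat.DivMod as DM
open import Data.Integer as ℤ using (ℤ; +_; -[1+_])
import Data.Integer.Properties as ℤP
open import Data.Rational as ℚ using (ℚ)
import Data.Rational.Properties as ℚP
import Data.Rational.Unnormalised as ℚᵘ
import Data.Rational.Unnormalised.Properties as ℚᵘP
open import Data.Bool using (Bool; true; false; if_then_else_) renaming (T to IsTrue)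
import Data.Bool.Properties as BoolP
open import Data.Unit using (⊤; tt)
import Data.Unit.Properties as ⊤P
open import Data.Empty using (⊥; ⊥-elim)
open import Data.Empty.Irrelevant using () renaming (⊥-elim to ⊥-elim-irr)
open import Data.Product using (Σ; ∃; ∃-syntax; _×_; _,_; proj₁; proj₂)
import Data.Product.Properties as ΣP
open import Data.Sum using (_⊎_; inj₁; inj₂)
open import Data.Fin as Fin using (Fin; toℕ)
import Data.Fin.Properties as FinP
open import Data.List as List using (List; []; _∷_; _++_; concatMap)
import Data.List.Properties as ListP
open import Data.List.Relation.Unary.Any as Any using (here; there)
open import Data.List.Relation.Unary.All as All using (All; []; _∷_)
import Data.List.Relation.Unary.All.Properties as AllP
import Data.List.Relation.Unary.AllPairs as AllPairs
open AllPairs using ([]; _∷_)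
open import Data.List.Relation.Unary.Unique.Propositional using (Unique)
import Data.List.Relation.Unary.Unique.Propositional.Properties as UniqueP
import Data.List.Relation.Unary.Unique.DecPropositional.Properties as UniqueDP
open import Data.List.Membership.Propositional using (_∈_; find)
import Data.List.Membership.Propositional.Properties as ∈P
import Data.List.Membership.Setoid.Properties as ∈SP
import Data.List.Membership.DecPropositional as DecMem
open import Data.List.Relation.Binary.Permutation.Propositional as Perm using (_↭_)
import Data.List.Relation.Binary.Permutation.Propositional.Properties as PermP
open import Algebra.Bundles using (CommutativeRing)
import Algebra.Properties.Ring
import Algebra.Properties.CommutativeSemigroup
open import Function using (_∘_; id)
open import Relation.Nullary using (¬_; Dec; yes; no; does)
open import Relation.Nullary.Decidable using (_×-dec_; ¬?)
open import Relation.Binary.Definitions using (DecidableEquality)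
open import Relation.Binary.PropositionalEquality using (_≡_; _≢_; refl; sym; trans; cong; cong₂; subst; subst₂; setoid; module ≡-Reasoning)

-- ℚ is made opaque because its operations normalise fractions, which would unfold everywhere.
infixl 6 _+ᵣ_ _-ᵣ_
infixl 7 _*ᵣ_
infix 8 -ᵣ_
infix 9 #_
infix 4 _≤ᵣ_ _<ᵣ_

opaque
  R : Set
  R = ℚ

  _+ᵣ_ _*ᵣ_ : R → R → R
  _+ᵣ_ = ℚ._+_
  _*ᵣ_ = ℚ._*_

  -ᵣ_ : R → R
  -ᵣ_ = ℚ.-_

  ι : ℤ → R
  ι z = z ℚ./ 1

  _≤ᵣ_ _<ᵣ_ : R → R → Set
  _≤ᵣ_ = ℚ._≤_
  _<ᵣ_ = ℚ._<_

#_ : ℕ → R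
# n = ι (+ n)

_-ᵣ_ : R → R → R
a -ᵣ b = a +ᵣ -ᵣ b

private
  ι-toℚᵘ : ∀ z → ℚ.toℚᵘ (z ℚ./ 1) ℚᵘ.≃ (z ℚᵘ./ 1)
  ι-toℚᵘ (+ n) = ℚᵘP.≃-reflexive (cong ℚ.toℚᵘ (ℚP.normalize-coprime {n} {0} (C.sym (C.1-coprimeTo n))))
    where import Data.Nat.Coprimality as C
  ι-toℚᵘ (-[1+ n ]) = ℚᵘP.≃-trans (ℚP.toℚᵘ-homo‿- ((+ suc n) ℚ./ 1))
    (ℚᵘP.-‿cong (ι-toℚᵘ (+ suc n)))

opaque
  unfolding R

  ι-+ : ∀ a b → ι (a ℤ.+ b) ≡ ι a +ᵣ ι b
  ι-+ a b = ℚP.toℚᵘ-injective (ℚᵘP.≃-trans (ι-toℚᵘ (a ℤ.+ b)) (ℚᵘP.≃-trans eq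
      (ℚᵘP.≃-trans (ℚᵘP.≃-sym (ℚᵘP.+-cong (ι-toℚᵘ a) (ι-toℚᵘ b)))
        (ℚᵘP.≃-sym (ℚP.toℚᵘ-homo-+ (ι a) (ι b))))))
    where
    eq : ((a ℤ.+ b) ℚᵘ./ 1) ℚᵘ.≃ ((a ℚᵘ./ 1) ℚᵘ.+ (b ℚᵘ./ 1))
    eq = ℚᵘ.*≡* (trans (ℤP.*-identityʳ _) (sym (trans (ℤP.*-identityʳ _)
      (cong₂ ℤ._+_ (ℤP.*-identityʳ a) (ℤP.*-identityʳ b)))))

  ι-* : ∀ a b → ι (a ℤ.* b) ≡ ι a *ᵣ ι b
  ι-* a b = ℚP.toℚᵘ-injective (ℚᵘP.≃-trans (ι-toℚᵘ (a ℤ.* b)) (ℚᵘP.≃-trans (ℚᵘ.*≡* refl)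
      (ℚᵘP.≃-trans (ℚᵘP.≃-sym (ℚᵘP.*-cong (ι-toℚᵘ a) (ι-toℚᵘ b)))
        (ℚᵘP.≃-sym (ℚP.toℚᵘ-homo-* (ι a) (ι b))))))

  +-assoc : ∀ a b c → (a +ᵣ b) +ᵣ c ≡ a +ᵣ (b +ᵣ c)
  +-assoc = ℚP.+-assoc
  +-comm : ∀ a b → a +ᵣ b ≡ b +ᵣ a
  +-comm = ℚP.+-comm
  +-0ˡ : ∀ a → # 0 +ᵣ a ≡ a
  +-0ˡ = ℚP.+-identityˡ
  +-inv : ∀ a → a +ᵣ -ᵣ a ≡ # 0
  +-inv = ℚP.+-inverseʳ
  *-assoc : ∀ a b c → (a *ᵣ b) *ᵣ c ≡ a *ᵣ (b *ᵣ c)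
  *-assoc = ℚP.*-assoc
  *-comm : ∀ a b → a *ᵣ b ≡ b *ᵣ a
  *-comm = ℚP.*-comm
  *-1ˡ : ∀ a → # 1 *ᵣ a ≡ a
  *-1ˡ = ℚP.*-identityˡ
  *-0ˡ : ∀ a → # 0 *ᵣ a ≡ # 0
  *-0ˡ = ℚP.*-zeroˡ
  distribˡ : ∀ a b c → a *ᵣ (b +ᵣ c) ≡ a *ᵣ b +ᵣ a *ᵣ c
  distribˡ = ℚP.*-distribˡ-+

  ≤-refl : ∀ {a} → a ≤ᵣ a
  ≤-refl = ℚP.≤-refl
  ≤-trans : ∀ {a b c} → a ≤ᵣ b → b ≤ᵣ c → a ≤ᵣ c
  ≤-trans = ℚP.≤-trans
  ≤-antisym : ∀ {a b} → a ≤ᵣ b → b ≤ᵣ a → a ≡ b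
  ≤-antisym = ℚP.≤-antisym
  +-mono : ∀ {a b c d} → a ≤ᵣ b → c ≤ᵣ d → a +ᵣ c ≤ᵣ b +ᵣ d
  +-mono = ℚP.+-mono-≤
  *-monoˡ : ∀ c {a b} → # 0 ≤ᵣ c → a ≤ᵣ b → c *ᵣ a ≤ᵣ c *ᵣ b
  *-monoˡ c p = ℚP.*-monoˡ-≤-nonNeg c {{ℚ.nonNegative p}}
  *-cancelˡ : ∀ c {a b} → # 0 <ᵣ c → c *ᵣ a ≤ᵣ c *ᵣ b → a ≤ᵣ b
  *-cancelˡ c p = ℚP.*-cancelˡ-≤-pos c {{ℚ.positive p}}
  infix 4 _≤?_
  _≤?_ : ∀ a b → Dec (a ≤ᵣ b)
  _≤?_ = ℚP._≤?_
  ≰⇒> : ∀ {a b} → ¬ (a ≤ᵣ b) → b <ᵣ a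
  ≰⇒> = ℚP.≰⇒>
  <⇒≤ : ∀ {a b} → a <ᵣ b → a ≤ᵣ b
  <⇒≤ = ℚP.<⇒≤
  <⇒≱ : ∀ {a b} → a <ᵣ b → ¬ (b ≤ᵣ a)
  <⇒≱ p q = ℚP.<-irrefl refl (ℚP.<-≤-trans p q)
  *-pos : ∀ {a b} → # 0 <ᵣ a → # 0 <ᵣ b → # 0 <ᵣ a *ᵣ b
  *-pos {a} {b} p q = ℚP.positive⁻¹ (a ℚ.* b) {{ℚP.pos*pos⇒pos a {{ℚ.positive p}} b {{ℚ.positive q}}}}

  ι-pos : ∀ n → # 0 <ᵣ # suc n
  ι-pos n = ℚP.positive⁻¹ _ {{ℚP.normalize-pos (suc n) 1}}

  -- Total, with value 0 away from the positive numbers, so that an expression may divide by a mass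
  -- without carrying a proof; positivity is asked for only when the quotient is cancelled by
  -- `inv-r`.
  inv : R → R
  inv x with ℚ.0ℚ ℚP.<? x
  ... | yes p = (ℚ.1/ x) {{ℚ.>-nonZero p}}
  ... | no _  = ℚ.0ℚ

  inv-r : ∀ {x} → # 0 <ᵣ x → x *ᵣ inv x ≡ # 1
  inv-r {x} p with ℚ.0ℚ ℚP.<? x
  ... | yes q = ℚP.*-inverseʳ x {{ℚ.>-nonZero q}}
  ... | no q = ⊥-elim (q p)

  inv-≥0 : ∀ x → # 0 ≤ᵣ inv x
  inv-≥0 x with ℚ.0ℚ ℚP.<? x
  ... | yes q = ℚP.<⇒≤ (ℚP.positive⁻¹ _ {{ℚP.1/pos⇒pos x {{ℚ.positive q}}}})
  ... | no _ = ℚP.≤-refl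

  archimedean : ∀ x → ∃[ n ] (x ≤ᵣ # n)
  archimedean x@(ℚ.mkℚ n d _) = ℤ.∣ n ∣ , ℚP.toℚᵘ-cancel-≤ (ℚᵘP.≤-trans (ℚᵘ.*≤* le) (ℚᵘP.≤-reflexive (ℚᵘP.≃-sym (ι-toℚᵘ (+ ℤ.∣ n ∣)))))
    where
    n≤ : ∀ n → n ℤ.≤ + ℤ.∣ n ∣
    n≤ (+ n) = ℤP.≤-refl
    n≤ (-[1+ n ]) = ℤ.-≤+
    le : n ℤ.* (+ 1) ℤ.≤ (+ ℤ.∣ n ∣) ℤ.* (+ suc d)
    le = ℤP.≤-trans (ℤP.≤-reflexive (ℤP.*-identityʳ n)) (ℤP.≤-trans (n≤ n)
      (ℤP.≤-trans (ℤP.≤-reflexive (sym (ℤP.*-identityʳ _)))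
        (ℤP.*-monoˡ-≤-nonNeg (+ ℤ.∣ n ∣) (ℤ.+≤+ (s≤s z≤n)))))

≤-reflexive : ∀ {a b} → a ≡ b → a ≤ᵣ b
≤-reflexive refl = ≤-refl

-- A checker for consequences of polynomial inequalities: a goal a ≤ b is accepted when
-- d (b - a) is a given ℕ-combination of the hypotheses plus a nonnegative constant.
module Checker where
  infixl 8 _:+_ _:-_
  infixl 9 _:*_
  infix 7 _:≤_ _:=_
  infix 3 _⊢_

  data Ex (n : ℕ) : Set where
    var : Fin n → Ex n
    con : ℕ → Ex n
    _:+_ _:-_ _:*_ : Ex n → Ex n → Ex n

  -- A nested product, so that eta expands an unknown valuation into separate unknowns; unifying the
  -- goal with `Claim` then finds the value of every variable.
  Tup : ℕ → Set
  Tup zero = ⊤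
  Tup (suc n) = R × Tup n

  look : ∀ {n} → Tup n → Fin n → R
  look (x , _) Fin.zero = x
  look (_ , ρ) (Fin.suc i) = look ρ i

  ev : ∀ {n} → Ex n → Tup n → R
  ev (var i) ρ = look ρ i
  ev (con k) ρ = # k
  ev (a :+ b) ρ = ev a ρ +ᵣ ev b ρ
  ev (a :- b) ρ = ev a ρ -ᵣ ev b ρ
  ev (a :* b) ρ = ev a ρ *ᵣ ev b ρ

  Mono : ℕ → Set
  Mono n = List (Fin n)
  NF : ℕ → Set
  NF n = List (ℤ × Mono n)

  evM : ∀ {n} → Mono n → Tup n → R
  evM [] ρ = # 1
  evM (i ∷ m) ρ = look ρ i *ᵣ evM m ρ

  evN : ∀ {n} → NF n → Tup n → R
  evN [] ρ = # 0
  evN ((c , m) ∷ p) ρ = ι c *ᵣ evM m ρ +ᵣ evN p ρ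

  ins : ∀ {n} → Fin n → Mono n → Mono n
  ins i [] = i ∷ []
  ins i (j ∷ m) = if Fin.toℕ i ℕ.≤ᵇ Fin.toℕ j then i ∷ j ∷ m else j ∷ ins i m

  mulM : ∀ {n} → Mono n → Mono n → Mono n
  mulM [] m' = m'
  mulM (i ∷ m) m' = ins i (mulM m m')

  eqM : ∀ {n} → (m m' : Mono n) → Dec (m ≡ m')
  eqM = ListP.≡-dec FinP._≟_

  addT : ∀ {n} → ℤ → Mono n → NF n → NF n
  addT c m [] = (c , m) ∷ []
  addT c m ((c' , m') ∷ p) with eqM m m'
  ... | yes _ = (c ℤ.+ c' , m') ∷ p
  ... | no _ = (c' , m') ∷ addT c m p

  addN : ∀ {n} → NF n → NF n → NF n
  addN [] q = q
  addN ((c , m) ∷ p) q = addT c m (addN p q)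

  mulT : ∀ {n} → ℤ → Mono n → NF n → NF n
  mulT c m [] = []
  mulT c m ((c' , m') ∷ p) = addT (c ℤ.* c') (mulM m m') (mulT c m p)

  mulN : ∀ {n} → NF n → NF n → NF n
  mulN [] q = []
  mulN ((c , m) ∷ p) q = addN (mulT c m q) (mulN p q)

  nf : ∀ {n} → Ex n → NF n
  nf (var i) = (+ 1 , i ∷ []) ∷ []
  nf (con k) = (+ k , []) ∷ []
  nf (a :+ b) = addN (nf a) (nf b)
  nf (a :- b) = addN (nf a) (mulT (-[1+ 0 ]) [] (nf b))
  nf (a :* b) = mulN (nf a) (nf b)

  private
    *-0ʳ : ∀ a → a *ᵣ # 0 ≡ # 0
    *-0ʳ a = trans (*-comm a _) (*-0ˡ a)
    *-1ʳ : ∀ a → a *ᵣ # 1 ≡ a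
    *-1ʳ a = trans (*-comm a _) (*-1ˡ a)
    +-0ʳ : ∀ a → a +ᵣ # 0 ≡ a
    +-0ʳ a = trans (+-comm a _) (+-0ˡ a)
    distribʳ : ∀ a b c → (a +ᵣ b) *ᵣ c ≡ a *ᵣ c +ᵣ b *ᵣ c
    distribʳ a b c = trans (*-comm _ c) (trans (distribˡ c a b) (cong₂ _+ᵣ_ (*-comm c a) (*-comm c b)))
    lcomm+ : ∀ a b c → a +ᵣ (b +ᵣ c) ≡ b +ᵣ (a +ᵣ c)
    lcomm+ a b c = trans (sym (+-assoc a b c)) (trans (cong (_+ᵣ c) (+-comm a b)) (+-assoc b a c))
    lcomm* : ∀ a b c → a *ᵣ (b *ᵣ c) ≡ b *ᵣ (a *ᵣ c)
    lcomm* a b c = trans (sym (*-assoc a b c)) (trans (cong (_*ᵣ c) (*-comm a b)) (*-assoc b a c))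
    neg-mul : ∀ a → ι (-[1+ 0 ]) *ᵣ a ≡ -ᵣ a
    neg-mul a = begin
      ι (-[1+ 0 ]) *ᵣ a ≡⟨ sym (+-0ʳ _) ⟩
      ι (-[1+ 0 ]) *ᵣ a +ᵣ # 0 ≡⟨ cong (ι (-[1+ 0 ]) *ᵣ a +ᵣ_) (sym (+-inv a)) ⟩
      ι (-[1+ 0 ]) *ᵣ a +ᵣ (a +ᵣ -ᵣ a) ≡⟨ sym (+-assoc _ a _) ⟩
      (ι (-[1+ 0 ]) *ᵣ a +ᵣ a) +ᵣ -ᵣ a ≡⟨ cong (λ z → (ι (-[1+ 0 ]) *ᵣ a +ᵣ z) +ᵣ -ᵣ a) (sym (*-1ˡ a)) ⟩
      (ι (-[1+ 0 ]) *ᵣ a +ᵣ # 1 *ᵣ a) +ᵣ -ᵣ a ≡⟨ cong (_+ᵣ -ᵣ a) (sym (distribʳ _ _ a)) ⟩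
      ((ι (-[1+ 0 ]) +ᵣ # 1) *ᵣ a) +ᵣ -ᵣ a ≡⟨ cong (λ z → (z *ᵣ a) +ᵣ -ᵣ a) (sym (ι-+ (-[1+ 0 ]) (+ 1))) ⟩
      (# 0 *ᵣ a) +ᵣ -ᵣ a ≡⟨ cong (_+ᵣ -ᵣ a) (*-0ˡ a) ⟩
      # 0 +ᵣ -ᵣ a ≡⟨ +-0ˡ _ ⟩
      -ᵣ a ∎
      where open ≡-Reasoning

  ev-ins : ∀ {n} i (m : Mono n) ρ → evM (ins i m) ρ ≡ look ρ i *ᵣ evM m ρ
  ev-ins i [] ρ = refl
  ev-ins i (j ∷ m) ρ with Fin.toℕ i ℕ.≤ᵇ Fin.toℕ j
  ... | true = refl
  ... | false = trans (cong (look ρ j *ᵣ_) (ev-ins i m ρ)) (lcomm* _ _ _)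

  ev-mulM : ∀ {n} (m m' : Mono n) ρ → evM (mulM m m') ρ ≡ evM m ρ *ᵣ evM m' ρ
  ev-mulM [] m' ρ = sym (*-1ˡ _)
  ev-mulM (i ∷ m) m' ρ = trans (ev-ins i (mulM m m') ρ) (trans (cong (look ρ i *ᵣ_) (ev-mulM m m' ρ)) (sym (*-assoc _ _ _)))

  ev-addT : ∀ {n} c (m : Mono n) p ρ → evN (addT c m p) ρ ≡ ι c *ᵣ evM m ρ +ᵣ evN p ρ
  ev-addT c m [] ρ = refl
  ev-addT c m ((c' , m') ∷ p) ρ with eqM m m'
  ... | yes refl = trans (cong (λ z → z *ᵣ evM m ρ +ᵣ evN p ρ) (ι-+ c c')) (trans (cong (_+ᵣ evN p ρ) (distribʳ _ _ _)) (+-assoc _ _ _))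
  ... | no _ = trans (cong (ι c' *ᵣ evM m' ρ +ᵣ_) (ev-addT c m p ρ)) (lcomm+ _ _ _)

  ev-addN : ∀ {n} (p q : NF n) ρ → evN (addN p q) ρ ≡ evN p ρ +ᵣ evN q ρ
  ev-addN [] q ρ = sym (+-0ˡ _)
  ev-addN ((c , m) ∷ p) q ρ = trans (ev-addT c m (addN p q) ρ) (trans (cong (_ +ᵣ_) (ev-addN p q ρ)) (sym (+-assoc _ _ _)))

  ev-mulT : ∀ {n} c (m : Mono n) p ρ → evN (mulT c m p) ρ ≡ (ι c *ᵣ evM m ρ) *ᵣ evN p ρ
  ev-mulT c m [] ρ = sym (*-0ʳ _)
  ev-mulT c m ((c' , m') ∷ p) ρ = trans (ev-addT (c ℤ.* c') (mulM m m') (mulT c m p) ρ)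
    (trans (cong₂ _+ᵣ_ (trans (cong₂ _*ᵣ_ (ι-* c c') (ev-mulM m m' ρ))
        (trans (*-assoc _ _ _) (trans (cong (ι c *ᵣ_) (lcomm* _ _ _)) (sym (*-assoc _ _ _)))))
      (ev-mulT c m p ρ)) (sym (distribˡ _ _ _)))

  ev-mulN : ∀ {n} (p q : NF n) ρ → evN (mulN p q) ρ ≡ evN p ρ *ᵣ evN q ρ
  ev-mulN [] q ρ = sym (*-0ˡ _)
  ev-mulN ((c , m) ∷ p) q ρ = trans (ev-addN (mulT c m q) (mulN p q) ρ)
    (trans (cong₂ _+ᵣ_ (ev-mulT c m q ρ) (ev-mulN p q ρ)) (sym (distribʳ _ _ _)))

  ev-nf : ∀ {n} (e : Ex n) ρ → evN (nf e) ρ ≡ ev e ρ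
  ev-nf (var i) ρ = trans (+-0ʳ _) (trans (*-1ˡ _) (*-1ʳ _))
  ev-nf (con k) ρ = trans (+-0ʳ _) (*-1ʳ _)
  ev-nf (a :+ b) ρ = trans (ev-addN (nf a) (nf b) ρ) (cong₂ _+ᵣ_ (ev-nf a ρ) (ev-nf b ρ))
  ev-nf (a :- b) ρ = trans (ev-addN (nf a) _ ρ) (cong₂ _+ᵣ_ (ev-nf a ρ)
    (trans (ev-mulT (-[1+ 0 ]) [] (nf b) ρ) (trans (cong (_*ᵣ evN (nf b) ρ) (*-1ʳ _)) (trans (neg-mul _) (cong -ᵣ_ (ev-nf b ρ))))))
  ev-nf (a :* b) ρ = trans (ev-mulN (nf a) (nf b) ρ) (cong₂ _*ᵣ_ (ev-nf a ρ) (ev-nf b ρ))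

  isZ isP : ∀ {n} → NF n → Bool
  isZ [] = true
  isZ ((+ 0 , m) ∷ p) = isZ p
  isZ (_ ∷ p) = false
  isP [] = true
  isP ((+ 0 , m) ∷ p) = isP p
  isP ((+ suc k , []) ∷ p) = isP p
  isP (_ ∷ p) = false

  isZ-sound : ∀ {n} (p : NF n) ρ → IsTrue (isZ p) → evN p ρ ≡ # 0
  isZ-sound [] ρ _ = refl
  isZ-sound ((+ 0 , m) ∷ p) ρ t = trans (cong₂ _+ᵣ_ (*-0ˡ _) (isZ-sound p ρ t)) (+-0ˡ _)

  isP-sound : ∀ {n} (p : NF n) ρ → IsTrue (isP p) → # 0 ≤ᵣ evN p ρ
  isP-sound [] ρ _ = ≤-refl
  isP-sound ((+ 0 , m) ∷ p) ρ t = ≤-trans (isP-sound p ρ t) (≤-reflexive (sym (trans (cong (_+ᵣ _) (*-0ˡ _)) (+-0ˡ _))))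
  isP-sound ((+ suc k , []) ∷ p) ρ t = ≤-trans (≤-reflexive (sym (+-0ˡ _)))
    (+-mono (≤-trans (<⇒≤ (ι-pos k)) (≤-reflexive (sym (*-1ʳ _)))) (isP-sound p ρ t))

  data Rel (n : ℕ) : Set where
    _:≤_ _:=_ : Ex n → Ex n → Rel n

  ⟦_⟧ : ∀ {n} → Rel n → Tup n → Set
  ⟦ a :≤ b ⟧ ρ = ev a ρ ≤ᵣ ev b ρ
  ⟦ a := b ⟧ ρ = ev a ρ ≡ ev b ρ

  data Stmt (n : ℕ) : Set where
    _⊢_ : List (Rel n) → Rel n → Stmt n

  Hyps : ∀ {n} → List (Rel n) → Rel n → Tup n → Set
  Hyps [] g ρ = ⟦ g ⟧ ρ
  Hyps (r ∷ rs) g ρ = ⟦ r ⟧ ρ → Hyps rs g ρ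

  gap : ∀ {n} → Rel n → NF n
  gap (a :≤ b) = nf (b :- a)
  gap (a := b) = nf (b :- a)

  comb : ∀ {n} → List (Rel n) → List ℕ → NF n
  comb [] _ = []
  comb (_ ∷ _) [] = []
  comb (r ∷ rs) (c ∷ cs) = addN (mulT (+ c) [] (gap r)) (comb rs cs)

  -- Hypotheses are combined linearly only; where a proof multiplies inequalities, the product is
  -- supplied as a further hypothesis. Normal forms need not be canonical: a poor one can make the
  -- test fail but not succeed wrongly.
  check : ∀ {n} → Stmt n → List ℕ → ℕ → Bool
  check (hs ⊢ a :≤ b) cs d = isP (addN (mulT (+ suc d) [] (nf (b :- a))) (mulT (-[1+ 0 ]) [] (comb hs cs)))
  check (hs ⊢ a := b) cs d = isZ (nf (b :- a))

  private
    sub-≥0 : ∀ {a b} → a ≤ᵣ b → # 0 ≤ᵣ b -ᵣ a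
    sub-≥0 {a} p = ≤-trans (≤-reflexive (sym (+-inv a))) (+-mono p ≤-refl)
    sub-≥0⁻ : ∀ {a b} → # 0 ≤ᵣ b -ᵣ a → a ≤ᵣ b
    sub-≥0⁻ {a} {b} p = ≤-trans (≤-reflexive (sym (+-0ˡ a))) (≤-trans (+-mono p ≤-refl)
      (≤-reflexive (trans (+-assoc b _ a) (trans (cong (b +ᵣ_) (trans (+-comm _ a) (+-inv a))) (+-0ʳ b)))))
    #-≥0 : ∀ n → # 0 ≤ᵣ # n
    #-≥0 zero = ≤-refl
    #-≥0 (suc n) = <⇒≤ (ι-pos n)

    gap-≥0 : ∀ {n} (r : Rel n) ρ → ⟦ r ⟧ ρ → # 0 ≤ᵣ evN (gap r) ρ
    gap-≥0 (a :≤ b) ρ p = ≤-trans (sub-≥0 p) (≤-reflexive (sym (ev-nf (b :- a) ρ)))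
    gap-≥0 (a := b) ρ p = ≤-trans (sub-≥0 (≤-reflexive p)) (≤-reflexive (sym (ev-nf (b :- a) ρ)))

    scale-≥0 : ∀ {n} c (p : NF n) ρ → # 0 ≤ᵣ evN p ρ → # 0 ≤ᵣ evN (mulT (+ c) [] p) ρ
    scale-≥0 c p ρ h = ≤-trans (≤-reflexive (sym (*-0ʳ _))) (≤-trans (*-monoˡ (# c) (#-≥0 c) h)
      (≤-reflexive (sym (trans (ev-mulT (+ c) [] p ρ) (cong (_*ᵣ evN p ρ) (*-1ʳ _))))))


    feed : ∀ {n} (hs : List (Rel n)) (g : Rel n) cs ρ →
      (# 0 ≤ᵣ evN (comb hs cs) ρ → ⟦ g ⟧ ρ) → Hyps hs g ρ
    feed [] g cs ρ k = k ≤-refl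
    feed (r ∷ rs) g [] ρ k p = feed rs g [] ρ (λ _ → k ≤-refl)
    feed (r ∷ rs) g (c ∷ cs) ρ k p = feed rs g cs ρ λ h → k (≤-trans (≤-reflexive (sym (+-0ˡ _)))
      (≤-trans (+-mono (scale-≥0 c (gap r) ρ (gap-≥0 r ρ p)) h) (≤-reflexive (sym (ev-addN (mulT (+ c) [] (gap r)) (comb rs cs) ρ)))))

  Claim : ∀ {n} → Stmt n → Tup n → Set
  Claim (hs ⊢ g) ρ = Hyps hs g ρ

  sound : ∀ {n} (s : Stmt n) cs d → IsTrue (check s cs d) → ∀ ρ → Claim s ρ
  sound (hs ⊢ a :≤ b) cs d t ρ = feed hs (a :≤ b) cs ρ λ h → *-cancelˡ (# suc d) (ι-pos d) (sub-≥0⁻ (fin h))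
    where
    N = nf (b :- a)
    fin : # 0 ≤ᵣ evN (comb hs cs) ρ → # 0 ≤ᵣ (# suc d *ᵣ ev b ρ) -ᵣ (# suc d *ᵣ ev a ρ)
    fin h = ≤-trans (≤-trans (≤-reflexive (sym (+-0ˡ _))) (+-mono (isP-sound (addN (mulT (+ suc d) [] N) (mulT (-[1+ 0 ]) [] (comb hs cs))) ρ t) h)) (≤-reflexive eq)
      where
      open ≡-Reasoning
      C = evN (comb hs cs) ρ
      negmul : ∀ x y → x *ᵣ (-ᵣ y) ≡ -ᵣ (x *ᵣ y)
      negmul x y = trans (cong (x *ᵣ_) (sym (neg-mul y))) (trans (lcomm* _ _ _) (neg-mul _))
      eq : evN (addN (mulT (+ suc d) [] N) (mulT (-[1+ 0 ]) [] (comb hs cs))) ρ +ᵣ C ≡ (# suc d *ᵣ ev b ρ) -ᵣ (# suc d *ᵣ ev a ρ)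
      eq = begin
        _ ≡⟨ cong (_+ᵣ C) (ev-addN (mulT (+ suc d) [] N) (mulT (-[1+ 0 ]) [] (comb hs cs)) ρ) ⟩
        (evN (mulT (+ suc d) [] N) ρ +ᵣ evN (mulT (-[1+ 0 ]) [] (comb hs cs)) ρ) +ᵣ C
          ≡⟨ cong (_+ᵣ C) (cong₂ _+ᵣ_ (trans (ev-mulT (+ suc d) [] N ρ) (cong₂ _*ᵣ_ (*-1ʳ _) (ev-nf (b :- a) ρ)))
             (trans (ev-mulT (-[1+ 0 ]) [] (comb hs cs) ρ) (trans (cong (_*ᵣ C) (*-1ʳ _)) (neg-mul C)))) ⟩
        (# suc d *ᵣ (ev b ρ -ᵣ ev a ρ) +ᵣ -ᵣ C) +ᵣ C ≡⟨ trans (+-assoc _ _ C) (trans (cong (_ +ᵣ_) (trans (+-comm _ C) (+-inv C))) (+-0ʳ _)) ⟩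
        # suc d *ᵣ (ev b ρ -ᵣ ev a ρ) ≡⟨ trans (distribˡ _ _ _) (cong (_ +ᵣ_) (negmul _ _)) ⟩
        _ ∎
  sound (hs ⊢ a := b) cs d t ρ = feed hs (a := b) [] ρ λ _ →
    ≤-antisym (sub-≥0⁻ (≤-reflexive (sym e))) (sub-≥0⁻ (≤-trans (≤-reflexive (sym e')) ≤-refl))
    where
    e : ev b ρ -ᵣ ev a ρ ≡ # 0
    e = trans (sym (ev-nf (b :- a) ρ)) (isZ-sound (nf (b :- a)) ρ t)
    e' : ev a ρ -ᵣ ev b ρ ≡ # 0
    e' = begin
      ev a ρ -ᵣ ev b ρ ≡⟨ sym (+-0ʳ _) ⟩
      (ev a ρ -ᵣ ev b ρ) +ᵣ # 0 ≡⟨ cong ((ev a ρ -ᵣ ev b ρ) +ᵣ_) (sym e) ⟩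
      (ev a ρ -ᵣ ev b ρ) +ᵣ (ev b ρ -ᵣ ev a ρ) ≡⟨ trans (+-assoc (ev a ρ) (-ᵣ ev b ρ) _) (cong (ev a ρ +ᵣ_) (sym (+-assoc (-ᵣ ev b ρ) (ev b ρ) (-ᵣ ev a ρ)))) ⟩
      ev a ρ +ᵣ ((-ᵣ ev b ρ +ᵣ ev b ρ) -ᵣ ev a ρ) ≡⟨ cong (λ z → ev a ρ +ᵣ (z -ᵣ ev a ρ)) (trans (+-comm _ _) (+-inv _)) ⟩
      ev a ρ +ᵣ (# 0 -ᵣ ev a ρ) ≡⟨ cong (ev a ρ +ᵣ_) (+-0ˡ _) ⟩
      ev a ρ -ᵣ ev a ρ ≡⟨ +-inv (ev a ρ) ⟩
      # 0 ∎
      where open ≡-Reasoning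

  Lam : ℕ → ℕ → Set
  Lam n zero = Stmt n
  Lam n (suc k) = Ex n → Lam n k

  app : ∀ {n} k → Lam n k → (Fin k → Fin n) → Stmt n
  app zero s f = s
  app (suc k) s f = app k (s (var (f Fin.zero))) (λ i → f (Fin.suc i))

  lin/ : (d : ℕ) (cs : List ℕ) (n : ℕ) (s : Lam n n) →
    {_ : IsTrue (check (app n s (λ i → i)) cs (ℕ.pred d))} {ρ : Tup n} → Claim (app n s (λ i → i)) ρ
  lin/ d cs n s {t} {ρ} with app n s (λ i → i)
  ... | hs ⊢ g = sound (hs ⊢ g) cs (ℕ.pred d) t ρ

  lin : (cs : List ℕ) (n : ℕ) (s : Lam n n) →
    {_ : IsTrue (check (app n s (λ i → i)) cs 0)} {ρ : Tup n} → Claim (app n s (λ i → i)) ρ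
  lin cs n s {t} {ρ} = lin/ 1 cs n s {t} {ρ}

  ring : (n : ℕ) (s : Lam n n) →
    {_ : IsTrue (check (app n s (λ i → i)) [] 0)} {ρ : Tup n} → Claim (app n s (λ i → i)) ρ
  ring n s {t} {ρ} = lin/ 1 [] n s {t} {ρ}

open Checker public using (lin; lin/; ring; con; _:+_; _:-_; _:*_; _:≤_; _:=_; _⊢_)

#-+ : ∀ m n → # (m ℕ.+ n) ≡ # m +ᵣ # n
#-+ m n = ι-+ (+ m) (+ n)

#-≥0 : ∀ n → # 0 ≤ᵣ # n
#-≥0 zero = ≤-refl
#-≥0 (suc n) = <⇒≤ (ι-pos n)

#-mono : ∀ {m n} → m ℕ.≤ n → # m ≤ᵣ # n
#-mono {m} {n} p = subst (λ k → # m ≤ᵣ # k) (ℕP.m+[n∸m]≡n p)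
  (≤-trans (lin (1 ∷ []) 2 (λ a b → con 0 :≤ b ∷ [] ⊢ a :≤ a :+ b) (#-≥0 (n ℕ.∸ m))) (≤-reflexive (sym (#-+ m (n ℕ.∸ m)))))

*-monoʳ : ∀ c {a b} → # 0 ≤ᵣ c → a ≤ᵣ b → a *ᵣ c ≤ᵣ b *ᵣ c
*-monoʳ c {a} {b} p q = subst₂ _≤ᵣ_ (*-comm c a) (*-comm c b) (*-monoˡ c p q)

*-≥0 : ∀ {a b} → # 0 ≤ᵣ a → # 0 ≤ᵣ b → # 0 ≤ᵣ a *ᵣ b
*-≥0 {a} p q = ≤-trans (lin [] 1 (λ a → [] ⊢ con 0 :≤ a :* con 0)) (*-monoˡ a p q)

*-mono : ∀ {a b c d} → # 0 ≤ᵣ c → # 0 ≤ᵣ b → a ≤ᵣ b → c ≤ᵣ d → a *ᵣ c ≤ᵣ b *ᵣ d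
*-mono {b = b} {c = c} p q r s = ≤-trans (*-monoʳ c p r) (*-monoˡ b q s)

≤-<-trans : ∀ {a b c} → a ≤ᵣ b → b <ᵣ c → a <ᵣ c
≤-<-trans p q = ≰⇒> λ r → <⇒≱ q (≤-trans r p)
<-≤-trans : ∀ {a b c} → a <ᵣ b → b ≤ᵣ c → a <ᵣ c
<-≤-trans p q = ≰⇒> λ r → <⇒≱ p (≤-trans q r)
≮⇒≥ : ∀ {a b} → ¬ (a <ᵣ b) → b ≤ᵣ a
≮⇒≥ {a} {b} p with b ≤? a
... | yes q = q
... | no q = ⊥-elim (p (≰⇒> q))
inv-intro : ∀ {x a b} → # 0 <ᵣ x → a *ᵣ x ≤ᵣ b → a ≤ᵣ b *ᵣ inv x
inv-intro {x} {a} {b} p q = ≤-trans (≤-reflexive (sym (trans (*-assoc a x _)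
  (trans (cong (a *ᵣ_) (inv-r p)) (ring 1 λ b → [] ⊢ b :* con 1 := b))))) (*-monoʳ (inv x) (inv-≥0 x) q)
inv-pos : ∀ {x} → # 0 <ᵣ x → # 0 <ᵣ inv x
inv-pos {x} p = ≰⇒> λ q → <⇒≱ (ι-pos 0) (≤-trans (≤-reflexive (sym (inv-r p)))
  (≤-trans (*-monoˡ x (<⇒≤ p) q) (lin [] 1 (λ a → [] ⊢ a :* con 0 :≤ con 0))))

-- Powers of two and integer logarithms.

pow2 : ℕ → R
pow2 zero = # 1
pow2 (suc m) = # 2 *ᵣ pow2 m

pow2-+ : ∀ m n → pow2 (m ℕ.+ n) ≡ pow2 m *ᵣ pow2 n
pow2-+ zero n = sym (*-1ˡ _)
pow2-+ (suc m) n = trans (cong (# 2 *ᵣ_) (pow2-+ m n)) (sym (*-assoc _ _ _))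

pow2-lower : ∀ m → # (suc m) ≤ᵣ pow2 m
pow2-lower zero = ≤-refl
pow2-lower (suc m) = ≤-trans (≤-reflexive (#-+ 1 (suc m))) (≤-trans (+-mono (#-mono {1} {suc m} (s≤s z≤n)) ≤-refl)
  (≤-trans (lin [] 1 (λ a → [] ⊢ a :+ a :≤ con 2 :* a)) (*-monoˡ (# 2) (#-≥0 2) (pow2-lower m))))

pow2-≥1 : ∀ m → # 1 ≤ᵣ pow2 m
pow2-≥1 m = ≤-trans (#-mono {1} {suc m} (s≤s z≤n)) (pow2-lower m)

pow2-≥0 : ∀ m → # 0 ≤ᵣ pow2 m
pow2-≥0 m = ≤-trans (#-≥0 1) (pow2-≥1 m)

pow2-pos : ∀ m → # 0 <ᵣ pow2 m
pow2-pos m = <-≤-trans (ι-pos 0) (pow2-≥1 m)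

pow2-mono : ∀ {m n} → m ℕ.≤ n → pow2 m ≤ᵣ pow2 n
pow2-mono {m} {n} p = subst (λ k → pow2 m ≤ᵣ pow2 k) (ℕP.m+[n∸m]≡n p)
  (≤-trans (≤-reflexive (ring 1 λ a → [] ⊢ a := a :* con 1)) (≤-trans (*-monoˡ (pow2 m) (pow2-≥0 m) (pow2-≥1 (n ℕ.∸ m)))
    (≤-reflexive (sym (pow2-+ m (n ℕ.∸ m))))))

private
  -- Counts how often x can be doubled without exceeding 1. The fuel k suffices as soon as x times
  -- 2^k exceeds 1, which `fuel` obtains from an integer bound for 1/x.
  search : ℕ → R → ℕ
  search zero x = 0
  search (suc k) x with # 2 *ᵣ x ≤? # 1
  ... | yes _ = suc (search k (# 2 *ᵣ x))
  ... | no _ = 0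

  search-lo : ∀ k x → x ≤ᵣ # 1 → x *ᵣ pow2 (search k x) ≤ᵣ # 1
  search-lo zero x p = ≤-trans (≤-reflexive (ring 1 λ a → [] ⊢ a :* con 1 := a)) p
  search-lo (suc k) x p with # 2 *ᵣ x ≤? # 1
  ... | yes q = ≤-trans (≤-reflexive (ring 2 λ x y → [] ⊢ x :* (con 2 :* y) := (con 2 :* x) :* y)) (search-lo k (# 2 *ᵣ x) q)
  ... | no _ = ≤-trans (≤-reflexive (ring 1 λ a → [] ⊢ a :* con 1 := a)) p

  search-hi : ∀ k x → # 1 <ᵣ x *ᵣ pow2 k → # 1 <ᵣ x *ᵣ pow2 (suc (search k x))
  search-hi zero x p = <-≤-trans p (≤-trans (lin (1 ∷ []) 1 (λ x → con 1 :≤ x :* con 1 ∷ [] ⊢ x :* con 1 :≤ x :* (con 2 :* con 1)) (<⇒≤ p)) ≤-refl)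
  search-hi (suc k) x p with # 2 *ᵣ x ≤? # 1
  ... | yes q = <-≤-trans (search-hi k (# 2 *ᵣ x) (<-≤-trans p (≤-reflexive (ring 2 λ x y → [] ⊢ x :* (con 2 :* y) := (con 2 :* x) :* y))))
    (≤-reflexive (ring 2 λ x y → [] ⊢ (con 2 :* x) :* y := x :* (con 2 :* y)))
  ... | no q = <-≤-trans (≰⇒> q) (≤-reflexive (ring 1 λ x → [] ⊢ con 2 :* x := x :* (con 2 :* con 1)))

private
  fuel : R → ℕ
  fuel x = proj₁ (archimedean (inv x))

  fuel-ok : ∀ {x} → # 0 <ᵣ x → # 1 <ᵣ x *ᵣ pow2 (fuel x)
  fuel-ok {x} p = <-≤-trans lt (*-monoˡ x (<⇒≤ p) (pow2-lower N))
    where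
    N : ℕ
    N = fuel x
    q : # 1 ≤ᵣ x *ᵣ # N
    q = ≤-trans (≤-reflexive (sym (inv-r p))) (*-monoˡ x (<⇒≤ p) (proj₂ (archimedean (inv x))))
    lt : # 1 <ᵣ x *ᵣ # (suc N)
    lt = <-≤-trans (≤-<-trans q (≰⇒> λ r → <⇒≱ p (lin (1 ∷ []) 2 (λ x n → x :* (con 1 :+ n) :≤ x :* n ∷ [] ⊢ x :≤ con 0)
      (≤-trans (≤-reflexive (cong (x *ᵣ_) (sym (#-+ 1 N)))) r)))) ≤-refl

opaque
  hn : R → ℕ
  hn x = search (fuel x) x

  hn-lo : ∀ {x} → x ≤ᵣ # 1 → x *ᵣ pow2 (hn x) ≤ᵣ # 1
  hn-lo {x} = search-lo (fuel x) x

  hn-hi : ∀ {x} → # 0 <ᵣ x → # 1 <ᵣ x *ᵣ pow2 (suc (hn x))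
  hn-hi {x} p = search-hi (fuel x) x (fuel-ok p)

-- A probability x ∈ (0,1] has information content h x = ⌊log₂ (1/x)⌋; rounding costs only bounded errors.
h : R → R
h x = # hn x

hn-anti : ∀ {x y} → # 0 <ᵣ x → x ≤ᵣ y → y ≤ᵣ # 1 → hn y ℕ.≤ hn x
hn-anti {x} {y} p q r = ℕP.≮⇒≥ λ lt → <⇒≱ (hn-hi p)
  (≤-trans (*-mono (pow2-≥0 (suc (hn x))) (<⇒≤ (<-≤-trans p q)) q (pow2-mono lt)) (hn-lo r))

h-anti : ∀ {x y} → # 0 <ᵣ x → x ≤ᵣ y → y ≤ᵣ # 1 → h y ≤ᵣ h x
h-anti p q r = #-mono (hn-anti p q r)

private
  rearr : ∀ {x y a b} → (x *ᵣ y) *ᵣ (a *ᵣ b) ≡ (x *ᵣ a) *ᵣ (y *ᵣ b)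
  rearr = ring 4 λ x y a b → [] ⊢ (x :* y) :* (a :* b) := (x :* a) :* (y :* b)

-- Integer parts are superadditive, so this direction is free of error; the converse `h-sub` loses 1
-- to rounding.
h-sup : ∀ {x y} → # 0 <ᵣ x → x ≤ᵣ # 1 → # 0 <ᵣ y → y ≤ᵣ # 1 → h x +ᵣ h y ≤ᵣ h (x *ᵣ y)
h-sup {x} {y} p p' q q' = ≤-trans (≤-reflexive (sym (#-+ (hn x) (hn y)))) (#-mono (ℕP.≮⇒≥ λ lt →
  <⇒≱ (hn-hi (*-pos p q)) (≤-trans (*-monoˡ _ (<⇒≤ (*-pos p q)) (pow2-mono lt))
    (≤-trans (≤-reflexive (trans (cong (x *ᵣ y *ᵣ_) (pow2-+ (hn x) (hn y))) rearr))
      (≤-trans (*-mono (*-≥0 (<⇒≤ q) (pow2-≥0 (hn y))) (#-≥0 1) (hn-lo p') (hn-lo q')) (≤-reflexive (*-1ˡ (# 1))))))))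

h-sub : ∀ {x y} → # 0 <ᵣ x → x ≤ᵣ # 1 → # 0 <ᵣ y → y ≤ᵣ # 1 → h (x *ᵣ y) ≤ᵣ h x +ᵣ h y +ᵣ # 1
h-sub {x} {y} p p' q q' = ≤-trans (#-mono (ℕP.≮⇒≥ λ lt →
    <⇒≱ (gt lt) (hn-lo (≤-trans (*-mono (<⇒≤ q) (#-≥0 1) p' q') (≤-reflexive (*-1ˡ (# 1)))))))
    (≤-reflexive (trans (#-+ (hn x ℕ.+ hn y) 1) (cong (_+ᵣ # 1) (#-+ (hn x) (hn y)))))
  where
  eq : hn x ℕ.+ hn y ℕ.+ 1 ℕ.+ 1 ≡ suc (hn x) ℕ.+ suc (hn y)
  eq = trans (ℕP.+-assoc (hn x ℕ.+ hn y) 1 1) (trans (ℕP.+-comm _ 2) (cong suc (sym (ℕP.+-suc (hn x) (hn y)))))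
  gt : hn x ℕ.+ hn y ℕ.+ 1 ℕ.< hn (x *ᵣ y) → # 1 <ᵣ x *ᵣ y *ᵣ pow2 (hn (x *ᵣ y))
  gt lt = ≤-<-trans (≤-reflexive (sym (*-1ˡ (# 1)))) (<-≤-trans (<-≤-trans (≰⇒> λ r → <⇒≱ (hn-hi p)
     (≤-trans (lin (1 ∷ []) 1 (λ a → [] ⊢ a :≤ a :* con 1)) (≤-trans (*-monoˡ _ (*-≥0 (<⇒≤ p) (pow2-≥0 (suc (hn x)))) (<⇒≤ (hn-hi q))) (≤-trans r (≤-reflexive (*-1ˡ (# 1)))))))
     ≤-refl)
     (≤-trans (≤-reflexive (trans (sym rearr) (cong (x *ᵣ y *ᵣ_) (sym (pow2-+ (suc (hn x)) (suc (hn y)))))))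
       (*-monoˡ _ (<⇒≤ (*-pos p q)) (pow2-mono (subst (ℕ._≤ hn (x *ᵣ y)) eq (subst (ℕ._≤ hn (x *ᵣ y)) (ℕP.+-comm 1 (hn x ℕ.+ hn y ℕ.+ 1)) lt))))))

h-1 : h (# 1) ≡ # 0
h-1 = cong #_ (ℕP.n≤0⇒n≡0 (ℕP.≮⇒≥ λ lt → <⇒≱ {# 1} {# 2} lt12
    (≤-trans (lin [] 0 ([] ⊢ con 2 :≤ con 1 :* (con 2 :* con 1))) (≤-trans (*-monoˡ (# 1) (#-≥0 1) (pow2-mono lt)) (hn-lo ≤-refl)))))
  where
  lt12 : # 1 <ᵣ # 2
  lt12 = ≰⇒> λ q → <⇒≱ (ι-pos 0) (lin (1 ∷ []) 0 (con 2 :≤ con 1 ∷ [] ⊢ con 1 :≤ con 0) q)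

-- Stands in for log r ≤ r: if d is the excess of h x over h y + 1, then 2^d ≤ r, while d + 1 ≤ 2^d.
-- The bound is linear in r and can therefore be averaged, which is how Jensen's inequality is
-- replaced throughout.
h-log : ∀ {x y r} → # 0 <ᵣ x → x ≤ᵣ # 1 → # 0 <ᵣ y → # 0 ≤ᵣ r → y ≤ᵣ r *ᵣ x → h x ≤ᵣ h y +ᵣ r +ᵣ # 1
h-log {x} {y} {r} p p' q r0 yr with ℕP.≤-total (hn x) (suc (hn y))
... | inj₁ le = ≤-trans (#-mono le) (≤-trans (≤-reflexive (#-+ 1 (hn y))) (lin (1 ∷ []) 2 (λ a r → con 0 :≤ r ∷ [] ⊢ con 1 :+ a :≤ a :+ r :+ con 1) r0))
... | inj₂ ge = ≤-trans (≤-reflexive (trans (cong #_ (sym (ℕP.m+[n∸m]≡n ge))) (trans (#-+ (suc (hn y)) d) (cong (_+ᵣ # d) (#-+ 1 (hn y))))))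
    (lin (1 ∷ []) 3 (λ a d r → d :≤ r ∷ [] ⊢ (con 1 :+ a) :+ d :≤ a :+ r :+ con 1) d≤r)
  where
  d = hn x ℕ.∸ suc (hn y)
  w = x *ᵣ pow2 (suc (hn y))
  wpos : # 0 <ᵣ w
  wpos = *-pos p (pow2-pos (suc (hn y)))
  le1 : w *ᵣ pow2 d ≤ᵣ # 1
  le1 = ≤-trans (≤-reflexive (trans (*-assoc x _ _) (cong (x *ᵣ_) (trans (sym (pow2-+ (suc (hn y)) d)) (cong pow2 (ℕP.m+[n∸m]≡n ge)))))) (hn-lo p')
  le2 : # 1 ≤ᵣ w *ᵣ r
  le2 = ≤-trans (<⇒≤ (hn-hi q)) (≤-trans (*-monoʳ _ (pow2-≥0 (suc (hn y))) yr) (≤-reflexive (ring 3 λ r x z → [] ⊢ (r :* x) :* z := (x :* z) :* r)))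
  d≤r : # d ≤ᵣ r
  d≤r = ≤-trans (#-mono (ℕP.n≤1+n d)) (≤-trans (pow2-lower d) (*-cancelˡ w wpos (≤-trans le1 le2)))

-- Finite sums and indicators.

∑ : ∀ {A : Set} → List A → (A → R) → R
∑ [] φ = # 0
∑ (a ∷ as) φ = φ a +ᵣ ∑ as φ

module _ {A : Set} where
  ∑-mono : ∀ (xs : List A) {φ ψ} → (∀ {a} → a ∈ xs → φ a ≤ᵣ ψ a) → ∑ xs φ ≤ᵣ ∑ xs ψ
  ∑-mono [] p = ≤-refl
  ∑-mono (x ∷ xs) p = +-mono (p (here refl)) (∑-mono xs (λ m → p (there m)))

  ∑-cong : ∀ (xs : List A) {φ ψ} → (∀ {a} → a ∈ xs → φ a ≡ ψ a) → ∑ xs φ ≡ ∑ xs ψ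
  ∑-cong [] p = refl
  ∑-cong (x ∷ xs) p = cong₂ _+ᵣ_ (p (here refl)) (∑-cong xs (λ m → p (there m)))

  ∑-+ : ∀ (xs : List A) φ ψ → ∑ xs (λ a → φ a +ᵣ ψ a) ≡ ∑ xs φ +ᵣ ∑ xs ψ
  ∑-+ [] φ ψ = ring 0 ([] ⊢ con 0 := con 0 :+ con 0)
  ∑-+ (x ∷ xs) φ ψ = trans (cong (_ +ᵣ_) (∑-+ xs φ ψ)) (ring 4 λ a b c d → [] ⊢ (a :+ b) :+ (c :+ d) := (a :+ c) :+ (b :+ d))

  ∑-* : ∀ (xs : List A) c φ → ∑ xs (λ a → c *ᵣ φ a) ≡ c *ᵣ ∑ xs φ
  ∑-* [] c φ = ring 1 λ c → [] ⊢ con 0 := c :* con 0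
  ∑-* (x ∷ xs) c φ = trans (cong (_ +ᵣ_) (∑-* xs c φ)) (ring 3 λ c a b → [] ⊢ c :* a :+ c :* b := c :* (a :+ b))

  ∑-0 : ∀ (xs : List A) → ∑ xs (λ _ → # 0) ≡ # 0
  ∑-0 [] = refl
  ∑-0 (x ∷ xs) = trans (cong (# 0 +ᵣ_) (∑-0 xs)) (+-0ˡ _)

  ∑-++ : ∀ (xs ys : List A) φ → ∑ (xs ++ ys) φ ≡ ∑ xs φ +ᵣ ∑ ys φ
  ∑-++ [] ys φ = sym (+-0ˡ _)
  ∑-++ (x ∷ xs) ys φ = trans (cong (φ x +ᵣ_) (∑-++ xs ys φ)) (sym (+-assoc _ _ _))

  ∑-≥0 : ∀ (xs : List A) {φ} → (∀ {a} → a ∈ xs → # 0 ≤ᵣ φ a) → # 0 ≤ᵣ ∑ xs φ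
  ∑-≥0 xs p = ≤-trans (≤-reflexive (sym (∑-0 xs))) (∑-mono xs p)

  ∑-term : ∀ {xs : List A} {φ a} → (∀ {a} → a ∈ xs → # 0 ≤ᵣ φ a) → a ∈ xs → φ a ≤ᵣ ∑ xs φ
  ∑-term {x ∷ xs} p (here refl) = ≤-trans (lin [] 1 (λ a → [] ⊢ a :≤ a :+ con 0)) (+-mono ≤-refl (∑-≥0 xs (λ m → p (there m))))
  ∑-term {x ∷ xs} p (there m) = ≤-trans (lin [] 1 (λ a → [] ⊢ a :≤ con 0 :+ a)) (+-mono (p (here refl)) (∑-term (λ m → p (there m)) m))

∑-map : ∀ {A B : Set} (f : A → B) xs φ → ∑ (List.map f xs) φ ≡ ∑ xs (φ ∘ f)
∑-map f [] φ = refl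
∑-map f (x ∷ xs) φ = cong (_ +ᵣ_) (∑-map f xs φ)

∑-concatMap : ∀ {A B : Set} (f : A → List B) xs φ → ∑ (concatMap f xs) φ ≡ ∑ xs (λ a → ∑ (f a) φ)
∑-concatMap f [] φ = refl
∑-concatMap f (x ∷ xs) φ = trans (∑-++ (f x) _ φ) (cong (_ +ᵣ_) (∑-concatMap f xs φ))

∑-swap : ∀ {A B : Set} (xs : List A) (ys : List B) (φ : A → B → R) → ∑ xs (λ a → ∑ ys (λ b → φ a b)) ≡ ∑ ys (λ b → ∑ xs (λ a → φ a b))
∑-swap [] ys φ = sym (∑-0 ys)
∑-swap (x ∷ xs) ys φ = trans (cong (_ +ᵣ_) (∑-swap xs ys φ)) (sym (∑-+ ys _ _))

ind : ∀ {P : Set} → Dec P → R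
ind (yes _) = # 1
ind (no _) = # 0

ind-≥0 : ∀ {P : Set} (d : Dec P) → # 0 ≤ᵣ ind d
ind-≥0 (yes _) = #-≥0 1
ind-≥0 (no _) = ≤-refl

ind-≤1 : ∀ {P : Set} (d : Dec P) → ind d ≤ᵣ # 1
ind-≤1 (yes _) = ≤-refl
ind-≤1 (no _) = #-≥0 1

ind-yes : ∀ {P : Set} (d : Dec P) → P → ind d ≡ # 1
ind-yes (yes _) p = refl
ind-yes (no np) p = ⊥-elim (np p)

ind-no : ∀ {P : Set} (d : Dec P) → ¬ P → ind d ≡ # 0
ind-no (yes p) np = ⊥-elim (np p)
ind-no (no _) np = refl

ind-mono : ∀ {P Q : Set} (d : Dec P) (e : Dec Q) → (P → Q) → ind d ≤ᵣ ind e
ind-mono (yes p) e f = ≤-reflexive (sym (ind-yes e (f p)))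
ind-mono (no _) e f = ind-≥0 e

ind-cong : ∀ {P Q : Set} (d : Dec P) (e : Dec Q) → (P → Q) → (Q → P) → ind d ≡ ind e
ind-cong d e f g = ≤-antisym (ind-mono d e f) (ind-mono e d g)

ind-≤ : ∀ {P : Set} (d : Dec P) {c x} → # 0 ≤ᵣ x → (P → c ≤ᵣ x) → ind d *ᵣ c ≤ᵣ x
ind-≤ (yes p) q f = ≤-trans (≤-reflexive (*-1ˡ _)) (f p)
ind-≤ (no _) q f = ≤-trans (≤-reflexive (*-0ˡ _)) q

-- Distributions and entropy

-- Points may be repeated in the list and weights may vanish, which is why `Supp` asks for an
-- occurrence of positive weight.
record Dist (Ω : Set) : Set where
  no-eta-equality
  constructor dist
  field
    pts : List (R × Ω)
    nonneg : ∀ {w a} → (w , a) ∈ pts → # 0 ≤ᵣ w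
    total : ∑ pts proj₁ ≡ # 1
open Dist public

opaque
  E : ∀ {Ω} → Dist Ω → (Ω → R) → R
  E μ φ = ∑ (pts μ) (λ p → proj₁ p *ᵣ φ (proj₂ p))

Supp : ∀ {Ω} → Dist Ω → Ω → Set
Supp μ a = ∃[ w ] ((w , a) ∈ pts μ × # 0 <ᵣ w)

opaque
 unfolding E

 E-def : ∀ {Ω} (μ : Dist Ω) φ → E μ φ ≡ ∑ (pts μ) (λ p → proj₁ p *ᵣ φ (proj₂ p))
 E-def μ φ = refl

module _ {Ω : Set} (μ : Dist Ω) where
 opaque
  unfolding E
  E-mono : ∀ {φ ψ} → (∀ {a} → Supp μ a → φ a ≤ᵣ ψ a) → E μ φ ≤ᵣ E μ ψ
  E-mono {φ} {ψ} f = ∑-mono (pts μ) λ {p} m → go p m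
    where
    go : ∀ p → p ∈ pts μ → proj₁ p *ᵣ φ (proj₂ p) ≤ᵣ proj₁ p *ᵣ ψ (proj₂ p)
    go (w , a) m with w ≤? # 0
    ... | yes q = ≤-reflexive (trans (cong (_*ᵣ φ a) w0) (trans (*-0ˡ _) (sym (trans (cong (_*ᵣ ψ a) w0) (*-0ˡ _)))))
      where
      w0 : w ≡ # 0
      w0 = ≤-antisym q (nonneg μ m)
    ... | no q = *-monoˡ w (nonneg μ m) (f (w , m , ≰⇒> q))

  E-cong : ∀ {φ ψ} → (∀ {a} → Supp μ a → φ a ≡ ψ a) → E μ φ ≡ E μ ψ
  E-cong f = ≤-antisym (E-mono (λ s → ≤-reflexive (f s))) (E-mono (λ s → ≤-reflexive (sym (f s))))

  E-ext : ∀ {φ ψ} → (∀ a → φ a ≡ ψ a) → E μ φ ≡ E μ ψ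
  E-ext f = ∑-cong (pts μ) (λ {p} _ → cong (proj₁ p *ᵣ_) (f (proj₂ p)))

  E-+ : ∀ φ ψ → E μ (λ a → φ a +ᵣ ψ a) ≡ E μ φ +ᵣ E μ ψ
  E-+ φ ψ = trans (∑-cong (pts μ) (λ _ → distribˡ _ _ _)) (∑-+ (pts μ) _ _)

  E-* : ∀ c φ → E μ (λ a → c *ᵣ φ a) ≡ c *ᵣ E μ φ
  E-* c φ = trans (∑-cong (pts μ) (λ _ → ring 3 λ w c x → [] ⊢ w :* (c :* x) := c :* (w :* x))) (∑-* (pts μ) c _)

  E-*ʳ : ∀ c φ → E μ (λ a → φ a *ᵣ c) ≡ E μ φ *ᵣ c
  E-*ʳ c φ = trans (E-ext (λ a → *-comm (φ a) c)) (trans (E-* c φ) (*-comm c _))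

  E-const : ∀ c → E μ (λ _ → c) ≡ c
  E-const c = trans (∑-cong (pts μ) (λ _ → *-comm _ c)) (trans (∑-* (pts μ) c proj₁)
    (trans (cong (c *ᵣ_) (total μ)) (ring 1 λ c → [] ⊢ c :* con 1 := c)))

  E-≥0 : ∀ {φ} → (∀ {a} → Supp μ a → # 0 ≤ᵣ φ a) → # 0 ≤ᵣ E μ φ
  E-≥0 f = ≤-trans (≤-reflexive (sym (E-const _))) (E-mono f)

  E-≤c : ∀ {φ c} → (∀ {a} → Supp μ a → φ a ≤ᵣ c) → E μ φ ≤ᵣ c
  E-≤c f = ≤-trans (E-mono f) (≤-reflexive (E-const _))

  E-exists : ∀ φ c → E μ φ <ᵣ c → ∃[ a ] (Supp μ a × φ a ≤ᵣ c)
  E-exists φ c lt = go (pts μ) (λ m → m) (<-≤-trans lt (≤-reflexive (trans (ring 1 λ c → [] ⊢ c := c :* con 1) (cong (c *ᵣ_) (sym (total μ))))))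
    where
    go : ∀ xs → (∀ {p} → p ∈ xs → p ∈ pts μ) → ∑ xs (λ p → proj₁ p *ᵣ φ (proj₂ p)) <ᵣ c *ᵣ ∑ xs proj₁ → ∃[ a ] (Supp μ a × φ a ≤ᵣ c)
    go [] i lt = ⊥-elim (<⇒≱ lt (lin [] 1 λ c → [] ⊢ c :* con 0 :≤ con 0))
    go ((w , a) ∷ xs) i lt with w ≤? # 0 | φ a ≤? c
    ... | no q | yes r = a , (w , i (here refl) , ≰⇒> q) , r
    ... | yes q | _ = go xs (i ∘ there) (≰⇒> λ r → <⇒≱ lt (≤-trans (≤-reflexive (trans (cong (λ w → c *ᵣ (w +ᵣ ∑ xs proj₁)) w0) (cong (c *ᵣ_) (+-0ˡ _))))
        (≤-trans r (≤-reflexive (sym (trans (cong (λ w → w *ᵣ φ a +ᵣ ∑ xs _) w0) (trans (cong (_+ᵣ _) (*-0ˡ _)) (+-0ˡ _))))))))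
      where
      w0 : w ≡ # 0
      w0 = ≤-antisym q (nonneg μ (i (here refl)))
    ... | no q | no r = go xs (i ∘ there) (≰⇒> λ s → <⇒≱ lt
        (lin (1 ∷ 1 ∷ []) 5 (λ w f c S W → (w :* c :≤ w :* f) ∷ (c :* W :≤ S) ∷ [] ⊢ c :* (w :+ W) :≤ w :* f :+ S)
          (*-monoˡ w (nonneg μ (i (here refl))) (<⇒≤ (≰⇒> r))) s))

opaque
 unfolding E
 E-swap : ∀ {A B} (μ : Dist A) (ν : Dist B) (φ : A → B → R) → E μ (λ a → E ν (λ b → φ a b)) ≡ E ν (λ b → E μ (λ a → φ a b))
 E-swap μ ν φ = trans (∑-cong (pts μ) (λ {p} _ → sym (∑-* (pts ν) (proj₁ p) _)))
   (trans (∑-swap (pts μ) (pts ν) _) (∑-cong (pts ν) (λ {q} _ → trans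
     (∑-cong (pts μ) (λ {p} _ → ring 3 λ w v x → [] ⊢ w :* (v :* x) := v :* (w :* x))) (∑-* (pts μ) (proj₁ q) _))))

dirac : ∀ {Ω} → Ω → Dist Ω
dirac a = dist ((# 1 , a) ∷ []) (λ { (here refl) → #-≥0 1 }) (ring 0 ([] ⊢ con 1 :+ con 0 := con 1))

E-dirac : ∀ {Ω} (a : Ω) (φ : Ω → R) → E (dirac a) φ ≡ φ a
E-dirac a φ = trans (E-def (dirac a) φ) (ring 1 λ x → [] ⊢ con 1 :* x :+ con 0 := x)

private
  scale-points : ∀ {A B : Set} → R → A → List (R × B) → List (R × (A × B))
  scale-points w a = List.map (λ { (v , b) → w *ᵣ v , (a , b) })

  ∑-scaled : ∀ {A B : Set} w (a : A) (xs : List (R × B)) (φ : A × B → R) →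
    ∑ (scale-points w a xs) (λ p → proj₁ p *ᵣ φ (proj₂ p)) ≡ w *ᵣ ∑ xs (λ p → proj₁ p *ᵣ φ (a , proj₂ p))
  ∑-scaled w a xs φ = trans (∑-map _ xs _) (trans (∑-cong xs (λ {p} _ → *-assoc w (proj₁ p) _)) (∑-* xs w _))

bindPts : ∀ {A B : Set} → Dist A → (A → Dist B) → List (R × (A × B))
bindPts μ κ = concatMap (λ { (w , a) → scale-points w a (pts (κ a)) }) (pts μ)

private
  ∑-bind : ∀ {A B : Set} (μ : Dist A) (κ : A → Dist B) (φ : A × B → R) →
    ∑ (bindPts μ κ) (λ p → proj₁ p *ᵣ φ (proj₂ p)) ≡ E μ (λ a → E (κ a) (λ b → φ (a , b)))
  ∑-bind μ κ φ = trans (∑-concatMap _ (pts μ) _) (trans (∑-cong (pts μ) (λ { {w , a} _ →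
    trans (∑-scaled w a (pts (κ a)) φ) (cong (w *ᵣ_) (sym (E-def (κ a) _))) })) (sym (E-def μ _)))

  bind-∈ : ∀ {A B : Set} (μ : Dist A) (κ : A → Dist B) {u a b} → (u , (a , b)) ∈ bindPts μ κ →
    ∃[ w ] ∃[ v ] ((w , a) ∈ pts μ × (v , b) ∈ pts (κ a) × u ≡ w *ᵣ v)
  bind-∈ μ κ m with ∈P.∈-concatMap⁻ (λ { (w , a) → scale-points w a (pts (κ a)) }) {xs = pts μ} m
  ... | q with find q
  ... | (w , a) , ma , mb with ∈P.∈-map⁻ _ mb
  ... | (v , b) , mv , refl = w , v , ma , mv , refl

opaque
  -- The first coordinate is kept, so that independent products and conditionally independent copies
  -- are instances of one construction.
  bind : ∀ {A B : Set} → Dist A → (A → Dist B) → Dist (A × B)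
  bind μ κ = dist (bindPts μ κ)
    (λ {u} {p} m → let (w , v , mw , mv , eq) = bind-∈ μ κ m in
       ≤-trans (*-≥0 (nonneg μ mw) (nonneg (κ (proj₁ p)) mv)) (≤-reflexive (sym eq)))
    (trans (∑-cong (bindPts μ κ) (λ {p} _ → ring 1 λ x → [] ⊢ x := x :* con 1))
      (trans (∑-bind μ κ (λ _ → # 1)) (trans (E-cong μ (λ {a} _ → E-const (κ a) (# 1))) (E-const μ (# 1)))))

  E-bind : ∀ {A B : Set} (μ : Dist A) (κ : A → Dist B) (φ : A × B → R) → E (bind μ κ) φ ≡ E μ (λ a → E (κ a) (λ b → φ (a , b)))
  E-bind μ κ φ = trans (E-def (bind μ κ) φ) (∑-bind μ κ φ)

  Supp-bind : ∀ {A B : Set} (μ : Dist A) (κ : A → Dist B) {a b} → Supp (bind μ κ) (a , b) → Supp μ a × Supp (κ a) b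
  Supp-bind μ κ {a} {b} (u , m , pos) with bind-∈ μ κ m
  ... | w , v , mw , mv , refl = (w , mw , ≰⇒> wn) , (v , mv , ≰⇒> vn)
    where
    wn : ¬ (w ≤ᵣ # 0)
    wn q = <⇒≱ pos (≤-trans (*-monoʳ v (nonneg (κ a) mv) q) (≤-reflexive (*-0ˡ v)))
    vn : ¬ (v ≤ᵣ # 0)
    vn q = <⇒≱ pos (≤-trans (*-monoˡ w (nonneg μ mw) q) (lin [] 1 λ w → [] ⊢ w :* con 0 :≤ con 0))

  Supp-bind⁺ : ∀ {A B : Set} (μ : Dist A) (κ : A → Dist B) {a b} → Supp μ a → Supp (κ a) b → Supp (bind μ κ) (a , b)
  Supp-bind⁺ μ κ (w , m , p) (v , m' , p') = w *ᵣ v , ∈P.∈-concatMap⁺ _ (Any.map (λ { refl → ∈P.∈-map⁺ _ m' }) m) , *-pos p p'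

infixr 5 _⊗_
_⊗_ : ∀ {A B : Set} → Dist A → Dist B → Dist (A × B)
μ ⊗ ν = bind μ (λ _ → ν)

-- The values matter only up to equality: a random variable acts as the partition that it induces,
-- and entropies are compared through `⟶`.
record RV (Ω : Set) : Set₁ where
  no-eta-equality
  constructor rv
  field
    {Val} : Set
    dec : DecidableEquality Val
    fn : Ω → Val
open RV public

infixr 6 _∘ᵣ_
_∘ᵣ_ : ∀ {Ω Ω'} → RV Ω' → (Ω → Ω') → RV Ω
f ∘ᵣ φ = rv (dec f) (fn f ∘ φ)

opaque
  pairDec : ∀ {A B : Set} → DecidableEquality A → DecidableEquality B → DecidableEquality (A × B)
  pairDec d e = ΣP.≡-dec d e

⟨_,_⟩ : ∀ {Ω} → RV Ω → RV Ω → RV Ω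
⟨ f , g ⟩ = rv (pairDec (dec f) (dec g)) (λ a → fn f a , fn g a)

⊤ᵣ : ∀ {Ω} → RV Ω
⊤ᵣ = rv ⊤P._≟_ (λ _ → tt)

infix 4 _⟶_
_⟶_ : ∀ {Ω} → RV Ω → RV Ω → Set
f ⟶ g = ∀ {a b} → fn f a ≡ fn f b → fn g a ≡ fn g b

same : ∀ {Ω} (f : RV Ω) (a b : Ω) → R
same f a b = ind (dec f (fn f a) (fn f b))

mass : ∀ {Ω} → Dist Ω → RV Ω → Ω → R
mass μ f a = E μ (same f a)

module _ {Ω : Set} (μ : Dist Ω) where
  mass-≤1 : ∀ f a → mass μ f a ≤ᵣ # 1
  mass-≤1 f a = E-≤c μ λ _ → ind-≤1 (dec f _ _)

  mass-≥w : ∀ f {w a} → (w , a) ∈ pts μ → w ≤ᵣ mass μ f a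
  mass-≥w f {w} {a} m = ≤-trans (≤-trans (≤-reflexive (trans (ring 1 λ w → [] ⊢ w := w :* con 1)
     (cong (w *ᵣ_) (sym (ind-yes (dec f (fn f a) (fn f a)) refl)))))
     (∑-term {xs = pts μ} {φ = λ p → proj₁ p *ᵣ same f a (proj₂ p)}
       (λ {p} m' → *-≥0 (nonneg μ m') (ind-≥0 (dec f (fn f a) (fn f (proj₂ p))))) m)) (≤-reflexive (sym (E-def μ _)))

  mass-pos : ∀ f {a} → Supp μ a → # 0 <ᵣ mass μ f a
  mass-pos f (w , m , p) = <-≤-trans p (mass-≥w f m)

  mass-class : ∀ f {a b} → fn f a ≡ fn f b → mass μ f a ≡ mass μ f b
  mass-class f {a} {b} e = E-ext μ λ c → ind-cong (dec f _ _) (dec f _ _) (trans (sym e)) (trans e)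

  mass-mono : ∀ f g {a} → (∀ {b} → Supp μ b → fn f a ≡ fn f b → fn g a ≡ fn g b) → mass μ f a ≤ᵣ mass μ g a
  mass-mono f g d = E-mono μ λ s → ind-mono (dec f _ _) (dec g _ _) (d s)

  opaque
    H : RV Ω → R
    H f = E μ (λ a → h (mass μ f a))

    H-def : ∀ f → H f ≡ E μ (λ a → h (mass μ f a))
    H-def f = refl

    H-+ : ∀ f g → H f +ᵣ H g ≡ E μ (λ a → h (mass μ f a) +ᵣ h (mass μ g a))
    H-+ f g = sym (E-+ μ _ _)

    H-mono : ∀ f g → (∀ {a} → Supp μ a → h (mass μ g a) ≤ᵣ h (mass μ f a)) → H g ≤ᵣ H f
    H-mono f g p = E-mono μ p

  -- The version of `⟶` restricted to the support, for relations that hold only with probability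
  -- one, such as the equality of two sums after conditioning.
  Det : RV Ω → RV Ω → Set
  Det f g = ∀ {a b} → Supp μ a → Supp μ b → fn f a ≡ fn f b → fn g a ≡ fn g b

  H-Det : ∀ f g → Det f g → H g ≤ᵣ H f
  H-Det f g d = H-mono f g λ {a} s → h-anti (mass-pos f s) (mass-mono f g (λ s' → d s s')) (mass-≤1 g a)

  H-det : ∀ f g → f ⟶ g → H g ≤ᵣ H f
  H-det f g d = H-Det f g (λ _ _ → d)

  H-iso : ∀ f g → f ⟶ g → g ⟶ f → H f ≡ H g
  H-iso f g d d' = ≤-antisym (H-det g f d') (H-det f g d)

  H-⊤ : H ⊤ᵣ ≡ # 0
  H-⊤ = trans (H-def ⊤ᵣ) (trans (E-ext μ λ a → trans (cong h (E-const μ (# 1))) h-1) (E-const μ (# 0)))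

  findSupp : ∀ {Q : Ω → Set} → (∀ a → Dec (Q a)) → (∃[ a ] (Supp μ a × Q a)) ⊎ (∀ {a} → Supp μ a → ¬ Q a)
  findSupp {Q} q = conclude (bads (pts μ) (λ m → m))
    where
    Bad : List (R × Ω) → Set
    Bad xs = ∀ {w a} → (w , a) ∈ xs → # 0 <ᵣ w → ¬ Q a
    bads : ∀ xs → (∀ {p} → p ∈ xs → p ∈ pts μ) → (∃[ a ] (Supp μ a × Q a)) ⊎ Bad xs
    bads [] i = inj₂ λ ()
    bads ((w , a) ∷ xs) i with w ≤? # 0 | q a | bads xs (i ∘ there)
    ... | _ | _ | inj₁ r = inj₁ r
    ... | no p | yes r | _ = inj₁ (a , (w , i (here refl) , ≰⇒> p) , r)
    ... | yes p | _ | inj₂ b = inj₂ λ { (here refl) pos → ⊥-elim (<⇒≱ pos p) ; (there m) → b m }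
    ... | no _ | no r | inj₂ b = inj₂ λ { (here refl) _ → r ; (there m) → b m }
    conclude : (∃[ a ] (Supp μ a × Q a)) ⊎ Bad (pts μ) → (∃[ a ] (Supp μ a × Q a)) ⊎ (∀ {a} → Supp μ a → ¬ Q a)
    conclude (inj₁ r) = inj₁ r
    conclude (inj₂ b) = inj₂ λ { (w , m , p) → b m p }

  -- For an event of positive probability inside one class of F, the expectation is its probability
  -- divided by that of the class. Sums over the values of F are expressed in this way, since the
  -- values are never listed.
  class-sum : ∀ F {Q : Ω → Set} (q : ∀ a → Dec (Q a)) →
    (∀ {a b} → Q a → Q b → fn F a ≡ fn F b) → E μ (λ a → ind (q a) *ᵣ inv (mass μ F a)) ≤ᵣ # 1
  class-sum F {Q} q d with findSupp q
  ... | inj₁ (a₀ , s , qa₀) = ≤-trans (E-mono μ {ψ = λ a → same F a₀ a *ᵣ inv (mass μ F a₀)} λ {a} _ →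
          ind-≤ (q a) (*-≥0 (ind-≥0 (dec F _ _)) (inv-≥0 _)) λ qa → ≤-reflexive (trans (cong inv (mass-class F (d qa qa₀)))
            (trans (sym (*-1ˡ _)) (cong (_*ᵣ inv (mass μ F a₀)) (sym (ind-yes (dec F _ _) (d qa₀ qa)))))))
        (≤-reflexive (trans (E-*ʳ μ (inv (mass μ F a₀)) (same F a₀)) (inv-r (mass-pos F s))))
  ... | inj₂ none = ≤-trans (E-≤c μ {c = # 0} λ {a} s → ≤-reflexive (trans (cong (_*ᵣ _) (ind-no (q a) (none s))) (*-0ˡ _))) (#-≥0 1)

  module _ (f g k : RV Ω) where
    private
      mfk mgk mfgk mk ratio : Ω → R
      mfk = mass μ ⟨ f , k ⟩
      mgk = mass μ ⟨ g , k ⟩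
      mfgk = mass μ ⟨ f , ⟨ g , k ⟩ ⟩
      mk = mass μ k
      ratio a = (mfk a *ᵣ mgk a) *ᵣ (inv (mfgk a) *ᵣ inv (mk a))

      -- For fixed b and c the points a that count lie in one class of (f, g, k), so `class-sum`
      -- applies; and there are such points only if k agrees at b and c.
      inner : ∀ b c → E μ (λ a → same ⟨ f , k ⟩ a b *ᵣ same ⟨ g , k ⟩ a c *ᵣ (inv (mfgk a) *ᵣ inv (mk a)))
        ≤ᵣ same k b c *ᵣ inv (mk b)
      inner b c = ≤-trans (E-mono μ {ψ = λ a → (ind (q a) *ᵣ inv (mfgk a)) *ᵣ (same k b c *ᵣ inv (mk b))} λ {a} _ → pt a)
        (≤-trans (≤-reflexive (E-*ʳ μ _ _)) (≤-trans (*-monoʳ _ (*-≥0 (ind-≥0 (dec k _ _)) (inv-≥0 _))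
          (class-sum ⟨ f , ⟨ g , k ⟩ ⟩ q λ { (p , r) (p' , r') → cong₂ _,_ (trans (cong proj₁ p) (sym (cong proj₁ p')))
              (cong₂ _,_ (trans (cong proj₁ r) (sym (cong proj₁ r'))) (trans (cong proj₂ r) (sym (cong proj₂ r')))) }))
          (≤-reflexive (*-1ˡ _))))
        where
        Q : Ω → Set
        Q a = fn ⟨ f , k ⟩ a ≡ fn ⟨ f , k ⟩ b × fn ⟨ g , k ⟩ a ≡ fn ⟨ g , k ⟩ c
        q : ∀ a → Dec (Q a)
        q a = dec ⟨ f , k ⟩ _ _ ×-dec dec ⟨ g , k ⟩ _ _
        pt : ∀ a → same ⟨ f , k ⟩ a b *ᵣ same ⟨ g , k ⟩ a c *ᵣ (inv (mfgk a) *ᵣ inv (mk a)) ≤ᵣ (ind (q a) *ᵣ inv (mfgk a)) *ᵣ (same k b c *ᵣ inv (mk b))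
        pt a with dec ⟨ f , k ⟩ (fn ⟨ f , k ⟩ a) (fn ⟨ f , k ⟩ b) | dec ⟨ g , k ⟩ (fn ⟨ g , k ⟩ a) (fn ⟨ g , k ⟩ c)
        ... | yes p | yes r = ≤-reflexive (trans (cong (λ z → # 1 *ᵣ # 1 *ᵣ (inv (mfgk a) *ᵣ inv z)) (mass-class k (cong proj₂ p)))
             (trans (ring 2 λ x y → [] ⊢ con 1 :* con 1 :* (x :* y) := (con 1 :* x) :* (con 1 :* y))
               (cong (λ z → (# 1 *ᵣ inv (mfgk a)) *ᵣ (z *ᵣ inv (mk b))) (sym (ind-yes (dec k _ _) (trans (sym (cong proj₂ p)) (cong proj₂ r)))))))
        ... | yes p | no r = lin [] 4 (λ x y z w → [] ⊢ con 1 :* con 0 :* (x :* y) :≤ (con 0 :* x) :* (z :* w))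
        ... | no p | yes r = lin [] 4 (λ x y z w → [] ⊢ con 0 :* con 1 :* (x :* y) :≤ (con 0 :* x) :* (z :* w))
        ... | no p | no r = lin [] 4 (λ x y z w → [] ⊢ con 0 :* con 0 :* (x :* y) :≤ (con 0 :* x) :* (z :* w))

      -- The mean of p(f,k) p(g,k) / (p(f,g,k) p(k)). Each factor of the numerator is an expectation
      -- over an independent point, b or c; then a is summed first, c next and b last.
      ratio-≤1 : E μ ratio ≤ᵣ # 1
      ratio-≤1 = ≤-trans (≤-reflexive eq) (≤-trans (E-mono μ {ψ = λ b → E μ (λ c → same k b c *ᵣ inv (mk b))} (λ {b} _ → E-mono μ (λ {c} _ → inner b c)))
          (≤-trans (E-≤c μ {c = # 1} λ {b} s → ≤-reflexive (trans (E-*ʳ μ _ _) (inv-r (mass-pos k s)))) ≤-refl))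
        where
        W : Ω → R
        W a = inv (mfgk a) *ᵣ inv (mk a)
        eq : E μ ratio ≡ E μ (λ b → E μ (λ c → E μ (λ a → same ⟨ f , k ⟩ a b *ᵣ same ⟨ g , k ⟩ a c *ᵣ W a)))
        eq = trans (E-ext μ λ a → trans (cong (_*ᵣ W a) (trans (sym (E-*ʳ μ (mgk a) (same ⟨ f , k ⟩ a)))
                 (E-ext μ λ b → sym (E-* μ (same ⟨ f , k ⟩ a b) (same ⟨ g , k ⟩ a)))))
               (trans (sym (E-*ʳ μ (W a) _)) (E-ext μ λ b → sym (E-*ʳ μ (W a) _))))
             (trans (E-swap μ μ (λ a b → E μ (λ c → same ⟨ f , k ⟩ a b *ᵣ same ⟨ g , k ⟩ a c *ᵣ W a)))
               (E-ext μ λ b → E-swap μ μ (λ a c → same ⟨ f , k ⟩ a b *ᵣ same ⟨ g , k ⟩ a c *ᵣ W a)))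

    -- Submodularity. The pointwise difference is bounded through `h-log` by the ratio, whose mean
    -- is at most 1; the other 2 are the errors of `h-log` and `h-sub`.
    H-sub : H ⟨ f , ⟨ g , k ⟩ ⟩ +ᵣ H k ≤ᵣ H ⟨ f , k ⟩ +ᵣ H ⟨ g , k ⟩ +ᵣ # 3
    H-sub = ≤-trans (≤-reflexive (H-+ ⟨ f , ⟨ g , k ⟩ ⟩ k)) (≤-trans (E-mono μ {ψ = λ a → (h (mfk a) +ᵣ h (mgk a)) +ᵣ (ratio a +ᵣ # 2)} pt)
      (≤-trans (≤-reflexive (trans (E-+ μ _ _) (cong₂ _+ᵣ_ (sym (H-+ ⟨ f , k ⟩ ⟨ g , k ⟩)) (trans (E-+ μ _ _) (cong (E μ ratio +ᵣ_) (E-const μ (# 2)))))))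
        (lin (1 ∷ []) 3 (λ x y r → r :≤ con 1 ∷ [] ⊢ (x :+ y) :+ (r :+ con 2) :≤ x :+ y :+ con 3) ratio-≤1)))
      where
      pt : ∀ {a} → Supp μ a → h (mfgk a) +ᵣ h (mk a) ≤ᵣ (h (mfk a) +ᵣ h (mgk a)) +ᵣ (ratio a +ᵣ # 2)
      pt {a} s = lin (1 ∷ 1 ∷ 1 ∷ []) 7 (λ A B C D r x y → A :+ B :≤ x ∷ x :≤ y :+ r :+ con 1 ∷ y :≤ C :+ D :+ con 1 ∷ []
                     ⊢ A :+ B :≤ (C :+ D) :+ (r :+ con 2))
          (h-sup p1 (mass-≤1 ⟨ f , ⟨ g , k ⟩ ⟩ a) p2 (mass-≤1 k a))
          (h-log {y = mfk a *ᵣ mgk a} {r = ratio a} (*-pos p1 p2) (≤-trans (*-mono (<⇒≤ p2) (#-≥0 1) (mass-≤1 ⟨ f , ⟨ g , k ⟩ ⟩ a) (mass-≤1 k a)) (≤-reflexive (*-1ˡ _)))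
             (*-pos p3 p4) (*-≥0 (*-≥0 (<⇒≤ p3) (<⇒≤ p4)) (*-≥0 (inv-≥0 _) (inv-≥0 _)))
             (≤-reflexive (sym (trans (ring 5 λ y i j u v → [] ⊢ (y :* (i :* j)) :* (u :* v) := y :* ((u :* i) :* (v :* j)))
                (trans (cong₂ (λ u v → mfk a *ᵣ mgk a *ᵣ (u *ᵣ v)) (inv-r p1) (inv-r p2)) (ring 1 λ y → [] ⊢ y :* (con 1 :* con 1) := y))))))
          (h-sub p3 (mass-≤1 ⟨ f , k ⟩ a) p4 (mass-≤1 ⟨ g , k ⟩ a))
        where
        p1 : # 0 <ᵣ mfgk a
        p1 = mass-pos ⟨ f , ⟨ g , k ⟩ ⟩ s
        p2 : # 0 <ᵣ mk a
        p2 = mass-pos k s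
        p3 : # 0 <ᵣ mfk a
        p3 = mass-pos ⟨ f , k ⟩ s
        p4 : # 0 <ᵣ mgk a
        p4 = mass-pos ⟨ g , k ⟩ s

  H-subadd : ∀ f g → H ⟨ f , g ⟩ ≤ᵣ H f +ᵣ H g +ᵣ # 3
  H-subadd f g = lin (1 ∷ 1 ∷ 1 ∷ 1 ∷ []) 6 (λ fg f g fk gk fgk → fgk :+ con 0 :≤ fk :+ gk :+ con 3 ∷ fg :≤ fgk ∷ fk :≤ f ∷ gk :≤ g ∷ []
      ⊢ fg :≤ f :+ g :+ con 3)
    (subst (λ z → H ⟨ f , ⟨ g , ⊤ᵣ ⟩ ⟩ +ᵣ z ≤ᵣ H ⟨ f , ⊤ᵣ ⟩ +ᵣ H ⟨ g , ⊤ᵣ ⟩ +ᵣ # 3) H-⊤ (H-sub f g ⊤ᵣ))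
    (H-det ⟨ f , ⟨ g , ⊤ᵣ ⟩ ⟩ ⟨ f , g ⟩ (λ e → cong₂ _,_ (cong proj₁ e) (cong (proj₁ ∘ proj₂) e)))
    (H-det f ⟨ f , ⊤ᵣ ⟩ (λ e → cong (_, tt) e)) (H-det g ⟨ g , ⊤ᵣ ⟩ (λ e → cong (_, tt) e))

  -- Meant for l the pair of f and g, and k a variable given which they are independent: the
  -- identity of masses is conditional independence.
  H-ind : ∀ f g k l → (∀ {a} → Supp μ a → mass μ l a *ᵣ mass μ k a ≡ mass μ f a *ᵣ mass μ g a) →
    H f +ᵣ H g ≤ᵣ H l +ᵣ H k +ᵣ # 1
  H-ind f g k l e = ≤-trans (≤-reflexive (H-+ f g)) (≤-trans (E-mono μ {ψ = λ a → (h (mass μ l a) +ᵣ h (mass μ k a)) +ᵣ # 1} λ {a} s →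
      ≤-trans (h-sup (mass-pos f s) (mass-≤1 f a) (mass-pos g s) (mass-≤1 g a)) (≤-trans (≤-reflexive (cong h (sym (e s))))
        (h-sub (mass-pos l s) (mass-≤1 l a) (mass-pos k s) (mass-≤1 k a))))
      (≤-reflexive (trans (E-+ μ _ _) (cong₂ _+ᵣ_ (sym (H-+ l k)) (E-const μ _)))))

ind-× : ∀ {A B : Set} {a c : A} {b d : B} (x : Dec ((a , b) ≡ (c , d))) (p : Dec (a ≡ c)) (q : Dec (b ≡ d)) → ind x ≡ ind p *ᵣ ind q
ind-× x (yes refl) (yes refl) = trans (ind-yes x refl) (ring 0 ([] ⊢ con 1 := con 1 :* con 1))
ind-× x (yes p) (no q) = trans (ind-no x (λ r → q (cong proj₂ r))) (ring 0 ([] ⊢ con 0 := con 1 :* con 0))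
ind-× x (no p) e = trans (ind-no x (λ r → p (cong proj₁ r))) (ring 1 (λ z → [] ⊢ con 0 := con 0 :* z))

mass-⊗ : ∀ {A B} (μ : Dist A) (ν : Dist B) f g a b → mass (μ ⊗ ν) ⟨ f ∘ᵣ proj₁ , g ∘ᵣ proj₂ ⟩ (a , b) ≡ mass μ f a *ᵣ mass ν g b
mass-⊗ μ ν f g a b = trans (E-bind μ (λ _ → ν) _) (trans (E-ext μ λ a' → trans (E-ext ν λ b' → ind-× (dec ⟨ f ∘ᵣ proj₁ , g ∘ᵣ proj₂ ⟩ (fn f a , fn g b) (fn f a' , fn g b')) (dec f _ _) (dec g _ _)) (E-* ν _ _)) (E-*ʳ μ _ _))
H-⊗-lo : ∀ {A B} (μ : Dist A) (ν : Dist B) f g → H μ f +ᵣ H ν g ≤ᵣ H (μ ⊗ ν) ⟨ f ∘ᵣ proj₁ , g ∘ᵣ proj₂ ⟩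
H-⊗-lo μ ν f g = ≤-trans (≤-reflexive (trans (cong₂ _+ᵣ_ (H-def μ f) (H-def ν g)) (sym (trans (E-ext μ λ a → trans (E-+ ν _ _) (cong (_+ᵣ E ν (λ b → h (mass ν g b))) (E-const ν _)))
    (trans (E-+ μ _ _) (cong (E μ (λ a → h (mass μ f a)) +ᵣ_) (E-const μ _)))))))
  (≤-trans (E-mono μ λ {a} s → E-mono ν λ {b} s' → ≤-trans (h-sup (mass-pos μ f s) (mass-≤1 μ f a) (mass-pos ν g s') (mass-≤1 ν g b))
    (≤-reflexive (cong h (sym (mass-⊗ μ ν f g a b))))) (≤-reflexive (sym (trans (H-def (μ ⊗ ν) _) (E-bind μ (λ _ → ν) _)))))

*-cancel-1 : ∀ {x y} → y ≡ # 1 → x *ᵣ y ≡ x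
*-cancel-1 {x} e = trans (cong (x *ᵣ_) e) (ring 1 λ x → [] ⊢ x :* con 1 := x)

E-c+ : ∀ {Ω} (μ : Dist Ω) c φ → E μ (λ a → c +ᵣ φ a) ≡ c +ᵣ E μ φ
E-c+ μ c φ = trans (E-+ μ _ φ) (cong (_+ᵣ E μ φ) (E-const μ c))

E-+c : ∀ {Ω} (μ : Dist Ω) c φ → E μ (λ a → φ a +ᵣ c) ≡ E μ φ +ᵣ c
E-+c μ c φ = trans (E-+ μ φ _) (cong (E μ φ +ᵣ_) (E-const μ c))

-- Says that ν is the image of μ under φ, tested on functions. Rearranging independent factors then
-- amounts to `E-swap`.
record Law {A B : Set} (μ : Dist A) (ν : Dist B) (φ : A → B) : Set where
  constructor mkLaw
  field at : ∀ ψ → E μ (ψ ∘ φ) ≡ E ν ψ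
open Law public

H-law : ∀ {A B} {μ : Dist A} {ν : Dist B} {φ} → Law μ ν φ → ∀ f → H μ (f ∘ᵣ φ) ≡ H ν f
H-law {μ = μ} {ν} {φ} L f = trans (H-def μ (f ∘ᵣ φ)) (trans (trans (E-ext μ λ a → cong h (at L (same f (φ a)))) (at L (λ b → h (mass ν f b)))) (sym (H-def ν f)))

Law-id : ∀ {A} {μ : Dist A} → Law μ μ id
Law-id = mkLaw λ ψ → refl

Law-∘ : ∀ {A B C} {μ : Dist A} {ν : Dist B} {ξ : Dist C} {φ χ} → Law μ ν φ → Law ν ξ χ → Law μ ξ (χ ∘ φ)
Law-∘ L M = mkLaw λ ψ → trans (at L _) (at M ψ)

E-⊗ : ∀ {A B} (μ : Dist A) (ν : Dist B) (φ : A × B → R) → E (μ ⊗ ν) φ ≡ E μ (λ a → E ν (λ b → φ (a , b)))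
E-⊗ μ ν = E-bind μ (λ _ → ν)

Law-proj₁ : ∀ {A B} (μ : Dist A) (κ : A → Dist B) → Law (bind μ κ) μ proj₁
Law-proj₁ μ κ = mkLaw λ ψ → trans (E-bind μ κ _) (E-ext μ λ a → E-const (κ a) _)

Law-proj₂ : ∀ {A B} (μ : Dist A) (ν : Dist B) → Law (μ ⊗ ν) ν proj₂
Law-proj₂ μ ν = mkLaw λ ψ → trans (E-⊗ μ ν _) (E-const μ _)

Law-map : ∀ {A B C D} {μ : Dist A} {ν : Dist B} {μ' : Dist C} {ν' : Dist D} {φ χ} →
  Law μ μ' φ → Law ν ν' χ → Law (μ ⊗ ν) (μ' ⊗ ν') (λ p → φ (proj₁ p) , χ (proj₂ p))
Law-map {μ = μ} {ν} {μ'} {ν'} {φ} {χ} L M = mkLaw λ ψ → trans (E-⊗ μ ν _) (trans (E-ext μ λ a → at M (λ d → ψ (φ a , d)))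
  (trans (at L (λ c → E ν' (λ d → ψ (c , d)))) (sym (E-⊗ μ' ν' ψ))))

swap× : ∀ {A B : Set} → A × B → B × A
swap× (a , b) = b , a

Law-swap : ∀ {A B} (μ : Dist A) (ν : Dist B) → Law (μ ⊗ ν) (ν ⊗ μ) swap×
Law-swap μ ν = mkLaw λ ψ → trans (E-⊗ μ ν _) (trans (E-swap μ ν _) (sym (E-⊗ ν μ ψ)))

assoc× : ∀ {A B C : Set} → (A × B) × C → A × (B × C)
assoc× ((a , b) , c) = a , (b , c)
unassoc× : ∀ {A B C : Set} → A × (B × C) → (A × B) × C
unassoc× (a , (b , c)) = (a , b) , c

Law-unassoc : ∀ {A B C} (μ : Dist A) (ν : Dist B) (ξ : Dist C) → Law (μ ⊗ (ν ⊗ ξ)) ((μ ⊗ ν) ⊗ ξ) unassoc×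
Law-unassoc μ ν ξ = mkLaw λ ψ → trans (E-⊗ μ (ν ⊗ ξ) _) (trans (E-ext μ λ a → E-⊗ ν ξ _)
  (sym (trans (E-⊗ (μ ⊗ ν) ξ ψ) (E-⊗ μ ν _))))

Law-assoc : ∀ {A B C} (μ : Dist A) (ν : Dist B) (ξ : Dist C) → Law ((μ ⊗ ν) ⊗ ξ) (μ ⊗ (ν ⊗ ξ)) assoc×
Law-assoc μ ν ξ = mkLaw λ ψ → sym (at (Law-unassoc μ ν ξ) (ψ ∘ assoc×))

mid× : ∀ {A B C D : Set} → (A × B) × (C × D) → (A × C) × (B × D)
mid× ((a , b) , (c , d)) = (a , c) , (b , d)

Law-mid : ∀ {A B C D} (μ : Dist A) (ν : Dist B) (ξ : Dist C) (π : Dist D) →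
  Law ((μ ⊗ ν) ⊗ (ξ ⊗ π)) ((μ ⊗ ξ) ⊗ (ν ⊗ π)) mid×
Law-mid μ ν ξ π = mkLaw λ ψ → trans (E-⊗ (μ ⊗ ν) (ξ ⊗ π) _) (trans (E-⊗ μ ν _) (trans (E-ext μ λ a →
    trans (E-ext ν λ b → E-⊗ ξ π _) (E-swap ν ξ _)) (sym (trans (E-⊗ (μ ⊗ ξ) (ν ⊗ π) ψ) (trans (E-⊗ μ ξ _) (E-ext μ λ a → E-ext ξ λ c → E-⊗ ν π _))))))

H-⊗-hi : ∀ {A B} (μ : Dist A) (ν : Dist B) f g → H (μ ⊗ ν) ⟨ f ∘ᵣ proj₁ , g ∘ᵣ proj₂ ⟩ ≤ᵣ H μ f +ᵣ H ν g +ᵣ # 3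
H-⊗-hi μ ν f g = ≤-trans (H-subadd (μ ⊗ ν) (f ∘ᵣ proj₁) (g ∘ᵣ proj₂)) (≤-reflexive (cong₂ (λ x y → x +ᵣ y +ᵣ # 3) (H-law {μ = μ ⊗ ν} (Law-proj₁ μ (λ _ → ν)) f) (H-law {μ = μ ⊗ ν} (Law-proj₂ μ ν) g)))

-- Conditioning on a null event returns the original distribution.
module _ {Ω : Set} (μ : Dist Ω) (f : RV Ω) where
  private
    wt : Ω → R × Ω → R × Ω
    wt a (w , b) = (w *ᵣ same f a b) *ᵣ inv (mass μ f a) , b

    ∑-cond : ∀ a (φ : Ω → R) → ∑ (List.map (wt a) (pts μ)) (λ p → proj₁ p *ᵣ φ (proj₂ p)) ≡ E μ (λ b → same f a b *ᵣ φ b) *ᵣ inv (mass μ f a)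
    ∑-cond a φ = trans (∑-map (wt a) (pts μ) _) (trans (∑-cong (pts μ) λ {p} _ →
        ring 4 λ w s i x → [] ⊢ ((w :* s) :* i) :* x := i :* (w :* (s :* x))) (trans (∑-* (pts μ) (inv (mass μ f a)) _) (trans (*-comm (inv (mass μ f a)) _) (cong (_*ᵣ inv (mass μ f a)) (sym (E-def μ _))))))

  opaque
    cond : Ω → Dist Ω
    cond a with mass μ f a ≤? # 0
    ... | yes _ = μ
    ... | no p = dist (List.map (wt a) (pts μ))
      (λ {w} {b} m → case (∈P.∈-map⁻ (wt a) m))
      (trans (∑-cong (List.map (wt a) (pts μ)) (λ _ → ring 1 λ x → [] ⊢ x := x :* con 1))
        (trans (∑-cond a (λ _ → # 1)) (trans (cong (_*ᵣ inv (mass μ f a)) (E-ext μ λ b → ring 1 λ x → [] ⊢ x :* con 1 := x)) (inv-r (≰⇒> p)))))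
      where
      case : ∀ {w b} → ∃[ p ] (p ∈ pts μ × (w , b) ≡ wt a p) → # 0 ≤ᵣ w
      case ((w , b) , m , refl) = *-≥0 (*-≥0 (nonneg μ m) (ind-≥0 (dec f _ _))) (inv-≥0 _)

    E-cond : ∀ {a} → Supp μ a → ∀ φ → E (cond a) φ ≡ E μ (λ b → same f a b *ᵣ φ b) *ᵣ inv (mass μ f a)
    E-cond {a} s φ with mass μ f a ≤? # 0
    ... | yes q = ⊥-elim (<⇒≱ (mass-pos μ f s) q)
    ... | no _ = trans (E-def _ φ) (∑-cond a φ)

    Supp-cond : ∀ {a b} → Supp μ a → Supp (cond a) b → Supp μ b × fn f a ≡ fn f b
    Supp-cond {a} {b} s t with mass μ f a ≤? # 0
    ... | yes q = ⊥-elim (<⇒≱ (mass-pos μ f s) q)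
    ... | no _ with t
    ... | u , m , pos with ∈P.∈-map⁻ (wt a) m
    ... | (w , c) , mc , refl with w ≤? # 0 | dec f (fn f a) (fn f c)
    ... | yes w0 | _ = ⊥-elim (<⇒≱ pos (≤-trans (≤-reflexive (cong (λ z → (z *ᵣ _) *ᵣ inv (mass μ f a)) (≤-antisym w0 (nonneg μ mc)))) (lin [] 2 λ x y → [] ⊢ (con 0 :* x) :* y :≤ con 0)))
    ... | no _ | no _ = ⊥-elim (<⇒≱ pos (lin [] 2 λ x y → [] ⊢ (x :* con 0) :* y :≤ con 0))
    ... | no w0 | yes e = (w , mc , ≰⇒> w0) , e

  cond-class : ∀ {a b} → Supp μ a → Supp μ b → fn f a ≡ fn f b → ∀ φ → E (cond a) φ ≡ E (cond b) φ
  cond-class {a} {b} s t e φ = trans (E-cond s φ) (trans (cong₂ _*ᵣ_ (E-ext μ λ c → cong (_*ᵣ φ c)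
    (ind-cong (dec f _ _) (dec f _ _) (trans (sym e)) (trans e))) (cong inv (mass-class μ f e))) (sym (E-cond t φ)))

  -- The tower property, where Φ may depend on the conditioning point as long as, on the support,
  -- only its class matters. Written as a double expectation, the weight of a pair (a, b) in one
  -- class is symmetric, so the roles of a and b can be exchanged.
  E-total : ∀ (Φ : Ω → Ω → R) → (∀ {a b} → Supp μ a → Supp μ b → fn f a ≡ fn f b → Φ a b ≡ Φ b b) →
    E μ (λ a → E (cond a) (Φ a)) ≡ E μ (λ a → Φ a a)
  E-total Φ c = trans (E-cong μ λ {a} s → trans (E-cond s (Φ a)) (trans (sym (E-*ʳ μ _ _))
      (E-cong μ λ {b} t → pt s t))) (trans (E-swap μ μ (λ a b → same f b a *ᵣ (Φ b b *ᵣ inv (mass μ f b))))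
      (E-cong μ λ {b} t → trans (E-*ʳ μ _ (same f b)) (trans (ring 3 λ m x i → [] ⊢ m :* (x :* i) := x :* (m :* i))
        (trans (cong (Φ b b *ᵣ_) (inv-r (mass-pos μ f t))) (ring 1 λ x → [] ⊢ x :* con 1 := x)))))
    where
    pt : ∀ {a b} → Supp μ a → Supp μ b → same f a b *ᵣ Φ a b *ᵣ inv (mass μ f a) ≡ same f b a *ᵣ (Φ b b *ᵣ inv (mass μ f b))
    pt {a} {b} s t with dec f (fn f a) (fn f b) | dec f (fn f b) (fn f a)
    ... | yes e | yes _ = trans (cong₂ (λ x y → # 1 *ᵣ x *ᵣ inv y) (c s t e) (mass-class μ f e)) (ring 2 λ x y → [] ⊢ con 1 :* x :* y := con 1 :* (x :* y))
    ... | yes e | no n = ⊥-elim (n (sym e))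
    ... | no n | yes e = ⊥-elim (n (sym e))
    ... | no _ | no _ = ring 3 λ x y z → [] ⊢ con 0 :* x :* y := con 0 :* z

  module _ {Ω' : Set} (κ : Ω → Dist Ω') (g : RV (Ω × Ω')) where
    private
      J : Dist (Ω × Ω')
      J = bind μ κ
      Ja : Ω → Dist (Ω × Ω')
      Ja a = bind (cond a) κ
      fib : ∀ {a} → Supp μ a → ∀ b → mass J ⟨ f ∘ᵣ proj₁ , g ⟩ (a , b) ≡ mass μ f a *ᵣ mass (Ja a) g (a , b)
      fib {a} s b = trans (E-bind μ κ _) (trans (E-ext μ λ a' → trans (E-ext (κ a') λ b' →
            ind-× (dec ⟨ f ∘ᵣ proj₁ , g ⟩ (fn f a , fn g (a , b)) (fn f a' , fn g (a' , b'))) (dec f _ _) (dec g _ _)) (E-* (κ a') _ _))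
          (sym (trans (cong (mass μ f a *ᵣ_) (trans (E-bind (cond a) κ _) (E-cond s _)))
            (trans (ring 3 λ m x i → [] ⊢ m :* (x :* i) := x :* (m :* i)) (*-cancel-1 (inv-r (mass-pos μ f s)))))))

      cond-H : E μ (λ a → E (κ a) (λ b → h (mass (Ja a) g (a , b)))) ≡ E μ (λ a → H (Ja a) g)
      cond-H = sym (trans (E-ext μ λ a → trans (H-def (Ja a) g) (E-bind (cond a) κ _)) (E-total (λ a a' → E (κ a') (λ b → h (mass (Ja a) g (a' , b))))
        λ {a} {a'} s t e → E-ext (κ a') λ b → cong h (trans (E-bind (cond a) κ _) (trans (cond-class s t e _) (sym (E-bind (cond a') κ _))))))

      total-H : E μ (λ a → E (κ a) (λ b → h (mass μ f a) +ᵣ h (mass (Ja a) g (a , b)))) ≡ H μ f +ᵣ E μ (λ a → H (Ja a) g)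
      total-H = trans (E-ext μ λ a → E-c+ (κ a) _ _) (trans (E-+ μ _ _) (cong₂ _+ᵣ_ (sym (H-def μ f)) cond-H))

      cpos : ∀ {a b} → Supp μ a → Supp (κ a) b → # 0 <ᵣ mass (Ja a) g (a , b)
      cpos {a} {b} s t = ≰⇒> λ q → <⇒≱ (mass-pos J ⟨ f ∘ᵣ proj₁ , g ⟩ {a , b} (Supp-bind⁺ μ κ s t))
          (≤-trans (≤-reflexive (fib s b)) (≤-trans (*-monoˡ (mass μ f a) (<⇒≤ (mass-pos μ f s)) q) (lin [] 1 λ x → [] ⊢ x :* con 0 :≤ con 0)))

    -- The chain rule with a kernel κ that adds randomness after the conditioning. A Dirac kernel
    -- gives the plain rule, a constant kernel adjoins an independent variable, and `cond` itself
    -- adjoins a second copy over the same value of f.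
    chain-lo : H μ f +ᵣ E μ (λ a → H (bind (cond a) κ) g) ≤ᵣ H J ⟨ f ∘ᵣ proj₁ , g ⟩
    chain-lo = ≤-trans (≤-reflexive (sym total-H)) (≤-trans (E-mono μ λ {a} s → E-mono (κ a) λ {b} t →
       ≤-trans (h-sup (mass-pos μ f s) (mass-≤1 μ f a) (cpos s t) (mass-≤1 (Ja a) g (a , b))) (≤-reflexive (cong h (sym (fib s b)))))
       (≤-reflexive (sym (trans (H-def J _) (E-bind μ κ _)))))

    chain-hi : H J ⟨ f ∘ᵣ proj₁ , g ⟩ ≤ᵣ H μ f +ᵣ E μ (λ a → H (bind (cond a) κ) g) +ᵣ # 1
    chain-hi = ≤-trans (≤-reflexive (trans (H-def J _) (E-bind μ κ _))) (≤-trans (E-mono μ λ {a} s → E-mono (κ a) λ {b} t →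
         ≤-trans (≤-reflexive (cong h (fib s b))) (h-sub (mass-pos μ f s) (mass-≤1 μ f a) (cpos s t) (mass-≤1 (Ja a) g (a , b))))
       (≤-reflexive (trans (E-ext μ λ a → E-+c (κ a) _ _) (trans (E-+ μ _ _) (cong₂ _+ᵣ_ total-H (E-const μ _))))))

-- Entropy in abelian groups

record Grp : Set₁ where
  no-eta-equality
  infixl 6 _∙_
  field
    Car : Set
    _≟g_ : DecidableEquality Car
    _∙_ : Car → Car → Car
    ε : Car
    _⁻ : Car → Car
    g-assoc : ∀ a b c → (a ∙ b) ∙ c ≡ a ∙ (b ∙ c)
    g-comm : ∀ a b → a ∙ b ≡ b ∙ a
    g-idˡ : ∀ a → ε ∙ a ≡ a
    g-invʳ : ∀ a → a ∙ (a ⁻) ≡ ε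

  g-idʳ : ∀ a → a ∙ ε ≡ a
  g-idʳ a = trans (g-comm a ε) (g-idˡ a)
  g-cancelʳ : ∀ {a b} c → a ∙ c ≡ b ∙ c → a ≡ b
  g-cancelʳ {a} {b} c e = trans (sym (r a)) (trans (cong (_∙ (c ⁻)) e) (r b))
    where
    r : ∀ x → (x ∙ c) ∙ (c ⁻) ≡ x
    r x = trans (g-assoc x c _) (trans (cong (x ∙_) (g-invʳ c)) (g-idʳ x))
  g-cancelˡ : ∀ {a b} c → c ∙ a ≡ c ∙ b → a ≡ b
  g-cancelˡ c e = g-cancelʳ c (trans (g-comm _ c) (trans e (g-comm c _)))
  g-inv-inj : ∀ {a b} → a ⁻ ≡ b ⁻ → a ≡ b
  g-inv-inj {a} {b} e = g-cancelʳ (a ⁻) (trans (g-invʳ a) (sym (trans (cong (b ∙_) e) (g-invʳ b))))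
  g-inv-uniq : ∀ {a b} → a ∙ b ≡ ε → b ≡ a ⁻
  g-inv-uniq {a} e = g-cancelˡ a (trans e (sym (g-invʳ a)))
  g-mid : ∀ a b c d → (a ∙ b) ∙ (c ∙ d) ≡ (a ∙ c) ∙ (b ∙ d)
  g-mid a b c d = trans (g-assoc a b _) (trans (cong (a ∙_) (trans (sym (g-assoc b c d))
    (trans (cong (_∙ d) (g-comm b c)) (g-assoc c b d)))) (sym (g-assoc a c _)))
  g-inv-∙ : ∀ a b → (a ∙ b) ⁻ ≡ a ⁻ ∙ b ⁻
  g-inv-∙ a b = sym (g-inv-uniq (trans (g-mid a b _ _) (trans (cong₂ _∙_ (g-invʳ a) (g-invʳ b)) (g-idˡ ε))))
  g-inv-inv : ∀ a → (a ⁻) ⁻ ≡ a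
  g-inv-inv a = sym (g-inv-uniq (trans (g-comm _ a) (g-invʳ a)))
open Grp public

_×g_ : Grp → Grp → Grp
G ×g K = record
  { Car = Car G × Car K ; _≟g_ = pairDec (_≟g_ G) (_≟g_ K)
  ; _∙_ = λ { (a , b) (c , d) → _∙_ G a c , _∙_ K b d } ; ε = ε G , ε K ; _⁻ = λ { (a , b) → _⁻ G a , _⁻ K b }
  ; g-assoc = λ _ _ _ → cong₂ _,_ (g-assoc G _ _ _) (g-assoc K _ _ _)
  ; g-comm = λ _ _ → cong₂ _,_ (g-comm G _ _) (g-comm K _ _)
  ; g-idˡ = λ _ → cong₂ _,_ (g-idˡ G _) (g-idˡ K _)
  ; g-invʳ = λ _ → cong₂ _,_ (g-invʳ G _) (g-invʳ K _) }

-- Conditional entropy and variables with side information.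

cH : ∀ {Ω} → Dist Ω → RV Ω → RV Ω → R
cH μ f T = H μ ⟨ f , T ⟩ -ᵣ H μ T

,-inj : ∀ {A B : Set} {a c : A} {b d : B} → (a , b) ≡ (c , d) → a ≡ c × b ≡ d
,-inj refl = refl , refl

module _ {Ω : Set} (μ : Dist Ω) (T : RV Ω) where
  cH-mono : ∀ f g → ⟨ f , T ⟩ ⟶ g → cH μ g T ≤ᵣ cH μ f T
  cH-mono f g d = lin (1 ∷ []) 3 (λ a b t → a :≤ b ∷ [] ⊢ a :- t :≤ b :- t)
    (H-det μ ⟨ f , T ⟩ ⟨ g , T ⟩ λ e → cong₂ _,_ (d e) (proj₂ (,-inj e)))

  cH-subk : ∀ f g k → cH μ ⟨ f , ⟨ g , k ⟩ ⟩ T +ᵣ cH μ k T ≤ᵣ cH μ ⟨ f , k ⟩ T +ᵣ cH μ ⟨ g , k ⟩ T +ᵣ # 3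
  cH-subk f g k = lin (1 ∷ 1 ∷ 1 ∷ 1 ∷ []) 8 (λ a b c d t a' c' d' → a' :+ b :≤ c' :+ d' :+ con 3 ∷ a :≤ a' ∷ c' :≤ c ∷ d' :≤ d ∷ [] ⊢ (a :- t) :+ (b :- t) :≤ (c :- t) :+ (d :- t) :+ con 3)
    (H-sub μ f g ⟨ k , T ⟩)
    (H-det μ ⟨ f , ⟨ g , ⟨ k , T ⟩ ⟩ ⟩ ⟨ ⟨ f , ⟨ g , k ⟩ ⟩ , T ⟩ λ { e → let (p , e₁) = ,-inj e ; (q , e₂) = ,-inj e₁ ; (r , t) = ,-inj e₂ in cong₂ _,_ (cong₂ _,_ p (cong₂ _,_ q r)) t })
    (H-det μ ⟨ ⟨ f , k ⟩ , T ⟩ ⟨ f , ⟨ k , T ⟩ ⟩ λ { e → let (p , t) = ,-inj e ; (q , r) = ,-inj p in cong₂ _,_ q (cong₂ _,_ r t) })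
    (H-det μ ⟨ ⟨ g , k ⟩ , T ⟩ ⟨ g , ⟨ k , T ⟩ ⟩ λ { e → let (p , t) = ,-inj e ; (q , r) = ,-inj p in cong₂ _,_ q (cong₂ _,_ r t) })

  cH-sub : ∀ f g → cH μ ⟨ f , g ⟩ T ≤ᵣ cH μ f T +ᵣ cH μ g T +ᵣ # 3
  cH-sub f g = lin (1 ∷ 1 ∷ []) 5 (λ a a' b c t → a' :+ t :≤ b :+ c :+ con 3 ∷ a :≤ a' ∷ [] ⊢ a :- t :≤ (b :- t) :+ (c :- t) :+ con 3)
    (H-sub μ f g T)
    (H-det μ ⟨ f , ⟨ g , T ⟩ ⟩ ⟨ ⟨ f , g ⟩ , T ⟩ λ e → let (p , e₁) = ,-inj e ; (q , t) = ,-inj e₁ in cong₂ _,_ (cong₂ _,_ p q) t)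

cH-law : ∀ {Ω Ω'} {μ : Dist Ω} {ν : Dist Ω'} {φ : Ω → Ω'} → Law μ ν φ → ∀ f T g S →
  ⟨ f , T ⟩ ⟶ (g ∘ᵣ φ) → ⟨ g ∘ᵣ φ , S ∘ᵣ φ ⟩ ⟶ f → T ⟶ (S ∘ᵣ φ) → (S ∘ᵣ φ) ⟶ T → cH μ f T ≡ cH ν g S
cH-law {μ = μ} {ν} {φ} L f T g S d d' e e' = cong₂ _-ᵣ_
  (trans (H-iso μ ⟨ f , T ⟩ (⟨ g , S ⟩ ∘ᵣ φ) (λ q → cong₂ _,_ (d q) (e (proj₂ (,-inj q)))) (λ q → cong₂ _,_ (d' q) (e' (proj₂ (,-inj q))))) (H-law L ⟨ g , S ⟩))
  (trans (H-iso μ T (S ∘ᵣ φ) e e') (H-law L S))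

infixr 5 _⊗ᵣ_
_⊗ᵣ_ : ∀ {A B} → RV A → RV B → RV (A × B)
f ⊗ᵣ g = ⟨ f ∘ᵣ proj₁ , g ∘ᵣ proj₂ ⟩

module _ {A B : Set} (μ : Dist A) (ν : Dist B) (f : RV A) (g : RV B) (T : RV A) (S : RV B) where
  private
    fwd : ⟨ f , T ⟩ ⊗ᵣ ⟨ g , S ⟩ ⟶ ⟨ f ⊗ᵣ g , T ⊗ᵣ S ⟩
    fwd e = let (p , q) = ,-inj e ; (a , b) = ,-inj p ; (c , d) = ,-inj q in cong₂ _,_ (cong₂ _,_ a c) (cong₂ _,_ b d)
    bwd : ⟨ f ⊗ᵣ g , T ⊗ᵣ S ⟩ ⟶ ⟨ f , T ⟩ ⊗ᵣ ⟨ g , S ⟩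
    bwd e = let (p , q) = ,-inj e ; (a , b) = ,-inj p ; (c , d) = ,-inj q in cong₂ _,_ (cong₂ _,_ a c) (cong₂ _,_ b d)

  cH-⊗-hi : cH (μ ⊗ ν) (f ⊗ᵣ g) (T ⊗ᵣ S) ≤ᵣ cH μ f T +ᵣ cH ν g S +ᵣ # 3
  cH-⊗-hi = lin (1 ∷ 1 ∷ 1 ∷ []) 7 (λ a a' t b c u v → a :≤ a' ∷ a' :≤ b :+ c :+ con 3 ∷ u :+ v :≤ t ∷ [] ⊢ a :- t :≤ (b :- u) :+ (c :- v) :+ con 3)
    (H-det (μ ⊗ ν) (⟨ f , T ⟩ ⊗ᵣ ⟨ g , S ⟩) ⟨ f ⊗ᵣ g , T ⊗ᵣ S ⟩ fwd) (H-⊗-hi μ ν ⟨ f , T ⟩ ⟨ g , S ⟩) (H-⊗-lo μ ν T S)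

  cH-⊗-lo : cH μ f T +ᵣ cH ν g S ≤ᵣ cH (μ ⊗ ν) (f ⊗ᵣ g) (T ⊗ᵣ S) +ᵣ # 3
  cH-⊗-lo = lin (1 ∷ 1 ∷ 1 ∷ []) 7 (λ a a' t b c u v → a' :≤ a ∷ b :+ c :≤ a' ∷ t :≤ u :+ v :+ con 3 ∷ [] ⊢ (b :- u) :+ (c :- v) :≤ a :- t :+ con 3)
    (H-det (μ ⊗ ν) ⟨ f ⊗ᵣ g , T ⊗ᵣ S ⟩ (⟨ f , T ⟩ ⊗ᵣ ⟨ g , S ⟩) bwd) (H-⊗-lo μ ν ⟨ f , T ⟩ ⟨ g , S ⟩) (H-⊗-hi μ ν T S)

cH-triv : ∀ {Ω} (μ : Dist Ω) T f → T ⟶ f → cH μ f T ≡ # 0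
cH-triv μ T f d = trans (cong (_-ᵣ H μ T) (H-iso μ ⟨ f , T ⟩ T (λ e → proj₂ (,-inj e)) (λ e → cong₂ _,_ (d e) e))) (ring 1 λ x → [] ⊢ x :- x := con 0)

module _ {A B : Set} (μ : Dist A) (ν : Dist B) (f : RV A) (T : RV A) (S : RV B) where
  private
    eq : cH (μ ⊗ ν) (f ⊗ᵣ ⊤ᵣ) (T ⊗ᵣ S) ≡ cH (μ ⊗ ν) (f ∘ᵣ proj₁) (T ⊗ᵣ S)
    eq = cH-law {μ = μ ⊗ ν} Law-id (f ⊗ᵣ ⊤ᵣ) (T ⊗ᵣ S) (f ∘ᵣ proj₁) (T ⊗ᵣ S) (λ e → proj₁ (,-inj (proj₁ (,-inj e)))) (λ e → cong (_, tt) (proj₁ (,-inj e))) id id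

  cH-proj₁-hi : cH (μ ⊗ ν) (f ∘ᵣ proj₁) (T ⊗ᵣ S) ≤ᵣ cH μ f T +ᵣ # 3
  cH-proj₁-hi = ≤-trans (≤-reflexive (sym eq)) (≤-trans (cH-⊗-hi μ ν f ⊤ᵣ T S) (lin (1 ∷ []) 2 (λ a b → b :≤ con 0 ∷ [] ⊢ a :+ b :+ con 3 :≤ a :+ con 3) (≤-reflexive (cH-triv ν S ⊤ᵣ (λ _ → refl)))))

  cH-proj₁-lo : cH μ f T ≤ᵣ cH (μ ⊗ ν) (f ∘ᵣ proj₁) (T ⊗ᵣ S) +ᵣ # 3
  cH-proj₁-lo = ≤-trans (lin (1 ∷ []) 2 (λ a b → con 0 :≤ b ∷ [] ⊢ a :≤ a :+ b) (≤-reflexive (sym (cH-triv ν S ⊤ᵣ (λ _ → refl))))) (≤-trans (cH-⊗-lo μ ν f ⊤ᵣ T S) (≤-reflexive (cong (_+ᵣ # 3) eq)))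

cH-swap : ∀ {A B} (μ : Dist A) (ν : Dist B) f T S → cH (μ ⊗ ν) (f ∘ᵣ swap×) (T ⊗ᵣ S) ≡ cH (ν ⊗ μ) f (S ⊗ᵣ T)
cH-swap μ ν f T S = cH-law {μ = μ ⊗ ν} (Law-swap μ ν) (f ∘ᵣ swap×) (T ⊗ᵣ S) f (S ⊗ᵣ T) (λ e → proj₁ (,-inj e)) (λ e → proj₁ (,-inj e))
  (λ e → let (p , q) = ,-inj e in cong₂ _,_ q p) (λ e → let (p , q) = ,-inj e in cong₂ _,_ q p)

-- A group-valued random variable X together with side information T.
record Obj (G : Grp) : Set₁ where
  no-eta-equality
  constructor obj
  field
    {Ω} : Set
    μ : Dist Ω
    X : Ω → Car G
    T : RV Ω
  Xr : RV Ω
  Xr = rv (_≟g_ G) X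
open Obj public

rvg : ∀ {Ω} (G : Grp) → (Ω → Car G) → RV Ω
rvg G f = rv (_≟g_ G) f

hh : ∀ {G} → Obj G → R
hh O = cH (μ O) (Xr O) (T O)

infixr 6 _⊞_ _⊟_
infixr 6 _⊠_
_⊞_ : ∀ {G} → Obj G → Obj G → Obj G
_⊞_ {G} A B = obj (μ A ⊗ μ B) (λ p → _∙_ G (X A (proj₁ p)) (X B (proj₂ p))) (T A ⊗ᵣ T B)

_⊠_ : ∀ {G K} → Obj G → Obj K → Obj (G ×g K)
A ⊠ B = obj (μ A ⊗ μ B) (λ p → X A (proj₁ p) , X B (proj₂ p)) (T A ⊗ᵣ T B)

neg : ∀ {G} → Obj G → Obj G
neg {G} A = obj (μ A) (λ a → _⁻ G (X A a)) (T A)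

_⊟_ : ∀ {G} → Obj G → Obj G → Obj G
A ⊟ B = A ⊞ neg B

infix 4 _⇒_
-- The map need not be invertible: preserving the measure, the group values and the content of the
-- side information is enough to preserve `hh`. This allows `flat-++` to drop a trivial factor.
record _⇒_ {G} (A B : Obj G) : Set where
  constructor mk⇒
  field
    φ : Ω A → Ω B
    law : Law (μ A) (μ B) φ
    Xeq : ∀ a → X A a ≡ X B (φ a)
    T→ : T A ⟶ T B ∘ᵣ φ
    T← : T B ∘ᵣ φ ⟶ T A
open _⇒_ public

module _ {G : Grp} where
  hh-⇒ : {A B : Obj G} → A ⇒ B → hh A ≡ hh B
  hh-⇒ {A} {B} m = cH-law (law m) (Xr A) (T A) (Xr B) (T B)
    (λ {a} {b} e → trans (sym (Xeq m a)) (trans (proj₁ (,-inj e)) (Xeq m b)))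
    (λ {a} {b} e → trans (Xeq m a) (trans (proj₁ (,-inj e)) (sym (Xeq m b)))) (T→ m) (T← m)

  ⇒-id : {A : Obj G} → A ⇒ A
  ⇒-id = mk⇒ id Law-id (λ _ → refl) id id

  infixr 5 _⇒∘_
  _⇒∘_ : {A B C : Obj G} → A ⇒ B → B ⇒ C → A ⇒ C
  m ⇒∘ n = mk⇒ (φ n ∘ φ m) (Law-∘ (law m) (law n)) (λ a → trans (Xeq m a) (Xeq n (φ m a))) (T→ n ∘ T→ m) (T← m ∘ T← n)

  ⇒-⊞ : {A B C D : Obj G} → A ⇒ C → B ⇒ D → A ⊞ B ⇒ C ⊞ D
  ⇒-⊞ m n = mk⇒ (λ p → φ m (proj₁ p) , φ n (proj₂ p)) (Law-map (law m) (law n)) (λ p → cong₂ (_∙_ G) (Xeq m _) (Xeq n _))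
    (λ e → let (p , q) = ,-inj e in cong₂ _,_ (T→ m p) (T→ n q)) (λ e → let (p , q) = ,-inj e in cong₂ _,_ (T← m p) (T← n q))

  ⊞-comm : {A B : Obj G} → A ⊞ B ⇒ B ⊞ A
  ⊞-comm {A} {B} = mk⇒ swap× (Law-swap (μ A) (μ B)) (λ p → g-comm G _ _)
    (λ e → let (p , q) = ,-inj e in cong₂ _,_ q p) (λ e → let (p , q) = ,-inj e in cong₂ _,_ q p)

  ⊞-assoc : {A B C : Obj G} → (A ⊞ B) ⊞ C ⇒ A ⊞ (B ⊞ C)
  ⊞-assoc {A} {B} {C} = mk⇒ assoc× (Law-assoc (μ A) (μ B) (μ C)) (λ p → g-assoc G _ _ _)
    (λ e → let (p , q) = ,-inj e ; (a , b) = ,-inj p in cong₂ _,_ a (cong₂ _,_ b q))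
    (λ e → let (p , q) = ,-inj e ; (a , b) = ,-inj q in cong₂ _,_ (cong₂ _,_ p a) b)

  ⊞-unassoc : {A B C : Obj G} → A ⊞ (B ⊞ C) ⇒ (A ⊞ B) ⊞ C
  ⊞-unassoc {A} {B} {C} = mk⇒ unassoc× (Law-unassoc (μ A) (μ B) (μ C)) (λ p → sym (g-assoc G _ _ _))
    (λ e → let (p , q) = ,-inj e ; (a , b) = ,-inj q in cong₂ _,_ (cong₂ _,_ p a) b)
    (λ e → let (p , q) = ,-inj e ; (a , b) = ,-inj p in cong₂ _,_ a (cong₂ _,_ b q))

  hh-neg : (A : Obj G) → hh (neg A) ≡ hh A
  hh-neg A = cH-law {μ = μ A} Law-id (Xr (neg A)) (T A) (Xr A) (T A) (λ e → g-inv-inj G (proj₁ (,-inj e))) (λ e → cong (_⁻ G) (proj₁ (,-inj e))) id id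

  hh-neg-⊞ : (A B : Obj G) → hh (neg A ⊞ neg B) ≡ hh (A ⊞ B)
  hh-neg-⊞ A B = trans (hh-⇒ {neg A ⊞ neg B} {neg (A ⊞ B)} (mk⇒ id Law-id (λ p → sym (g-inv-∙ G _ _)) id id)) (hh-neg (A ⊞ B))

  ⇒-neg : {A B : Obj G} → A ⇒ B → neg A ⇒ neg B
  ⇒-neg m = mk⇒ (φ m) (law m) (λ a → cong (_⁻ G) (Xeq m a)) (T→ m) (T← m)

  neg-neg : {A : Obj G} → A ⇒ neg (neg A)
  neg-neg {A} = mk⇒ id Law-id (λ a → sym (g-inv-inv G _)) id id

hh-⊠-lo : ∀ {G K} (A : Obj G) (B : Obj K) → hh A +ᵣ hh B ≤ᵣ hh (A ⊠ B) +ᵣ # 3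
hh-⊠-lo A B = cH-⊗-lo (μ A) (μ B) (Xr A) (Xr B) (T A) (T B)
hh-⊠-hi : ∀ {G K} (A : Obj G) (B : Obj K) → hh (A ⊠ B) ≤ᵣ hh A +ᵣ hh B +ᵣ # 3
hh-⊠-hi A B = cH-⊗-hi (μ A) (μ B) (Xr A) (Xr B) (T A) (T B)

module _ {G : Grp} where
  private
    _+g_ : Car G → Car G → Car G
    _+g_ = _∙_ G

  -- The pair of summands is recovered from the sum and the second summand, and the latter
  -- contributes only `hh B`, which cancels.
  hh-⊞-mono : (A B : Obj G) → hh A ≤ᵣ hh (A ⊞ B) +ᵣ # 9
  hh-⊞-mono A B = lin (1 ∷ 1 ∷ 1 ∷ 1 ∷ []) 6 (λ a b j s c b' → a :+ b :≤ j :+ con 3 ∷ j :≤ c ∷ c :≤ s :+ b' :+ con 3 ∷ b' :≤ b :+ con 3 ∷ [] ⊢ a :≤ s :+ con 9)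
    (hh-⊠-lo A B)
    (cH-mono M (T A ⊗ᵣ T B) ⟨ Xr (A ⊞ B) , Xr B ∘ᵣ proj₂ ⟩ (Xr (A ⊠ B)) λ {a} e → let (p , q) = ,-inj e ; (s , b) = ,-inj p in
       cong₂ _,_ (g-cancelʳ G (X B (proj₂ a)) (trans s (cong (_ +g_) (sym b)))) b)
    (cH-sub M (T A ⊗ᵣ T B) (Xr (A ⊞ B)) (Xr B ∘ᵣ proj₂))
    (≤-trans (≤-reflexive (cH-swap (μ A) (μ B) (Xr B ∘ᵣ proj₁) (T A) (T B))) (cH-proj₁-hi (μ B) (μ A) (Xr B) (T B) (T A)))
    where
    M : Dist (Ω A × Ω B)
    M = μ A ⊗ μ B

  -- The Kaimanovich–Vershik inequality.
  kv : (A B C : Obj G) → hh (A ⊞ (B ⊞ C)) +ᵣ hh B ≤ᵣ hh (A ⊞ B) +ᵣ hh (B ⊞ C) +ᵣ # 15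
  kv A B C = lin (1 ∷ 1 ∷ 1 ∷ 1 ∷ 1 ∷ 1 ∷ []) 11 (λ a b c ab bc s J3 J2 fs gs l →
        l :+ s :≤ fs :+ gs :+ con 3 ∷ a :+ J2 :≤ J3 :+ con 3 ∷ b :+ c :≤ J2 :+ con 3 ∷ J3 :≤ l ∷ fs :≤ a :+ bc :+ con 3 ∷ gs :≤ c :+ ab :+ con 3 ∷ []
        ⊢ s :+ b :≤ ab :+ bc :+ con 15)
      (cH-subk M TT f g S) (hh-⊠-lo A (B ⊠ C)) (hh-⊠-lo B C)
      (cH-mono M TT ⟨ f , ⟨ g , S ⟩ ⟩ (Xr (A ⊠ (B ⊠ C))) λ {p} e → let (q , _) = ,-inj e ; (a , r) = ,-inj q ; (c , s) = ,-inj r in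
         cong₂ _,_ a (cong₂ _,_ (g-cancelʳ G (X C (proj₂ (proj₂ p))) (g-cancelˡ G (X A (proj₁ p)) (trans s (cong₂ (λ x y → x +g (_ +g y)) (sym a) (sym c))))) c))
      (≤-trans (cH-mono M TT (Xr (A ⊠ (B ⊞ C))) ⟨ f , S ⟩ λ e → let (q , _) = ,-inj e ; (a , r) = ,-inj q in cong₂ _,_ a (cong₂ _+g_ a r)) (hh-⊠-hi A (B ⊞ C)))
      (≤-trans (≤-trans (cH-mono M TT g' ⟨ g , S ⟩ λ e → let (q , _) = ,-inj e ; (c , r) = ,-inj q in
            cong₂ _,_ c (trans (sym (g-assoc G _ _ _)) (trans (cong₂ _+g_ r c) (g-assoc G _ _ _))))
          (≤-reflexive (cH-law {μ = M} {ν = μ C ⊗ (μ A ⊗ μ B)} {φ = swap× ∘ unassoc×} (Law-∘ (Law-unassoc (μ A) (μ B) (μ C)) (Law-swap (μ A ⊗ μ B) (μ C)))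
             g' TT (Xr (C ⊠ (A ⊞ B))) (T (C ⊠ (A ⊞ B))) (λ e → proj₁ (,-inj e)) (λ e → proj₁ (,-inj e))
             (λ e → let (a , r) = ,-inj e ; (b , c) = ,-inj r in cong₂ _,_ c (cong₂ _,_ a b)) (λ e → let (c , r) = ,-inj e ; (a , b) = ,-inj r in cong₂ _,_ a (cong₂ _,_ b c)))))
        (hh-⊠-hi C (A ⊞ B)))
    where
    M : Dist (Ω A × (Ω B × Ω C))
    M = μ A ⊗ (μ B ⊗ μ C)
    TT f g S g' : RV (Ω A × (Ω B × Ω C))
    TT = T A ⊗ᵣ (T B ⊗ᵣ T C)
    f = Xr A ∘ᵣ proj₁
    g = Xr C ∘ᵣ (proj₂ ∘ proj₂)
    S = Xr (A ⊞ (B ⊞ C))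
    g' = Xr (C ⊠ (A ⊞ B)) ∘ᵣ (swap× ∘ unassoc×)

  -- Ruzsa's triangle inequality.
  triangle : (A B V : Obj G) → hh (A ⊞ V) +ᵣ hh B ≤ᵣ hh (A ⊟ B) +ᵣ hh (B ⊞ V) +ᵣ # 27
  triangle A B V = lin (1 ∷ 1 ∷ 1 ∷ 1 ∷ 1 ∷ 1 ∷ 1 ∷ 1 ∷ 1 ∷ []) 14 (λ a b v av ab bv J2 J3 l k fk gk f r →
        l :+ k :≤ fk :+ gk :+ con 3 ∷ a :+ J2 :≤ J3 :+ con 3 ∷ b :+ v :≤ J2 :+ con 3 ∷ J3 :≤ l ∷ fk :≤ f :+ r :+ con 3 ∷ f :≤ ab :+ con 3 ∷ r :≤ bv :+ con 3 ∷ gk :≤ a :+ v :+ con 6 ∷ av :≤ k :+ con 3 ∷ []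
        ⊢ av :+ b :≤ ab :+ bv :+ con 27)
      (cH-subk M TT f g k) (hh-⊠-lo A (B ⊠ V)) (hh-⊠-lo B V)
      (cH-mono M TT ⟨ f , ⟨ g , k ⟩ ⟩ (Xr (A ⊠ (B ⊠ V))) λ {p} e → let (q , _) = ,-inj e ; (fe , r) = ,-inj q ; (a , ke) = ,-inj r in
         cong₂ _,_ a (cong₂ _,_ (g-inv-inj G (g-cancelˡ G (X A (proj₁ p)) (trans fe (cong (_+g _) (sym a))))) (g-cancelˡ G (X A (proj₁ p)) (trans ke (cong (_+g _) (sym a))))))
      (≤-trans (cH-mono M TT ⟨ f , r ⟩ ⟨ f , k ⟩ λ e → let (q , _) = ,-inj e ; (fe , re) = ,-inj q in cong₂ _,_ fe (trans (keq _) (trans (cong₂ _+g_ fe re) (sym (keq _))))) (cH-sub M TT f r))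
      (≤-trans (≤-reflexive (cH-law {μ = M} {ν = (μ A ⊗ μ B) ⊗ μ V} {φ = unassoc×} (Law-unassoc (μ A) (μ B) (μ V)) f TT (Xr (A ⊟ B) ∘ᵣ proj₁) ((T A ⊗ᵣ T B) ⊗ᵣ T V)
          (λ e → proj₁ (,-inj e)) (λ e → proj₁ (,-inj e)) (λ e → let (a , s) = ,-inj e ; (b , c) = ,-inj s in cong₂ _,_ (cong₂ _,_ a b) c) (λ e → let (s , c) = ,-inj e ; (a , b) = ,-inj s in cong₂ _,_ a (cong₂ _,_ b c))))
        (cH-proj₁-hi (μ A ⊗ μ B) (μ V) (Xr (A ⊟ B)) (T A ⊗ᵣ T B) (T V)))
      (≤-trans (≤-reflexive (cH-swap (μ A) (μ B ⊗ μ V) (Xr (B ⊞ V) ∘ᵣ proj₁) (T A) (T B ⊗ᵣ T V))) (cH-proj₁-hi (μ B ⊗ μ V) (μ A) (Xr (B ⊞ V)) (T B ⊗ᵣ T V) (T A)))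
      (≤-trans (cH-mono M TT av ⟨ g , k ⟩ λ e → let (q , _) = ,-inj e ; (a , v) = ,-inj q in cong₂ _,_ a (cong₂ _+g_ a v))
        (≤-trans (≤-reflexive (cHρ (Xr (A ⊠ V)))) (≤-trans (cH-proj₁-hi (μ A ⊗ μ V) (μ B) (Xr (A ⊠ V)) (T A ⊗ᵣ T V) (T B))
          (lin (1 ∷ []) 2 (λ x y → x :≤ y :+ con 3 ∷ [] ⊢ x :+ con 3 :≤ y :+ con 6) (hh-⊠-hi A V)))))
      (≤-trans (cH-proj₁-lo (μ A ⊗ μ V) (μ B) (Xr (A ⊞ V)) (T A ⊗ᵣ T V) (T B)) (≤-reflexive (cong (_+ᵣ # 3) (sym (cHρ (Xr (A ⊞ V)))))))
    where
    M : Dist (Ω A × (Ω B × Ω V))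
    M = μ A ⊗ (μ B ⊗ μ V)
    TT f g k r av : RV (Ω A × (Ω B × Ω V))
    TT = T A ⊗ᵣ (T B ⊗ᵣ T V)
    f = Xr (A ⊟ B) ∘ᵣ (proj₁ ∘ unassoc×)
    g = Xr A ∘ᵣ proj₁
    k = rvg G λ p → X A (proj₁ p) +g X V (proj₂ (proj₂ p))
    r = Xr (B ⊞ V) ∘ᵣ proj₂
    av = ⟨ Xr A ∘ᵣ proj₁ , Xr V ∘ᵣ (proj₂ ∘ proj₂) ⟩
    keq : ∀ p → fn k p ≡ fn f p +g fn r p
    keq (a , b , v) = sym (trans (g-assoc G _ _ _) (cong (X A a +g_) (trans (sym (g-assoc G _ _ _))
       (trans (cong (_+g X V v) (trans (g-comm G _ _) (g-invʳ G (X B b)))) (g-idˡ G _)))))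
    ρ : Ω A × (Ω B × Ω V) → (Ω A × Ω V) × Ω B
    ρ (a , b , v) = (a , v) , b
    lawρ : Law M ((μ A ⊗ μ V) ⊗ μ B) ρ
    lawρ = Law-∘ {φ = λ p → proj₁ p , swap× (proj₂ p)} {χ = unassoc×} (Law-map {φ = id} Law-id (Law-swap (μ B) (μ V))) (Law-unassoc (μ A) (μ V) (μ B))
    cHρ : ∀ l → cH M (l ∘ᵣ (proj₁ ∘ ρ)) TT ≡ cH ((μ A ⊗ μ V) ⊗ μ B) (l ∘ᵣ proj₁) ((T A ⊗ᵣ T V) ⊗ᵣ T B)
    cHρ l = cH-law {μ = M} {ν = (μ A ⊗ μ V) ⊗ μ B} {φ = ρ} lawρ (l ∘ᵣ (proj₁ ∘ ρ)) TT (l ∘ᵣ proj₁) ((T A ⊗ᵣ T V) ⊗ᵣ T B)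
          (λ e → proj₁ (,-inj e)) (λ e → proj₁ (,-inj e)) (λ e → let (a , s) = ,-inj e ; (b , c) = ,-inj s in cong₂ _,_ (cong₂ _,_ a c) b) (λ e → let (s , b) = ,-inj e ; (a , c) = ,-inj s in cong₂ _,_ a (cong₂ _,_ b c))

chain : ∀ {Ω} (μ : Dist Ω) T f g → cH μ ⟨ f , g ⟩ T ≡ cH μ f T +ᵣ cH μ g ⟨ f , T ⟩
chain μ T f g = trans (cong (_-ᵣ H μ T) (H-iso μ ⟨ ⟨ f , g ⟩ , T ⟩ ⟨ g , ⟨ f , T ⟩ ⟩
    (λ e → let (p , t) = ,-inj e ; (a , b) = ,-inj p in cong₂ _,_ b (cong₂ _,_ a t))
    (λ e → let (b , p) = ,-inj e ; (a , t) = ,-inj p in cong₂ _,_ (cong₂ _,_ a b) t)))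
  (ring 3 λ x y z → [] ⊢ x :- z := (y :- z) :+ (x :- y))

cond-more : ∀ {Ω} (μ : Dist Ω) g f k → k ⟶ f → cH μ g k ≤ᵣ cH μ g f +ᵣ # 3
cond-more μ g f k d = lin (1 ∷ 1 ∷ 1 ∷ []) 6 (λ gkf f gf kf gk k → gkf :+ f :≤ gf :+ kf :+ con 3 ∷ gk :≤ gkf ∷ kf :≤ k ∷ [] ⊢ gk :- k :≤ gf :- f :+ con 3)
  (H-sub μ g k f)
  (H-det μ ⟨ g , ⟨ k , f ⟩ ⟩ ⟨ g , k ⟩ (λ e → let (a , p) = ,-inj e in cong₂ _,_ a (proj₁ (,-inj p))))
  (H-det μ k ⟨ k , f ⟩ (λ e → cong₂ _,_ e (d e)))

cH-≥0 : ∀ {Ω} (μ : Dist Ω) f T → # 0 ≤ᵣ cH μ f T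
cH-≥0 μ f T = lin (1 ∷ []) 2 (λ a b → b :≤ a ∷ [] ⊢ con 0 :≤ a :- b) (H-det μ ⟨ f , T ⟩ T (λ e → proj₂ (,-inj e)))

-- Sums of independent copies.

Pow : List ℕ → Set → Set
Pow [] Ω = ⊤
Pow (_ ∷ cs) Ω = Ω × Pow cs Ω

powD : ∀ cs {Ω} → Dist Ω → Dist (Pow cs Ω)
powD [] μ = dirac tt
powD (_ ∷ cs) μ = μ ⊗ powD cs μ

-- The list entries are labels passed on to the summands, while `Pow` sees only the length; one list
-- both counts the copies and carries their coefficients.
Σ̃ : ∀ (G : Grp) cs {Ω} → (ℕ → Ω → Car G) → Pow cs Ω → Car G
Σ̃ G [] F _ = ε G
Σ̃ G (c ∷ cs) F (a , ω) = _∙_ G (F c a) (Σ̃ G cs F ω)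

Π̃ : ∀ cs {Ω} → RV Ω → RV (Pow cs Ω)
Π̃ [] T = ⊤ᵣ
Π̃ (_ ∷ cs) T = T ⊗ᵣ Π̃ cs T

Π̃-⟶ : ∀ cs {Ω} {f g : RV Ω} → f ⟶ g → Π̃ cs f ⟶ Π̃ cs g
Π̃-⟶ [] d _ = refl
Π̃-⟶ (_ ∷ cs) {f = f} {g} d e = let (p , q) = ,-inj e in cong₂ _,_ (d p) (Π̃-⟶ cs {f = f} {g} d q)

Π̃-pair : ∀ cs {Ω} {f g : RV Ω} → Π̃ cs ⟨ f , g ⟩ ⟶ ⟨ Π̃ cs f , Π̃ cs g ⟩
Π̃-pair [] _ = refl
Π̃-pair (_ ∷ cs) {f = f} {g} e = let (p , q) = ,-inj e ; (a , b) = ,-inj p ; (u , v) = ,-inj (Π̃-pair cs {f = f} {g} q) in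
  cong₂ _,_ (cong₂ _,_ a u) (cong₂ _,_ b v)

Π̃-unpair : ∀ cs {Ω} {f g : RV Ω} → ⟨ Π̃ cs f , Π̃ cs g ⟩ ⟶ Π̃ cs ⟨ f , g ⟩
Π̃-unpair [] _ = refl
Π̃-unpair (_ ∷ cs) {f = f} {g} e = let (p , q) = ,-inj e ; (a , u) = ,-inj p ; (b , v) = ,-inj q in
  cong₂ _,_ (cong₂ _,_ a b) (Π̃-unpair cs {f = f} {g} (cong₂ _,_ u v))

Π̃-Σ̃ : ∀ (G : Grp) cs {Ω} (F : ℕ → Ω → Car G) (f : RV Ω) → (∀ c → f ⟶ rvg G (F c)) → Π̃ cs f ⟶ rvg G (Σ̃ G cs F)
Π̃-Σ̃ G [] F f d _ = refl
Π̃-Σ̃ G (c ∷ cs) F f d e = let (p , q) = ,-inj e in cong₂ (_∙_ G) (d c p) (Π̃-Σ̃ G cs F f d q)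

Σ̃-cong : ∀ (G : Grp) cs {Ω} {F F' : ℕ → Ω → Car G} → (∀ c a → F c a ≡ F' c a) → ∀ ω → Σ̃ G cs F ω ≡ Σ̃ G cs F' ω
Σ̃-cong G [] e ω = refl
Σ̃-cong G (c ∷ cs) e (a , ω) = cong₂ (_∙_ G) (e c a) (Σ̃-cong G cs e ω)

unzip× : ∀ cs {A B : Set} → Pow cs (A × B) → Pow cs A × Pow cs B
unzip× [] _ = tt , tt
unzip× (_ ∷ cs) ((a , b) , ω) = (a , proj₁ (unzip× cs ω)) , (b , proj₂ (unzip× cs ω))

Law-unzip : ∀ cs {A B} (μ : Dist A) (ν : Dist B) → Law (powD cs (μ ⊗ ν)) (powD cs μ ⊗ powD cs ν) (unzip× cs)
Law-unzip [] μ ν = mkLaw λ ψ → trans (E-dirac tt _) (sym (trans (E-⊗ (dirac tt) (dirac tt) ψ) (trans (E-dirac tt _) (E-dirac tt _))))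
Law-unzip (_ ∷ cs) μ ν = Law-∘ {φ = λ p → proj₁ p , unzip× cs (proj₂ p)} {χ = mid×}
  (Law-map {φ = id} Law-id (Law-unzip cs μ ν)) (Law-mid μ ν (powD cs μ) (powD cs ν))

unzip-Π̃ : ∀ cs {A B} {f : RV A} {g : RV B} → Π̃ cs (f ⊗ᵣ g) ⟶ (Π̃ cs f ⊗ᵣ Π̃ cs g) ∘ᵣ unzip× cs
unzip-Π̃ [] _ = refl
unzip-Π̃ (_ ∷ cs) {f = f} {g} e = let (p , q) = ,-inj e ; (a , b) = ,-inj p ; (u , v) = ,-inj (unzip-Π̃ cs {f = f} {g} q) in
  cong₂ _,_ (cong₂ _,_ a u) (cong₂ _,_ b v)

unzip-Π̃⁻ : ∀ cs {A B} {f : RV A} {g : RV B} → (Π̃ cs f ⊗ᵣ Π̃ cs g) ∘ᵣ unzip× cs ⟶ Π̃ cs (f ⊗ᵣ g)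
unzip-Π̃⁻ [] _ = refl
unzip-Π̃⁻ (_ ∷ cs) {f = f} {g} e = let (p , q) = ,-inj e ; (a , u) = ,-inj p ; (b , v) = ,-inj q in
  cong₂ _,_ (cong₂ _,_ a b) (unzip-Π̃⁻ cs {f = f} {g} (cong₂ _,_ u v))

sumObj : ∀ {G Ω} cs → Dist Ω → (ℕ → Ω → Car G) → RV Ω → Obj G
sumObj {G} cs μ F T = obj (powD cs μ) (Σ̃ G cs F) (Π̃ cs T)

npow : ∀ {G} → List ℕ → Obj G → Obj G
npow cs O = sumObj cs (μ O) (λ _ → X O) (T O)

len : List ℕ → R
len cs = # List.length cs

len-∷ : ∀ c cs → len (c ∷ cs) ≡ # 1 +ᵣ len cs
len-∷ c cs = #-+ 1 (List.length cs)

module _ {G : Grp} (O : Obj G) where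

  -- The Kaimanovich-Vershik inequality with O as the middle term: next to one copy of O, a further
  -- copy costs no more than the second copy did, up to a constant.
  npow-step : ∀ c cs → hh (O ⊞ npow (c ∷ cs) O) ≤ᵣ hh (npow (c ∷ cs) O) +ᵣ (hh (O ⊞ O) -ᵣ hh O +ᵣ # 15)
  npow-step c cs = lin (1 ∷ []) 4 (λ a b o2 b' → a :+ b :≤ o2 :+ b' :+ con 15 ∷ [] ⊢ a :≤ b' :+ (o2 :- b :+ con 15)) (kv O O (npow cs O))

  npow-one : ∀ c → hh (npow (c ∷ []) O) ≤ᵣ hh O +ᵣ # 3
  npow-one c = ≤-trans (≤-reflexive (cH-law {μ = μ O ⊗ dirac tt} Law-id (Xr (npow (c ∷ []) O)) (T (npow (c ∷ []) O)) (Xr O ∘ᵣ proj₁) (T O ⊗ᵣ ⊤ᵣ)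
      (λ e → g-cancelʳ G (ε G) (proj₁ (,-inj e))) (λ e → cong (λ z → _∙_ G z (ε G)) (proj₁ (,-inj e))) id id))
    (cH-proj₁-hi (μ O) (dirac tt) (Xr O) (T O) ⊤ᵣ)

  npow-upper : ∀ c cs → hh (npow (c ∷ cs) O) ≤ᵣ hh O +ᵣ len cs *ᵣ (hh (O ⊞ O) -ᵣ hh O +ᵣ # 15) +ᵣ # 3
  npow-upper c [] = ≤-trans (npow-one c) (lin [] 2 λ a x → [] ⊢ a :+ con 3 :≤ a :+ con 0 :* x :+ con 3)
  npow-upper c (c' ∷ cs) = ≤-trans (npow-step c' cs) (≤-trans (+-mono (npow-upper c' cs) ≤-refl)
    (≤-trans (lin [] 3 λ o l x → [] ⊢ (o :+ l :* x :+ con 3) :+ x :≤ o :+ (con 1 :+ l) :* x :+ con 3)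
      (≤-reflexive (cong (λ z → hh O +ᵣ z *ᵣ _ +ᵣ # 3) (sym (len-∷ c' cs))))))

  k2-upper : ∀ c c' cs → hh (O ⊞ O) ≤ᵣ hh (npow (c ∷ c' ∷ cs) O) +ᵣ # 9
  k2-upper c c' cs = ≤-trans (hh-⊞-mono (O ⊞ O) (npow cs O)) (≤-reflexive (cong (_+ᵣ # 9) (hh-⇒ (⊞-assoc {A = O} {B = O} {C = npow cs O}))))

-- `Y` is the vector of the copies in one row of the array, so that a sum of independent rows is the
-- vector of column sums. `Yσ` is the same vector with the row sum revealed. `cand` is one copy
-- given the sum of its row, a first candidate for smaller doubling.
module Iid {G : Grp} (O : Obj G) where
  GPow : List ℕ → Grp
  GPow [] = record { Car = ⊤ ; _≟g_ = ⊤P._≟_ ; _∙_ = λ _ _ → tt ; ε = tt ; _⁻ = λ _ → tt ; g-assoc = λ _ _ _ → refl ; g-comm = λ _ _ → refl ; g-idˡ = λ _ → refl ; g-invʳ = λ _ → refl }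
  GPow (_ ∷ cs) = G ×g GPow cs

  Yv : ∀ cs → Pow cs (Ω O) → Car (GPow cs)
  Yv [] _ = tt
  Yv (_ ∷ cs) (a , ω) = X O a , Yv cs ω

  σ : ∀ cs → RV (Pow cs (Ω O))
  σ cs = Xr (npow cs O)
  TT : ∀ cs → RV (Pow cs (Ω O))
  TT cs = Π̃ cs (T O)

  Y Yσ : ∀ cs → Obj (GPow cs)
  Y cs = obj (powD cs (μ O)) (Yv cs) (TT cs)
  Yσ cs = obj (powD cs (μ O)) (Yv cs) ⟨ σ cs , TT cs ⟩

  cand : ℕ → List ℕ → Obj G
  cand c cs = obj (powD (c ∷ cs) (μ O)) (X O ∘ proj₁) ⟨ σ (c ∷ cs) , TT (c ∷ cs) ⟩

  npow-⊠ : ∀ {K L : Grp} ds (A : Obj K) (B : Obj L) → hh (npow ds (A ⊠ B)) ≡ hh (npow ds A ⊠ npow ds B)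
  npow-⊠ {K} {L} ds A B = hh-⇒ {A = npow ds (A ⊠ B)} {B = npow ds A ⊠ npow ds B} (mk⇒ (unzip× ds) (Law-unzip ds (μ A) (μ B)) (sumEq ds)
      (λ {a} {b} → unzip-Π̃ ds {f = T A} {g = T B} {a} {b}) (λ {a} {b} → unzip-Π̃⁻ ds {f = T A} {g = T B} {a} {b}))
    where
    sumEq : ∀ ds ω → Σ̃ (K ×g L) ds (λ _ → X (A ⊠ B)) ω ≡ (Σ̃ K ds (λ _ → X A) (proj₁ (unzip× ds ω)) , Σ̃ L ds (λ _ → X B) (proj₂ (unzip× ds ω)))
    sumEq [] ω = refl
    sumEq (_ ∷ ds) (_ , ω) rewrite sumEq ds ω = refl

  nY-upper : ∀ ds cs → hh (npow ds (Y cs)) ≤ᵣ len cs *ᵣ (hh (npow ds O) +ᵣ # 3)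
  nY-upper ds [] = ≤-trans (≤-reflexive (cH-triv _ (T (npow ds (Y []))) (Xr (npow ds (Y []))) (λ _ → refl))) (lin [] 1 λ x → [] ⊢ con 0 :≤ con 0 :* x)
  nY-upper ds (c ∷ cs) = ≤-trans (≤-reflexive (npow-⊠ ds O (Y cs))) (≤-trans (hh-⊠-hi (npow ds O) (npow ds (Y cs)))
    (≤-trans (lin (1 ∷ []) 3 (λ s y l → y :≤ l :* (s :+ con 3) ∷ [] ⊢ s :+ y :+ con 3 :≤ (con 1 :+ l) :* (s :+ con 3)) (nY-upper ds cs))
      (≤-reflexive (cong (_*ᵣ (hh (npow ds O) +ᵣ # 3)) (sym (len-∷ c cs))))))

  -- Peels off the first column of a matrix whose row sums are known. Its column sum is a sum of
  -- copies of `cand`; revealing its entries as well only lowers the entropy of the other column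
  -- sums, and reduces the known row sums to those of the remaining columns.
  nYσ-step : ∀ ds c cs → hh (npow ds (cand c cs)) +ᵣ hh (npow ds (Yσ cs)) ≤ᵣ hh (npow ds (Yσ (c ∷ cs))) +ᵣ # 6
  nYσ-step ds c cs = lin (1 ∷ 1 ∷ 1 ∷ 1 ∷ []) 6 (λ a b t r q t' → t' :≤ t ∷ a :+ q :≤ t' ∷ r :≤ q :+ con 3 ∷ b :≤ r :+ con 3 ∷ [] ⊢ a :+ b :≤ t :+ con 6)
      (cH-mono M S (Xr (npow ds (Yσ (c ∷ cs)))) ⟨ f , g ⟩ (λ {a} {b} e → let p = proj₁ (,-inj e) in
          cong₂ _,_ (trans (sym (split₁ a)) (trans (cong proj₁ p) (split₁ b))) (trans (sym (split₂ a)) (trans (cong proj₂ p) (split₂ b)))) )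
      (≤-reflexive (sym (chain M S f g)))
      (cond-more M g ⟨ f , S ⟩ ⟨ k , S ⟩ λ {a} {b} e → cong₂ _,_ (Π̃-Σ̃ G ds (λ _ → X O ∘ proj₁) (Xr O ∘ᵣ proj₁) (λ _ → id) {a} {b} (proj₁ (,-inj e))) (proj₂ (,-inj e)))
      (≤-trans (cH-proj₁-lo N₂ N₁ (Xr (npow ds (Yσ cs))) (Π̃ ds ⟨ σ cs , TT cs ⟩) (Π̃ ds ⟨ Xr O , T O ⟩))
        (≤-reflexive (cong (_+ᵣ # 3) (trans (sym (cH-swap N₁ N₂ (Xr (npow ds (Yσ cs)) ∘ᵣ proj₁) (Π̃ ds ⟨ Xr O , T O ⟩) (Π̃ ds ⟨ σ cs , TT cs ⟩)))
          (sym (cH-law (Law-unzip ds (μ O) (powD cs (μ O))) g ⟨ k , S ⟩ (Xr (npow ds (Yσ cs)) ∘ᵣ proj₂) (Π̃ ds ⟨ Xr O , T O ⟩ ⊗ᵣ Π̃ ds ⟨ σ cs , TT cs ⟩)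
             (λ e → proj₁ (,-inj e)) (λ e → proj₁ (,-inj e)) to from))))))
    where
    M : Dist (Pow ds (Ω O × Pow cs (Ω O)))
    M = powD ds (μ O ⊗ powD cs (μ O))
    N₁ : Dist (Pow ds (Ω O))
    N₁ = powD ds (μ O)
    N₂ : Dist (Pow ds (Pow cs (Ω O)))
    N₂ = powD ds (powD cs (μ O))
    S k f g : RV (Pow ds (Ω O × Pow cs (Ω O)))
    S = Π̃ ds ⟨ σ (c ∷ cs) , TT (c ∷ cs) ⟩
    k = Π̃ ds (Xr O ∘ᵣ proj₁)
    f = Xr (npow ds (cand c cs))
    g = Xr (npow ds (Yσ cs)) ∘ᵣ (proj₂ ∘ unzip× ds)
    split₁ : ∀ ω → proj₁ (Σ̃ (GPow (c ∷ cs)) ds (λ _ → Yv (c ∷ cs)) ω) ≡ Σ̃ G ds (λ _ → X O ∘ proj₁) ω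
    split₁ = go ds
      where
      go : ∀ ds ω → proj₁ (Σ̃ (GPow (c ∷ cs)) ds (λ _ → Yv (c ∷ cs)) ω) ≡ Σ̃ G ds (λ _ → X O ∘ proj₁) ω
      go [] ω = refl
      go (_ ∷ ds) (a , ω) = cong (_∙_ G _) (go ds ω)
    split₂ : ∀ ω → proj₂ (Σ̃ (GPow (c ∷ cs)) ds (λ _ → Yv (c ∷ cs)) ω) ≡ Σ̃ (GPow cs) ds (λ _ → Yv cs) (proj₂ (unzip× ds ω))
    split₂ = go ds
      where
      go : ∀ ds ω → proj₂ (Σ̃ (GPow (c ∷ cs)) ds (λ _ → Yv (c ∷ cs)) ω) ≡ Σ̃ (GPow cs) ds (λ _ → Yv cs) (proj₂ (unzip× ds ω))
      go [] ω = refl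
      go (_ ∷ ds) (a , ω) = cong (_∙_ (GPow cs) _) (go ds ω)
    W₁ W₂ : RV (Ω O × Pow cs (Ω O))
    W₁ = ⟨ Xr O ∘ᵣ proj₁ , ⟨ σ (c ∷ cs) , TT (c ∷ cs) ⟩ ⟩
    W₂ = ⟨ Xr O , T O ⟩ ⊗ᵣ ⟨ σ cs , TT cs ⟩
    w→ : W₁ ⟶ W₂
    w→ {a} {b} e = let (x , p) = ,-inj e ; (s , t) = ,-inj p ; (t₀ , t') = ,-inj t in
      cong₂ _,_ (cong₂ _,_ x t₀) (cong₂ _,_ (g-cancelˡ G (X O (proj₁ a)) (trans s (cong (λ z → _∙_ G z (fn (σ cs) (proj₂ b))) (sym x)))) t')
    w← : W₂ ⟶ W₁
    w← e = let (p , q) = ,-inj e ; (x , t₀) = ,-inj p ; (s , t') = ,-inj q in cong₂ _,_ x (cong₂ _,_ (cong₂ (_∙_ G) x s) (cong₂ _,_ t₀ t'))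
    to : ⟨ k , S ⟩ ⟶ (Π̃ ds ⟨ Xr O , T O ⟩ ⊗ᵣ Π̃ ds ⟨ σ cs , TT cs ⟩) ∘ᵣ unzip× ds
    to e = unzip-Π̃ ds {f = ⟨ Xr O , T O ⟩} {g = ⟨ σ cs , TT cs ⟩} (Π̃-⟶ ds {f = W₁} {g = W₂} w→ (Π̃-unpair ds {f = Xr O ∘ᵣ proj₁} {g = ⟨ σ (c ∷ cs) , TT (c ∷ cs) ⟩} e))
    from : (Π̃ ds ⟨ Xr O , T O ⟩ ⊗ᵣ Π̃ ds ⟨ σ cs , TT cs ⟩) ∘ᵣ unzip× ds ⟶ ⟨ k , S ⟩
    from e = Π̃-pair ds {f = Xr O ∘ᵣ proj₁} {g = ⟨ σ (c ∷ cs) , TT (c ∷ cs) ⟩} (Π̃-⟶ ds {f = W₂} {g = W₁} w← (unzip-Π̃⁻ ds {f = ⟨ Xr O , T O ⟩} {g = ⟨ σ cs , TT cs ⟩} e))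

  -- The first copy and the sum of the others carry the same information as the total and the first
  -- copy.
  cand-lower : ∀ c cs → hh O +ᵣ hh (npow cs O) ≤ᵣ hh (cand c cs) +ᵣ hh (npow (c ∷ cs) O) +ᵣ # 3
  cand-lower c cs = lin (1 ∷ 1 ∷ 1 ∷ []) 6 (λ o r j j' s cd → o :+ r :≤ j :+ con 3 ∷ j :≤ j' ∷ j' :≤ s :+ cd ∷ [] ⊢ o :+ r :≤ cd :+ s :+ con 3)
    (hh-⊠-lo O (npow cs O))
    (cH-mono _ (TT (c ∷ cs)) ⟨ σ (c ∷ cs) , Xr O ∘ᵣ proj₁ ⟩ (Xr (O ⊠ npow cs O)) λ {a} {b} e → let (p , _) = ,-inj e ; (s , x) = ,-inj p in
       cong₂ _,_ x (g-cancelˡ G (X O (proj₁ a)) (trans s (cong (λ z → _∙_ G z (fn (σ cs) (proj₂ b))) (sym x)))))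
    (≤-reflexive (chain _ (TT (c ∷ cs)) (σ (c ∷ cs)) (Xr O ∘ᵣ proj₁)))

  cand-upper : ∀ c cs → hh (cand c cs) ≤ᵣ hh O +ᵣ # 6
  cand-upper c cs = lin (1 ∷ 1 ∷ []) 3 (λ a b o → a :≤ b :+ con 3 ∷ b :≤ o :+ con 3 ∷ [] ⊢ a :≤ o :+ con 6)
    (cond-more (μ O ⊗ powD cs (μ O)) (Xr O ∘ᵣ proj₁) (TT (c ∷ cs)) ⟨ σ (c ∷ cs) , TT (c ∷ cs) ⟩ (λ e → proj₂ (,-inj e)))
    (cH-proj₁-hi (μ O) (powD cs (μ O)) (Xr O) (T O) (TT cs))

-- Torsion and the symmetries of coefficient lists.

times : ∀ (G : Grp) → ℕ → Car G → Car G
times G zero a = ε G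
times G (suc k) a = _∙_ G a (times G k a)

times-ε : ∀ (G : Grp) k → times G k (ε G) ≡ ε G
times-ε G zero = refl
times-ε G (suc k) = trans (g-idˡ G _) (times-ε G k)

times-∙ : ∀ (G : Grp) k a b → times G k (_∙_ G a b) ≡ _∙_ G (times G k a) (times G k b)
times-∙ G zero a b = sym (g-idˡ G _)
times-∙ G (suc k) a b = trans (cong (_∙_ G _) (times-∙ G k a b)) (g-mid G a b _ _)

times-+ : ∀ (G : Grp) j k a → times G (j ℕ.+ k) a ≡ _∙_ G (times G j a) (times G k a)
times-+ G zero k a = sym (g-idˡ G _)
times-+ G (suc j) k a = trans (cong (_∙_ G a) (times-+ G j k a)) (sym (g-assoc G _ _ _))

Σ̃-∙ : ∀ (G : Grp) cs {Ω} (F F' : ℕ → Ω → Car G) ω → Σ̃ G cs (λ c a → _∙_ G (F c a) (F' c a)) ω ≡ _∙_ G (Σ̃ G cs F ω) (Σ̃ G cs F' ω)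
Σ̃-∙ G [] F F' ω = sym (g-idˡ G _)
Σ̃-∙ G (c ∷ cs) F F' (a , ω) = trans (cong (_∙_ G _) (Σ̃-∙ G cs F F' ω)) (g-mid G _ _ _ _)

Σ̃-times : ∀ (G : Grp) k cs {Ω} (F : ℕ → Ω → Car G) ω → Σ̃ G cs (λ c a → times G k (F c a)) ω ≡ times G k (Σ̃ G cs F ω)
Σ̃-times G k [] F ω = sym (times-ε G k)
Σ̃-times G k (c ∷ cs) F (a , ω) = trans (cong (_∙_ G _) (Σ̃-times G k cs F ω)) (sym (times-∙ G k _ _))

Σ̃-pair : ∀ (G K : Grp) cs {Ω} (F : ℕ → Ω → Car G) (F' : ℕ → Ω → Car K) ω → Σ̃ (G ×g K) cs (λ c a → F c a , F' c a) ω ≡ (Σ̃ G cs F ω , Σ̃ K cs F' ω)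
Σ̃-pair G K [] F F' ω = refl
Σ̃-pair G K (c ∷ cs) F F' (a , ω) rewrite Σ̃-pair G K cs F F' ω = refl

-- Permutations of lists of coefficients, where coefficients acting identically are interchangeable.
module Coeff (G : Grp) where
  infix 4 _∼_
  data _∼_ : List ℕ → List ℕ → Set where
    ∼refl : ∀ {as} → as ∼ as
    ∼prep : ∀ {a b as bs} → (∀ x → times G a x ≡ times G b x) → as ∼ bs → a ∷ as ∼ b ∷ bs
    ∼swap : ∀ {a b as} → a ∷ b ∷ as ∼ b ∷ a ∷ as
    ∼trans : ∀ {as bs cs} → as ∼ bs → bs ∼ cs → as ∼ cs

  ↭⇒∼ : ∀ {as bs} → as ↭ bs → as ∼ bs
  ↭⇒∼ Perm.refl = ∼refl
  ↭⇒∼ (Perm.prep x p) = ∼prep (λ _ → refl) (↭⇒∼ p)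
  ↭⇒∼ (Perm.swap x y p) = ∼trans ∼swap (∼prep (λ _ → refl) (∼prep (λ _ → refl) (↭⇒∼ p)))
  ↭⇒∼ (Perm.trans p q) = ∼trans (↭⇒∼ p) (↭⇒∼ q)

  ∼-++ʳ : ∀ as {bs cs} → bs ∼ cs → as ++ bs ∼ as ++ cs
  ∼-++ʳ [] p = p
  ∼-++ʳ (a ∷ as) p = ∼prep (λ _ → refl) (∼-++ʳ as p)

  ∼-++ˡ : ∀ {as bs} cs → as ∼ bs → as ++ cs ∼ bs ++ cs
  ∼-++ˡ cs ∼refl = ∼refl
  ∼-++ˡ cs (∼prep e p) = ∼prep e (∼-++ˡ cs p)
  ∼-++ˡ cs ∼swap = ∼swap
  ∼-++ˡ cs (∼trans p q) = ∼trans (∼-++ˡ cs p) (∼-++ˡ cs q)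

  ∼-suc : ∀ {as bs} → as ∼ bs → List.map suc as ∼ List.map suc bs
  ∼-suc ∼refl = ∼refl
  ∼-suc (∼prep e p) = ∼prep (λ x → cong (_∙_ G x) (e x)) (∼-suc p)
  ∼-suc ∼swap = ∼swap
  ∼-suc (∼trans p q) = ∼trans (∼-suc p) (∼-suc q)

  rowsOf : (ℕ → ℕ → ℕ) → List ℕ → List ℕ → List ℕ
  rowsOf a ds es = concatMap (λ i → List.map (a i) es) ds

  rowwise : ∀ a b ds es → (∀ i → List.map (a i) es ∼ List.map (b i) es) → rowsOf a ds es ∼ rowsOf b ds es
  rowwise a b [] es p = ∼refl
  rowwise a b (i ∷ ds) es p = ∼trans (∼-++ˡ _ (p i)) (∼-++ʳ (List.map (b i) es) (rowwise a b ds es p))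

  private
    column : ∀ (a : ℕ → ℕ → ℕ) e es ds → rowsOf a ds (e ∷ es) ↭ List.map (λ i → a i e) ds ++ rowsOf a ds es
    column a e es [] = Perm.refl
    column a e es (i ∷ ds) = Perm.prep _ (Perm.trans (PermP.++⁺ˡ (List.map (a i) es) (column a e es ds))
      (Perm.trans (Perm.↭-sym (Perm.↭-reflexive (ListP.++-assoc (List.map (a i) es) (List.map (λ i → a i e) ds) _)))
      (Perm.trans (PermP.++⁺ʳ (rowsOf a ds es) (PermP.++-comm (List.map (a i) es) (List.map (λ i → a i e) ds)))
        (Perm.↭-reflexive (ListP.++-assoc (List.map (λ i → a i e) ds) (List.map (a i) es) _)))))
    noRows : ∀ (a : ℕ → ℕ → ℕ) ds → rowsOf a ds [] ≡ []
    noRows a [] = refl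
    noRows a (i ∷ ds) = noRows a ds
    transpose : ∀ (a : ℕ → ℕ → ℕ) ds es → rowsOf a ds es ↭ rowsOf (λ j i → a i j) es ds
    transpose a ds [] = Perm.↭-reflexive (noRows a ds)
    transpose a ds (e ∷ es) = Perm.trans (column a e es ds) (PermP.++⁺ˡ (List.map (λ i → a i e) ds) (transpose a ds es))

  transpose∼ : ∀ a ds es → rowsOf a ds es ∼ rowsOf (λ j i → a i j) es ds
  transpose∼ a ds es = ↭⇒∼ (transpose a ds es)

  module _ (m : ℕ) (torsion : ∀ x → times G (suc m) x ≡ ε G) where
    -- Adding 1 to the coefficients 0, ..., m gives 1, ..., m + 1, and m + 1 acts as 0.
    rotate1 : List.map suc (List.upTo (suc m)) ∼ List.upTo (suc m)
    rotate1 = ∼trans (↭⇒∼ (Perm.trans (Perm.↭-reflexive (trans (ListP.map-applyUpTo id suc (suc m)) (sym (ListP.applyUpTo-∷ʳ suc m))))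
        (PermP.++-comm (List.applyUpTo suc m) (suc m ∷ [])))) (∼prep torsion ∼refl)

    rotate : ∀ i → List.map (i ℕ.+_) (List.upTo (suc m)) ∼ List.upTo (suc m)
    rotate zero = ↭⇒∼ (Perm.↭-reflexive (ListP.map-id _))
    rotate (suc i) = ∼trans (↭⇒∼ (Perm.↭-reflexive (ListP.map-∘ (List.upTo (suc m))))) (∼trans (∼-suc (rotate i)) rotate1)

-- The square array of independent copies.

module Array {G : Grp} (O : Obj G) (cs : List ℕ) where
  open Iid O
  open Coeff G

  module _ {K : Grp} (F : ℕ → Ω O → Car K) where
    -- What an array sum depends on: the list of its coefficients, in any order. Through `arr⇒flat`
    -- and `flat-∼` the symmetries of the coefficient matrices become equalities of entropies.
    flat : List ℕ → Obj K
    flat as = sumObj as (μ O) F (T O)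

    arr : (ℕ → ℕ → ℕ) → List ℕ → List ℕ → Obj K
    arr a ds es = obj (powD ds (powD es (μ O))) (Σ̃ K ds (λ i → Σ̃ K es (λ j → F (a i j)))) (Π̃ ds (Π̃ es (T O)))

    flat-++ : ∀ as bs → flat as ⊞ flat bs ⇒ flat (as ++ bs)
    flat-++ [] bs = mk⇒ proj₂ (Law-proj₂ (dirac tt) (powD bs (μ O))) (λ p → g-idˡ K _) (λ e → proj₂ (,-inj e)) (λ e → cong (tt ,_) e)
    flat-++ (a ∷ as) bs = ⊞-assoc {A = obj (μ O) (F a) (T O)} {B = flat as} {C = flat bs} ⇒∘ ⇒-⊞ {A = obj (μ O) (F a) (T O)} ⇒-id (flat-++ as bs)

    row⇒flat : ∀ (f : ℕ → ℕ) es → sumObj es (μ O) (λ j → F (f j)) (T O) ⇒ flat (List.map f es)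
    row⇒flat f [] = ⇒-id
    row⇒flat f (e ∷ es) = ⇒-⊞ {A = obj (μ O) (F (f e)) (T O)} {B = sumObj es (μ O) (λ j → F (f j)) (T O)} ⇒-id (row⇒flat f es)

    arr⇒flat : ∀ a ds es → arr a ds es ⇒ flat (rowsOf a ds es)
    arr⇒flat a [] es = ⇒-id
    arr⇒flat a (i ∷ ds) es = ⇒-⊞ {A = sumObj es (μ O) (λ j → F (a i j)) (T O)} {B = arr a ds es} (row⇒flat (a i) es) (arr⇒flat a ds es) ⇒∘ flat-++ (List.map (a i) es) (rowsOf a ds es)

    module _ (F-cong : ∀ {a b} → (∀ x → times G a x ≡ times G b x) → ∀ ω → F a ω ≡ F b ω) where
      flat-∼ : ∀ {as bs} → as ∼ bs → flat as ⇒ flat bs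
      flat-∼ ∼refl = ⇒-id
      flat-∼ {a ∷ as} {b ∷ bs} (∼prep e p) = ⇒-⊞ {A = obj (μ O) (F a) (T O)} {B = flat as} {C = obj (μ O) (F b) (T O)} (mk⇒ id Law-id (F-cong {a} {b} e) id id) (flat-∼ p)
      flat-∼ {a ∷ b ∷ as} ∼swap = ⊞-unassoc {A = A} {B = B} {C = flat as} ⇒∘ ⇒-⊞ {A = A ⊞ B} {B = flat as} (⊞-comm {A = A} {B = B}) ⇒-id ⇒∘ ⊞-assoc {A = B} {B = A} {C = flat as}
        where
        A B : Obj K
        A = obj (μ O) (F a) (T O)
        B = obj (μ O) (F b) (T O)
      flat-∼ (∼trans p q) = flat-∼ p ⇒∘ flat-∼ q

  M : Dist (Pow cs (Pow cs (Ω O)))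
  M = powD cs (powD cs (μ O))

  𝒯 : RV (Pow cs (Pow cs (Ω O)))
  𝒯 = Π̃ cs (TT cs)

  arrF : (ℕ → ℕ → ℕ) → Pow cs (Pow cs (Ω O)) → Car G
  arrF a = Σ̃ G cs (λ i → Σ̃ G cs (λ j → times G (a i j) ∘ X O))

  -- U is a function of the row sums, V a function of the column sums, and the total S a function of
  -- either; Z is U + V.
  U V Z S : RV (Pow cs (Pow cs (Ω O)))
  U = rvg G (arrF (λ i j → i))
  V = rvg G (arrF (λ i j → j))
  Z = rvg G (arrF ℕ._+_)
  S = Xr (npow cs (npow cs O))

  Z-sum : ∀ ω → fn Z ω ≡ _∙_ G (fn U ω) (fn V ω)
  Z-sum ω = trans (Σ̃-cong G cs (λ i ρ → trans (Σ̃-cong G cs (λ j a → times-+ G i j (X O a)) ρ) (Σ̃-∙ G cs (λ j → times G i ∘ X O) (λ j → times G j ∘ X O) ρ)) ω)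
    (Σ̃-∙ G cs (λ i → Σ̃ G cs (λ j → times G i ∘ X O)) (λ i → Σ̃ G cs (λ j → times G j ∘ X O)) ω)

  private
    -- A linear form on the vector of column sums: weighting column j by j it yields V, weighting
    -- all columns by 1 it yields S.
    wsum : (ℕ → Car G → Car G) → ∀ es → Car (GPow es) → Car G
    wsum f [] _ = ε G
    wsum f (e ∷ es) (x , v) = _∙_ G (f e x) (wsum f es v)

    module _ (f : ℕ → Car G → Car G) (f-hom : ∀ j a b → f j (_∙_ G a b) ≡ _∙_ G (f j a) (f j b)) (f-ε : ∀ j → f j (ε G) ≡ ε G) where
      wsum-hom : ∀ es v w → wsum f es (_∙_ (GPow es) v w) ≡ _∙_ G (wsum f es v) (wsum f es w)
      wsum-hom [] v w = sym (g-idˡ G _)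
      wsum-hom (e ∷ es) (x , v) (y , w) = trans (cong₂ (_∙_ G) (f-hom e x y) (wsum-hom es v w)) (g-mid G _ _ _ _)
      wsum-ε : ∀ es → wsum f es (ε (GPow es)) ≡ ε G
      wsum-ε [] = refl
      wsum-ε (e ∷ es) = trans (cong₂ (_∙_ G) (f-ε e) (wsum-ε es)) (g-idˡ G _)
      wsum-Yv : ∀ es ω → wsum f es (Yv es ω) ≡ Σ̃ G es (λ j → f j ∘ X O) ω
      wsum-Yv [] ω = refl
      wsum-Yv (e ∷ es) (a , ω) = cong (_∙_ G _) (wsum-Yv es ω)
      wsum-C : ∀ ds es ω → wsum f es (Σ̃ (GPow es) ds (λ _ → Yv es) ω) ≡ Σ̃ G ds (λ _ → Σ̃ G es (λ j → f j ∘ X O)) ω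
      wsum-C [] es ω = wsum-ε es
      wsum-C (_ ∷ ds) es (a , ω) = trans (wsum-hom es _ _) (cong₂ (_∙_ G) (wsum-Yv es a) (wsum-C ds es ω))

    C Rr : RV (Pow cs (Pow cs (Ω O)))
    C = Xr (npow cs (Y cs))
    Rr = Π̃ cs (σ cs)

    C⟶V : C ⟶ V
    C⟶V {a} {b} e = trans (sym (wsum-C (times G) (times-∙ G) (times-ε G) cs cs a)) (trans (cong (wsum (times G) cs) e) (wsum-C (times G) (times-∙ G) (times-ε G) cs cs b))
    C⟶S : C ⟶ S
    C⟶S {a} {b} e = trans (sym (wsum-C (λ _ x → x) (λ _ _ _ → refl) (λ _ → refl) cs cs a)) (trans (cong (wsum (λ _ x → x) cs) e) (wsum-C (λ _ x → x) (λ _ _ _ → refl) (λ _ → refl) cs cs b))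
    R⟶U : Rr ⟶ U
    R⟶U {a} {b} = Π̃-Σ̃ G cs (λ i → Σ̃ G cs (λ j → times G i ∘ X O)) (σ cs) (λ i {x} {y} e → trans (Σ̃-times G i cs (λ _ → X O) x) (trans (cong (times G i) e) (sym (Σ̃-times G i cs (λ _ → X O) y)))) {a} {b}
    R⟶S : Rr ⟶ S
    R⟶S {a} {b} = Π̃-Σ̃ G cs (λ i → Σ̃ G cs (λ j → X O)) (σ cs) (λ _ → id) {a} {b}

  -- With C the column sums and R the row sums this is H(C) - H(C | R) - H(S), the mutual
  -- information of C and R given S up to rounding, because both determine S.
  excess : R
  excess = hh (npow cs (Y cs)) -ᵣ hh (npow cs (Yσ cs)) -ᵣ hh (npow cs (npow cs O))

  -- Data processing: the information shared by U and V given S is at most that shared by the row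
  -- sums and the column sums. One use of submodularity passes from the column sums to V, the other
  -- from the row sums to U.
  information : cH M ⟨ U , S ⟩ 𝒯 +ᵣ cH M ⟨ V , S ⟩ 𝒯 ≤ᵣ cH M ⟨ U , ⟨ V , S ⟩ ⟩ 𝒯 +ᵣ cH M S 𝒯 +ᵣ excess +ᵣ # 6
  information = lin (1 ∷ 1 ∷ 1 ∷ 1 ∷ 1 ∷ 1 ∷ 1 ∷ 1 ∷ []) 14 (λ us vs uvs s nY nYσ cr r crvs cvs rvs rvus rus vus →
        crvs :+ vs :≤ cvs :+ rvs :+ con 3 ∷ cvs :≤ nY ∷ cr :≤ crvs ∷ rvus :+ us :≤ rus :+ vus :+ con 3 ∷ rus :≤ r ∷ rvs :≤ rvus ∷ vus :≤ uvs ∷ nYσ :+ r :≤ cr ∷ []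
        ⊢ us :+ vs :≤ uvs :+ s :+ (nY :- nYσ :- s) :+ con 6)
    (cH-subk M 𝒯 C Rr ⟨ V , S ⟩)
    (cH-mono M 𝒯 C ⟨ C , ⟨ V , S ⟩ ⟩ λ {a} {b} e → let c = proj₁ (,-inj e) in cong₂ _,_ c (cong₂ _,_ (C⟶V {a} {b} c) (C⟶S {a} {b} c)))
    (cH-mono M 𝒯 ⟨ C , ⟨ Rr , ⟨ V , S ⟩ ⟩ ⟩ ⟨ C , Rr ⟩ λ e → let (c , p) = ,-inj (proj₁ (,-inj e)) in cong₂ _,_ c (proj₁ (,-inj p)))
    (cH-subk M 𝒯 Rr V ⟨ U , S ⟩)
    (cH-mono M 𝒯 Rr ⟨ Rr , ⟨ U , S ⟩ ⟩ λ {a} {b} e → let r = proj₁ (,-inj e) in cong₂ _,_ r (cong₂ _,_ (R⟶U {a} {b} r) (R⟶S {a} {b} r)))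
    (cH-mono M 𝒯 ⟨ Rr , ⟨ V , ⟨ U , S ⟩ ⟩ ⟩ ⟨ Rr , ⟨ V , S ⟩ ⟩ λ e → let (r , p) = ,-inj (proj₁ (,-inj e)) ; (v , q) = ,-inj p in cong₂ _,_ r (cong₂ _,_ v (proj₂ (,-inj q))))
    (cH-mono M 𝒯 ⟨ U , ⟨ V , S ⟩ ⟩ ⟨ V , ⟨ U , S ⟩ ⟩ λ e → let (u , p) = ,-inj (proj₁ (,-inj e)) ; (v , s) = ,-inj p in cong₂ _,_ v (cong₂ _,_ u s))
    (lin (1 ∷ 1 ∷ []) 5 (λ a b c d e → a :≤ b ∷ d :≤ c ∷ [] ⊢ (a :- c) :+ (d :- e) :≤ b :- e)
      (H-det M ⟨ ⟨ C , Rr ⟩ , 𝒯 ⟩ ⟨ C , Π̃ cs ⟨ σ cs , TT cs ⟩ ⟩ λ {a} {b} e → let (p , t) = ,-inj e ; (c , r) = ,-inj p in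
         cong₂ _,_ c (Π̃-unpair cs {f = σ cs} {g = TT cs} {a} {b} (cong₂ _,_ r t)))
      (H-det M (Π̃ cs ⟨ σ cs , TT cs ⟩) ⟨ Rr , 𝒯 ⟩ λ {a} {b} e → Π̃-pair cs {f = σ cs} {g = TT cs} {a} {b} e))

  -- The second component accumulates S, so that a weighted sum taken jointly with S is again a sum
  -- of independent terms, in G × G.
  pairF : ℕ → Ω O → Car (G ×g G)
  pairF a ω = times G a (X O ω) , X O ω

  pairF-cong : ∀ {a b} → (∀ x → times G a x ≡ times G b x) → ∀ ω → pairF a ω ≡ pairF b ω
  pairF-cong e ω = cong (_, X O ω) (e (X O ω))

  joint-flat : ∀ a → cH M ⟨ rvg G (arrF a) , S ⟩ 𝒯 ≡ hh (flat pairF (rowsOf a cs cs))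
  joint-flat a = trans (cH-law {μ = M} Law-id ⟨ rvg G (arrF a) , S ⟩ 𝒯 (Xr (arr pairF a cs cs)) 𝒯
      (λ {x} {y} e → trans (eq x) (trans (proj₁ (,-inj e)) (sym (eq y)))) (λ {x} {y} e → trans (sym (eq x)) (trans (proj₁ (,-inj e)) (eq y))) id id)
    (hh-⇒ (arr⇒flat pairF a cs cs))
    where
    eq : ∀ ω → X (arr pairF a cs cs) ω ≡ (arrF a ω , fn S ω)
    eq ω = trans (Σ̃-cong (G ×g G) cs (λ i ρ → Σ̃-pair G G cs (λ j → times G (a i j) ∘ X O) (λ _ → X O) ρ) ω)
      (Σ̃-pair G G cs (λ i → Σ̃ G cs (λ j → times G (a i j) ∘ X O)) (λ _ → Σ̃ G cs (λ _ → X O)) ω)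

-- Entropy of multiples, and closeness of random variables.

weight : List ℕ → ℕ
weight [] = 1
weight (a ∷ as) = a ℕ.+ (1 ℕ.+ weight as)

module _ {G : Grp} where
  private
    _+g_ : Car G → Car G → Car G
    _+g_ = _∙_ G

  scaled : ℕ → Obj G → Obj G
  scaled k O = obj (μ O) (times G k ∘ X O) (T O)

  -- (k+1) y + a is recovered both from (y , a) and from (y - y' , k y + a + y').
  dilate : (A O : Obj G) → ∀ k → hh (A ⊞ scaled (suc k) O) +ᵣ hh O ≤ᵣ hh (O ⊟ O) +ᵣ hh ((A ⊞ scaled k O) ⊞ O) +ᵣ # 24
  dilate A O k = lin (1 ∷ 1 ∷ 1 ∷ 1 ∷ 1 ∷ 1 ∷ 1 ∷ 1 ∷ 1 ∷ []) 14 (λ a o at oo ako l K fK gK j3 j2 ao g K' →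
        l :+ K :≤ fK :+ gK :+ con 3 ∷ a :+ j2 :≤ j3 :+ con 3 ∷ o :+ o :≤ j2 :+ con 3 ∷ j3 :≤ l ∷ at :≤ K :+ con 3 ∷ fK :≤ ao :+ con 3 ∷ ao :≤ a :+ o :+ con 3 ∷ gK :≤ g :+ K' :+ con 3 ∷ (g :+ K' :≤ (oo :+ con 3) :+ ako) ∷ []
        ⊢ at :+ o :≤ oo :+ ako :+ con 24)
      (cH-subk M TT f g K) (hh-⊠-lo A (O ⊠ O)) (hh-⊠-lo O O)
      (cH-mono M TT ⟨ f , ⟨ g , K ⟩ ⟩ (Xr (A ⊠ (O ⊠ O))) λ {p} {q} e → let (y , r) = ,-inj (proj₁ (,-inj e)) ; (d , s) = ,-inj r in
         cong₂ _,_ (g-cancelʳ G (times G (suc k) (X O (proj₁ (proj₂ p)))) (trans s (cong (λ z → X A (proj₁ q) +g times G (suc k) z) (sym y))))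
           (cong₂ _,_ y (g-inv-inj G (g-cancelˡ G (X O (proj₁ (proj₂ p))) (trans d (cong (_+g _⁻ G (X O (proj₂ (proj₂ q)))) (sym y)))))))
      (≤-trans (cH-proj₁-lo (μ A ⊗ μ O) (μ O) (Xr (A ⊞ scaled (suc k) O)) (T A ⊗ᵣ T O) (T O)) (≤-reflexive (cong (_+ᵣ # 3) (sym (viaU (Xr (A ⊞ scaled (suc k) O) ∘ᵣ proj₁))))))
      (≤-trans (cH-mono M TT (Xr (A ⊠ O) ∘ᵣ (proj₁ ∘ unassoc×)) ⟨ f , K ⟩ λ e → let (q , _) = ,-inj e ; (a , y) = ,-inj q in cong₂ _,_ y (cong₂ (λ u v → u +g times G (suc k) v) a y))
        (≤-trans (≤-reflexive (viaU (Xr (A ⊠ O) ∘ᵣ proj₁))) (cH-proj₁-hi (μ A ⊗ μ O) (μ O) (Xr (A ⊠ O)) (T A ⊗ᵣ T O) (T O))))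
      (hh-⊠-hi A O)
      (≤-trans (cH-mono M TT ⟨ g , K' ⟩ ⟨ g , K ⟩ λ {p} {q} e → let (r , _) = ,-inj e ; (d , s) = ,-inj r in cong₂ _,_ d (trans (Keq p) (trans (cong₂ _+g_ s d) (sym (Keq q))))) (cH-sub M TT g K'))
      (+-mono (≤-trans (≤-reflexive (cH-swap (μ A) (μ O ⊗ μ O) (Xr (O ⊟ O) ∘ᵣ proj₁) (T A) (T O ⊗ᵣ T O))) (cH-proj₁-hi (μ O ⊗ μ O) (μ A) (Xr (O ⊟ O)) (T O ⊗ᵣ T O) (T A)))
        (≤-reflexive (viaU (Xr ((A ⊞ scaled k O) ⊞ O)))))
    where
    M : Dist (Ω A × (Ω O × Ω O))
    M = μ A ⊗ (μ O ⊗ μ O)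
    TT f g K K' : RV (Ω A × (Ω O × Ω O))
    TT = T A ⊗ᵣ (T O ⊗ᵣ T O)
    f = Xr O ∘ᵣ (proj₁ ∘ proj₂)
    g = Xr (O ⊟ O) ∘ᵣ proj₂
    K = Xr (A ⊞ scaled (suc k) O) ∘ᵣ (proj₁ ∘ unassoc×)
    K' = Xr ((A ⊞ scaled k O) ⊞ O) ∘ᵣ unassoc×
    viaU : ∀ l → cH M (l ∘ᵣ unassoc×) TT ≡ cH ((μ A ⊗ μ O) ⊗ μ O) l ((T A ⊗ᵣ T O) ⊗ᵣ T O)
    viaU l = cH-law {μ = M} {φ = unassoc×} (Law-unassoc (μ A) (μ O) (μ O)) (l ∘ᵣ unassoc×) TT l ((T A ⊗ᵣ T O) ⊗ᵣ T O)
      (λ e → proj₁ (,-inj e)) (λ e → proj₁ (,-inj e)) (λ e → let (a , s) = ,-inj e ; (b , c) = ,-inj s in cong₂ _,_ (cong₂ _,_ a b) c) (λ e → let (s , c) = ,-inj e ; (a , b) = ,-inj s in cong₂ _,_ a (cong₂ _,_ b c))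
    Keq : ∀ p → fn K p ≡ fn K' p +g fn g p
    Keq (a , y , y') = sym (trans (g-assoc G (X A a +g times G k (X O y)) (X O y') (X O y +g _⁻ G (X O y')))
      (trans (cong ((X A a +g times G k (X O y)) +g_) (trans (cong (X O y' +g_) (g-comm G _ _)) (trans (sym (g-assoc G _ _ _)) (trans (cong (_+g X O y) (g-invʳ G _)) (g-idˡ G _)))))
        (trans (g-assoc G _ _ _) (cong (X A a +g_) (g-comm G _ _)))))

  -- The triangle inequality through -O.
  sum-diff : (O : Obj G) → hh (O ⊟ O) +ᵣ hh O ≤ᵣ hh (O ⊞ O) +ᵣ hh (O ⊞ O) +ᵣ # 27
  sum-diff O = ≤-trans (≤-reflexive (cong (hh (O ⊟ O) +ᵣ_) (sym (hh-neg O)))) (≤-trans (triangle O (neg O) (neg O))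
    (≤-reflexive (cong₂ (λ x y → x +ᵣ y +ᵣ # 27) (sym (hh-⇒ (⇒-⊞ {A = O} {B = O} ⇒-id (neg-neg {A = O})))) (hh-neg-⊞ O O))))

  -- The Kaimanovich-Vershik inequality with middle term -O, whose sums with both neighbours are
  -- differences.
  diff-sum : (O : Obj G) → hh (O ⊞ O) +ᵣ hh O ≤ᵣ hh (O ⊟ O) +ᵣ hh (O ⊟ O) +ᵣ # 24
  diff-sum O = lin (1 ∷ 1 ∷ 1 ∷ 1 ∷ []) 6 (λ o2 o x d n d' → o2 :≤ x :+ con 9 ∷ x :+ n :≤ d :+ d' :+ con 15 ∷ d' :≤ d ∷ o :≤ n ∷ [] ⊢ o2 :+ o :≤ d :+ d :+ con 24)
    (≤-trans (hh-⊞-mono (O ⊞ O) (neg O)) (≤-reflexive (cong (_+ᵣ # 9) (hh-⇒ {B = O ⊞ (neg O ⊞ O)} (⊞-assoc {A = O} {B = O} {C = neg O} ⇒∘ ⇒-⊞ {A = O} ⇒-id (⊞-comm {A = O} {B = neg O}))))))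
    (kv O (neg O) O) (≤-reflexive (hh-⇒ (⊞-comm {A = neg O} {B = O}))) (≤-reflexive (sym (hh-neg O)))

  -- An upper bound for the entropy cost of adding one more copy of an integer multiple of O.
  cost : Obj G → R
  cost O = # 3 *ᵣ (hh (O ⊞ O) -ᵣ hh O) +ᵣ # 66

  module _ (O : Obj G) where
    private
      K2 : R
      K2 = hh (O ⊞ O) -ᵣ hh O

    cost-≥0 : # 0 ≤ᵣ cost O
    cost-≥0 = lin (3 ∷ []) 2 (λ a b → b :≤ a :+ con 9 ∷ [] ⊢ con 0 :≤ con 3 :* (a :- b) :+ con 66) (hh-⊞-mono O O)

    -- `dilate` trades one step of the multiple for one more copy of O. The copy of O already inside
    -- `O ⊞ A` makes this affordable: beside it, `kv` bounds the price of a further copy by the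
    -- doubling.
    scaled-step : ∀ A k → hh ((O ⊞ A) ⊞ scaled (suc k) O) ≤ᵣ hh ((O ⊞ A) ⊞ scaled k O) +ᵣ cost O
    scaled-step A k = lin (1 ∷ 1 ∷ 1 ∷ 1 ∷ []) 7 (λ x y z d o2 o w → x :+ o :≤ d :+ z :+ con 24 ∷ z :≤ w ∷ w :+ o :≤ y :+ o2 :+ con 15 ∷ d :+ o :≤ o2 :+ o2 :+ con 27 ∷ []
        ⊢ x :≤ y :+ (con 3 :* (o2 :- o) :+ con 66))
      (dilate (O ⊞ A) O k)
      (≤-reflexive (hh-⇒ {A = ((O ⊞ A) ⊞ scaled k O) ⊞ O} {B = W ⊞ (O ⊞ O)} (⇒-⊞ {A = (O ⊞ A) ⊞ scaled k O} {B = O} front ⇒-id ⇒∘ ⊞-assoc {A = W} {B = O} {C = O})))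
      (≤-trans (kv W O O) (≤-reflexive (cong (λ z → z +ᵣ hh (O ⊞ O) +ᵣ # 15) (sym (hh-⇒ front)))))
      (sum-diff O)
      where
      W : Obj G
      W = A ⊞ scaled k O
      front : (O ⊞ A) ⊞ scaled k O ⇒ W ⊞ O
      front = ⊞-assoc {A = O} {B = A} {C = scaled k O} ⇒∘ ⊞-comm {A = O} {B = A ⊞ scaled k O}

    scaled-zero : ∀ A → hh (A ⊞ scaled 0 O) ≤ᵣ hh A +ᵣ # 3
    scaled-zero A = ≤-trans (≤-reflexive (cH-law {μ = μ A ⊗ μ O} Law-id (Xr (A ⊞ scaled 0 O)) (T A ⊗ᵣ T O) (Xr A ∘ᵣ proj₁) (T A ⊗ᵣ T O)
      (λ e → g-cancelʳ G (ε G) (proj₁ (,-inj e))) (λ e → cong (_+g ε G) (proj₁ (,-inj e))) id id)) (cH-proj₁-hi (μ A) (μ O) (Xr A) (T A) (T O))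

    scaled-upper : ∀ A k → hh ((O ⊞ A) ⊞ scaled k O) ≤ᵣ hh (O ⊞ A) +ᵣ # k *ᵣ cost O +ᵣ # 3
    scaled-upper A zero = ≤-trans (scaled-zero (O ⊞ A)) (lin [] 2 λ x c → [] ⊢ x :+ con 3 :≤ x :+ con 0 :* c :+ con 3)
    scaled-upper A (suc k) = ≤-trans (scaled-step A k) (≤-trans (+-mono (scaled-upper A k) ≤-refl)
      (≤-trans (lin [] 3 λ x k c → [] ⊢ x :+ k :* c :+ con 3 :+ c :≤ x :+ (con 1 :+ k) :* c :+ con 3) (≤-reflexive (cong (λ z → hh (O ⊞ A) +ᵣ z *ᵣ cost O +ᵣ # 3) (sym (#-+ 1 k))))))

    multiples : List ℕ → Obj G
    multiples as = sumObj as (μ O) (λ a → times G a ∘ X O) (T O)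

    -- The constant 3 is absorbed since cost O + 3 ≥ 3.
    multiples-upper : ∀ as → hh (O ⊞ multiples as) ≤ᵣ hh O +ᵣ # weight as *ᵣ (cost O +ᵣ # 3)
    multiples-upper [] = ≤-trans (npow-one O 0) (lin (1 ∷ []) 2 (λ o c → con 0 :≤ c ∷ [] ⊢ o :+ con 3 :≤ o :+ con 1 :* (c :+ con 3)) cost-≥0)
    multiples-upper (a ∷ as) = ≤-trans (≤-reflexive (hh-⇒ {A = O ⊞ (scaled a O ⊞ multiples as)} {B = (O ⊞ multiples as) ⊞ scaled a O}
        (⇒-⊞ {A = O} {B = scaled a O ⊞ multiples as} ⇒-id (⊞-comm {A = scaled a O} {B = multiples as}) ⇒∘ ⊞-unassoc {A = O} {B = multiples as} {C = scaled a O})))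
      (≤-trans (scaled-upper (multiples as) a) (≤-trans (lin (1 ∷ 1 ∷ 3 ∷ []) 5 (λ x o a w c → x :≤ o :+ w :* (c :+ con 3) ∷ con 0 :≤ c ∷ con 0 :≤ a ∷ []
          ⊢ x :+ a :* c :+ con 3 :≤ o :+ (a :+ (con 1 :+ w)) :* (c :+ con 3)) (multiples-upper as) cost-≥0 (#-≥0 a))
        (≤-reflexive (cong (λ z → hh O +ᵣ z *ᵣ (cost O +ᵣ # 3)) (sym (trans (#-+ a (1 ℕ.+ weight as)) (cong (# a +ᵣ_) (#-+ 1 (weight as)))))))))

  -- Twice the entropic Ruzsa distance from -V, with the entropy of V cancelled on both sides.
  -- Quantifying over all V makes closeness compose by adding constants, and lets V be uniform on a
  -- subgroup that is found only at the end.
  Close : Obj G → Obj G → R → Set₁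
  Close O O' c = ∀ V → hh (O ⊞ V) +ᵣ hh (O ⊞ V) -ᵣ hh O ≤ᵣ hh (O' ⊞ V) +ᵣ hh (O' ⊞ V) -ᵣ hh O' +ᵣ c

  close-via-diff : (O Y : Obj G) → Close O Y (hh (O ⊟ Y) +ᵣ hh (O ⊟ Y) -ᵣ hh O -ᵣ hh Y +ᵣ # 54)
  close-via-diff O Y V = lin (2 ∷ []) 5 (λ ov o yv y d → ov :+ y :≤ d :+ yv :+ con 27 ∷ [] ⊢ ov :+ ov :- o :≤ yv :+ yv :- y :+ (d :+ d :- o :- y :+ con 54)) (triangle O Y V)

  close-npow : ∀ c cs (O : Obj G) → Close O (npow (c ∷ cs) O) (hh (npow (c ∷ cs) O) -ᵣ hh O +ᵣ # 18)
  close-npow c cs O V = lin (2 ∷ []) 4 (λ ov o rv r → ov :≤ rv :+ con 9 ∷ [] ⊢ ov :+ ov :- o :≤ rv :+ rv :- r :+ (r :- o :+ con 18))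
    (≤-trans (hh-⊞-mono (O ⊞ V) (npow cs O)) (≤-reflexive (cong (_+ᵣ # 9) (hh-⇒ {A = (O ⊞ V) ⊞ npow cs O} {B = (O ⊞ npow cs O) ⊞ V}
      (⊞-assoc {A = O} {B = V} {C = npow cs O} ⇒∘ ⇒-⊞ {A = O} {B = V ⊞ npow cs O} ⇒-id (⊞-comm {A = V} {B = npow cs O}) ⇒∘ ⊞-unassoc {A = O} {B = npow cs O} {C = V})))))

  close-cand : ∀ c c' cs (O : Obj G) → Close O (Iid.cand O c (c' ∷ cs)) (# 2 *ᵣ (hh (O ⊞ O) -ᵣ hh O) +ᵣ # 78)
  close-cand c c' es O V = lin (2 ∷ 2 ∷ 1 ∷ []) 7 (λ ov o cv cd n n1 o2 → ov :+ n :≤ n1 :+ cv :+ con 21 ∷ n1 :≤ n :+ (o2 :- o :+ con 15) ∷ cd :≤ o :+ con 6 ∷ [] ⊢ ov :+ ov :- o :≤ cv :+ cv :- cd :+ (con 2 :* (o2 :- o) :+ con 78))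
      main (npow-step O c' es) (cand-upper c cs)
    where
    open Iid O
    cs : List ℕ
    cs = c' ∷ es
    B : Set
    B = Pow cs (Ω O)
    ν : Dist B
    ν = powD cs (μ O)
    M : Dist ((Ω O × B) × Ω V)
    M = (μ O ⊗ ν) ⊗ μ V
    S f g k : RV ((Ω O × B) × Ω V)
    S = TT (c ∷ cs) ⊗ᵣ T V
    f = (Xr O ∘ᵣ proj₁) ⊗ᵣ Xr V
    g = σ (c ∷ cs) ∘ᵣ proj₁
    k = rvg G (λ p → X O (proj₁ (proj₁ p)) +g X V (proj₂ p))
    ρ : (Ω O × B) × Ω V → (Ω O × Ω V) × B
    ρ ((a , b) , v) = (a , v) , b
    lawρ : Law M ((μ O ⊗ μ V) ⊗ ν) ρ
    lawρ = Law-∘ {φ = assoc×} {χ = λ p → unassoc× (proj₁ p , swap× (proj₂ p))} (Law-assoc (μ O) ν (μ V))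
      (Law-∘ {φ = λ p → proj₁ p , swap× (proj₂ p)} {χ = unassoc×} (Law-map {φ = id} Law-id (Law-swap ν (μ V))) (Law-unassoc (μ O) (μ V) ν))
    -- What X + V tells about the row sum is at most what X and V tell together. This is what X
    -- tells: the entropy of the row sum minus that of the sum of the other copies.
    main : hh (O ⊞ V) +ᵣ hh (npow cs O) ≤ᵣ hh (npow (c ∷ cs) O) +ᵣ hh (cand c cs ⊞ V) +ᵣ # 21
    main = lin (1 ∷ 1 ∷ 1 ∷ 1 ∷ 1 ∷ 1 ∷ 1 ∷ 1 ∷ 1 ∷ []) 14 (λ ov n n1 cv l k fk gk o v j2 f' f1 g' →
          l :+ k :≤ fk :+ gk :+ con 3 ∷ j2 :+ v :≤ l :+ con 3 ∷ o :+ n :≤ j2 :+ con 3 ∷ ov :≤ k :+ con 3 ∷ fk :≤ f' ∷ f' :≤ f1 :+ v :+ con 3 ∷ f1 :≤ o :+ con 3 ∷ gk :≤ g' :+ cv ∷ g' :≤ n1 :+ con 3 ∷ []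
          ⊢ ov :+ n :≤ n1 :+ cv :+ con 21)
      (cH-subk M S f g k)
      (≤-trans (hh-⊠-lo (O ⊠ npow cs O) V) (+-mono (cH-mono M S ⟨ f , ⟨ g , k ⟩ ⟩ (Xr ((O ⊠ npow cs O) ⊠ V)) λ {p} {q} e → let (fe , r) = ,-inj (proj₁ (,-inj e)) ; (x , v) = ,-inj fe ; (s , _) = ,-inj r in
         cong₂ _,_ (cong₂ _,_ x (g-cancelˡ G (X O (proj₁ (proj₁ p))) (trans s (cong (_+g fn (σ cs) (proj₂ (proj₁ q))) (sym x))))) v) ≤-refl))
      (hh-⊠-lo O (npow cs O))
      (≤-trans (cH-proj₁-lo (μ O ⊗ μ V) ν (Xr (O ⊞ V)) (T O ⊗ᵣ T V) (TT cs)) (≤-reflexive (cong (_+ᵣ # 3) (sym (cH-law {μ = M} {ν = (μ O ⊗ μ V) ⊗ ν} {φ = ρ} lawρ k S (Xr (O ⊞ V) ∘ᵣ proj₁) ((T O ⊗ᵣ T V) ⊗ᵣ TT cs)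
         (λ e → proj₁ (,-inj e)) (λ e → proj₁ (,-inj e)) (λ e → let (p , v) = ,-inj e ; (a , b) = ,-inj p in cong₂ _,_ (cong₂ _,_ a v) b) (λ e → let (p , b) = ,-inj e ; (a , v) = ,-inj p in cong₂ _,_ (cong₂ _,_ a b) v))))))
      (cH-mono M S f ⟨ f , k ⟩ λ e → let (x , v) = ,-inj (proj₁ (,-inj e)) in cong₂ _,_ (proj₁ (,-inj e)) (cong₂ _+g_ x v))
      (cH-⊗-hi (μ O ⊗ ν) (μ V) (Xr O ∘ᵣ proj₁) (Xr V) (TT (c ∷ cs)) (T V))
      (cH-proj₁-hi (μ O) ν (Xr O) (T O) (TT cs))
      (≤-trans (≤-reflexive (chain M S g k)) (+-mono ≤-refl (≤-reflexive (cH-law {μ = M} Law-id k ⟨ g , S ⟩ (Xr (cand c cs ⊞ V)) (T (cand c cs ⊞ V)) (λ e → proj₁ (,-inj e)) (λ e → proj₁ (,-inj e))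
         (λ e → let (s , p) = ,-inj e ; (t , v) = ,-inj p in cong₂ _,_ (cong₂ _,_ s t) v) (λ e → let (p , v) = ,-inj e ; (s , t) = ,-inj p in cong₂ _,_ s (cong₂ _,_ t v))))))
      (cH-proj₁-hi (μ O ⊗ ν) (μ V) (σ (c ∷ cs)) (TT (c ∷ cs)) (T V))

-- Conditioning on a sum.

cH-const : ∀ {Ω} (μ : Dist Ω) f T → (∀ a b → fn T a ≡ fn T b) → cH μ f T ≡ H μ f
cH-const μ f T c = trans (cong₂ _-ᵣ_ (H-iso μ ⟨ f , T ⟩ f (λ e → proj₁ (,-inj e)) (λ e → cong₂ _,_ e (c _ _))) (trans (H-iso μ T ⊤ᵣ (λ _ → refl) (λ _ → c _ _)) (H-⊤ μ)))
  (ring 1 λ x → [] ⊢ x :- con 0 := x)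

mass-law : ∀ {A B} {μ : Dist A} {ν : Dist B} {φ} → Law μ ν φ → ∀ f a → mass μ (f ∘ᵣ φ) a ≡ mass ν f (φ a)
mass-law {φ = φ} L f a = at L (same f (φ a))

module Fibre {G : Grp} {Ω₀ : Set} (M : Dist Ω₀) (A B : Ω₀ → Car G) (Q : RV Ω₀) where
  private
    _+g_ : Car G → Car G → Car G
    _+g_ = _∙_ G
    Ar Br : RV Ω₀
    Ar = rvg G A
    Br = rvg G B

  Zr F : RV Ω₀
  Zr = rvg G (λ a → A a +g B a)
  F = ⟨ Zr , Q ⟩

  -- The condition is imposed here, whereas `whole` keeps it as side information. Averages over the
  -- fibres are compared with `whole`, and one good fibre is selected afterwards.
  fibre : Ω₀ → Obj G
  fibre a = obj (cond M F a) A ⊤ᵣ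

  whole : Obj G
  whole = obj M A F

  fibre-lower : hh whole ≤ᵣ E M (λ a → hh (fibre a)) +ᵣ # 1
  fibre-lower = lin (1 ∷ 1 ∷ 1 ∷ []) 5 (λ af fa f e e' → af :≤ fa ∷ fa :≤ f :+ e' :+ con 1 ∷ e' :≤ e ∷ [] ⊢ af :- f :≤ e :+ con 1)
      (≤-trans (H-det M ⟨ F , Ar ⟩ ⟨ Ar , F ⟩ (λ e → let (p , q) = ,-inj e in cong₂ _,_ q p)) (≤-reflexive (sym (H-law (Law-proj₁ M κ) ⟨ F , Ar ⟩))))
      (chain-hi M F κ (Ar ∘ᵣ proj₁))
      (≤-reflexive (E-ext M λ a → trans (H-law (Law-proj₁ (cond M F a) κ) Ar) (sym (cH-const (cond M F a) Ar ⊤ᵣ (λ _ _ → refl)))))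
    where
    κ : Ω₀ → Dist ⊤
    κ _ = dirac tt

  fibre-diff : (O : Obj G) → E M (λ a → hh (O ⊟ fibre a)) ≤ᵣ hh (O ⊟ whole) +ᵣ # 3
  fibre-diff O = lin (1 ∷ 1 ∷ 1 ∷ 1 ∷ []) 7 (λ e e' f j to w tw → e :≤ e' :- to ∷ f :+ e' :≤ j ∷ j :≤ w ∷ tw :≤ to :+ f :+ con 3 ∷ [] ⊢ e :≤ w :- tw :+ con 3)
      (≤-reflexive (trans (E-ext M each) (trans (E-+c M (-ᵣ H (μ O) (T O)) (λ a → H (cond M F a ⊗ μ O) g)) refl)))
      (chain-lo M F (λ _ → μ O) g)
      (≤-trans (H-det (M ⊗ μ O) (⟨ Xr (O ⊟ whole) , T (O ⊟ whole) ⟩ ∘ᵣ swap×) ⟨ F ∘ᵣ proj₁ , g ⟩ (λ e → let (d , p) = ,-inj e ; (t , f) = ,-inj p in cong₂ _,_ f (cong₂ _,_ d t)))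
        (≤-reflexive (H-law (Law-swap M (μ O)) ⟨ Xr (O ⊟ whole) , T (O ⊟ whole) ⟩)))
      (H-⊗-hi (μ O) M (T O) F)
    where
    g : RV (Ω₀ × Ω O)
    g = ⟨ rvg G (λ p → X O (proj₂ p) +g _⁻ G (A (proj₁ p))) , T O ∘ᵣ proj₂ ⟩
    each : ∀ a → hh (O ⊟ fibre a) ≡ H (cond M F a ⊗ μ O) g -ᵣ H (μ O) (T O)
    each a = cong₂ _-ᵣ_
      (trans (sym (H-law (Law-swap (cond M F a) (μ O)) ⟨ Xr (O ⊟ fibre a) , T (O ⊟ fibre a) ⟩))
        (H-iso (cond M F a ⊗ μ O) (⟨ Xr (O ⊟ fibre a) , T (O ⊟ fibre a) ⟩ ∘ᵣ swap×) g (λ e → let (d , p) = ,-inj e in cong₂ _,_ d (proj₁ (,-inj p))) (λ e → let (d , p) = ,-inj e in cong₂ _,_ d (cong (_, tt) p))))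
      (trans (H-iso (μ O ⊗ cond M F a) (T O ⊗ᵣ ⊤ᵣ) (T O ∘ᵣ proj₁) (λ e → proj₁ (,-inj e)) (λ e → cong (_, tt) e)) (H-law (Law-proj₁ (μ O) (λ _ → cond M F a)) (T O)))

  private
    κ : Ω₀ → Dist Ω₀
    κ = cond M F
    -- Two copies over the same value of F, independent given that value.
    J : Dist (Ω₀ × Ω₀)
    J = bind M κ
    W : RV Ω₀
    W = ⟨ Ar , ⟨ Br , Q ⟩ ⟩
    WF : W ⟶ F
    WF e = let (a , p) = ,-inj e ; (b , q) = ,-inj p in cong₂ _,_ (cong₂ _+g_ a b) q
    J₂ : Law J M proj₂
    J₂ = mkLaw λ ψ → trans (E-bind M κ (ψ ∘ proj₂)) (E-total M F (λ _ b → ψ b) (λ _ _ _ → refl))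
    suppJ : ∀ {p} → Supp J p → Supp M (proj₁ p) × Supp M (proj₂ p) × fn F (proj₁ p) ≡ fn F (proj₂ p)
    suppJ s = let (sa , sb) = Supp-bind M κ s ; (sb' , e) = Supp-cond M F sa sb in sa , sb' , e
    A1 A2 B1 B2 Q1 D L : RV (Ω₀ × Ω₀)
    A1 = Ar ∘ᵣ proj₁
    A2 = Ar ∘ᵣ proj₂
    B1 = Br ∘ᵣ proj₁
    B2 = Br ∘ᵣ proj₂
    Q1 = Q ∘ᵣ proj₁
    D = rvg G (λ p → A (proj₁ p) +g _⁻ G (A (proj₂ p)))
    L = ⟨ W ∘ᵣ proj₁ , W ∘ᵣ proj₂ ⟩

    massL : ∀ {p} → Supp J p → mass J L p *ᵣ mass J (F ∘ᵣ proj₁) p ≡ mass J (W ∘ᵣ proj₁) p *ᵣ mass J (W ∘ᵣ proj₂) p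
    massL {a , b} s = let (sa , sb , e) = suppJ s in
      trans (cong₂ _*ᵣ_ (trans (E-bind M κ _) (trans (E-cong M {ψ = λ a' → same W a a' *ᵣ (mass M W b *ᵣ inv (mass M F a))} λ {a'} s' → inner sa s' e)
          (E-*ʳ M _ (same W a)))) (mass-law (Law-proj₁ M κ) F (a , b)))
        (trans (ring 4 λ x y i m → [] ⊢ (x :* (y :* i)) :* m := (x :* y) :* (m :* i)) (trans (*-cancel-1 (inv-r (mass-pos M F sa)))
          (cong₂ _*ᵣ_ (sym (mass-law (Law-proj₁ M κ) W (a , b))) (sym (mass-law J₂ W (a , b))))))
      where
      inner : Supp M a → ∀ {a'} → Supp M a' → fn F a ≡ fn F b → E (κ a') (λ b' → same L (a , b) (a' , b')) ≡ same W a a' *ᵣ (mass M W b *ᵣ inv (mass M F a))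
      inner sa {a'} s' e = trans (trans (E-ext (κ a') λ b' → ind-× (dec L (fn L (a , b)) (fn L (a' , b'))) (dec W _ _) (dec W _ _)) (E-* (κ a') _ _)) (go (dec W (fn W a) (fn W a')))
        where
        go : ∀ d → ind d *ᵣ E (κ a') (same W b) ≡ ind d *ᵣ (mass M W b *ᵣ inv (mass M F a))
        go (no _) = trans (*-0ˡ _) (sym (*-0ˡ _))
        go (yes w) = cong (# 1 *ᵣ_) (trans (cond-class M F s' sa (sym (WF {a} {a'} w)) (same W b)) (trans (E-cond M F sa (same W b))
           (cong (_*ᵣ inv (mass M F a)) (E-ext M λ c → absorb c (dec W (fn W b) (fn W c))))))
          where
          absorb : ∀ c d → same F a c *ᵣ ind d ≡ ind d
          absorb c (no _) = ring 1 λ x → [] ⊢ x :* con 0 := con 0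
          absorb c (yes q) = trans (cong (_*ᵣ # 1) (ind-yes (dec F (fn F a) (fn F c)) (trans e (WF {b} {c} q)))) (*-1ˡ _)

    sub-AA : ∀ (R : RV Ω₀) → H J ⟨ R ∘ᵣ proj₁ , ⟨ R ∘ᵣ proj₂ , Q1 ⟩ ⟩ +ᵣ H M Q ≤ᵣ H M ⟨ R , Q ⟩ +ᵣ H M ⟨ R , Q ⟩ +ᵣ # 3
    sub-AA R = lin (1 ∷ 1 ∷ 1 ∷ 1 ∷ []) 6 (λ x q q' r r1 r2 → x :+ q' :≤ r1 :+ r2 :+ con 3 ∷ q :≤ q' ∷ r1 :≤ r ∷ r2 :≤ r ∷ [] ⊢ x :+ q :≤ r :+ r :+ con 3)
      (H-sub J (R ∘ᵣ proj₁) (R ∘ᵣ proj₂) Q1) (≤-reflexive (sym (H-law (Law-proj₁ M κ) Q))) (≤-reflexive (H-law (Law-proj₁ M κ) ⟨ R , Q ⟩))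
      (≤-trans (H-Det J (⟨ R , Q ⟩ ∘ᵣ proj₂) ⟨ R ∘ᵣ proj₂ , Q1 ⟩ λ s s' e → let (r , q) = ,-inj e ; (_ , _ , f) = suppJ s ; (_ , _ , f') = suppJ s' in
          cong₂ _,_ r (trans (proj₂ (,-inj f)) (trans q (sym (proj₂ (,-inj f')))))) (≤-reflexive (H-law J₂ ⟨ R , Q ⟩)))

    D-swap : ∀ {p} → Supp J p → fn D p ≡ B (proj₂ p) +g _⁻ G (B (proj₁ p))
    D-swap {a , b} s = let (_ , _ , f) = suppJ s in g-cancelʳ G (A b +g B a) (trans (cancel (A a) (A b) (B a))
       (trans (proj₁ (,-inj f)) (sym (trans (cong ((B b +g _⁻ G (B a)) +g_) (g-comm G (A b) (B a))) (trans (cancel (B b) (B a) (A b)) (g-comm G _ _))))))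
      where
      cancel : ∀ x y z → (x +g _⁻ G y) +g (y +g z) ≡ x +g z
      cancel x y z = trans (g-assoc G x _ _) (cong (x +g_) (trans (sym (g-assoc G _ y z)) (trans (cong (_+g z) (trans (g-comm G _ y) (g-invʳ G y))) (g-idˡ G z))))

    -- A₁ and A₁ - A₂ give A₂; with B₂ this gives the common value of A + B, and then B₁.
    detL : Det J ⟨ A1 , ⟨ B2 , ⟨ D , Q1 ⟩ ⟩ ⟩ L
    detL {p} {p'} s s' e = cong₂ _,_ (cong₂ _,_ a (cong₂ _,_ b1 q)) (cong₂ _,_ a2 (cong₂ _,_ b (trans (sym (proj₂ f)) (trans q (proj₂ f')))))
      where
      a : fn A1 p ≡ fn A1 p'
      a = proj₁ (,-inj e)
      b : fn B2 p ≡ fn B2 p'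
      b = proj₁ (,-inj (proj₂ (,-inj e)))
      d : fn D p ≡ fn D p'
      d = proj₁ (,-inj (proj₂ (,-inj (proj₂ (,-inj e)))))
      q : fn Q1 p ≡ fn Q1 p'
      q = proj₂ (,-inj (proj₂ (,-inj (proj₂ (,-inj e)))))
      f : (A (proj₁ p) +g B (proj₁ p) ≡ A (proj₂ p) +g B (proj₂ p)) × (fn Q (proj₁ p) ≡ fn Q (proj₂ p))
      f = ,-inj (proj₂ (proj₂ (suppJ s)))
      f' : (A (proj₁ p') +g B (proj₁ p') ≡ A (proj₂ p') +g B (proj₂ p')) × (fn Q (proj₁ p') ≡ fn Q (proj₂ p'))
      f' = ,-inj (proj₂ (proj₂ (suppJ s')))
      a2 : A (proj₂ p) ≡ A (proj₂ p')
      a2 = g-inv-inj G (g-cancelˡ G (A (proj₁ p)) (trans d (cong (_+g _⁻ G (A (proj₂ p'))) (sym a))))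
      b1 : B (proj₁ p) ≡ B (proj₁ p')
      b1 = g-cancelˡ G (A (proj₁ p)) (trans (proj₁ f) (trans (cong₂ _+g_ a2 b) (trans (sym (proj₁ f')) (cong (_+g B (proj₁ p')) (sym a)))))

  -- Entropic Balog–Szemerédi–Gowers: the two copies of A over the same value of A + B differ by A₁ − A₂ = B₂ − B₁.
  fibre-self : E M (λ a → hh (fibre a ⊟ fibre a)) ≤ᵣ # 2 *ᵣ (H M ⟨ rvg G A , Q ⟩ +ᵣ H M ⟨ rvg G B , Q ⟩ -ᵣ H M ⟨ rvg G A , ⟨ rvg G B , Q ⟩ ⟩) +ᵣ H M F -ᵣ # 3 *ᵣ H M Q +ᵣ # 16
  fibre-self = lin (1 ∷ 1 ∷ 1 ∷ 1 ∷ 1 ∷ 1 ∷ 1 ∷ 1 ∷ 1 ∷ 1 ∷ []) 15 (λ e e' f fd dq q aq bq abq l abdq adq bdq aa bb →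
        e :≤ e' ∷ f :+ e' :≤ fd ∷ fd :+ q :≤ dq :+ f :+ con 3 ∷ abdq :+ dq :≤ adq :+ bdq :+ con 3 ∷ l :≤ abdq ∷ adq :≤ aa ∷ bdq :≤ bb ∷ (abq :+ abq :≤ l :+ f :+ con 1) ∷ aa :+ q :≤ aq :+ aq :+ con 3 ∷ bb :+ q :≤ bq :+ bq :+ con 3 ∷ []
        ⊢ e :≤ con 2 :* (aq :+ bq :- abq) :+ f :- con 3 :* q :+ con 16)
      (≤-reflexive (E-cong M λ {a} s → trans (cH-const _ _ (⊤ᵣ ⊗ᵣ ⊤ᵣ) (λ _ _ → refl)) (sym (H-law {μ = bind (κ a) κ} {ν = κ a ⊗ κ a} (mkLaw λ ψ →
          trans (E-bind (κ a) κ ψ) (trans (E-cong (κ a) λ {b} t → let (sb , e) = Supp-cond M F s t in cond-class M F sb s (sym e) _) (sym (E-⊗ (κ a) (κ a) ψ)))) D))))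
      (chain-lo M F κ D)
      (lin (1 ∷ 1 ∷ 1 ∷ 1 ∷ []) 7 (λ fd x q q' dq f f' → x :+ q' :≤ dq :+ f' :+ con 3 ∷ fd :≤ x ∷ q :≤ q' ∷ f' :≤ f ∷ [] ⊢ fd :+ q :≤ dq :+ f :+ con 3)
        (H-sub J D (Zr ∘ᵣ proj₁) Q1) (H-det J ⟨ D , F ∘ᵣ proj₁ ⟩ ⟨ F ∘ᵣ proj₁ , D ⟩ (λ e → let (d , f) = ,-inj e in cong₂ _,_ f d)) (≤-reflexive (sym (H-law (Law-proj₁ M κ) Q))) (≤-reflexive (H-law (Law-proj₁ M κ) F)))
      (H-sub J A1 B2 ⟨ D , Q1 ⟩)
      (H-Det J ⟨ A1 , ⟨ B2 , ⟨ D , Q1 ⟩ ⟩ ⟩ L detL)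
      (H-det J ⟨ A1 , ⟨ A2 , Q1 ⟩ ⟩ ⟨ A1 , ⟨ D , Q1 ⟩ ⟩ λ e → let (a , r) = ,-inj e ; (a' , q) = ,-inj r in cong₂ _,_ a (cong₂ _,_ (cong₂ (λ x y → x +g _⁻ G y) a a') q))
      (H-Det J ⟨ B1 , ⟨ B2 , Q1 ⟩ ⟩ ⟨ B2 , ⟨ D , Q1 ⟩ ⟩ λ s s' e → let (b , r) = ,-inj e ; (b' , q) = ,-inj r in
         cong₂ _,_ b' (cong₂ _,_ (trans (D-swap s) (trans (cong₂ (λ x y → x +g _⁻ G y) b' b) (sym (D-swap s')))) q))
      (≤-trans (≤-reflexive (cong₂ _+ᵣ_ (sym (H-law (Law-proj₁ M κ) W)) (sym (H-law J₂ W)))) (≤-trans (H-ind J (W ∘ᵣ proj₁) (W ∘ᵣ proj₂) (F ∘ᵣ proj₁) L massL)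
         (≤-reflexive (cong (λ z → H J L +ᵣ z +ᵣ # 1) (H-law (Law-proj₁ M κ) F)))))
      (sub-AA Ar) (sub-AA Br)

E-sub : ∀ {Ω} (μ : Dist Ω) f g → E μ (λ a → f a -ᵣ g a) ≡ E μ f -ᵣ E μ g
E-sub μ f g = trans (E-+ μ f _) (cong (E μ f +ᵣ_) (trans (E-ext μ λ a → neg≡ (g a)) (trans (E-* μ (# 0 -ᵣ # 1) g) (sym (neg≡ (E μ g))))))
  where
  neg≡ : ∀ z → -ᵣ z ≡ (# 0 -ᵣ # 1) *ᵣ z
  neg≡ z = trans (sym (+-0ˡ _)) (ring 1 λ z → [] ⊢ con 0 :- z := (con 0 :- con 1) :* z)

-- The combination y φ + x ψ has mean at most 2 x y, so it is at most 4 x y at some point; there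
-- each of its two nonnegative terms is at most 4 x y.
markov₂ : ∀ {Ω} (M : Dist Ω) φ ψ x y → # 0 <ᵣ x → # 0 <ᵣ y → (∀ {a} → Supp M a → # 0 ≤ᵣ φ a) → (∀ {a} → Supp M a → # 0 ≤ᵣ ψ a) →
  E M φ ≤ᵣ x → E M ψ ≤ᵣ y → ∃[ a ] (Supp M a × φ a ≤ᵣ # 4 *ᵣ x × ψ a ≤ᵣ # 4 *ᵣ y)
markov₂ M φ ψ x y x0 y0 φ0 ψ0 Eφ Eψ = let (a , s , le) = E-exists M (λ a → y *ᵣ φ a +ᵣ x *ᵣ ψ a) (# 4 *ᵣ (x *ᵣ y)) lt in
  a , s , *-cancelˡ y y0 (lin (1 ∷ 1 ∷ []) 4 (λ x y u v → y :* u :+ x :* v :≤ con 4 :* (x :* y) ∷ con 0 :≤ x :* v ∷ [] ⊢ y :* u :≤ y :* (con 4 :* x)) le (*-≥0 (<⇒≤ x0) (ψ0 s))) ,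
  *-cancelˡ x x0 (lin (1 ∷ 1 ∷ []) 4 (λ x y u v → y :* u :+ x :* v :≤ con 4 :* (x :* y) ∷ con 0 :≤ y :* u ∷ [] ⊢ x :* v :≤ x :* (con 4 :* y)) le (*-≥0 (<⇒≤ y0) (φ0 s)))
  where
  lt : E M (λ a → y *ᵣ φ a +ᵣ x *ᵣ ψ a) <ᵣ # 4 *ᵣ (x *ᵣ y)
  lt = ≰⇒> λ q → <⇒≱ (*-pos x0 y0) (lin/ 2 (1 ∷ 1 ∷ 1 ∷ 1 ∷ []) 5 (λ x y e u v → con 4 :* (x :* y) :≤ e ∷ e :≤ y :* u :+ x :* v ∷ y :* u :≤ y :* x ∷ x :* v :≤ x :* y ∷ [] ⊢ x :* y :≤ con 0 )
       q (≤-reflexive (trans (E-+ M _ _) (cong₂ _+ᵣ_ (E-* M y φ) (E-* M x ψ)))) (*-monoˡ y (<⇒≤ y0) Eφ) (*-monoˡ x (<⇒≤ x0) Eψ))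

-- The entropy decrement

module Decrement (G : Grp) (m : ℕ) (torsion : ∀ x → times G (suc (suc m)) x ≡ ε G) where
  open Coeff G

  -- The torsion exponent is n = m + 2, so that `cs`, the coefficients 0, ..., n - 1, unfolds to
  -- `0 ∷ 1 ∷ tl`.
  cs tl : List ℕ
  cs = List.upTo (suc (suc m))
  tl = List.applyUpTo (λ k → suc (suc k)) m

  n : R
  n = len cs

  Dbl : Obj G → R
  Dbl O = hh (npow cs O) -ᵣ hh O

  n' : R
  n' = len (1 ∷ tl)

  n≡ : n ≡ # 1 +ᵣ n'
  n≡ = len-∷ 0 (1 ∷ tl)

  n'≥1 : # 1 ≤ᵣ n'
  n'≥1 = #-mono (s≤s z≤n)

  n≥1 : # 1 ≤ᵣ n
  n≥1 = #-mono (s≤s z≤n)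

  -- A round lowers the doubling by the fraction 1 / N. The factor 100 is what the final inequality
  -- in `gain` requires.
  N : R
  N = # 100 *ᵣ (n *ᵣ n)

  n²≥1 : # 1 ≤ᵣ n *ᵣ n
  n²≥1 = ≤-trans (lin [] 0 ([] ⊢ con 1 :≤ con 1 :* con 1)) (*-mono (#-≥0 1) (≤-trans (#-≥0 1) n≥1) n≥1 n≥1)

  N-pos : # 0 <ᵣ N
  N-pos = *-pos (ι-pos 99) (<-≤-trans (ι-pos 0) n²≥1)

  Dbl-lower : ∀ O → hh (O ⊞ O) -ᵣ hh O ≤ᵣ Dbl O +ᵣ # 9
  Dbl-lower O = lin (1 ∷ []) 3 (λ o2 o s → o2 :≤ s :+ con 9 ∷ [] ⊢ o2 :- o :≤ s :- o :+ con 9) (k2-upper O 0 1 tl)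

  Dbl-≥ : ∀ O → # 0 ≤ᵣ Dbl O +ᵣ # 9
  Dbl-≥ O = lin (1 ∷ []) 2 (λ o s → o :≤ s :+ con 9 ∷ [] ⊢ con 0 :≤ s :- o :+ con 9) (hh-⊞-mono O (npow (1 ∷ tl) O))

  Close-mono : ∀ (O O' : Obj G) {c c'} → c ≤ᵣ c' → Close O O' c → Close O O' c'
  Close-mono O O' p C V = ≤-trans (C V) (+-mono ≤-refl p)

  ones LU LV LZ : List ℕ
  ones = rowsOf (λ _ _ → 1) cs cs
  LU = rowsOf (λ i j → i) cs cs
  LV = rowsOf (λ i j → j) cs cs
  LZ = rowsOf ℕ._+_ cs cs

  LZ∼LV : LZ ∼ LV
  LZ∼LV = rowwise ℕ._+_ (λ i j → j) cs cs λ i → ∼trans (rotate (suc m) torsion i) (↭⇒∼ (Perm.↭-reflexive (sym (ListP.map-id cs))))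

  LU∼LV : LU ∼ LV
  LU∼LV = transpose∼ (λ i j → i) cs cs

  -- w₁ and w₂ count the steps in which `multiples-upper` builds U and S out of O; b times the
  -- doubling bounds the mean of `ψ₀`, and C₁ times the doubling bounds the movement in one round.
  -- All depend on m alone.
  w₁ w₂ b C₁ : R
  w₁ = # weight LU
  w₂ = # weight ones
  b = # 99 *ᵣ (# 2 *ᵣ w₁ +ᵣ w₂) +ᵣ # 24 *ᵣ n +ᵣ # 132
  C₁ = # 4 *ᵣ b +ᵣ # 160

  b≥0 : # 0 ≤ᵣ b
  b≥0 = lin (198 ∷ 99 ∷ 24 ∷ []) 3 (λ u v n → con 0 :≤ u ∷ con 0 :≤ v ∷ con 1 :≤ n ∷ [] ⊢ con 0 :≤ con 99 :* (con 2 :* u :+ v) :+ con 24 :* n :+ con 132) (#-≥0 (weight LU)) (#-≥0 (weight ones)) n≥1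

  C₁≥0 : # 0 ≤ᵣ C₁
  C₁≥0 = lin (4 ∷ []) 1 (λ b → con 0 :≤ b ∷ [] ⊢ con 0 :≤ con 4 :* b :+ con 160) b≥0

  -- The first half says that the doubling shrinks by the factor 1 - 1/N. The movement allowed in
  -- the second half is proportional to the same doubling, hence to the decrease, and so telescopes
  -- over the rounds.
  Better : Obj G → Obj G → Set₁
  Better O O' = (N *ᵣ Dbl O' +ᵣ Dbl O ≤ᵣ N *ᵣ Dbl O) × Close O O' (C₁ *ᵣ Dbl O)

  module Step (O : Obj G) (large : # 1300 *ᵣ (n *ᵣ n) ≤ᵣ Dbl O) where
    open Iid O
    open Array O cs

    D d K2 : R
    D = Dbl O
    d = D *ᵣ inv N
    K2 = hh (O ⊞ O) -ᵣ hh O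

    D≡ : D ≡ N *ᵣ d
    D≡ = sym (trans (ring 3 λ x D i → [] ⊢ x :* (D :* i) := D :* (x :* i)) (*-cancel-1 (inv-r N-pos)))

    D≥1 : # 1 ≤ᵣ D
    D≥1 = lin (1 ∷ 1300 ∷ []) 2 (λ D k → con 1300 :* k :≤ D ∷ con 1 :≤ k ∷ [] ⊢ con 1 :≤ D) large n²≥1

    d≥13 : # 13 ≤ᵣ d
    d≥13 = *-cancelˡ N N-pos (≤-trans (lin (1 ∷ []) 2 (λ k D → con 1300 :* k :≤ D ∷ [] ⊢ (con 100 :* k) :* con 13 :≤ D) large) (≤-reflexive D≡))

    d≤D : d ≤ᵣ D
    d≤D = ≤-trans (≤-trans (lin (1 ∷ []) 2 (λ k d → d :≤ k :* d ∷ [] ⊢ d :≤ k :* d) d≤n²d) (lin (99 ∷ []) 2 (λ k d → con 0 :≤ k :* d ∷ [] ⊢ k :* d :≤ (con 100 :* k) :* d) (*-≥0 (≤-trans (#-≥0 1) n²≥1) (≤-trans (#-≥0 13) d≥13)))) (≤-reflexive (sym D≡))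
      where
      d≤n²d : d ≤ᵣ (n *ᵣ n) *ᵣ d
      d≤n²d = ≤-trans (≤-reflexive (sym (*-1ˡ d))) (*-monoʳ d (≤-trans (#-≥0 13) d≥13) n²≥1)

    improve : ∀ O' → Dbl O' +ᵣ d ≤ᵣ D → Close O O' (C₁ *ᵣ D) → Better O O'
    improve O' p c = ≤-trans (+-mono ≤-refl (≤-reflexive D≡)) (≤-trans (≤-reflexive (sym (distribˡ N (Dbl O') d))) (*-monoˡ N (<⇒≤ N-pos) p)) , c

    K2≤ : K2 ≤ᵣ # 10 *ᵣ D
    K2≤ = lin (1 ∷ 9 ∷ []) 2 (λ k D → k :≤ D :+ con 9 ∷ con 1 :≤ D ∷ [] ⊢ k :≤ con 10 :* D) (Dbl-lower O) D≥1

    c3 : R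
    c3 = cost O +ᵣ # 3

    c3≤ : c3 ≤ᵣ # 99 *ᵣ D
    c3≤ = lin (3 ∷ 96 ∷ []) 3 (λ o2 o D → o2 :- o :≤ D :+ con 9 ∷ con 1 :≤ D ∷ [] ⊢ con 3 :* (o2 :- o) :+ con 66 :+ con 3 :≤ con 99 :* D) (Dbl-lower O) D≥1

    -- If no copy conditioned on the rest of its row has smaller doubling, then every column peeled
    -- off by `nYσ-step` contributes at least D - d beyond the entropy of its candidate, and the
    -- lower bounds of `cand-lower` telescope. The last column is fixed by the row sums and
    -- contributes no such gain.
    scan : ∀ c es → (Σ (Obj G) (Better O)) ⊎
      (len (c ∷ es) *ᵣ hh O +ᵣ len es *ᵣ (D -ᵣ d) ≤ᵣ hh (npow cs (Yσ (c ∷ es))) +ᵣ hh (npow (c ∷ es) O) +ᵣ len (c ∷ es) *ᵣ # 20)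
    scan c [] = inj₂ (lin (1 ∷ 1 ∷ []) 5 (λ o y r D d → o :≤ r :+ con 9 ∷ con 0 :≤ y ∷ [] ⊢ con 1 :* o :+ con 0 :* (D :- d) :≤ y :+ r :+ con 1 :* con 20)
      (hh-⊞-mono O (npow [] O)) (cH-≥0 _ (Xr (npow cs (Yσ (c ∷ [])))) (T (npow cs (Yσ (c ∷ []))))))
    scan c (c' ∷ es) with Dbl (cand c (c' ∷ es)) +ᵣ d ≤? D | scan c' es
    ... | yes p | _ = inj₁ (cand c (c' ∷ es) , improve (cand c (c' ∷ es)) p (Close-mono O (cand c (c' ∷ es))
        (lin (4 ∷ 158 ∷ 2 ∷ []) 4 (λ o2 o D c → con 0 :≤ c :* D ∷ con 1 :≤ D ∷ o2 :- o :≤ D :+ con 9 ∷ [] ⊢ con 2 :* (o2 :- o) :+ con 78 :≤ (con 4 :* c :+ con 160) :* D)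
          (*-≥0 b≥0 (≤-trans (#-≥0 1) D≥1)) D≥1 (Dbl-lower O)) (close-cand c c' es O)))
    ... | no _ | inj₁ r = inj₁ r
    ... | no p | inj₂ q = inj₂ (subst₂ (λ L l → L *ᵣ hh O +ᵣ l *ᵣ (D -ᵣ d) ≤ᵣ hh (npow cs (Yσ (c ∷ c' ∷ es))) +ᵣ hh (npow (c ∷ c' ∷ es) O) +ᵣ L *ᵣ # 20)
        (sym (len-∷ c (c' ∷ es))) (sym (len-∷ c' es)) (lin (1 ∷ 1 ∷ 1 ∷ 1 ∷ []) 11 (λ o l D d y y' r r' nc ca L → L :* o :+ l :* (D :- d) :≤ y' :+ r' :+ L :* con 20 ∷ D :≤ nc :- ca :+ d ∷ nc :+ y' :≤ y :+ con 6 ∷ o :+ r' :≤ ca :+ r :+ con 3 ∷ []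
          ⊢ (con 1 :+ L) :* o :+ (con 1 :+ l) :* (D :- d) :≤ y :+ r :+ (con 1 :+ L) :* con 20)
        q (<⇒≤ (≰⇒> p)) (nYσ-step cs c (c' ∷ es)) (cand-lower c (c' ∷ es))))

    -- Entered when row sums and column sums share little information given the total; then some
    -- fibre of U over U + V must have smaller doubling.
    module Endgame (small : excess ≤ᵣ n *ᵣ (d +ᵣ # 23)) where
      private
        u uv s4 h0 : R
        u = hh (flat {K = G ×g G} pairF LV)
        uv = cH M ⟨ U , ⟨ V , S ⟩ ⟩ 𝒯
        s4 = cH M S 𝒯
        h0 = H M 𝒯

      U-eq : cH M ⟨ U , S ⟩ 𝒯 ≡ u
      U-eq = trans (joint-flat (λ i j → i)) (hh-⇒ (flat-∼ {K = G ×g G} pairF (λ {a} {b} → pairF-cong {a} {b}) LU∼LV))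
      V-eq : cH M ⟨ V , S ⟩ 𝒯 ≡ u
      V-eq = joint-flat (λ i j → j)
      Z-eq : cH M ⟨ Z , S ⟩ 𝒯 ≡ u
      Z-eq = trans (joint-flat ℕ._+_) (hh-⇒ (flat-∼ {K = G ×g G} pairF (λ {a} {b} → pairF-cong {a} {b}) LZ∼LV))

      info : # 2 *ᵣ u ≤ᵣ uv +ᵣ s4 +ᵣ excess +ᵣ # 6
      info = ≤-trans (≤-reflexive (trans (ring 1 λ u → [] ⊢ con 2 :* u := u :+ u) (cong₂ _+ᵣ_ (sym U-eq) (sym V-eq)))) information

      Q : RV (Pow cs (Pow cs (Ω O)))
      Q = ⟨ S , 𝒯 ⟩

      open Fibre {G} M (arrF (λ i j → i)) (arrF (λ i j → j)) Q

      assocH : ∀ f → H M ⟨ f , Q ⟩ ≡ cH M ⟨ f , S ⟩ 𝒯 +ᵣ h0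
      assocH f = trans (H-iso M ⟨ f , Q ⟩ ⟨ ⟨ f , S ⟩ , 𝒯 ⟩ (λ e → let (a , p) = ,-inj e ; (b , c) = ,-inj p in cong₂ _,_ (cong₂ _,_ a b) c) (λ e → let (p , c) = ,-inj e ; (a , b) = ,-inj p in cong₂ _,_ a (cong₂ _,_ b c)))
        (ring 2 λ x y → [] ⊢ x := (x :- y) :+ y)

      HF : H M F ≡ u +ᵣ h0
      HF = trans (H-iso M F ⟨ Z , Q ⟩ (λ {a} {b} e → let (z , q) = ,-inj e in cong₂ _,_ (trans (Z-sum a) (trans z (sym (Z-sum b)))) q)
          (λ {a} {b} e → let (z , q) = ,-inj e in cong₂ _,_ (trans (sym (Z-sum a)) (trans z (Z-sum b))) q)) (trans (assocH Z) (cong (_+ᵣ h0) Z-eq))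

      HUV : H M ⟨ U , ⟨ V , Q ⟩ ⟩ ≡ uv +ᵣ h0
      HUV = trans (H-iso M ⟨ U , ⟨ V , Q ⟩ ⟩ ⟨ ⟨ U , ⟨ V , S ⟩ ⟩ , 𝒯 ⟩
          (λ e → let (a , p) = ,-inj e ; (b , q) = ,-inj p ; (c , t) = ,-inj q in cong₂ _,_ (cong₂ _,_ a (cong₂ _,_ b c)) t)
          (λ e → let (p , t) = ,-inj e ; (a , q) = ,-inj p ; (b , c) = ,-inj q in cong₂ _,_ a (cong₂ _,_ b (cong₂ _,_ c t))))
        (ring 2 λ x y → [] ⊢ x := (x :- y) :+ y)

      HQ : H M Q ≡ s4 +ᵣ h0
      HQ = ring 2 λ x y → [] ⊢ x := (x :- y) :+ y

      whole-eq : hh whole ≡ uv -ᵣ u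
      whole-eq = trans (cong₂ _-ᵣ_ (trans (H-iso M ⟨ U , F ⟩ ⟨ U , ⟨ V , Q ⟩ ⟩
          (λ {a} {b} e → let (x , f) = ,-inj e ; (z , q) = ,-inj f in cong₂ _,_ x (cong₂ _,_ (g-cancelˡ G (fn U a) (trans z (cong (λ y → _∙_ G y (fn V b)) (sym x)))) q))
          (λ e → let (x , p) = ,-inj e ; (y , q) = ,-inj p in cong₂ _,_ x (cong₂ _,_ (cong₂ (_∙_ G) x y) q))) HUV) HF)
        (ring 3 λ x y z → [] ⊢ (x :+ z) :- (y :+ z) := x :- y)

      E-self : E M (λ a → hh (fibre a ⊟ fibre a)) ≤ᵣ # 5 *ᵣ u -ᵣ # 2 *ᵣ uv -ᵣ # 3 *ᵣ s4 +ᵣ # 16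
      E-self = ≤-trans fibre-self (≤-trans (≤-reflexive (cong₂ (λ x y → x +ᵣ y +ᵣ # 16)
          (cong₂ _+ᵣ_ (cong (# 2 *ᵣ_) (cong₂ _-ᵣ_ (cong₂ _+ᵣ_ (trans (assocH U) (cong (_+ᵣ h0) U-eq)) (trans (assocH V) (cong (_+ᵣ h0) V-eq))) HUV)) HF) (cong (λ z → -ᵣ (# 3 *ᵣ z)) HQ)))
        (lin [] 4 λ u v s h → [] ⊢ con 2 :* ((u :+ h) :+ (u :+ h) :- (v :+ h)) :+ (u :+ h) :- con 3 :* (s :+ h) :+ con 16 :≤ con 5 :* u :- con 2 :* v :- con 3 :* s :+ con 16))

      E-fibre : uv -ᵣ u ≤ᵣ E M (λ a → hh (fibre a)) +ᵣ # 1
      E-fibre = ≤-trans (≤-reflexive (sym whole-eq)) fibre-lower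

      -- The coefficients 0 and 1 both occur in V: two such copies contribute the pair (X', X + X'),
      -- from which X and X' are recovered.
      u-lower : # 2 *ᵣ hh O ≤ᵣ u +ᵣ # 12
      u-lower = lin (1 ∷ 1 ∷ 1 ∷ []) 4 (λ o j b u → o :+ o :≤ j :+ con 3 ∷ j :≤ b ∷ b :≤ u :+ con 9 ∷ [] ⊢ con 2 :* o :≤ u :+ con 12)
        (hh-⊠-lo O O)
        (cH-mono (μ O ⊗ μ O) (T O ⊗ᵣ T O) (Xr (B0 ⊞ B1)) (Xr (O ⊠ O)) (λ {a} {b} → recover {a} {b}))
        (≤-trans (hh-⊞-mono (B0 ⊞ B1) (flat {K = G ×g G} pairF rest)) (≤-reflexive (cong (_+ᵣ # 9) (hh-⇒ (⊞-assoc {A = B0} {B = B1} {C = flat {K = G ×g G} pairF rest})))))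
        where
        B0 B1 : Obj (G ×g G)
        B0 = obj (μ O) (pairF 0) (T O)
        B1 = obj (μ O) (pairF 1) (T O)
        recover : ⟨ Xr (B0 ⊞ B1) , T O ⊗ᵣ T O ⟩ ⟶ Xr (O ⊠ O)
        recover {a} {b} e = cong₂ _,_ (g-cancelʳ G (X O (proj₂ a)) (trans (proj₂ pq) (cong (_∙_ G (X O (proj₁ b))) (sym y)))) y
          where
          pq : (_∙_ G (ε G) (_∙_ G (X O (proj₂ a)) (ε G)) ≡ _∙_ G (ε G) (_∙_ G (X O (proj₂ b)) (ε G))) × (_∙_ G (X O (proj₁ a)) (X O (proj₂ a)) ≡ _∙_ G (X O (proj₁ b)) (X O (proj₂ b)))
          pq = ,-inj (proj₁ (,-inj e))
          y : X O (proj₂ a) ≡ X O (proj₂ b)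
          y = g-cancelʳ G (ε G) (g-cancelˡ G (ε G) (proj₁ pq))
        rest : List ℕ
        rest = List.map (λ j → j) tl ++ rowsOf (λ i j → j) (1 ∷ tl) cs

      s4-upper : s4 ≤ᵣ hh O +ᵣ w₂ *ᵣ c3 +ᵣ # 9
      s4-upper = ≤-trans (≤-reflexive (trans (hh-⇒ {A = npow cs (npow cs O)} {B = arr {K = G} (λ a → times G a ∘ X O) (λ _ _ → 1) cs cs}
            (mk⇒ id Law-id (Σ̃-cong G cs (λ _ → Σ̃-cong G cs (λ _ a → sym (g-idʳ G (X O a))))) id id))
          (hh-⇒ (arr⇒flat {K = G} (λ a → times G a ∘ X O) (λ _ _ → 1) cs cs))))
        (≤-trans (hh-⊞-mono (multiples O ones) O) (≤-trans (+-mono (≤-reflexive (hh-⇒ (⊞-comm {A = multiples O ones} {B = O}))) ≤-refl) (+-mono (multiples-upper O ones) ≤-refl)))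

      diff-upper : hh (O ⊟ whole) ≤ᵣ hh (O ⊞ O) +ᵣ w₁ *ᵣ c3 +ᵣ # 30
      diff-upper = lin (1 ∷ 1 ∷ 1 ∷ 1 ∷ 1 ∷ []) 8 (λ x y n oo a o2 o r → x :≤ y :+ con 3 ∷ y :+ n :≤ oo :+ a :+ con 27 ∷ oo :≤ o2 ∷ a :≤ o :+ r ∷ o :≤ n ∷ [] ⊢ x :≤ o2 :+ r :+ con 30)
        (cond-more (μ O ⊗ M) (Xr (O ⊟ whole)) (T O ⊗ᵣ 𝒯) (T O ⊗ᵣ F) (λ e → let (t , f) = ,-inj e in cong₂ _,_ t (proj₂ (,-inj (proj₂ (,-inj f))))))
        (triangle O (neg O) (neg W))
        (≤-reflexive (sym (hh-⇒ (⇒-⊞ {A = O} {B = O} ⇒-id (neg-neg {A = O})))))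
        (≤-trans (≤-reflexive (trans (hh-neg-⊞ O W) (hh-⇒ (⇒-⊞ {A = O} {B = W} {C = O} {D = multiples O LU} ⇒-id (arr⇒flat {K = G} (λ a → times G a ∘ X O) (λ i j → i) cs cs))))) (multiples-upper O LU))
        (≤-reflexive (sym (hh-neg O)))
        where
        W : Obj G
        W = obj M (arrF (λ i j → i)) 𝒯

      x y : R
      x = # 3 *ᵣ (n *ᵣ (d +ᵣ # 23)) +ᵣ # 44
      y = b *ᵣ D

      n≥0 : # 0 ≤ᵣ n
      n≥0 = ≤-trans (#-≥0 1) n≥1
      d≥0 : # 0 ≤ᵣ d
      d≥0 = ≤-trans (#-≥0 13) d≥13

      x-pos : # 0 <ᵣ x
      x-pos = <-≤-trans (ι-pos 43) (lin (3 ∷ []) 1 (λ z → con 0 :≤ z ∷ [] ⊢ con 44 :≤ con 3 :* z :+ con 44) (*-≥0 n≥0 (≤-trans d≥0 (lin [] 1 λ d → [] ⊢ d :≤ d :+ con 23))))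

      y-pos : # 0 <ᵣ y
      y-pos = *-pos (<-≤-trans (ι-pos 131) (lin (198 ∷ 99 ∷ 24 ∷ []) 3 (λ u v n → con 0 :≤ u ∷ con 0 :≤ v ∷ con 0 :≤ n ∷ [] ⊢ con 132 :≤ con 99 :* (con 2 :* u :+ v) :+ con 24 :* n :+ con 132) (#-≥0 (weight LU)) (#-≥0 (weight ones)) n≥0)) (<-≤-trans (ι-pos 0) D≥1)

      -- φ₀ measures the doubling of a fibre by differences, ψ₀ is twice its distance from O. The
      -- constants 9 and 18 make them nonnegative in spite of rounding, as `markov₂` requires.
      φ₀ ψ₀ : Pow cs (Pow cs (Ω O)) → R
      φ₀ a = (hh (fibre a ⊟ fibre a) +ᵣ # 9) -ᵣ hh (fibre a)
      ψ₀ a = # 2 *ᵣ hh (O ⊟ fibre a) +ᵣ (# 18 -ᵣ hh O) -ᵣ hh (fibre a)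

      E-φ₀ : E M φ₀ ≤ᵣ x
      E-φ₀ = ≤-trans (≤-reflexive (trans (E-sub M _ _) (cong (_-ᵣ E M (λ a → hh (fibre a))) (E-+c M (# 9) _))))
        -- Up to constants the combination of `E-self` and `E-fibre` is 3 (2 u - uv - s4), three
        -- times the information that `info` bounds by the excess.
        (lin (1 ∷ 1 ∷ 3 ∷ 3 ∷ []) 7 (λ e f u uv s ex k → e :≤ con 5 :* u :- con 2 :* uv :- con 3 :* s :+ con 16 ∷ uv :- u :≤ f :+ con 1 ∷ con 2 :* u :≤ uv :+ s :+ ex :+ con 6 ∷ ex :≤ k ∷ []
          ⊢ (e :+ con 9) :- f :≤ con 3 :* k :+ con 44) E-self E-fibre info small)

      E-ψ₀ : E M ψ₀ ≤ᵣ y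
      E-ψ₀ = ≤-trans (≤-reflexive (trans (E-sub M _ _) (cong (_-ᵣ E M (λ a → hh (fibre a))) (trans (E-+c M (# 18 -ᵣ hh O) _) (cong (_+ᵣ (# 18 -ᵣ hh O)) (E-* M (# 2) _))))))
        (lin (2 ∷ 2 ∷ 1 ∷ 1 ∷ 1 ∷ 1 ∷ 1 ∷ 2 ∷ 1 ∷ 1 ∷ 2 ∷ 112 ∷ []) 15 (λ e w f u uv s ex k o o2 w1 w2 c D n →
            e :≤ w :+ con 3 ∷ w :≤ o2 :+ w1 :* c :+ con 30 ∷ uv :- u :≤ f :+ con 1 ∷ con 2 :* u :≤ uv :+ s :+ ex :+ con 6 ∷ ex :≤ k ∷ con 2 :* o :≤ u :+ con 12 ∷ s :≤ o :+ w2 :* c :+ con 9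
            ∷ w1 :* c :≤ w1 :* (con 99 :* D) ∷ w2 :* c :≤ w2 :* (con 99 :* D) ∷ k :≤ n :* (con 24 :* D) ∷ o2 :- o :≤ con 10 :* D ∷ con 1 :≤ D ∷ []
            ⊢ con 2 :* e :+ (con 18 :- o) :- f :≤ (con 99 :* (con 2 :* w1 :+ w2) :+ con 24 :* n :+ con 132) :* D)
          (fibre-diff O) diff-upper E-fibre info small u-lower s4-upper (*-monoˡ w₁ (#-≥0 (weight LU)) c3≤) (*-monoˡ w₂ (#-≥0 (weight ones)) c3≤)
          (*-monoˡ n n≥0 (lin (1 ∷ 23 ∷ []) 2 (λ d D → d :≤ D ∷ con 1 :≤ D ∷ [] ⊢ d :+ con 23 :≤ con 24 :* D) d≤D D≥1)) K2≤ D≥1)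

      pick : ∃[ a ] (Supp M a × φ₀ a ≤ᵣ # 4 *ᵣ x × ψ₀ a ≤ᵣ # 4 *ᵣ y)
      pick = markov₂ M φ₀ ψ₀ x y x-pos y-pos
        (λ {a} _ → lin (1 ∷ []) 2 (λ z f → f :≤ z :+ con 9 ∷ [] ⊢ con 0 :≤ (z :+ con 9) :- f) (hh-⊞-mono (fibre a) (neg (fibre a))))
        (λ {a} _ → lin (1 ∷ 1 ∷ []) 3 (λ z f o → f :≤ z :+ con 9 ∷ o :≤ z :+ con 9 ∷ [] ⊢ con 0 :≤ con 2 :* z :+ (con 18 :- o) :- f)
          (≤-trans (≤-reflexive (sym (hh-neg (fibre a)))) (≤-trans (hh-⊞-mono (neg (fibre a)) O) (≤-reflexive (cong (_+ᵣ # 9) (hh-⇒ (⊞-comm {A = neg (fibre a)} {B = O}))))))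
          (hh-⊞-mono O (neg (fibre a))))
        E-φ₀ E-ψ₀

      conclude : Σ (Obj G) (Better O)
      conclude = let (a , _ , p , q) = pick in fibre a , improve (fibre a) (gain (fibre a) p)
         (Close-mono O (fibre a) (lin (1 ∷ 160 ∷ []) 5 (λ z f o b D → con 2 :* z :+ (con 18 :- o) :- f :≤ con 4 :* (b :* D) ∷ con 1 :≤ D ∷ [] ⊢ z :+ z :- o :- f :+ con 54 :≤ (con 4 :* b :+ con 160) :* D) q D≥1)
           (close-via-diff O (fibre a)))
        where
        gain : ∀ Y → (hh (Y ⊟ Y) +ᵣ # 9) -ᵣ hh Y ≤ᵣ # 4 *ᵣ x → Dbl Y +ᵣ d ≤ᵣ D
        -- The bounds add up to at most 25 n² d + 928 n², and since d ≥ 13 the remaining 75 n² d is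
        -- at least 975 n². Hence the factor 100 in `N` and the threshold 1300 n².
        gain Y p = ≤-trans (lin (1 ∷ 1 ∷ 1 ∷ 1 ∷ 373 ∷ 1 ∷ 50 ∷ 75 ∷ []) 7 (λ s f k n' n d z →
              s :≤ f :+ n' :* (k :+ con 15) :+ con 3 ∷ n' :* (k :+ con 15) :≤ n' :* z ∷ n' :* z :≤ n :* z ∷ n :* z :≤ n :* (con 24 :* (n :* (d :+ con 23)) :+ con 373) ∷ n :≤ n :* n ∷ d :≤ (n :* n) :* d ∷ con 1 :≤ n :* n ∷ (n :* n) :* con 13 :≤ (n :* n) :* d ∷ []
              ⊢ s :- f :+ d :≤ (con 100 :* (n :* n)) :* d)
            (npow-upper Y 0 (1 ∷ tl)) (*-monoˡ n' (≤-trans (#-≥0 1) n'≥1) k≤) (*-monoʳ (# 8 *ᵣ x +ᵣ # 21) z≥0 n'≤n)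
            (*-monoˡ n n≥0 (lin [] 1 λ k → [] ⊢ con 8 :* (con 3 :* k :+ con 44) :+ con 21 :≤ con 24 :* k :+ con 373))
            (≤-trans (lin [] 1 λ n → [] ⊢ n :≤ n :* con 1) (*-monoˡ n n≥0 n≥1)) (≤-trans (≤-reflexive (sym (*-1ˡ d))) (*-monoʳ d d≥0 n²≥1)) n²≥1 (*-monoˡ (n *ᵣ n) (≤-trans (#-≥0 1) n²≥1) d≥13)) (≤-reflexive (sym D≡))
          where
          n'≤n : n' ≤ᵣ n
          n'≤n = lin (1 ∷ []) 2 (λ n n' → n' :+ con 1 :≤ n ∷ [] ⊢ n' :≤ n) (≤-reflexive (trans (+-comm n' (# 1)) (sym n≡)))
          z≥0 : # 0 ≤ᵣ # 8 *ᵣ x +ᵣ # 21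
          z≥0 = lin (8 ∷ []) 1 (λ x → con 0 :≤ x ∷ [] ⊢ con 0 :≤ con 8 :* x :+ con 21) (<⇒≤ x-pos)
          k≤ : hh (Y ⊞ Y) -ᵣ hh Y +ᵣ # 15 ≤ᵣ # 8 *ᵣ x +ᵣ # 21
          k≤ = lin (1 ∷ 2 ∷ []) 4 (λ y2 yy y x → y2 :+ y :≤ yy :+ yy :+ con 24 ∷ (yy :+ con 9) :- y :≤ con 4 :* x ∷ [] ⊢ y2 :- y :+ con 15 :≤ con 8 :* x :+ con 21) (diff-sum Y) p

    decrement : Σ (Obj G) (Better O)
    decrement with scan 0 (1 ∷ tl) | Dbl (npow cs O) +ᵣ d ≤? D
    ... | inj₁ r | _ = r
    ... | inj₂ _ | yes p = npow cs O , improve (npow cs O) p (Close-mono O (npow cs O)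
      (lin (4 ∷ 159 ∷ []) 2 (λ c D → con 0 :≤ c :* D ∷ con 1 :≤ D ∷ [] ⊢ D :+ con 18 :≤ (con 4 :* c :+ con 160) :* D) (*-≥0 b≥0 (≤-trans (#-≥0 1) D≥1)) D≥1) (close-npow 0 (1 ∷ tl) O))
    -- Rejecting the n-fold sum as a candidate bounds the entropy of the total from below; with
    -- `nY-upper` and `scan` all multiples of D cancel and n (d + 23) is left.
    ... | inj₂ q | no p = Endgame.conclude (lin (1 ∷ 1 ∷ 1 ∷ []) 7 (λ n' o s r nY nYσ d →
          nY :≤ (con 1 :+ n') :* (s :+ con 3) ∷ ((con 1 :+ n') :* o :+ n' :* ((s :- o) :- d) :≤ nYσ :+ s :+ (con 1 :+ n') :* con 20) ∷ (s :- o :≤ r :- s :+ d) ∷ []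
          ⊢ nY :- nYσ :- r :≤ (con 1 :+ n') :* (d :+ con 23))
        (subst (λ z → hh (npow cs (Y cs)) ≤ᵣ z *ᵣ (hh (npow cs O) +ᵣ # 3)) n≡ (nY-upper cs cs))
        (subst (λ z → z *ᵣ hh O +ᵣ n' *ᵣ (D -ᵣ d) ≤ᵣ hh (npow cs (Yσ cs)) +ᵣ hh (npow cs O) +ᵣ z *ᵣ # 20) n≡ q) (<⇒≤ (≰⇒> p)) `then` λ z → ≤-trans z (≤-reflexive (cong (_*ᵣ (d +ᵣ # 23)) (sym n≡))))
      where
      infixl 1 _`then`_
      _`then`_ : ∀ {A B : Set} → A → (A → B) → B
      a `then` f = f a

-- Finite sets in abelian groups

card# : ∀ {A : Set} → List A → R
card# xs = # List.length xs

card#-∑ : ∀ {A : Set} (xs : List A) → ∑ xs (λ _ → # 1) ≡ card# xs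
card#-∑ [] = refl
card#-∑ (x ∷ xs) = trans (cong (# 1 +ᵣ_) (card#-∑ xs)) (sym (#-+ 1 (List.length xs)))

∑-const : ∀ {A : Set} (xs : List A) c → ∑ xs (λ _ → c) ≡ card# xs *ᵣ c
∑-const xs c = trans (∑-cong xs (λ _ → ring 1 λ c → [] ⊢ c := c :* con 1)) (trans (∑-* xs c (λ _ → # 1)) (trans (cong (c *ᵣ_) (card#-∑ xs)) (*-comm c _)))

∑-cart : ∀ {A B C : Set} (f : A → B → C) xs ys φ → ∑ (List.cartesianProductWith f xs ys) φ ≡ ∑ xs (λ x → ∑ ys (λ y → φ (f x y)))
∑-cart f [] ys φ = refl
∑-cart f (x ∷ xs) ys φ = trans (∑-++ (List.map (f x) ys) _ φ) (cong₂ _+ᵣ_ (∑-map (f x) ys φ) (∑-cart f xs ys φ))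

card#-cart : ∀ {A B C : Set} (f : A → B → C) xs ys → card# (List.cartesianProductWith f xs ys) ≡ card# xs *ᵣ card# ys
card#-cart f xs ys = trans (sym (card#-∑ (List.cartesianProductWith f xs ys))) (trans (∑-cart f xs ys _) (trans (∑-cong xs (λ _ → card#-∑ ys)) (∑-const xs (card# ys))))

unique-ind : ∀ {A : Set} {P : A → Set} (p : ∀ a → Dec (P a)) {xs} → Unique xs → (∀ {a b} → a ∈ xs → b ∈ xs → P a → P b → a ≡ b) → ∑ xs (λ a → ind (p a)) ≤ᵣ # 1
unique-ind p {[]} [] i = #-≥0 1
unique-ind p {x ∷ xs} (x∉ ∷ u) i with p x
... | no _ = ≤-trans (≤-reflexive (+-0ˡ _)) (unique-ind p u (λ m m' → i (there m) (there m')))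
... | yes px = ≤-trans (+-mono ≤-refl (≤-trans (∑-mono xs (λ {a} m → ≤-reflexive (ind-no (p a) (λ pa → All.lookup x∉ m (i (here refl) (there m) px pa))))) (≤-reflexive (∑-0 xs))))
    (lin [] 0 ([] ⊢ con 1 :+ con 0 :≤ con 1))

ind-∈ : ∀ {A : Set} {P : A → Set} (p : ∀ a → Dec (P a)) {xs a} → a ∈ xs → P a → # 1 ≤ᵣ ∑ xs (λ a → ind (p a))
ind-∈ p {xs} {a} m pa = ≤-trans (≤-reflexive (sym (ind-yes (p a) pa))) (∑-term {xs = xs} {φ = λ a → ind (p a)} (λ {b} _ → ind-≥0 (p b)) m)

-- Injections are counted by summing the indicator of f x = y over all pairs (x , y).
inject-count : ∀ {A B : Set} (_≟_ : DecidableEquality B) {P : A → Set} (p : ∀ a → Dec (P a)) (f : A → B) {xs ys} → Unique xs →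
  (∀ {a} → a ∈ xs → P a → f a ∈ ys) → (∀ {a b} → a ∈ xs → b ∈ xs → P a → P b → f a ≡ f b → a ≡ b) → ∑ xs (λ a → ind (p a)) ≤ᵣ card# ys
inject-count _≟_ {P} p f {xs} {ys} u into inj = ≤-trans (∑-mono xs {ψ = λ a → ∑ ys (λ y → ind (p a ×-dec (f a ≟ y)))} each)
    (≤-trans (≤-reflexive (∑-swap xs ys _)) (≤-trans (∑-mono ys (λ {y} _ → unique-ind (λ a → p a ×-dec (f a ≟ y)) u (λ m m' (pa , e) (pb , e') → inj m m' pa pb (trans e (sym e')))))
      (≤-reflexive (card#-∑ ys))))
  where
  each : ∀ {a} → a ∈ xs → ind (p a) ≤ᵣ ∑ ys (λ y → ind (p a ×-dec (f a ≟ y)))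
  each {a} m = ≤-trans (≤-reflexive (ring 1 λ x → [] ⊢ x := x :* con 1)) (ind-≤ (p a) (∑-≥0 ys (λ {y} _ → ind-≥0 (p a ×-dec (f a ≟ y)))) λ pa → ind-∈ (λ y → p a ×-dec (f a ≟ y)) (into m pa) (pa , refl))

pigeonhole : ∀ {A B : Set} (_≟_ : DecidableEquality B) (f : A → B) {xs ys} → Unique xs → (∀ {a} → a ∈ xs → f a ∈ ys) →
  (∀ {a b} → a ∈ xs → b ∈ xs → f a ≡ f b → a ≡ b) → card# xs ≤ᵣ card# ys
pigeonhole _≟_ f {xs} u into inj = ≤-trans (≤-reflexive (sym (card#-∑ xs))) (inject-count _≟_ {P = λ _ → ⊤} (λ _ → yes tt) f u (λ m _ → into m) (λ m m' _ _ → inj m m'))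

#-reflect : ∀ {m n} → # m ≤ᵣ # n → m ℕ.≤ n
#-reflect {m} {n} p = ℕP.≮⇒≥ λ lt → <⇒≱ (ι-pos 0) (lin (1 ∷ 1 ∷ []) 2 (λ m n → con 1 :+ n :≤ m ∷ m :≤ n ∷ [] ⊢ con 1 :≤ con 0) (≤-trans (≤-reflexive (sym (#-+ 1 n))) (#-mono lt)) p)

∑-exists : ∀ {A : Set} (xs : List A) φ c {a} → a ∈ xs → ∑ xs (λ _ → c) ≤ᵣ ∑ xs φ → ∃[ b ] (b ∈ xs × c ≤ᵣ φ b)
∑-exists (x ∷ []) φ c _ p = x , here refl , lin (1 ∷ []) 2 (λ c f → c :+ con 0 :≤ f :+ con 0 ∷ [] ⊢ c :≤ f) p
∑-exists {A} (x ∷ ys@(y ∷ xs)) φ c _ p = pick (c ≤? φ x) λ q → ∑-exists ys φ c (here refl)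
    (lin (1 ∷ 1 ∷ []) 4 (λ c s f t → c :+ s :≤ f :+ t ∷ f :≤ c ∷ [] ⊢ s :≤ t) p (<⇒≤ (≰⇒> q)))
  where
  pick : Dec (c ≤ᵣ φ x) → (¬ (c ≤ᵣ φ x) → ∃[ b ] (b ∈ ys × c ≤ᵣ φ b)) → ∃[ b ] (b ∈ x ∷ ys × c ≤ᵣ φ b)
  pick (yes q) _ = x , here refl , q
  pick (no q) k = let (b , m , r) = k q in b , there m , r

module Sets (G : Grp) where
  open DecMem (_≟g_ G) using (_∈?_) public
  private
    _+g_ : Car G → Car G → Car G
    _+g_ = _∙_ G
    -g_ : Car G → Car G
    -g_ = _⁻ G

  opaque
    dd : List (Car G) → List (Car G)
    dd = List.deduplicate (_≟g_ G)
    dd-def : ∀ xs → dd xs ≡ List.deduplicate (_≟g_ G) xs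
    dd-def xs = refl
    dd-! : ∀ xs → Unique (dd xs)
    dd-! = UniqueDP.deduplicate-! (_≟g_ G)
    dd⁺ : ∀ {xs z} → z ∈ xs → z ∈ dd xs
    dd⁺ = ∈P.∈-deduplicate⁺ (_≟g_ G)
    dd⁻ : ∀ xs {z} → z ∈ dd xs → z ∈ xs
    dd⁻ = ∈P.∈-deduplicate⁻ (_≟g_ G)

  dd-len : ∀ xs → card# (dd xs) ≤ᵣ card# xs
  dd-len xs = pigeonhole (_≟g_ G) id (dd-! xs) (dd⁻ xs) (λ _ _ e → e)

  infixl 6 _⊕_ _⊝_
  opaque
    _⊕_ _⊝_ : List (Car G) → List (Car G) → List (Car G)
    xs ⊕ ys = dd (List.cartesianProductWith _+g_ xs ys)
    xs ⊝ ys = dd (List.cartesianProductWith (λ a b → a +g (-g b)) xs ys)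
    ⊝-def : ∀ xs ys → xs ⊝ ys ≡ dd (List.cartesianProductWith (λ a b → a +g (-g b)) xs ys)
    ⊝-def xs ys = refl
    ⊕-! : ∀ xs ys → Unique (xs ⊕ ys)
    ⊕-! xs ys = dd-! _
    ⊝-! : ∀ xs ys → Unique (xs ⊝ ys)
    ⊝-! xs ys = dd-! _

    ⊕⁺ : ∀ {xs ys a b} → a ∈ xs → b ∈ ys → a +g b ∈ xs ⊕ ys
    ⊕⁺ m m' = dd⁺ (∈P.∈-cartesianProductWith⁺ _+g_ m m')
    ⊕⁻ : ∀ xs ys {z} → z ∈ xs ⊕ ys → ∃[ a ] ∃[ b ] (a ∈ xs × b ∈ ys × z ≡ a +g b)
    ⊕⁻ xs ys m = ∈P.∈-cartesianProductWith⁻ _+g_ xs ys (dd⁻ (List.cartesianProductWith _+g_ xs ys) m)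
    ⊝⁺ : ∀ {xs ys a b} → a ∈ xs → b ∈ ys → a +g (-g b) ∈ xs ⊝ ys
    ⊝⁺ m m' = dd⁺ (∈P.∈-cartesianProductWith⁺ (λ a b → a +g (-g b)) m m')
    ⊝⁻ : ∀ xs ys {z} → z ∈ xs ⊝ ys → ∃[ a ] ∃[ b ] (a ∈ xs × b ∈ ys × z ≡ a +g (-g b))
    ⊝⁻ xs ys m = ∈P.∈-cartesianProductWith⁻ (λ a b → a +g (-g b)) xs ys (dd⁻ (List.cartesianProductWith (λ a b → a +g (-g b)) xs ys) m)

  cancel₁ : ∀ x y z → (x +g (-g y)) +g (y +g z) ≡ x +g z
  cancel₁ x y z = trans (g-assoc G x _ _) (cong (x +g_) (trans (sym (g-assoc G _ y z)) (trans (cong (_+g z) (trans (g-comm G _ y) (g-invʳ G y))) (g-idˡ G z))))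

  sub-add : ∀ x y → (x +g (-g y)) +g y ≡ x
  sub-add x y = trans (g-assoc G x _ y) (trans (cong (x +g_) (trans (g-comm G _ y) (g-invʳ G y))) (g-idʳ G x))

  add-sub : ∀ x y → (x +g y) +g (-g y) ≡ x
  add-sub x y = trans (g-assoc G x y _) (trans (cong (x +g_) (g-invʳ G y)) (g-idʳ G x))

  -- Ruzsa's covering lemma: T is a maximal subset of B with the translates t + S disjoint.
  record Cover (B S : List (Car G)) : Set where
    field
      T : List (Car G)
      T⊆ : ∀ {t} → t ∈ T → t ∈ B
      covers : ∀ {b} → b ∈ B → ∃[ t ] ∃[ s ] ∃[ s' ] (t ∈ T × s ∈ S × s' ∈ S × b +g s ≡ t +g s')
      size : Unique S → card# T *ᵣ card# S ≤ᵣ card# (B ⊕ S)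

  cover : ∀ B S → (∃[ s ] (s ∈ S)) → Cover B S
  cover B S (s₀ , s₀∈) = record
    { T = proj₁ (greedy B) ; T⊆ = λ m → proj₁ (proj₂ (greedy B)) m
    ; covers = λ m → proj₁ (proj₂ (proj₂ (proj₂ (greedy B)))) m
    ; size = λ uS → let (T , T⊆ , dis , _ , uT) = greedy B in ≤-trans (≤-reflexive (sym (card#-cart _,_ T S)))
        (pigeonhole (_≟g_ G) (λ p → proj₁ p +g proj₂ p) (UniqueP.cartesianProduct⁺ uT uS)
          (λ {p} m → let (mt , ms) = ∈P.∈-cartesianProduct⁻ T S m in ⊕⁺ {B} {S} (T⊆ mt) ms)
          (λ {p} {q} m m' e → let (mt , ms) = ∈P.∈-cartesianProduct⁻ T S m ; (mt' , ms') = ∈P.∈-cartesianProduct⁻ T S m' in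
             cong₂ _,_ (dis mt mt' ms ms' e) (g-cancelˡ G (proj₁ p) (trans e (cong (_+g proj₂ q) (sym (dis mt mt' ms ms' e))))))) }
    where
    Meets : Car G → Car G → Set
    Meets b t = ∃[ s ] ∃[ s' ] (s ∈ S × s' ∈ S × b +g s ≡ t +g s')
    meets? : ∀ b t → Dec (Meets b t)
    meets? b t with Any.any? (λ s → Any.any? (λ s' → _≟g_ G (b +g s) (t +g s')) S) S
    ... | yes a = let (s , m , a') = find a ; (s' , m' , e) = find a' in yes (s , s' , m , m' , e)
    ... | no na = no λ { (s , s' , m , m' , e) → na (Any.map (λ { refl → Any.map (λ { refl → e }) m' }) m) }
    greedy : ∀ B → Σ (List (Car G)) λ T → (∀ {t} → t ∈ T → t ∈ B) × (∀ {t t' s s'} → t ∈ T → t' ∈ T → s ∈ S → s' ∈ S → t +g s ≡ t' +g s' → t ≡ t') ×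
      (∀ {b} → b ∈ B → ∃[ t ] ∃[ s ] ∃[ s' ] (t ∈ T × s ∈ S × s' ∈ S × b +g s ≡ t +g s')) × Unique T
    greedy [] = [] , (λ ()) , (λ ()) , (λ ()) , []
    greedy (b ∷ B) with greedy B
    ... | T , sub , dis , cov , u with Any.any? (meets? b) T
    ... | yes a = let (t , mt , s , s' , ms , ms' , e) = find a in T , (there ∘ sub) , dis , (λ { (here refl) → t , s , s' , mt , ms , ms' , e ; (there m) → cov m }) , u
    ... | no na = b ∷ T , (λ { (here e) → here e ; (there m) → there (sub m) }) , dis' ,
        (λ { (here refl) → b , s₀ , s₀ , here refl , s₀∈ , s₀∈ , refl ; (there m) → let (t , s , s' , mt , r) = cov m in t , s , s' , there mt , r }) ,
        (All.tabulate (λ {t} m e → na (Any.map (λ { refl → s₀ , s₀ , s₀∈ , s₀∈ , cong (_+g s₀) e }) m)) ∷ u)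
      where
      dis' : ∀ {t t' s s'} → t ∈ b ∷ T → t' ∈ b ∷ T → s ∈ S → s' ∈ S → t +g s ≡ t' +g s' → t ≡ t'
      dis' (here refl) (here refl) _ _ _ = refl
      dis' {s = s} {s'} (here refl) (there m) ms ms' e = ⊥-elim (na (Any.map (λ { refl → s , s' , ms , ms' , e }) m))
      dis' {s = s} {s'} (there m) (here refl) ms ms' e = ⊥-elim (na (Any.map (λ { refl → s' , s , ms' , ms , sym e }) m))
      dis' (there m) (there m') ms ms' e = dis m m' ms ms' e

  record Subgroup : Set where
    field
      els : List (Car G)
      uniq : Unique els
      has-ε : ε G ∈ els
      closed : ∀ {a b} → a ∈ els → b ∈ els → a +g b ∈ els
      closed⁻ : ∀ {a} → a ∈ els → -g a ∈ els
  open Subgroup public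

  -- With m + 1 the torsion exponent, these are the elements of the subgroup generated by the list,
  -- possibly with repetitions.
  combos : ℕ → List (Car G) → List (Car G)
  combos m [] = ε G ∷ []
  combos m (t ∷ T) = List.cartesianProductWith (λ k x → times G k t +g x) (List.upTo (suc m)) (combos m T)

  module _ (m : ℕ) (torsion : ∀ x → times G (suc m) x ≡ ε G) where
    times-mod : ∀ k x → times G k x ≡ times G (k DM.% suc m) x
    times-mod k x = trans (cong (λ j → times G j x) (DM.m≡m%n+[m/n]*n k (suc m))) (trans (times-+ G (k DM.% suc m) (k DM./ suc m ℕ.* suc m) x)
      (trans (cong (times G (k DM.% suc m) x +g_) (mult (k DM./ suc m))) (g-idʳ G _)))
      where
      mult : ∀ q → times G (q ℕ.* suc m) x ≡ ε G
      mult zero = refl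
      mult (suc q) = trans (times-+ G (suc m) (q ℕ.* suc m) x) (trans (cong₂ _+g_ (torsion x) (mult q)) (g-idˡ G _))

    combos-closed : ∀ T {a b} → a ∈ combos m T → b ∈ combos m T → a +g b ∈ combos m T
    combos-closed [] (here refl) (here refl) = here (g-idˡ G _)
    combos-closed (t ∷ T) {a} {b} ma mb with ∈P.∈-cartesianProductWith⁻ (λ k x → times G k t +g x) (List.upTo (suc m)) (combos m T) ma
                                           | ∈P.∈-cartesianProductWith⁻ (λ k x → times G k t +g x) (List.upTo (suc m)) (combos m T) mb
    ... | k , x , _ , mx , refl | l , y , _ , my , refl = subst (_∈ combos m (t ∷ T)) eq
        (∈P.∈-cartesianProductWith⁺ (λ k x → times G k t +g x) (∈P.∈-upTo⁺ (DM.m%n<n (k ℕ.+ l) (suc m))) (combos-closed T mx my))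
      where
      eq : times G ((k ℕ.+ l) DM.% suc m) t +g (x +g y) ≡ (times G k t +g x) +g (times G l t +g y)
      eq = trans (cong (_+g (x +g y)) (trans (sym (times-mod (k ℕ.+ l) t)) (times-+ G k l t))) (g-mid G _ _ _ _)

    combos-ε : ∀ T → ε G ∈ combos m T
    combos-ε [] = here refl
    combos-ε (t ∷ T) = subst (_∈ combos m (t ∷ T)) (g-idˡ G _) (∈P.∈-cartesianProductWith⁺ (λ k x → times G k t +g x) {xs = List.upTo (suc m)} {ys = combos m T} {a = 0} (here refl) (combos-ε T))

    combos-gen : (1 ℕ.≤ m) → ∀ T {t} → t ∈ T → t ∈ combos m T
    combos-gen 1≤m (t ∷ T) (here refl) = subst (_∈ combos m (t ∷ T)) (trans (g-idʳ G _) (g-idʳ G t))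
      (∈P.∈-cartesianProductWith⁺ (λ k x → times G k t +g x) (∈P.∈-upTo⁺ (s≤s 1≤m)) (combos-ε T))
    combos-gen 1≤m (t' ∷ T) (there mt) = subst (_∈ combos m (t' ∷ T)) (g-idˡ G _) (∈P.∈-cartesianProductWith⁺ (λ k x → times G k t' +g x) {xs = List.upTo (suc m)} {ys = combos m T} {a = 0} (here refl) (combos-gen 1≤m T mt))

    -- By torsion the inverse of a is m a, so closure under addition is enough.
    inverse-in : ∀ {L : List (Car G)} → ε G ∈ L → (∀ {a b} → a ∈ L → b ∈ L → a +g b ∈ L) → ∀ {a} → a ∈ L → -g a ∈ L
    inverse-in {L} e c {a} ma = subst (_∈ L) (g-inv-uniq G (torsion a)) (go m)
      where
      go : ∀ k → times G k a ∈ L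
      go zero = e
      go (suc k) = c ma (go k)

    mkSubgroup : (L : List (Car G)) → ε G ∈ L → (∀ {a b} → a ∈ L → b ∈ L → a +g b ∈ L) → Subgroup
    mkSubgroup L e c = record { els = dd L ; uniq = dd-! L ; has-ε = dd⁺ e ; closed = λ ma mb → dd⁺ (c (dd⁻ L ma) (dd⁻ L mb)) ; closed⁻ = λ ma → dd⁺ (inverse-in e c (dd⁻ L ma)) }

    combos-len : ∀ T → card# (combos m T) ≡ # (suc m ℕ.^ List.length T)
    combos-len [] = refl
    combos-len (t ∷ T) = trans (card#-cart (λ k x → times G k t +g x) (List.upTo (suc m)) (combos m T)) (trans (cong₂ _*ᵣ_ (cong #_ (ListP.length-applyUpTo id (suc m))) (combos-len T))
      (trans (sym (ι-* (+ suc m) (+ (suc m ℕ.^ List.length T)))) (cong ι (sym (ℤP.pos-* (suc m) (suc m ℕ.^ List.length T))))))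

  -- Freiman's theorem for groups of bounded torsion, through the popular differences S of A.
  module Freiman (m : ℕ) (torsion : ∀ x → times G (suc m) x ≡ ε G) (1≤m : 1 ℕ.≤ m)
      (A : List (Car G)) (uA : Unique A) {a₀ : Car G} (a₀∈ : a₀ ∈ A) (κ : R) (κ≥1 : # 1 ≤ᵣ κ) (small : card# (A ⊝ A) ≤ᵣ κ *ᵣ card# A) where
    private
      -- On average an element of A - A is represented at least α / κ times. The cutoff ρ is half of
      -- this, so the unpopular differences account for at most half of all pairs.
      α ρ : R
      α = card# A
      ρ = α *ᵣ inv (# 2 *ᵣ κ)
      κ>0 : # 0 <ᵣ κ
      κ>0 = <-≤-trans (ι-pos 0) κ≥1
      κ≥0 : # 0 ≤ᵣ κ
      κ≥0 = <⇒≤ κ>0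
      α≥1 : # 1 ≤ᵣ α
      α≥1 = ≤-trans (ind-∈ (λ a → _≟g_ G a a₀) a₀∈ refl) (≤-trans (∑-mono A (λ {a} _ → ind-≤1 (_≟g_ G a a₀))) (≤-reflexive (card#-∑ A)))
      α≥0 : # 0 ≤ᵣ α
      α≥0 = ≤-trans (#-≥0 1) α≥1
      ρ-eq : # 2 *ᵣ κ *ᵣ ρ ≡ α
      ρ-eq = trans (ring 3 λ k a i → [] ⊢ k :* (a :* i) := a :* (k :* i)) (*-cancel-1 (inv-r (*-pos (ι-pos 1) κ>0)))
      ρ≥0 : # 0 ≤ᵣ ρ
      ρ≥0 = *-≥0 α≥0 (inv-≥0 _)
      ρ≤α : ρ ≤ᵣ α
      ρ≤α = ≤-trans (lin (1 ∷ 1 ∷ []) 2 (λ r kr → r :≤ kr ∷ con 0 :≤ kr ∷ [] ⊢ r :≤ con 2 :* kr) (≤-trans (≤-reflexive (sym (*-1ˡ ρ))) (*-monoʳ ρ ρ≥0 κ≥1)) (*-≥0 κ≥0 ρ≥0)) (≤-reflexive (trans (sym (*-assoc _ _ _)) ρ-eq))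

      Δ : List (Car G)
      Δ = A ⊝ A

      rep : Car G → R
      rep s = ∑ A (λ b → ∑ A (λ a → ind (_≟g_ G (b +g s) a)))

      rep-neg : ∀ s → rep (-g s) ≡ rep s
      rep-neg s = trans (∑-swap A A _) (∑-cong A λ {a} _ → ∑-cong A λ {b} _ → ind-cong (_≟g_ G _ _) (_≟g_ G _ _)
        (λ e → trans (cong (_+g s) (sym e)) (sub-add b s)) (λ e → trans (cong (_+g (-g s)) (sym e)) (add-sub a s)))

      rep-ε : rep (ε G) ≡ α
      rep-ε = trans (∑-cong A λ {b} m → ≤-antisym (unique-ind (λ a → _≟g_ G (b +g ε G) a) uA (λ _ _ e e' → trans (sym e) e')) (ind-∈ (λ a → _≟g_ G (b +g ε G) a) m (g-idʳ G b))) (card#-∑ A)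

      rep-≤ : ∀ s → rep s ≤ᵣ α
      rep-≤ s = ≤-trans (∑-mono A λ {b} _ → unique-ind (λ a → _≟g_ G (b +g s) a) uA (λ _ _ e e' → trans (sym e) e')) (≤-reflexive (card#-∑ A))

      popular? : ∀ s → Dec (ρ ≤ᵣ rep s)
      popular? s = ρ ≤? rep s

      S : List (Car G)
      S = List.filter popular? Δ

      uS : Unique S
      uS = UniqueP.filter⁺ popular? (⊝-! A A)

      S-pop : ∀ {s} → s ∈ S → ρ ≤ᵣ rep s
      S-pop m = proj₂ (∈P.∈-filter⁻ popular? {xs = Δ} m)
      S-Δ : ∀ {s} → s ∈ S → s ∈ Δ
      S-Δ m = proj₁ (∈P.∈-filter⁻ popular? {xs = Δ} m)

      S-neg : ∀ {s} → s ∈ S → -g s ∈ S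
      S-neg {s} m = let (a , b , ma , mb , e) = ⊝⁻ A A (S-Δ m) in ∈P.∈-filter⁺ popular?
        (subst (_∈ Δ) (trans (trans (cong (_+g (-g a)) (sym (g-inv-inv G b))) (trans (g-comm G _ _) (sym (g-inv-∙ G a (-g b))))) (cong -g_ (sym e))) (⊝⁺ {A} {A} mb ma))
        (≤-trans (S-pop m) (≤-reflexive (sym (rep-neg s))))

      S-ε : ε G ∈ S
      S-ε = ∈P.∈-filter⁺ popular? (subst (_∈ Δ) (g-invʳ G a₀) (⊝⁺ {A} {A} a₀∈ a₀∈)) (≤-trans ρ≤α (≤-reflexive (sym rep-ε)))

      -- Each c + s − a' equals (c − b) + (b + s − a') for every b ∈ A with b + s ∈ A.
      expand : ∀ C → card# ((C ⊕ S) ⊝ A) *ᵣ ρ ≤ᵣ card# (C ⊝ A) *ᵣ card# Δ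
      expand C = ≤-trans (≤-reflexive (sym (∑-const L ρ))) (≤-trans (∑-mono L many) (≤-trans (≤-reflexive (sym (∑-cart _,_ L A _)))
          (≤-trans (inject-count (pairDec (_≟g_ G) (_≟g_ G)) (λ p → proj₂ p +g σ (proj₁ p) ∈? A) φ′ {ys = List.cartesianProduct (C ⊝ A) Δ} (UniqueP.cartesianProduct⁺ {xs = L} {ys = A} (⊝-! (C ⊕ S) A) uA) (λ {p} → into {p}) (λ {p} {q} → inj {p} {q}))
            (≤-reflexive (card#-cart _,_ (C ⊝ A) Δ)))))
        where
        L : List (Car G)
        L = (C ⊕ S) ⊝ A
        Rep : Car G → Set
        Rep x = ∃[ c ] ∃[ s ] ∃[ a ] (c ∈ C × s ∈ S × a ∈ A × x ≡ (c +g s) +g (-g a))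
        triple : ∀ x → x ∈ L → Rep x
        triple x m = let (y , a , my , ma , e) = ⊝⁻ (C ⊕ S) A m ; (c , s , mc , ms , e') = ⊕⁻ C S my in c , s , a , mc , ms , ma , trans e (cong (_+g (-g a)) e')
        choice : ∀ x → Dec (x ∈ L) → Car G × (Car G × Car G)
        choice x (yes p) = let (c , s , a , _) = triple x p in c , s , a
        choice x (no _) = ε G , ε G , ε G
        γ σ δ : Car G → Car G
        γ x = proj₁ (choice x (x ∈? L))
        σ x = proj₁ (proj₂ (choice x (x ∈? L)))
        δ x = proj₂ (proj₂ (choice x (x ∈? L)))
        spec : ∀ x → x ∈ L → (γ x ∈ C × σ x ∈ S × δ x ∈ A × x ≡ (γ x +g σ x) +g (-g (δ x)))
        spec x m = go (x ∈? L)
          where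
          go : ∀ d → (let (c , s , a) = choice x d in c ∈ C × s ∈ S × a ∈ A × x ≡ (c +g s) +g (-g a))
          go (yes p) = let (_ , _ , _ , r) = triple x p in r
          go (no n) = ⊥-elim (n m)
        φ′ : Car G × Car G → Car G × Car G
        φ′ (x , b) = γ x +g (-g b) , (b +g σ x) +g (-g (δ x))
        φ′-sum : ∀ x b → x ∈ L → (γ x +g (-g b)) +g ((b +g σ x) +g (-g (δ x))) ≡ x
        φ′-sum x b m = let (_ , _ , _ , e) = spec x m in trans (sym (g-assoc G _ _ _)) (trans (cong (_+g (-g (δ x))) (cancel₁ (γ x) b (σ x))) (sym e))
        many : ∀ {x} → x ∈ L → ρ ≤ᵣ ∑ A (λ b → ind (b +g σ x ∈? A))
        many {x} m = ≤-trans (S-pop (proj₁ (proj₂ (spec x m)))) (∑-mono A λ {b} mb → go b (b +g σ x ∈? A))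
          where
          go : ∀ b d → ∑ A (λ a → ind (_≟g_ G (b +g σ x) a)) ≤ᵣ ind d
          go b (yes _) = unique-ind (λ a → _≟g_ G (b +g σ x) a) uA (λ _ _ e e' → trans (sym e) e')
          go b (no n) = ≤-trans (∑-mono A λ {a} ma → ≤-reflexive (ind-no (_≟g_ G (b +g σ x) a) λ e → n (subst (_∈ A) (sym e) ma))) (≤-reflexive (∑-0 A))
        into : ∀ {p} → p ∈ List.cartesianProduct L A → proj₂ p +g σ (proj₁ p) ∈ A → φ′ p ∈ List.cartesianProduct (C ⊝ A) Δ
        into {x , b} m q = let (mx , mb) = ∈P.∈-cartesianProduct⁻ L A m ; (mc , ms , ma , _) = spec x mx in
          ∈P.∈-cartesianProduct⁺ (⊝⁺ {C} {A} mc mb) (⊝⁺ {A} {A} q ma)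
        inj : ∀ {p q} → p ∈ List.cartesianProduct L A → q ∈ List.cartesianProduct L A → proj₂ p +g σ (proj₁ p) ∈ A → proj₂ q +g σ (proj₁ q) ∈ A → φ′ p ≡ φ′ q → p ≡ q
        inj {x , b} {y , c} m m' _ _ e = go x≡y
          where
          mx = proj₁ (∈P.∈-cartesianProduct⁻ L A m)
          my = proj₁ (∈P.∈-cartesianProduct⁻ L A m')
          x≡y : x ≡ y
          x≡y = trans (sym (φ′-sum x b mx)) (trans (cong₂ _+g_ (cong proj₁ e) (cong proj₂ e)) (φ′-sum y c my))
          go : x ≡ y → (x , b) ≡ (y , c)
          go refl = cong (x ,_) (g-inv-inj G (g-cancelˡ G (γ x) (cong proj₁ e)))

      κ₂ : R
      κ₂ = # 2 *ᵣ (κ *ᵣ κ)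

      κ₂≥0 : # 0 ≤ᵣ κ₂
      κ₂≥0 = *-≥0 (#-≥0 2) (*-≥0 κ≥0 κ≥0)

      -- `expand` divided by ρ = α / 2κ, with |A - A| ≤ κ α. Every further summand S costs the same
      -- factor, which bounds all iterated sums of S.
      grow : ∀ C → card# ((C ⊕ S) ⊝ A) ≤ᵣ κ₂ *ᵣ card# (C ⊝ A)
      grow C = *-cancelˡ α (<-≤-trans (ι-pos 0) α≥1) (≤-trans (≤-reflexive (trans (cong (_*ᵣ L) (sym ρ-eq)) (ring 3 λ k r l → [] ⊢ con 2 :* k :* r :* l := con 2 :* k :* (l :* r))))
        (≤-trans (*-monoˡ (# 2 *ᵣ κ) (*-≥0 (#-≥0 2) κ≥0) (≤-trans (expand C) (*-monoˡ (card# (C ⊝ A)) (#-≥0 _) small)))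
          (≤-reflexive (ring 3 λ k c a → [] ⊢ con 2 :* k :* (c :* (k :* a)) := a :* (con 2 :* (k :* k) :* c)))))
        where
        L : R
        L = card# ((C ⊕ S) ⊝ A)

      C₀ 2S 4S C₂ C₃ C₁' : List (Car G)
      C₀ = ε G ∷ []
      C₁' = C₀ ⊕ S
      C₂ = C₁' ⊕ S
      C₃ = C₂ ⊕ S
      2S = C₂
      4S = C₃ ⊕ S

      size₀ : card# (C₀ ⊝ A) ≤ᵣ α
      size₀ = ≤-trans (≤-reflexive (cong card# (⊝-def C₀ A))) (≤-trans (dd-len (List.cartesianProductWith (λ a b → a +g (-g b)) C₀ A)) (≤-trans (≤-reflexive (card#-cart (λ a b → a +g (-g b)) C₀ A)) (≤-reflexive (*-1ˡ α))))

      less : ∀ {C} → Unique C → card# C ≤ᵣ card# (C ⊝ A)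
      less {C} u = pigeonhole (_≟g_ G) (λ x → x +g (-g a₀)) u (λ m → ⊝⁺ {C} {A} m a₀∈) (λ _ _ e → g-cancelʳ G (-g a₀) e)

      s₁ : card# (C₁' ⊝ A) ≤ᵣ κ₂ *ᵣ α
      s₁ = ≤-trans (grow C₀) (*-monoˡ κ₂ κ₂≥0 size₀)
      s₂ : card# (C₂ ⊝ A) ≤ᵣ κ₂ *ᵣ (κ₂ *ᵣ α)
      s₂ = ≤-trans (grow C₁') (*-monoˡ κ₂ κ₂≥0 s₁)
      s₃ : card# (C₃ ⊝ A) ≤ᵣ κ₂ *ᵣ (κ₂ *ᵣ (κ₂ *ᵣ α))
      s₃ = ≤-trans (grow C₂) (*-monoˡ κ₂ κ₂≥0 s₂)
      s₄ : card# (4S ⊝ A) ≤ᵣ κ₂ *ᵣ (κ₂ *ᵣ (κ₂ *ᵣ (κ₂ *ᵣ α)))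
      s₄ = ≤-trans (grow C₃) (*-monoˡ κ₂ κ₂≥0 s₃)

      rep-total : ∑ Δ rep ≡ α *ᵣ α
      rep-total = trans (∑-swap Δ A _) (trans (∑-cong A λ {b} mb → trans (∑-swap Δ A _) (trans (∑-cong A λ {a} ma → ≤-antisym
            (unique-ind (λ s → _≟g_ G (b +g s) a) (⊝-! A A) (λ _ _ e e' → g-cancelˡ G b (trans e (sym e'))))
            (ind-∈ (λ s → _≟g_ G (b +g s) a) (⊝⁺ {A} {A} ma mb) (trans (g-comm G _ _) (sub-add a b)))) (card#-∑ A)))
          (∑-const A α))

      split : ∑ Δ rep ≤ᵣ ∑ S rep +ᵣ card# Δ *ᵣ ρ
      split = ≤-trans (go Δ) (+-mono ≤-refl (≤-reflexive (∑-const Δ ρ)))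
        where
        go : ∀ xs → ∑ xs rep ≤ᵣ ∑ (List.filter popular? xs) rep +ᵣ ∑ xs (λ _ → ρ)
        go [] = lin [] 0 ([] ⊢ con 0 :≤ con 0 :+ con 0)
        go (x ∷ xs) with popular? x
        ... | yes _ = lin (1 ∷ 1 ∷ []) 5 (λ r s f c ρ → s :≤ f :+ c ∷ con 0 :≤ ρ ∷ [] ⊢ r :+ s :≤ r :+ f :+ (ρ :+ c)) (go xs) ρ≥0
        ... | no n = lin (1 ∷ 1 ∷ []) 5 (λ r s f c ρ → s :≤ f :+ c ∷ r :≤ ρ ∷ [] ⊢ r :+ s :≤ f :+ (ρ :+ c)) (go xs) (<⇒≤ (≰⇒> n))

      pop-mass : α *ᵣ α ≤ᵣ # 2 *ᵣ ∑ S rep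
      pop-mass = lin (2 ∷ 1 ∷ 2 ∷ 1 ∷ []) 5 (λ aa t s dr x → t :≤ s :+ dr ∷ (con 2 :* x :≤ aa) ∷ dr :≤ x ∷ aa :+ aa :≤ t :+ t ∷ [] ⊢ aa :≤ con 2 :* s)
        split (≤-reflexive (trans (ring 3 λ k a r → [] ⊢ con 2 :* (k :* a :* r) := a :* (con 2 :* k :* r)) (cong (α *ᵣ_) ρ-eq))) (*-monoʳ ρ ρ≥0 small) (≤-reflexive (sym (cong₂ _+ᵣ_ rep-total rep-total)))

      S-large : α ≤ᵣ # 2 *ᵣ card# S
      S-large = *-cancelˡ α (<-≤-trans (ι-pos 0) α≥1) (≤-trans pop-mass (≤-trans (*-monoˡ (# 2) (#-≥0 2) (≤-trans (∑-mono S (λ {s} _ → rep-≤ s)) (≤-reflexive (∑-const S α))))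
        (lin [] 2 λ s a → [] ⊢ con 2 :* (s :* a) :≤ a :* (con 2 :* s))))

      C₂∋ : ∀ {s t} → s ∈ S → t ∈ S → s +g t ∈ 2S
      C₂∋ {s} {t} ms mt = subst (_∈ 2S) (cong (_+g t) (g-idˡ G s)) (⊕⁺ {C₁'} {S} (⊕⁺ {C₀} {S} (here refl) ms) mt)
      C₂⁻ : ∀ {x} → x ∈ 2S → ∃[ s ] ∃[ t ] (s ∈ S × t ∈ S × x ≡ s +g t)
      C₂⁻ m = let (y , t , my , mt , e) = ⊕⁻ C₁' S m ; (z , s , mz , ms , e') = ⊕⁻ C₀ S my in s , t , ms , mt , trans e (cong (_+g t) (trans e' (trans (cong (_+g s) (only mz)) (g-idˡ G s))))
        where
        only : ∀ {z} → z ∈ C₀ → z ≡ ε G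
        only (here e) = e

      Cv : Cover C₃ S
      Cv = cover C₃ S (ε G , S-ε)
      T₀ : List (Car G)
      T₀ = Cover.T Cv

      -- 3S is covered by translates t + S - S, and S - S = 2S because S is symmetric: an element of
      -- 3S returns to 2S at the price of one element of T₀.
      reduce : ∀ {x s} → x ∈ 2S → s ∈ S → ∃[ t ] ∃[ y ] (t ∈ T₀ × y ∈ 2S × x +g s ≡ t +g y)
      reduce {x} {s} mx ms = let (t , s₁ , s₂ , mt , m₁ , m₂ , e) = Cover.covers Cv (⊕⁺ {C₂} {S} mx ms) in
        t , s₂ +g (-g s₁) , mt , C₂∋ m₂ (S-neg m₁) , trans (sym (add-sub (x +g s) s₁)) (trans (cong (_+g (-g s₁)) e) (g-assoc G t s₂ _))

      Hl : List (Car G)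
      Hl = List.cartesianProductWith _+g_ (combos m T₀) 2S

      -- The two elements of S that make up the second summand are absorbed one after the other by
      -- `reduce`, and the elements of T₀ that appear stay among the combinations.
      Hl-closed : ∀ {a b} → a ∈ Hl → b ∈ Hl → a +g b ∈ Hl
      Hl-closed {a} {b} ma mb = let
          (τ , x , mτ , mx , e) = ∈P.∈-cartesianProductWith⁻ _+g_ (combos m T₀) 2S ma
          (τ′ , y , mτ′ , my , e′) = ∈P.∈-cartesianProductWith⁻ _+g_ (combos m T₀) 2S mb
          (s , t , ms , mt , ey) = C₂⁻ my
          (t₁ , z , mt₁ , mz , e₁) = reduce mx ms
          (t₂ , w , mt₂ , mw , e₂) = reduce mz mt
        in subst (_∈ Hl) (sym (trans (cong₂ _+g_ e e′) (trans (g-mid G τ x τ′ y) (trans (cong ((τ +g τ′) +g_) (trans (cong (x +g_) ey) (trans (sym (g-assoc G x s t))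
             (trans (cong (_+g t) e₁) (trans (g-assoc G t₁ z t) (trans (cong (t₁ +g_) e₂) (sym (g-assoc G t₁ t₂ w)))))))) (sym (g-assoc G _ _ w))))))
          (∈P.∈-cartesianProductWith⁺ _+g_ (combos-closed m torsion T₀ (combos-closed m torsion T₀ mτ mτ′) (combos-closed m torsion T₀ (combos-gen m torsion 1≤m T₀ mt₁) (combos-gen m torsion 1≤m T₀ mt₂))) mw)

      2S-ε : ε G ∈ 2S
      2S-ε = subst (_∈ 2S) (g-idˡ G _) (C₂∋ S-ε S-ε)

    H₀ : Subgroup
    H₀ = mkSubgroup m torsion Hl (subst (_∈ Hl) (g-idˡ G _) (∈P.∈-cartesianProductWith⁺ _+g_ (combos-ε m torsion T₀) 2S-ε)) Hl-closed

    rank-bound : ℕ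
    rank-bound = proj₁ (archimedean (# 2 *ᵣ (κ₂ *ᵣ (κ₂ *ᵣ (κ₂ *ᵣ κ₂)))))

    private
      T-size : List.length T₀ ℕ.≤ rank-bound
      T-size = #-reflect (≤-trans (*-cancelˡ (card# S) S>0 (≤-trans (≤-reflexive (*-comm _ _)) (≤-trans (Cover.size Cv uS) (≤-trans (less {4S} (⊕-! C₃ S)) (≤-trans s₄
          (≤-trans (≤-reflexive (ring 2 λ k a → [] ⊢ k :* (k :* (k :* (k :* a))) := (k :* (k :* (k :* k))) :* a)) (≤-trans (*-monoˡ _ k4≥0 S-large) (lin [] 2 λ k s → [] ⊢ k :* (con 2 :* s) :≤ s :* (con 2 :* k)))))))))
          (proj₂ (archimedean (# 2 *ᵣ (κ₂ *ᵣ (κ₂ *ᵣ (κ₂ *ᵣ κ₂)))))))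
        where
        k4≥0 : # 0 ≤ᵣ κ₂ *ᵣ (κ₂ *ᵣ (κ₂ *ᵣ κ₂))
        k4≥0 = *-≥0 κ₂≥0 (*-≥0 κ₂≥0 (*-≥0 κ₂≥0 κ₂≥0))
        S>0 : # 0 <ᵣ card# S
        S>0 = ≰⇒> λ q → <⇒≱ (ι-pos 0) (≤-trans (≤-trans α≥1 S-large) (lin (2 ∷ []) 1 (λ s → s :≤ con 0 ∷ [] ⊢ con 2 :* s :≤ con 0) q))

    H₀-constant : R
    H₀-constant = # (suc m ℕ.^ rank-bound) *ᵣ (κ₂ *ᵣ κ₂)

    H₀-size : card# (els H₀) ≤ᵣ H₀-constant *ᵣ card# A
    H₀-size = ≤-trans (dd-len Hl) (≤-trans (≤-reflexive (trans (card#-cart _+g_ (combos m T₀) 2S) (cong (_*ᵣ card# 2S) (combos-len m torsion T₀))))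
      (≤-trans (*-mono (#-≥0 _) (#-≥0 _) (#-mono (ℕP.^-monoʳ-≤ (suc m) T-size)) (≤-trans (less {2S} (⊕-! C₁' S)) s₂)) (≤-reflexive (ring 3 λ p k a → [] ⊢ p :* (k :* (k :* a)) := p :* (k :* k) :* a))))

    -- Popular differences account for at least half of all pairs (a, b), and each of them lies in
    -- the subgroup; averaging over b gives a coset with half of A.
    H₀-centre : ∃[ b ] (b ∈ A × card# A ≤ᵣ # 2 *ᵣ ∑ A (λ a → ind (a +g (-g b) ∈? els H₀)))
    H₀-centre = let (b , mb , le) = ∑-exists A inCoset (α *ᵣ inv (# 2)) a₀∈ (≤-trans (≤-reflexive (∑-const A _)) avg) in
      b , mb , ≤-trans (≤-reflexive (sym (half α))) (*-monoˡ (# 2) (#-≥0 2) le)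
      where
      half : ∀ x → # 2 *ᵣ (x *ᵣ inv (# 2)) ≡ x
      half x = trans (ring 3 λ t x i → [] ⊢ t :* (x :* i) := x :* (t :* i)) (*-cancel-1 (inv-r (ι-pos 1)))
      inCoset : Car G → R
      inCoset b = ∑ A (λ a → ind (a +g (-g b) ∈? els H₀))
      S⊆H : ∀ {s} → s ∈ S → s ∈ els H₀
      S⊆H {s} ms = dd⁺ (subst (_∈ Hl) (trans (g-idˡ G _) (g-idʳ G s)) (∈P.∈-cartesianProductWith⁺ _+g_ (combos-ε m torsion T₀) (C₂∋ ms S-ε)))
      bound : ∀ b → ∑ S (λ s → ∑ A (λ a → ind (_≟g_ G (b +g s) a))) ≤ᵣ inCoset b
      bound b = ≤-trans (≤-reflexive (∑-swap S A _)) (∑-mono A λ {a} _ → go a (a +g (-g b) ∈? els H₀))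
        where
        go : ∀ a d → ∑ S (λ s → ind (_≟g_ G (b +g s) a)) ≤ᵣ ind d
        go a (yes _) = unique-ind (λ s → _≟g_ G (b +g s) a) uS (λ _ _ e e' → g-cancelˡ G b (trans e (sym e')))
        go a (no n) = ≤-trans (∑-mono S λ {s} ms → ≤-reflexive (ind-no (_≟g_ G (b +g s) a) λ e → n (subst (_∈ els H₀) (trans (sym (trans (cong (_+g (-g b)) (g-comm G b s)) (add-sub s b))) (cong (_+g (-g b)) e)) (S⊆H ms)))) (≤-reflexive (∑-0 S))
      avg : card# A *ᵣ (α *ᵣ inv (# 2)) ≤ᵣ ∑ A inCoset
      avg = *-cancelˡ (# 2) (ι-pos 1) (≤-trans (≤-reflexive (trans (ring 3 λ t x i → [] ⊢ t :* (x :* (x :* i)) := x :* (t :* (x :* i))) (cong (α *ᵣ_) (half α))))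
        (≤-trans pop-mass (*-monoˡ (# 2) (#-≥0 2) (≤-trans (≤-reflexive (∑-swap S A _)) (∑-mono A λ {b} _ → bound b)))))

-- Uniform distributions and level sets.

E-∑ : ∀ {Ω A : Set} (μ : Dist Ω) (xs : List A) (φ : Ω → A → R) → E μ (λ a → ∑ xs (φ a)) ≡ ∑ xs (λ x → E μ (λ a → φ a x))
E-∑ μ [] φ = E-const μ _
E-∑ μ (x ∷ xs) φ = trans (E-+ μ _ _) (cong (_ +ᵣ_) (E-∑ μ xs φ))

card#-pos : ∀ {A : Set} {xs : List A} {a} → a ∈ xs → # 0 <ᵣ card# xs
card#-pos {xs = x ∷ xs} _ = ι-pos (List.length xs)

module _ {A : Set} (L : List A) {a₀ : A} (a₀∈ : a₀ ∈ L) where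
  private
    N : R
    N = card# L
  uniform : Dist A
  uniform = dist (List.map (λ a → inv N , a) L) (λ m → let (_ , _ , e) = ∈P.∈-map⁻ _ m in ≤-trans (inv-≥0 N) (≤-reflexive (sym (cong proj₁ e))))
    (trans (∑-map _ L proj₁) (trans (∑-const L (inv N)) (inv-r (card#-pos a₀∈))))

  E-uniform : ∀ φ → E uniform φ ≡ inv N *ᵣ ∑ L φ
  E-uniform φ = trans (E-def uniform φ) (trans (∑-map _ L _) (∑-* L (inv N) φ))

  Supp-uniform : ∀ {a} → Supp uniform a → a ∈ L
  Supp-uniform (w , m , _) = let (b , mb , e) = ∈P.∈-map⁻ _ m in subst (_∈ L) (sym (cong proj₂ e)) mb

  H-uniform : (d : DecidableEquality A) → Unique L → H uniform (rv d id) ≡ h (inv N)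
  H-uniform d u = trans (H-def uniform (rv d id)) (trans (E-cong uniform λ {a} s → cong h (trans (E-uniform _) (trans (cong (inv N *ᵣ_)
      (≤-antisym (unique-ind (λ b → d a b) u (λ _ _ e e' → trans (sym e) e')) (ind-∈ (λ b → d a b) (Supp-uniform s) refl))) (ring 1 λ x → [] ⊢ x :* con 1 := x)))) (E-const uniform _))

-- The uniform distribution maximises entropy. By `h-log` the excess at a point is at most 1 / (|L|
-- mass) plus 1, and the mean of 1 / mass is at most the number |L| of possible values.
H-card : ∀ {Ω} (μ : Dist Ω) f (L : List (Val f)) {l₀} → l₀ ∈ L → (∀ {a} → Supp μ a → fn f a ∈ L) → H μ f ≤ᵣ h (inv (card# L)) +ᵣ # 2
H-card μ f L {l₀} l₀∈ into = ≤-trans (≤-reflexive (H-def μ f)) (≤-trans (E-mono μ {ψ = λ a → (h i +ᵣ # 1) +ᵣ i *ᵣ inv (mass μ f a)} λ {a} s →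
      ≤-trans (h-log {y = i} {r = i *ᵣ inv (mass μ f a)} (mass-pos μ f s) (mass-≤1 μ f a) i>0 (*-≥0 (inv-≥0 _) (inv-≥0 _))
          (≤-reflexive (sym (trans (*-assoc i _ _) (*-cancel-1 (trans (*-comm _ _) (inv-r (mass-pos μ f s)))))))) (lin [] 2 λ x y → [] ⊢ x :+ y :+ con 1 :≤ (x :+ con 1) :+ y))
    (≤-trans (≤-reflexive (trans (E-c+ μ _ _) (cong ((h i +ᵣ # 1) +ᵣ_) (E-* μ i _)))) (≤-trans (+-mono ≤-refl (*-monoˡ i (<⇒≤ i>0) inverses))
      (≤-trans (≤-reflexive (cong ((h i +ᵣ # 1) +ᵣ_) (trans (*-comm i _) (inv-r (card#-pos l₀∈))))) (lin [] 1 λ x → [] ⊢ (x :+ con 1) :+ con 1 :≤ x :+ con 2)))))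
  where
  i : R
  i = inv (card# L)
  i>0 : # 0 <ᵣ i
  i>0 = inv-pos (card#-pos l₀∈)
  inverses : E μ (λ a → inv (mass μ f a)) ≤ᵣ card# L
  inverses = ≤-trans (E-mono μ {ψ = λ a → ∑ L (λ l → ind (dec f (fn f a) l) *ᵣ inv (mass μ f a))} λ {a} s → ≤-trans (≤-reflexive (sym (*-1ˡ _)))
      (≤-trans (*-monoʳ _ (inv-≥0 _) (ind-∈ (λ l → dec f (fn f a) l) (into s) refl)) (≤-reflexive (trans (*-comm _ _) (trans (sym (∑-* L _ _)) (∑-cong L λ _ → *-comm _ _))))))
    (≤-trans (≤-reflexive (E-∑ μ L _)) (≤-trans (∑-mono L λ {l} _ → class-sum μ f (λ a → dec f (fn f a) l) (λ e e' → trans e (sym e'))) (≤-reflexive (card#-∑ L))))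

level : ∀ {x y} M → # 0 <ᵣ x → # 0 <ᵣ y → y ≤ᵣ # 1 → h x ≤ᵣ h y +ᵣ # M → y ≤ᵣ x *ᵣ pow2 (suc M)
level {x} {y} M px py y1 le = *-cancelˡ (pow2 (hn y)) (pow2-pos (hn y)) (≤-trans (≤-reflexive (*-comm _ _)) (≤-trans (hn-lo y1) (≤-trans (<⇒≤ (hn-hi px))
  (≤-trans (*-monoˡ x (<⇒≤ px) (pow2-mono (s≤s (#-reflect {hn x} {hn y ℕ.+ M} (≤-trans le (≤-reflexive (sym (#-+ (hn y) M))))))))
    (≤-reflexive (trans (cong (x *ᵣ_) (trans (cong (λ z → pow2 (suc z)) (ℕP.+-comm (hn y) M)) (pow2-+ (suc M) (hn y)))) (ring 3 λ x k z → [] ⊢ x :* (k :* z) := z :* (x :* k))))))))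

module _ {Ω B : Set} (μ : Dist Ω) (f : Ω → B) {Q : Ω → Set} (q : ∀ a → Dec (Q a)) where
  private
    pick? : ∀ (p : R × Ω) → Dec ((¬ (proj₁ p ≤ᵣ # 0)) × Q (proj₂ p))
    pick? (w , a) = ¬? (w ≤? # 0) ×-dec q a

  values : List B
  values = List.map (f ∘ proj₂) (List.filter pick? (pts μ))

  values⁻ : ∀ {x} → x ∈ values → ∃[ a ] (Supp μ a × Q a × x ≡ f a)
  values⁻ m with ∈P.∈-map⁻ (f ∘ proj₂) m
  ... | (w , a) , mp , e = let (mw , (w0 , t)) = ∈P.∈-filter⁻ pick? {xs = pts μ} mp in a , (w , mw , ≰⇒> w0) , t , e

  values⁺ : ∀ {a} → Supp μ a → Q a → f a ∈ values
  values⁺ {a} (w , m , p) t = ∈P.∈-map⁺ (f ∘ proj₂) {x = w , a} (∈P.∈-filter⁺ pick? {x = w , a} m (<⇒≱ p , t))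

plain : ∀ {G Ω} → Dist Ω → (Ω → Car G) → Obj G
plain ν X = obj ν X ⊤ᵣ

-- If X - X' has hardly more entropy than X, then for most pairs of values the masses of X at both
-- and the mass of their difference agree up to a constant factor. Typical values then form a set on
-- which X is nearly uniform and whose difference set is small.
module LevelSet (G : Grp) {Ω₀ : Set} (ν : Dist Ω₀) (X₀ : Ω₀ → Car G) (c : R) (c≥0 : # 0 ≤ᵣ c)
    (small : hh (plain {G} ν X₀ ⊟ plain ν X₀) ≤ᵣ hh (plain {G} ν X₀) +ᵣ c) where
  open Sets G
  private
    _+g_ : Car G → Car G → Car G
    _+g_ = _∙_ G
    -g_ : Car G → Car G
    -g_ = _⁻ G

  Yo : Obj G
  Yo = plain ν X₀

  private
    Xv : RV Ω₀
    Xv = rvg G X₀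
    ν₂ : Dist (Ω₀ × Ω₀)
    ν₂ = ν ⊗ ν
    Dr : RV (Ω₀ × Ω₀)
    Dr = rvg G (λ p → X₀ (proj₁ p) +g (-g X₀ (proj₂ p)))
    mX : Ω₀ → R
    mX = mass ν Xv
    P : Ω₀ → Ω₀ → R
    P a b = mass ν₂ Dr (a , b)
    -- A₁ compares the information of the difference with that of a. By `h-log` the added 2 r₁ + 1
    -- makes it at least r₁, hence nonnegative, and costs little since r₁ has mean at most 1. J is
    -- nonnegative with bounded mean, and a small J makes all three masses comparable.
    r₁ r₂ A₁ A₂ J : Ω₀ → Ω₀ → R
    r₁ a b = P a b *ᵣ inv (mX a)
    r₂ a b = P a b *ᵣ inv (mX b)
    A₁ a b = (h (P a b) +ᵣ (# 2 *ᵣ r₁ a b +ᵣ # 1)) -ᵣ h (mX a)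
    A₂ a b = (h (P a b) +ᵣ (# 2 *ᵣ r₂ a b +ᵣ # 1)) -ᵣ h (mX b)
    J a b = A₁ a b +ᵣ A₂ a b

    hY : R
    hY = H ν Xv
    hY-eq : hh Yo ≡ hY
    hY-eq = cH-const ν Xv ⊤ᵣ (λ _ _ → refl)
    hD-eq : hh (Yo ⊟ Yo) ≡ H ν₂ Dr
    hD-eq = cH-const ν₂ Dr (⊤ᵣ ⊗ᵣ ⊤ᵣ) (λ _ _ → refl)

    P-pos : ∀ {a b} → Supp ν a → Supp ν b → # 0 <ᵣ P a b
    P-pos s t = mass-pos ν₂ Dr (Supp-bind⁺ ν (λ _ → ν) s t)

    r₁≥0 : ∀ a b → # 0 ≤ᵣ r₁ a b
    r₁≥0 a b = *-≥0 (E-≥0 ν₂ λ _ → ind-≥0 (dec Dr _ _)) (inv-≥0 _)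
    r₂≥0 : ∀ a b → # 0 ≤ᵣ r₂ a b
    r₂≥0 a b = *-≥0 (E-≥0 ν₂ λ _ → ind-≥0 (dec Dr _ _)) (inv-≥0 _)

    over : ∀ {p x} → # 0 <ᵣ x → p ≤ᵣ (p *ᵣ inv x) *ᵣ x
    over {p} {x} q = ≤-reflexive (sym (trans (*-assoc p _ x) (*-cancel-1 (trans (*-comm _ x) (inv-r q)))))

    A₁≥ : ∀ {a b} → Supp ν a → Supp ν b → r₁ a b ≤ᵣ A₁ a b
    A₁≥ {a} {b} s t = lin (1 ∷ []) 3 (λ hp hm r → hm :≤ hp :+ r :+ con 1 ∷ [] ⊢ r :≤ (hp :+ (con 2 :* r :+ con 1)) :- hm)
      (h-log (mass-pos ν Xv s) (mass-≤1 ν Xv a) (P-pos s t) (r₁≥0 a b) (over (mass-pos ν Xv s)))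
    A₂≥ : ∀ {a b} → Supp ν a → Supp ν b → r₂ a b ≤ᵣ A₂ a b
    A₂≥ {a} {b} s t = lin (1 ∷ []) 3 (λ hp hm r → hm :≤ hp :+ r :+ con 1 ∷ [] ⊢ r :≤ (hp :+ (con 2 :* r :+ con 1)) :- hm)
      (h-log (mass-pos ν Xv t) (mass-≤1 ν Xv b) (P-pos s t) (r₂≥0 a b) (over (mass-pos ν Xv t)))

    J≥0 : ∀ {a b} → Supp ν a → Supp ν b → # 0 ≤ᵣ J a b
    J≥0 {a} {b} s t = ≤-trans (lin [] 0 ([] ⊢ con 0 :≤ con 0 :+ con 0)) (+-mono (≤-trans (r₁≥0 a b) (A₁≥ s t)) (≤-trans (r₂≥0 a b) (A₂≥ s t)))

    J-up : ∀ {a b} → Supp ν a → Supp ν b → h (mX a) ≤ᵣ h (mX b) +ᵣ J a b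
    J-up {a} {b} s t = lin (2 ∷ 2 ∷ []) 5 (λ hp ha hb r q → r :≤ (hp :+ (con 2 :* r :+ con 1)) :- ha ∷ con 0 :≤ q ∷ [] ⊢ ha :≤ hb :+ ((hp :+ (con 2 :* r :+ con 1) :- ha) :+ (hp :+ (con 2 :* q :+ con 1) :- hb)))
      (A₁≥ s t) (r₂≥0 a b)
    J-down : ∀ {a b} → Supp ν a → Supp ν b → h (mX b) ≤ᵣ h (mX a) +ᵣ J a b
    J-down {a} {b} s t = lin (2 ∷ 2 ∷ []) 5 (λ hp ha hb r q → q :≤ (hp :+ (con 2 :* q :+ con 1)) :- hb ∷ con 0 :≤ r ∷ [] ⊢ hb :≤ ha :+ ((hp :+ (con 2 :* r :+ con 1) :- ha) :+ (hp :+ (con 2 :* q :+ con 1) :- hb)))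
      (A₂≥ s t) (r₁≥0 a b)
    J-P : ∀ {a b} → Supp ν a → Supp ν b → h (P a b) ≤ᵣ h (mX a) +ᵣ J a b
    J-P {a} {b} s t = lin (1 ∷ 2 ∷ 1 ∷ []) 5 (λ hp ha hb r q → q :≤ (hp :+ (con 2 :* q :+ con 1)) :- hb ∷ con 0 :≤ r ∷ con 0 :≤ q ∷ [] ⊢ hp :≤ ha :+ ((hp :+ (con 2 :* r :+ con 1) :- ha) :+ (hp :+ (con 2 :* q :+ con 1) :- hb)))
      (A₂≥ s t) (r₁≥0 a b) (r₂≥0 a b)

    -- For a fixed second point and a fixed value of the difference, the first point ranges over one
    -- class of X.
    E-r₁ : E ν (λ a → E ν (r₁ a)) ≤ᵣ # 1
    E-r₁ = ≤-trans (≤-reflexive (trans (E-swap ν ν r₁) (E-ext ν λ b → trans (E-ext ν λ a → sym (E-*ʳ ν₂ (inv (mX a)) (same Dr (a , b)))) (E-swap ν ν₂ _))))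
      (E-≤c ν λ {b} _ → E-≤c ν₂ λ {w} _ → class-sum ν Xv (λ a → dec Dr (fn Dr (a , b)) (fn Dr w)) (λ e e' → g-cancelʳ G (-g X₀ b) (trans e (sym e'))))

    E-r₂ : E ν (λ a → E ν (r₂ a)) ≤ᵣ # 1
    E-r₂ = ≤-trans (≤-reflexive (E-ext ν λ a → trans (E-ext ν λ b → sym (E-*ʳ ν₂ (inv (mX b)) (same Dr (a , b)))) (E-swap ν ν₂ _)))
      (E-≤c ν λ {a} _ → E-≤c ν₂ λ {w} _ → class-sum ν Xv (λ b → dec Dr (fn Dr (a , b)) (fn Dr w)) (λ e e' → g-inv-inj G (g-cancelˡ G (X₀ a) (trans e (sym e')))))

    c₁ c₂ : R
    c₁ = # 2 *ᵣ c +ᵣ # 6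
    c₂ = c₁ +ᵣ # 1

    EE : (Ω₀ → Ω₀ → R) → R
    EE φ = E ν (λ a → E ν (φ a))

    EE-+ : ∀ φ ψ → EE (λ a b → φ a b +ᵣ ψ a b) ≡ EE φ +ᵣ EE ψ
    EE-+ φ ψ = trans (E-ext ν λ a → E-+ ν (φ a) (ψ a)) (E-+ ν _ _)

    EE-* : ∀ k φ → EE (λ a b → k *ᵣ φ a b) ≡ k *ᵣ EE φ
    EE-* k φ = trans (E-ext ν λ a → E-* ν k (φ a)) (E-* ν k (λ a → E ν (φ a)))

    EE-const : ∀ k → EE (λ _ _ → k) ≡ k
    EE-const k = trans (E-ext ν λ _ → E-const ν k) (E-const ν k)

    info hsum rsum : Ω₀ → Ω₀ → R
    info a b = h (P a b)
    hsum a b = h (mX a) +ᵣ h (mX b)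
    rsum a b = r₁ a b +ᵣ r₂ a b

    E-hsum : EE hsum ≡ hY +ᵣ hY
    E-hsum = trans (EE-+ (λ a _ → h (mX a)) (λ _ b → h (mX b))) (cong₂ _+ᵣ_ (trans (E-ext ν λ a → E-const ν (h (mX a))) (sym (H-def ν Xv))) (trans (E-const ν (E ν (λ b → h (mX b)))) (sym (H-def ν Xv))))

    E-info : EE info ≡ H ν₂ Dr
    E-info = sym (trans (H-def ν₂ Dr) (E-⊗ ν ν (λ w → h (mass ν₂ Dr w))))

    E-balance : EE J +ᵣ (hY +ᵣ hY) ≡ # 2 *ᵣ H ν₂ Dr +ᵣ # 2 *ᵣ EE rsum +ᵣ # 2
    E-balance = begin
      EE J +ᵣ (hY +ᵣ hY) ≡⟨ cong (EE J +ᵣ_) (sym E-hsum) ⟩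
      EE J +ᵣ EE hsum ≡⟨ sym (EE-+ J hsum) ⟩
      EE (λ a b → J a b +ᵣ hsum a b) ≡⟨ E-ext ν (λ a → E-ext ν (λ b → pt (h (P a b)) (h (mX a)) (h (mX b)) (r₁ a b) (r₂ a b))) ⟩
      EE (λ a b → (# 2 *ᵣ info a b +ᵣ # 2 *ᵣ rsum a b) +ᵣ # 2) ≡⟨ EE-+ (λ a b → # 2 *ᵣ info a b +ᵣ # 2 *ᵣ rsum a b) (λ _ _ → # 2) ⟩
      EE (λ a b → # 2 *ᵣ info a b +ᵣ # 2 *ᵣ rsum a b) +ᵣ EE (λ _ _ → # 2) ≡⟨ cong₂ _+ᵣ_ (EE-+ (λ a b → # 2 *ᵣ info a b) (λ a b → # 2 *ᵣ rsum a b)) (EE-const (# 2)) ⟩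
      (EE (λ a b → # 2 *ᵣ info a b) +ᵣ EE (λ a b → # 2 *ᵣ rsum a b)) +ᵣ # 2 ≡⟨ cong (_+ᵣ # 2) (cong₂ _+ᵣ_ (trans (EE-* (# 2) info) (cong (# 2 *ᵣ_) E-info)) (EE-* (# 2) rsum)) ⟩
      # 2 *ᵣ H ν₂ Dr +ᵣ # 2 *ᵣ EE rsum +ᵣ # 2 ∎
      where
      open ≡-Reasoning
      pt : ∀ p ha hb r q → (((p +ᵣ (# 2 *ᵣ r +ᵣ # 1)) -ᵣ ha) +ᵣ ((p +ᵣ (# 2 *ᵣ q +ᵣ # 1)) -ᵣ hb)) +ᵣ (ha +ᵣ hb) ≡ (# 2 *ᵣ p +ᵣ # 2 *ᵣ (r +ᵣ q)) +ᵣ # 2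
      pt p ha hb r q = ring 5 λ p ha hb r q → [] ⊢ (((p :+ (con 2 :* r :+ con 1)) :- ha) :+ ((p :+ (con 2 :* q :+ con 1)) :- hb)) :+ (ha :+ hb) := (con 2 :* p :+ con 2 :* (r :+ q)) :+ con 2

    E-J : EE J ≤ᵣ c₁
    E-J = lin (1 ∷ 2 ∷ 2 ∷ 2 ∷ 2 ∷ []) 7 (λ j y d rs r q c → j :+ (y :+ y) :≤ con 2 :* d :+ con 2 :* rs :+ con 2 ∷ d :≤ y :+ c ∷ rs :≤ r :+ q ∷ r :≤ con 1 ∷ q :≤ con 1 ∷ [] ⊢ j :≤ con 2 :* c :+ con 6)
        (≤-reflexive E-balance) (subst₂ (λ x y → x ≤ᵣ y +ᵣ c) hD-eq hY-eq small) (≤-reflexive (EE-+ r₁ r₂)) E-r₁ E-r₂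

    -- Fixes a reference value y₀ with which most points are comparable; its mass λ₀ is the level
    -- around which the set is built.
    base : ∃[ y ] (Supp ν y × E ν (λ a → J a y) ≤ᵣ c₂)
    base = E-exists ν (λ y → E ν (λ a → J a y)) c₂ (≤-<-trans (≤-trans (≤-reflexive (sym (E-swap ν ν J))) E-J) (≰⇒> λ q → <⇒≱ (ι-pos 0) (lin (1 ∷ []) 1 (λ c → c :+ con 1 :≤ c ∷ [] ⊢ con 1 :≤ con 0) q)))

    y₀ : Ω₀
    y₀ = proj₁ base
    sy₀ : Supp ν y₀
    sy₀ = proj₁ (proj₂ base)

  λ₀ : R
  λ₀ = mX y₀

  λ₀-pos : # 0 <ᵣ λ₀
  λ₀-pos = mass-pos ν Xv sy₀
  λ₀≤1 : λ₀ ≤ᵣ # 1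
  λ₀≤1 = mass-≤1 ν Xv y₀

  entropy-level : hh Yo ≤ᵣ h λ₀ +ᵣ (# 2 *ᵣ c +ᵣ # 7)
  entropy-level = ≤-trans (≤-reflexive (trans hY-eq (H-def ν Xv))) (≤-trans (E-mono ν λ s → J-up s sy₀) (≤-trans (≤-reflexive (E-c+ ν _ _))
    (lin (1 ∷ []) 3 (λ l j c → j :≤ con 2 :* c :+ con 6 :+ con 1 ∷ [] ⊢ l :+ j :≤ l :+ (con 2 :* c :+ con 7)) (proj₂ (proj₂ base)))))

  private
    M : ℕ
    -- By Markov's inequality J exceeds M with probability at most 1/40. This leaves 7/8 for the
    -- typical points and more than 3/8 for the common partners in `G₃-mass`.
    M = suc (proj₁ (archimedean (# 40 *ᵣ c₂)))
    M-big : # 40 *ᵣ c₂ ≤ᵣ # M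
    M-big = ≤-trans (proj₂ (archimedean (# 40 *ᵣ c₂))) (#-mono (ℕP.n≤1+n _))
    M-pos : # 0 <ᵣ # M
    M-pos = ι-pos _

  K : R
  K = pow2 (suc M)

  K≥1 : # 1 ≤ᵣ K
  K≥1 = pow2-≥1 (suc M)
  K≥0 : # 0 ≤ᵣ K
  K≥0 = pow2-≥0 (suc M)
  K>0 : # 0 <ᵣ K
  K>0 = pow2-pos (suc M)

  private
    good? : ∀ a b → Dec (J a b ≤ᵣ # M)
    good? a b = J a b ≤? # M
    g : Ω₀ → Ω₀ → R
    g a b = ind (good? a b)
    Γ : Ω₀ → R
    Γ a = E ν (g a)

    Typical : Ω₀ → Set
    Typical a = (J a y₀ ≤ᵣ # M) × (# 3 ≤ᵣ # 4 *ᵣ Γ a)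
    typical? : ∀ a → Dec (Typical a)
    typical? a = good? a y₀ ×-dec (# 3 ≤? # 4 *ᵣ Γ a)

    markov : ∀ {a b} → Supp ν a → Supp ν b → # M ≤ᵣ # M *ᵣ g a b +ᵣ J a b
    markov {a} {b} s t with good? a b
    ... | yes _ = lin (1 ∷ []) 2 (λ m j → con 0 :≤ j ∷ [] ⊢ m :≤ m :* con 1 :+ j) (J≥0 s t)
    ... | no n = lin (1 ∷ []) 2 (λ m j → m :≤ j ∷ [] ⊢ m :≤ m :* con 0 :+ j) (<⇒≤ (≰⇒> n))

    E-Γ : # M ≤ᵣ # M *ᵣ E ν Γ +ᵣ c₁
    E-Γ = ≤-trans (≤-reflexive (sym (trans (E-ext ν λ _ → E-const ν (# M)) (E-const ν (# M))))) (≤-trans (E-mono ν {ψ = λ a → # M *ᵣ Γ a +ᵣ E ν (J a)} λ {a} s →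
        ≤-trans (E-mono ν λ t → markov s t) (≤-reflexive (trans (E-+ ν _ _) (cong (_+ᵣ E ν (J a)) (E-* ν (# M) (g a))))))
      (≤-trans (≤-reflexive (trans (E-+ ν _ _) (cong (_+ᵣ EE J) (E-* ν (# M) Γ)))) (+-mono ≤-refl E-J)))

    E-near : # M ≤ᵣ # M *ᵣ E ν (λ a → g a y₀) +ᵣ c₂
    E-near = ≤-trans (≤-reflexive (sym (E-const ν (# M)))) (≤-trans (E-mono ν λ s → markov s sy₀) (≤-trans (≤-reflexive (trans (E-+ ν _ _) (cong (_+ᵣ E ν (λ a → J a y₀)) (E-* ν (# M) _)))) (+-mono ≤-refl (proj₂ (proj₂ base)))))

    near : # 39 ≤ᵣ # 40 *ᵣ E ν (λ a → g a y₀)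
    near = *-cancelˡ (# M) M-pos (lin (40 ∷ 1 ∷ []) 3 (λ m e c → m :≤ m :* e :+ c ∷ con 40 :* c :≤ m ∷ [] ⊢ m :* con 39 :≤ m :* (con 40 :* e)) E-near M-big)

    most : # 39 ≤ᵣ # 40 *ᵣ E ν Γ
    most = *-cancelˡ (# M) M-pos (lin (40 ∷ 1 ∷ []) 3 (λ m e c → m :≤ m :* e :+ c ∷ con 40 :* (c :+ con 1) :≤ m ∷ [] ⊢ m :* con 39 :≤ m :* (con 40 :* e)) E-Γ M-big)

    Γ≤1 : ∀ a → Γ a ≤ᵣ # 1
    Γ≤1 a = E-≤c ν λ {b} _ → ind-≤1 (good? a b)

    typical-mass : # 7 ≤ᵣ # 8 *ᵣ E ν (λ a → ind (typical? a))
    typical-mass = lin/ 5 (40 ∷ 1 ∷ 4 ∷ []) 3 (λ t n m → n :+ con 4 :* m :≤ t :+ con 4 ∷ con 39 :≤ con 40 :* n ∷ con 39 :≤ con 40 :* m ∷ [] ⊢ con 7 :≤ con 8 :* t) sum near most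
      where
      pt : ∀ {P : Set} {x} (d : Dec P) (e : Dec (# 3 ≤ᵣ # 4 *ᵣ x)) → x ≤ᵣ # 1 → ind d +ᵣ # 4 *ᵣ x ≤ᵣ ind (d ×-dec e) +ᵣ # 4
      pt (yes _) (yes _) = lin (4 ∷ []) 1 (λ x → x :≤ con 1 ∷ [] ⊢ con 1 :+ con 4 :* x :≤ con 1 :+ con 4)
      pt (yes _) (no n) _ = lin (1 ∷ []) 1 (λ x → con 4 :* x :≤ con 3 ∷ [] ⊢ con 1 :+ con 4 :* x :≤ con 0 :+ con 4) (<⇒≤ (≰⇒> n))
      pt (no _) (yes _) = lin (4 ∷ []) 1 (λ x → x :≤ con 1 ∷ [] ⊢ con 0 :+ con 4 :* x :≤ con 0 :+ con 4)
      pt (no _) (no _) = lin (4 ∷ []) 1 (λ x → x :≤ con 1 ∷ [] ⊢ con 0 :+ con 4 :* x :≤ con 0 :+ con 4)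
      sum : E ν (λ a → g a y₀) +ᵣ # 4 *ᵣ E ν Γ ≤ᵣ E ν (λ a → ind (typical? a)) +ᵣ # 4
      sum = ≤-trans (≤-reflexive (trans (cong (E ν (λ a → g a y₀) +ᵣ_) (sym (E-* ν (# 4) Γ))) (sym (E-+ ν _ _)))) (≤-trans (E-mono ν λ {a} _ → pt (good? a y₀) (# 3 ≤? # 4 *ᵣ Γ a) (Γ≤1 a)) (≤-reflexive (E-+c ν (# 4) _)))

    typ-upper : ∀ {a} → Supp ν a → J a y₀ ≤ᵣ # M → mX a ≤ᵣ λ₀ *ᵣ K
    typ-upper {a} s q = level M λ₀-pos (mass-pos ν Xv s) (mass-≤1 ν Xv a) (≤-trans (J-down s sy₀) (+-mono ≤-refl q))
    typ-lower : ∀ {a} → Supp ν a → J a y₀ ≤ᵣ # M → λ₀ ≤ᵣ mX a *ᵣ K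
    typ-lower {a} s q = level M (mass-pos ν Xv s) λ₀-pos λ₀≤1 (≤-trans (J-up s sy₀) (+-mono ≤-refl q))
    good-P : ∀ {a b} → Supp ν a → Supp ν b → J a b ≤ᵣ # M → mX a ≤ᵣ P a b *ᵣ K
    good-P {a} {b} s t q = level M (P-pos s t) (mass-pos ν Xv s) (mass-≤1 ν Xv a) (≤-trans (J-P s t) (+-mono ≤-refl q))

  A : List (Car G)
  A = dd (values ν X₀ typical?)

  uA : Unique A
  uA = dd-! (values ν X₀ typical?)

  private
    A⁻ : ∀ {x} → x ∈ A → ∃[ a ] (Supp ν a × Typical a × x ≡ X₀ a)
    A⁻ m = values⁻ ν X₀ typical? (dd⁻ (values ν X₀ typical?) m)

    A⁺ : ∀ {a} → Supp ν a → Typical a → X₀ a ∈ A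
    A⁺ s t = dd⁺ (values⁺ ν X₀ typical? s t)

  weightOf : Car G → R
  weightOf x = E ν (λ a → ind (_≟g_ G x (X₀ a)))

  weight-upper : ∀ {x} → x ∈ A → weightOf x ≤ᵣ λ₀ *ᵣ K
  weight-upper m = let (a , s , t , e) = A⁻ m in subst (λ x → weightOf x ≤ᵣ λ₀ *ᵣ K) (sym e) (typ-upper s (proj₁ t))
  weight-lower : ∀ {x} → x ∈ A → λ₀ ≤ᵣ weightOf x *ᵣ K
  weight-lower m = let (a , s , t , e) = A⁻ m in subst (λ x → λ₀ ≤ᵣ weightOf x *ᵣ K) (sym e) (typ-lower s (proj₁ t))

  A-size-lower : # 7 ≤ᵣ # 8 *ᵣ (card# A *ᵣ (λ₀ *ᵣ K))
  A-size-lower = ≤-trans typical-mass (*-monoˡ (# 8) (#-≥0 8) (≤-trans (E-mono ν {ψ = λ a → ∑ A (λ x → ind (_≟g_ G x (X₀ a)))} λ {a} s →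
        ≤-trans (≤-reflexive (ring 1 λ x → [] ⊢ x := x :* con 1)) (ind-≤ (typical? a) (∑-≥0 A λ {x} _ → ind-≥0 (_≟g_ G x (X₀ a))) λ t → ind-∈ (λ x → _≟g_ G x (X₀ a)) (A⁺ s t) refl))
    (≤-trans (≤-reflexive (E-∑ ν A _)) (≤-trans (∑-mono A weight-upper) (≤-reflexive (∑-const A _))))))

  A-size-upper : card# A *ᵣ λ₀ ≤ᵣ K
  A-size-upper = ≤-trans (≤-reflexive (sym (∑-const A λ₀))) (≤-trans (∑-mono A weight-lower) (≤-trans (≤-reflexive (trans (∑-cong A λ _ → *-comm _ K) (∑-* A K weightOf)))
    (≤-trans (*-monoˡ K K≥0 (≤-trans (≤-reflexive (sym (E-∑ ν A _))) (E-≤c ν λ {a} _ → unique-ind (λ x → _≟g_ G x (X₀ a)) uA (λ _ _ e e' → trans e (sym e'))))) (lin [] 1 λ k → [] ⊢ k :* con 1 :≤ k))))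

  A-inhabited : ∃[ x ] (x ∈ A)
  A-inhabited = nonempty A A-size-lower
    where
    nonempty : ∀ L {x} → # 7 ≤ᵣ # 8 *ᵣ (card# L *ᵣ x) → ∃[ x ] (x ∈ L)
    nonempty (x ∷ xs) _ = x , here refl
    nonempty [] p = ⊥-elim (<⇒≱ (ι-pos 6) (≤-trans p (lin [] 1 λ x → [] ⊢ con 8 :* (con 0 :* x) :≤ con 0)))

  private
    K⁵ : R
    K⁵ = K *ᵣ ((K *ᵣ K) *ᵣ (K *ᵣ K))
    K⁵≥0 : # 0 ≤ᵣ K⁵
    K⁵≥0 = *-≥0 K≥0 (*-≥0 (*-≥0 K≥0 K≥0) (*-≥0 K≥0 K≥0))

    -- The law of a difference of two independent differences. Its total mass over A - A is at most
    -- 1, so a lower bound of order λ₀ for each element counts A - A.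
    q : Car G → R
    q z = E ν₂ (λ w → E ν₂ (λ w' → ind (_≟g_ G z (fn Dr w +g (-g fn Dr w')))))

    three : ∀ {P Q S : Set} {l x} (d : Dec P) (e : Dec Q) (f : Dec S) → # 0 ≤ᵣ x → (P → Q → S → l ≤ᵣ x) → l *ᵣ ((ind d *ᵣ ind e) *ᵣ ind f) ≤ᵣ x
    three {l = l} (yes p) (yes q) (yes s) _ k = ≤-trans (lin [] 1 λ l → [] ⊢ l :* ((con 1 :* con 1) :* con 1) :≤ l) (k p q s)
    three (yes _) (yes _) (no _) x0 _ = ≤-trans (lin [] 1 λ l → [] ⊢ l :* ((con 1 :* con 1) :* con 0) :≤ con 0) x0
    three (yes _) (no _) f x0 _ = ≤-trans (lin [] 2 λ l f → [] ⊢ l :* ((con 1 :* con 0) :* f) :≤ con 0) x0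
    three (no _) e f x0 _ = ≤-trans (lin [] 3 λ l e f → [] ⊢ l :* ((con 0 :* e) :* f) :≤ con 0) x0

    union : ∀ {P Q S : Set} (d : Dec P) (e : Dec Q) (f : Dec S) → ind d +ᵣ (ind e +ᵣ ind f) ≤ᵣ (ind d *ᵣ ind e) *ᵣ ind f +ᵣ # 2
    union (yes _) (yes _) (yes _) = lin [] 0 ([] ⊢ con 1 :+ (con 1 :+ con 1) :≤ (con 1 :* con 1) :* con 1 :+ con 2)
    union (yes _) (yes _) (no _) = lin [] 0 ([] ⊢ con 1 :+ (con 1 :+ con 0) :≤ (con 1 :* con 1) :* con 0 :+ con 2)
    union (yes _) (no _) f = lin (1 ∷ []) 1 (λ f → f :≤ con 1 ∷ [] ⊢ con 1 :+ (con 0 :+ f) :≤ (con 1 :* con 0) :* f :+ con 2) (ind-≤1 f)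
    union (no _) e f = lin (1 ∷ 1 ∷ []) 2 (λ e f → e :≤ con 1 ∷ f :≤ con 1 ∷ [] ⊢ con 0 :+ (e :+ f) :≤ (con 0 :* e) :* f :+ con 2) (ind-≤1 e) (ind-≤1 f)

    module Pair {a₁ a₂ : Ω₀} (s₁ : Supp ν a₁) (s₂ : Supp ν a₂) (t₁ : Typical a₁) (t₂ : Typical a₂) where
      term G₃ : Ω₀ → R
      term y = P a₁ y *ᵣ P a₂ y *ᵣ inv (mX y)
      G₃ y = (g a₁ y *ᵣ g a₂ y) *ᵣ g y y₀

      term≥0 : ∀ y → # 0 ≤ᵣ K⁵ *ᵣ term y
      term≥0 y = *-≥0 K⁵≥0 (*-≥0 (*-≥0 (E-≥0 ν₂ λ _ → ind-≥0 (dec Dr _ _)) (E-≥0 ν₂ λ _ → ind-≥0 (dec Dr _ _))) (inv-≥0 _))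

      term-lower : ∀ {y} → Supp ν y → λ₀ *ᵣ G₃ y ≤ᵣ K⁵ *ᵣ term y
      term-lower {y} s = three (good? a₁ y) (good? a₂ y) (good? y y₀) (term≥0 y) λ j₁ j₂ j₃ →
        ≤-trans (≤-reflexive (sym (*-cancel-1 (inv-r (mass-pos ν Xv s))))) (≤-trans (*-monoˡ λ₀ (<⇒≤ λ₀-pos) (*-monoʳ (inv (mX y)) (inv-≥0 _) (typ-upper s j₃)))
          (≤-trans (≤-reflexive (ring 3 λ l k i → [] ⊢ l :* ((l :* k) :* i) := (k :* i) :* (l :* l)))
            (≤-trans (*-monoˡ (K *ᵣ inv (mX y)) (*-≥0 K≥0 (inv-≥0 _)) (*-mono (<⇒≤ λ₀-pos) (*-≥0 (*-≥0 (<⇒≤ (P-pos s₁ s)) K≥0) K≥0)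
                (≤-trans (typ-lower s₁ (proj₁ t₁)) (*-monoʳ K K≥0 (good-P s₁ s j₁))) (≤-trans (typ-lower s₂ (proj₁ t₂)) (*-monoʳ K K≥0 (good-P s₂ s j₂)))))
              (≤-reflexive (ring 4 λ k i p q → [] ⊢ (k :* i) :* (((p :* k) :* k) :* ((q :* k) :* k)) := (k :* ((k :* k) :* (k :* k))) :* (p :* q :* i))))))

      -- 3/4 + 3/4 + 39/40 exceeds 2 by more than 3/8.
      G₃-mass : # 3 ≤ᵣ # 8 *ᵣ E ν G₃
      G₃-mass = lin/ 5 (40 ∷ 10 ∷ 10 ∷ 1 ∷ []) 4 (λ x u v n → u :+ (v :+ n) :≤ x :+ con 2 ∷ con 3 :≤ con 4 :* u ∷ con 3 :≤ con 4 :* v ∷ con 39 :≤ con 40 :* n ∷ [] ⊢ con 3 :≤ con 8 :* x)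
        (≤-trans (≤-reflexive (sym (trans (E-+ ν (g a₁) _) (cong (Γ a₁ +ᵣ_) (E-+ ν (g a₂) _))))) (≤-trans (E-mono ν λ {y} _ → union (good? a₁ y) (good? a₂ y) (good? y y₀)) (≤-reflexive (E-+c ν (# 2) G₃))))
        (proj₂ t₁) (proj₂ t₂) near

      z : Car G
      z = X₀ a₁ +g (-g X₀ a₂)

      diff-diff : ∀ x x' y → (x +g (-g y)) +g (-g (x' +g (-g y))) ≡ x +g (-g x')
      diff-diff x x' y = trans (cong ((x +g (-g y)) +g_) (trans (g-inv-∙ G x' (-g y)) (trans (cong ((-g x') +g_) (g-inv-inv G y)) (g-comm G _ _)))) (cancel₁ x y (-g x'))

      -- Every y gives the representation z = (x₁ - y) - (x₂ - y); the division by the mass at y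
      -- makes each value of y count once.
      term-upper : E ν term ≤ᵣ q z
      term-upper = ≤-trans (≤-reflexive (trans (E-ext ν λ y → trans (cong (_*ᵣ inv (mX y)) (trans (sym (E-*ʳ ν₂ (P a₂ y) (same Dr (a₁ , y)))) (E-ext ν₂ λ w → sym (E-* ν₂ (same Dr (a₁ , y) w) (same Dr (a₂ , y))))))
            (trans (sym (E-*ʳ ν₂ (inv (mX y)) _)) (E-ext ν₂ λ w → sym (E-*ʳ ν₂ (inv (mX y)) _))))
          (trans (E-swap ν ν₂ (λ y w → E ν₂ (λ w' → same Dr (a₁ , y) w *ᵣ same Dr (a₂ , y) w' *ᵣ inv (mX y)))) (E-ext ν₂ λ w → E-swap ν ν₂ (λ y w' → same Dr (a₁ , y) w *ᵣ same Dr (a₂ , y) w' *ᵣ inv (mX y))))))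
        (E-mono ν₂ λ {w} _ → E-mono ν₂ λ {w'} _ → inner w w' (_≟g_ G z (fn Dr w +g (-g fn Dr w'))))
        where
        inner : ∀ w w' (d : Dec (z ≡ fn Dr w +g (-g fn Dr w'))) → E ν (λ y → same Dr (a₁ , y) w *ᵣ same Dr (a₂ , y) w' *ᵣ inv (mX y)) ≤ᵣ ind d
        inner w w' (yes _) = ≤-trans (E-mono ν {ψ = λ y → same Dr (a₁ , y) w *ᵣ inv (mX y)} λ {y} _ → *-monoʳ (inv (mX y)) (inv-≥0 _)
            (≤-trans (*-monoˡ _ (ind-≥0 (dec Dr (fn Dr (a₁ , y)) (fn Dr w))) (ind-≤1 (dec Dr (fn Dr (a₂ , y)) (fn Dr w')))) (lin [] 1 λ x → [] ⊢ x :* con 1 :≤ x)))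
          (class-sum ν Xv (λ y → dec Dr (fn Dr (a₁ , y)) (fn Dr w)) (λ e e' → g-inv-inj G (g-cancelˡ G (X₀ a₁) (trans e (sym e')))))
        inner w w' (no n) = E-≤c ν λ {y} _ → zero! (dec Dr (fn Dr (a₁ , y)) (fn Dr w)) (dec Dr (fn Dr (a₂ , y)) (fn Dr w')) y
          where
          zero! : ∀ {y} (d : Dec (fn Dr (a₁ , y) ≡ fn Dr w)) (e : Dec (fn Dr (a₂ , y) ≡ fn Dr w')) y' → ind d *ᵣ ind e *ᵣ inv (mX y') ≤ᵣ # 0
          zero! {y} (yes p) (yes p') _ = ⊥-elim (n (trans (sym (diff-diff (X₀ a₁) (X₀ a₂) (X₀ y))) (cong₂ (λ u v → u +g (-g v)) p p')))
          zero! (yes _) (no _) _ = lin [] 1 λ i → [] ⊢ con 1 :* con 0 :* i :≤ con 0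
          zero! (no _) e _ = lin [] 2 λ e i → [] ⊢ con 0 :* e :* i :≤ con 0

      popular : λ₀ *ᵣ # 3 ≤ᵣ # 8 *ᵣ (K⁵ *ᵣ q z)
      popular = ≤-trans (*-monoˡ λ₀ (<⇒≤ λ₀-pos) G₃-mass) (≤-trans (≤-reflexive (trans (ring 2 λ l e → [] ⊢ l :* (con 8 :* e) := con 8 :* (l :* e)) (cong (# 8 *ᵣ_) (sym (E-* ν λ₀ G₃)))))
        (*-monoˡ (# 8) (#-≥0 8) (≤-trans (E-mono ν term-lower) (≤-trans (≤-reflexive (E-* ν K⁵ term)) (*-monoˡ K⁵ K⁵≥0 term-upper)))))

    popular-all : ∀ {z} → z ∈ A ⊝ A → λ₀ *ᵣ # 3 ≤ᵣ # 8 *ᵣ (K⁵ *ᵣ q z)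
    popular-all m = let (x , x' , mx , mx' , e) = ⊝⁻ A A m ; (a , s , t , ea) = A⁻ mx ; (a' , s' , t' , ea') = A⁻ mx' in
      subst (λ z → λ₀ *ᵣ # 3 ≤ᵣ # 8 *ᵣ (K⁵ *ᵣ q z)) (sym (trans e (cong₂ (λ u v → u +g (-g v)) ea ea'))) (Pair.popular s s' t t')

    diff-count : card# (A ⊝ A) *ᵣ (λ₀ *ᵣ # 3) ≤ᵣ # 8 *ᵣ K⁵
    diff-count = ≤-trans (≤-reflexive (sym (∑-const (A ⊝ A) _))) (≤-trans (∑-mono (A ⊝ A) popular-all)
      (≤-trans (≤-reflexive (trans (∑-* (A ⊝ A) (# 8) _) (cong (# 8 *ᵣ_) (∑-* (A ⊝ A) K⁵ q)))) (*-monoˡ (# 8) (#-≥0 8) (≤-trans (*-monoˡ K⁵ K⁵≥0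
        (≤-trans (≤-reflexive (trans (sym (E-∑ ν₂ (A ⊝ A) _)) (E-ext ν₂ λ w → sym (E-∑ ν₂ (A ⊝ A) _)))) (E-≤c ν₂ λ _ → E-≤c ν₂ λ _ → unique-ind (λ z → _≟g_ G z _) (⊝-! A A) (λ _ _ e e' → trans e (sym e')))))
        (lin [] 1 λ k → [] ⊢ k :* con 1 :≤ k)))))

  -- The factor 8/3 of `diff-count` times 8/7 from `A-size-lower` is less than 4.
  κ : R
  κ = # 4 *ᵣ (K⁵ *ᵣ K)

  κ≥1 : # 1 ≤ᵣ κ
  κ≥1 = lin (4 ∷ []) 1 (λ x → con 1 :≤ x ∷ [] ⊢ con 1 :≤ con 4 :* x) (up (up K≥1 (up (up K≥1 K≥1) (up K≥1 K≥1))) K≥1)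
    where
    up : ∀ {x y} → # 1 ≤ᵣ x → # 1 ≤ᵣ y → # 1 ≤ᵣ x *ᵣ y
    up {x} {y} p q = ≤-trans (≤-reflexive (sym (*-1ˡ _))) (*-mono (#-≥0 1) (≤-trans (#-≥0 1) p) p q)

  doubling : card# (A ⊝ A) ≤ᵣ κ *ᵣ card# A
  doubling = *-cancelˡ λ₀ λ₀-pos (lin/ 6 (2 ∷ 3 ∷ 5 ∷ []) 5 (λ d l k5 k a → d :* (l :* con 3) :≤ con 8 :* k5 ∷ k5 :* con 7 :≤ k5 :* (con 8 :* (a :* (l :* k))) ∷ con 0 :≤ k5 ∷ [] ⊢ l :* d :≤ l :* (con 4 :* (k5 :* k) :* a))
    diff-count (*-monoˡ K⁵ K⁵≥0 A-size-lower) K⁵≥0)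

-- X is conditioned on having its value in A and in a coset that contains half of A. The event has
-- probability at least 1 / (4 K²), so the conditioned variable stays close to X, while it is spread
-- evenly over a coset of comparable size.
module Concentrated (G : Grp) {Ω₀ : Set} (ν : Dist Ω₀) (X₀ : Ω₀ → Car G) (c : R) (c≥0 : # 0 ≤ᵣ c)
    (small : hh (plain {G} ν X₀ ⊟ plain ν X₀) ≤ᵣ hh (plain {G} ν X₀) +ᵣ c)
    (K : R) (K>0 : # 0 <ᵣ K) (λ₀ : R) (λ₀-pos : # 0 <ᵣ λ₀) (λ₀≤1 : λ₀ ≤ᵣ # 1)
    (lv : R) (entropy-level : hh (plain {G} ν X₀) ≤ᵣ h λ₀ +ᵣ lv)
    (A : List (Car G)) (uA : Unique A)
    (weight-upper : ∀ {x} → x ∈ A → E ν (λ a → ind (_≟g_ G x (X₀ a))) ≤ᵣ λ₀ *ᵣ K)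
    (weight-lower : ∀ {x} → x ∈ A → λ₀ ≤ᵣ E ν (λ a → ind (_≟g_ G x (X₀ a))) *ᵣ K)
    (A-size-lower : # 7 ≤ᵣ # 8 *ᵣ (card# A *ᵣ (λ₀ *ᵣ K))) (A-size-upper : card# A *ᵣ λ₀ ≤ᵣ K)
    (H♯ : Sets.Subgroup G) (Cf : R) (Cf≥0 : # 0 ≤ᵣ Cf) (H-size : card# (Sets.els {G} H♯) ≤ᵣ Cf *ᵣ card# A)
    (H-centre : ∃[ b ] (b ∈ A × card# A ≤ᵣ # 2 *ᵣ ∑ A (λ a → ind (Sets._∈?_ G (_∙_ G a (_⁻ G b)) (Sets.els {G} H♯))))) where
  open Sets G
  private
    _+g_ : Car G → Car G → Car G
    _+g_ = _∙_ G
    -g_ : Car G → Car G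
    -g_ = _⁻ G
    Yo : Obj G
    Yo = plain ν X₀
    Xv : RV Ω₀
    Xv = rvg G X₀
    K≥0 : # 0 ≤ᵣ K
    K≥0 = <⇒≤ K>0
    weightOf : Car G → R
    weightOf x = E ν (λ a → ind (_≟g_ G x (X₀ a)))

  UH : Obj G
  UH = plain (uniform (els H♯) (has-ε H♯)) id

  private
    N : R
    N = card# (els H♯)
    hUH : hh UH ≡ h (inv N)
    hUH = trans (cH-const (uniform (els H♯) (has-ε H♯)) (rvg G id) ⊤ᵣ (λ _ _ → refl)) (H-uniform (els H♯) (has-ε H♯) (_≟g_ G) (uniq H♯))

    x₀ : Car G
    x₀ = proj₁ H-centre

    Ev : Ω₀ → Set
    Ev a = X₀ a ∈ A × (X₀ a +g (-g x₀)) ∈ els H♯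
    ev? : ∀ a → Dec (Ev a)
    ev? a = (X₀ a ∈? A) ×-dec ((X₀ a +g (-g x₀)) ∈? els H♯)

    Er : RV Ω₀
    Er = rv BoolP._≟_ (λ a → does (ev? a))

    -- With B = -A the sum is constant, so that conditioning on the sum and `Er` is conditioning on
    -- the event.
    open Fibre {G} ν X₀ (λ a → -g X₀ a) Er

    p₀⁻¹ : R
    p₀⁻¹ = # 4 *ᵣ (K *ᵣ K)

    p₀⁻¹>0 : # 0 <ᵣ p₀⁻¹
    p₀⁻¹>0 = *-pos (ι-pos 3) (*-pos K>0 K>0)

    event-mass : # 1 ≤ᵣ p₀⁻¹ *ᵣ E ν (λ a → ind (ev? a))
    event-mass = lin/ 4 (1 ∷ 8 ∷ 16 ∷ []) 5 (λ k l a C e → con 7 :≤ con 8 :* (a :* (l :* k)) ∷ (l :* k) :* a :≤ (l :* k) :* (con 2 :* C) ∷ k :* (l :* C) :≤ k :* (k :* e) ∷ [] ⊢ con 1 :≤ (con 4 :* (k :* k)) :* e)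
        A-size-lower (*-monoˡ (λ₀ *ᵣ K) (*-≥0 (<⇒≤ λ₀-pos) K≥0) (proj₂ (proj₂ H-centre))) (*-monoˡ K K≥0 coset)
      where
      inC : Car G → R
      inC x = ind ((x +g (-g x₀)) ∈? els H♯)
      coset : λ₀ *ᵣ ∑ A inC ≤ᵣ K *ᵣ E ν (λ a → ind (ev? a))
      coset = ≤-trans (≤-reflexive (sym (∑-* A λ₀ inC))) (≤-trans (∑-mono A {ψ = λ x → K *ᵣ (inC x *ᵣ weightOf x)} λ {x} mx →
            ≤-trans (*-monoʳ (inC x) (ind-≥0 ((x +g (-g x₀)) ∈? els H♯)) (weight-lower mx)) (lin [] 3 λ w k i → [] ⊢ (w :* k) :* i :≤ k :* (i :* w)))
        (≤-trans (≤-reflexive (trans (∑-* A K _) (cong (K *ᵣ_) (trans (∑-cong A λ {x} _ → sym (E-* ν (inC x) _)) (sym (E-∑ ν A _))))))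
          (*-monoˡ K K≥0 (E-mono ν λ {a} _ → hits a (ev? a)))))
        where
        hits : ∀ a (d : Dec (Ev a)) → ∑ A (λ x → inC x *ᵣ ind (_≟g_ G x (X₀ a))) ≤ᵣ ind d
        hits a (yes _) = ≤-trans (∑-mono A λ {x} _ → ≤-trans (*-monoʳ _ (ind-≥0 (_≟g_ G x (X₀ a))) (ind-≤1 ((x +g (-g x₀)) ∈? els H♯))) (≤-reflexive (*-1ˡ _)))
          (unique-ind (λ x → _≟g_ G x (X₀ a)) uA (λ _ _ e e' → trans e (sym e')))
        hits a (no n) = ≤-trans (∑-mono A λ {x} mx → none mx ((x +g (-g x₀)) ∈? els H♯) (_≟g_ G x (X₀ a))) (≤-reflexive (∑-0 A))
          where
          none : ∀ {x} → x ∈ A → (d : Dec ((x +g (-g x₀)) ∈ els H♯)) (e : Dec (x ≡ X₀ a)) → ind d *ᵣ ind e ≤ᵣ # 0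
          none mx (yes p) (yes refl) = ⊥-elim (n (mx , p))
          none _ (yes _) (no _) = lin [] 0 ([] ⊢ con 1 :* con 0 :≤ con 0)
          none _ (no _) e = lin [] 1 λ e → [] ⊢ con 0 :* e :≤ con 0

    v : Ω₀ → R
    v a = hh (Yo ⊟ fibre a) +ᵣ (# 9 -ᵣ hh Yo)

    v≥0 : ∀ a → # 0 ≤ᵣ v a
    v≥0 a = lin (1 ∷ []) 2 (λ x y → y :≤ x :+ con 9 ∷ [] ⊢ con 0 :≤ x :+ (con 9 :- y)) (hh-⊞-mono Yo (neg (fibre a)))

    E-v : E ν v ≤ᵣ c +ᵣ # 15
    E-v = ≤-trans (≤-reflexive (E-+c ν _ _)) (lin (1 ∷ 1 ∷ 1 ∷ []) 5 (λ e w d y c → e :≤ w :+ con 3 ∷ w :≤ d :+ con 3 ∷ d :≤ y :+ c ∷ [] ⊢ e :+ (con 9 :- y) :≤ c :+ con 15)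
      (fibre-diff Yo) (cond-more (ν ⊗ ν) (Xr (Yo ⊟ whole)) (⊤ᵣ ⊗ᵣ ⊤ᵣ) (⊤ᵣ ⊗ᵣ F) (λ _ → refl)) small)

    t₀ : R
    t₀ = (c +ᵣ # 16) *ᵣ p₀⁻¹

    -- Otherwise v would exceed t₀ throughout the event, and its mean would be at least c + 16,
    -- against `E-v`.
    chosen : ∃[ a ] (Supp ν a × (Ev a × v a ≤ᵣ t₀))
    chosen = conclude (findSupp ν (λ a → ev? a ×-dec (v a ≤? t₀)))
      where
      module _ (none : ∀ {a} → Supp ν a → ¬ (Ev a × v a ≤ᵣ t₀)) where
        each : ∀ a → Supp ν a → (d : Dec (Ev a)) → t₀ *ᵣ ind d ≤ᵣ v a
        each a s (no _) = ≤-trans (lin [] 1 λ t → [] ⊢ t :* con 0 :≤ con 0) (v≥0 a)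
        each a s (yes e) = ≤-trans (lin [] 1 λ t → [] ⊢ t :* con 1 :≤ t) (<⇒≤ (≰⇒> λ le → none s (e , le)))
        absurd : ⊥
        absurd = <⇒≱ (ι-pos 0) (lin (1 ∷ 1 ∷ []) 2 (λ c e → c :+ con 16 :≤ e ∷ e :≤ c :+ con 15 ∷ [] ⊢ con 1 :≤ con 0)
          (≤-trans (≤-trans (lin [] 1 λ c → [] ⊢ c :+ con 16 :≤ (c :+ con 16) :* con 1) (*-monoˡ (c +ᵣ # 16) (≤-trans c≥0 (lin [] 1 λ c → [] ⊢ c :≤ c :+ con 16)) event-mass))
            (≤-trans (≤-reflexive (trans (sym (*-assoc (c +ᵣ # 16) p₀⁻¹ _)) (sym (E-* ν t₀ (λ a → ind (ev? a)))))) (E-mono ν λ {a} s → each a s (ev? a)))) E-v)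
      conclude : (∃[ a ] (Supp ν a × (Ev a × v a ≤ᵣ t₀))) ⊎ (∀ {a} → Supp ν a → ¬ (Ev a × v a ≤ᵣ t₀)) → ∃[ a ] (Supp ν a × (Ev a × v a ≤ᵣ t₀))
      conclude (inj₁ r) = r
      conclude (inj₂ none) = ⊥-elim (absurd none)

    a⋆ : Ω₀
    a⋆ = proj₁ chosen
    s⋆ : Supp ν a⋆
    s⋆ = proj₁ (proj₂ chosen)
    e⋆ : Ev a⋆
    e⋆ = proj₁ (proj₂ (proj₂ chosen))
    Y₁ : Obj G
    Y₁ = fibre a⋆
    ν₁ : Dist Ω₀
    ν₁ = cond ν F a⋆

    does-yes : ∀ {P : Set} (d : Dec P) → does d ≡ true → P
    does-yes (yes p) _ = p
    does-true : ∀ {P : Set} (d : Dec P) → P → does d ≡ true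
    does-true (yes _) _ = refl
    does-true (no n) p = ⊥-elim (n p)

    in-event : ∀ {b} → Supp ν₁ b → Ev b
    in-event {b} s = does-yes (ev? b) (trans (sym (proj₂ (,-inj (proj₂ (Supp-cond ν F s⋆ s))))) (does-true (ev? a⋆) e⋆))

    F-mass : # 1 ≤ᵣ p₀⁻¹ *ᵣ mass ν F a⋆
    F-mass = ≤-trans event-mass (*-monoˡ p₀⁻¹ (<⇒≤ p₀⁻¹>0) (E-mono ν λ {b} _ → ind-mono (ev? b) (dec F (fn F a⋆) (fn F b))
      λ e → cong₂ _,_ (trans (g-invʳ G _) (sym (g-invʳ G _))) (trans (does-true (ev? a⋆) e⋆) (sym (does-true (ev? b) e)))))

    r₀ : R
    r₀ = K *ᵣ p₀⁻¹

    r₀≥0 : # 0 ≤ᵣ r₀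
    r₀≥0 = *-≥0 K≥0 (<⇒≤ p₀⁻¹>0)

    inv-F : inv (mass ν F a⋆) ≤ᵣ p₀⁻¹
    inv-F = *-cancelˡ (mass ν F a⋆) (mass-pos ν F s⋆) (≤-trans (≤-reflexive (inv-r (mass-pos ν F s⋆))) (≤-trans F-mass (≤-reflexive (*-comm _ _))))

    atom : ∀ {b} → Supp ν₁ b → mass ν₁ Xv b ≤ᵣ r₀ *ᵣ λ₀
    atom {b} s = ≤-trans (≤-reflexive (E-cond ν F s⋆ (same Xv b))) (≤-trans (*-monoʳ _ (inv-≥0 _) (≤-trans (E-mono ν {ψ = same Xv b} λ {b'} _ →
          ≤-trans (*-monoʳ _ (ind-≥0 (dec Xv (fn Xv b) (fn Xv b'))) (ind-≤1 (dec F (fn F a⋆) (fn F b')))) (≤-reflexive (*-1ˡ _))) (weight-upper (proj₁ (in-event s)))))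
        (≤-trans (*-monoˡ _ (*-≥0 (<⇒≤ λ₀-pos) K≥0) inv-F) (lin [] 3 λ l k p → [] ⊢ (l :* k) :* p :≤ (k :* p) :* l)))

    -- Conditioning enlarges masses by at most the factor p₀⁻¹, so no atom lies far above λ₀.
    Y₁-lower : h λ₀ ≤ᵣ hh Y₁ +ᵣ (r₀ +ᵣ # 1)
    Y₁-lower = ≤-trans (≤-reflexive (sym (E-const ν₁ _))) (≤-trans (E-mono ν₁ {ψ = λ b → h (mass ν₁ Xv b) +ᵣ (r₀ +ᵣ # 1)} λ s →
        ≤-trans (h-log λ₀-pos λ₀≤1 (mass-pos ν₁ Xv s) r₀≥0 (atom s)) (lin [] 2 λ x r → [] ⊢ x :+ r :+ con 1 :≤ x :+ (r :+ con 1)))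
      (≤-reflexive (trans (E-+c ν₁ _ _) (cong (_+ᵣ (r₀ +ᵣ # 1)) (trans (sym (H-def ν₁ Xv)) (sym (cH-const ν₁ Xv ⊤ᵣ (λ _ _ → refl))))))))

    shift : List (Car G)
    shift = List.map (x₀ +g_) (els H♯)

    Y₁+UH : hh (Y₁ ⊞ UH) ≤ᵣ h (inv N) +ᵣ # 2
    Y₁+UH = ≤-trans (≤-reflexive (cH-const _ _ _ (λ _ _ → refl))) (≤-trans (H-card (ν₁ ⊗ μ UH) (Xr (Y₁ ⊞ UH)) shift (∈P.∈-map⁺ (x₀ +g_) (has-ε H♯))
        λ {p} s → let (s₁ , s₂) = Supp-bind ν₁ (λ _ → μ UH) s in subst (_∈ shift) (trans (g-comm G x₀ _) (trans (g-assoc G _ _ x₀) (trans (cong ((X₀ (proj₁ p) +g (-g x₀)) +g_) (g-comm G _ x₀)) (trans (sym (g-assoc G _ x₀ _)) (cong (_+g proj₂ p) (sub-add (X₀ (proj₁ p)) x₀))))))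
           (∈P.∈-map⁺ (x₀ +g_) (closed H♯ (proj₂ (in-event s₁)) (Supp-uniform (els H♯) (has-ε H♯) s₂))))
      (≤-reflexive (cong (λ k → h (inv (# k)) +ᵣ # 2) (ListP.length-map (x₀ +g_) (els H♯)))))

    r₁' : R
    r₁' = Cf *ᵣ K

    N-level : h (inv N) ≤ᵣ h λ₀ +ᵣ r₁' +ᵣ # 1
    N-level = h-log (inv-pos N>0) inv≤1 λ₀-pos (*-≥0 Cf≥0 K≥0) (≤-trans (inv-intro N>0 (≤-trans (*-monoˡ λ₀ (<⇒≤ λ₀-pos) H-size)
        (≤-trans (lin [] 3 λ l c a → [] ⊢ l :* (c :* a) :≤ c :* (a :* l)) (*-monoˡ Cf Cf≥0 A-size-upper)))) ≤-refl)
      where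
      N>0 : # 0 <ᵣ N
      N>0 = card#-pos (has-ε H♯)
      inv≤1 : inv N ≤ᵣ # 1
      inv≤1 = ≤-trans (≤-trans (≤-reflexive (sym (*-1ˡ _))) (*-monoʳ (inv N) (inv-≥0 N) (≥1 (els H♯) (has-ε H♯)))) (≤-reflexive (inv-r N>0))
        where
        ≥1 : ∀ L {x : Car G} → x ∈ L → # 1 ≤ᵣ card# L
        ≥1 (x ∷ L) _ = #-mono (s≤s z≤n)

  base-constant : R
  base-constant = lv +ᵣ # 68 +ᵣ r₁' +ᵣ # 2 *ᵣ (t₀ +ᵣ r₀)

  -- The triangle inequality through the conditioned variable, whose sum with a uniform element of
  -- the subgroup stays within one coset.
  near-subgroup : hh (Yo ⊞ UH) +ᵣ hh (Yo ⊞ UH) -ᵣ hh Yo -ᵣ hh UH ≤ᵣ base-constant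
  near-subgroup = lin (2 ∷ 2 ∷ 2 ∷ 2 ∷ 1 ∷ 1 ∷ 1 ∷ []) 12 (λ yu y u d y1 yu1 hN l lv r0 r1 t →
        yu :+ y1 :≤ d :+ yu1 :+ con 27 ∷ d :+ (con 9 :- y) :≤ t ∷ yu1 :≤ hN :+ con 2 ∷ l :≤ y1 :+ (r0 :+ con 1) ∷ y :≤ l :+ lv ∷ hN :≤ l :+ r1 :+ con 1 ∷ hN :≤ u ∷ []
        ⊢ yu :+ yu :- y :- u :≤ lv :+ con 68 :+ r1 :+ con 2 :* (t :+ r0))
    (triangle Yo Y₁ UH) (proj₂ (proj₂ (proj₂ chosen))) Y₁+UH Y₁-lower entropy-level N-level (≤-reflexive (sym hUH))

-- Marton's conjecture for random variables and for sets.

record NearSubgroup (G : Grp) (Y : Obj G) (C : R) : Set₁ where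
  field
    grp : Sets.Subgroup G
  unif : Obj G
  unif = plain (uniform (Sets.els {G} grp) (Sets.has-ε {G} grp)) id
  field
    bound : hh (Y ⊞ unif) +ᵣ hh (Y ⊞ unif) -ᵣ hh Y -ᵣ hh unif ≤ᵣ C

-- The constants of the level set, of Freiman's theorem and of the conditioning as functions of m
-- and c alone: a bound that is uniform over random variables must not mention the particular one.
baseK baseκ₂ : R → R
baseK c = pow2 (suc (suc (proj₁ (archimedean (# 40 *ᵣ (# 2 *ᵣ c +ᵣ # 6 +ᵣ # 1))))))
baseκ₂ c = # 2 *ᵣ (κ *ᵣ κ)
  where
  K κ : R
  K = baseK c
  κ = # 4 *ᵣ (K *ᵣ ((K *ᵣ K) *ᵣ (K *ᵣ K)) *ᵣ K)

baseF : ℕ → R → R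
baseF m k = # (suc m ℕ.^ proj₁ (archimedean (# 2 *ᵣ (k *ᵣ (k *ᵣ (k *ᵣ k)))))) *ᵣ (k *ᵣ k)

baseC : ℕ → R → R
baseC m c = (# 2 *ᵣ c +ᵣ # 7) +ᵣ # 68 +ᵣ baseF m (baseκ₂ c) *ᵣ K +ᵣ # 2 *ᵣ ((c +ᵣ # 16) *ᵣ (# 4 *ᵣ (K *ᵣ K)) +ᵣ K *ᵣ (# 4 *ᵣ (K *ᵣ K)))
  where
  K : R
  K = baseK c

module _ {G : Grp} (m : ℕ) (torsion : ∀ x → times G (suc m) x ≡ ε G) (1≤m : 1 ℕ.≤ m) where
  plain-near : ∀ {Ω} (ν : Dist Ω) (X₀ : Ω → Car G) (c : R) → # 0 ≤ᵣ c → hh (plain {G} ν X₀ ⊟ plain ν X₀) ≤ᵣ hh (plain {G} ν X₀) +ᵣ c →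
    NearSubgroup G (plain ν X₀) (baseC m c)
  plain-near ν X₀ c c≥0 small = record { grp = H₀ ; bound = C.near-subgroup }
    where
    open LevelSet G ν X₀ c c≥0 small
    open Sets.Freiman G m torsion 1≤m A uA (proj₂ A-inhabited) κ κ≥1 doubling
    k₂ : # 0 ≤ᵣ # 2 *ᵣ (κ *ᵣ κ)
    k₂ = *-≥0 (#-≥0 2) (*-≥0 (≤-trans (#-≥0 1) κ≥1) (≤-trans (#-≥0 1) κ≥1))
    module C = Concentrated G ν X₀ c c≥0 small K K>0 λ₀ λ₀-pos λ₀≤1 (# 2 *ᵣ c +ᵣ # 7) entropy-level A uA weight-upper weight-lower A-size-lower A-size-upper
      H₀ H₀-constant (*-≥0 (#-≥0 _) (*-≥0 k₂ k₂)) H₀-size H₀-centre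

  transfer : ∀ {O Y : Obj G} {C c} → Close O Y c → NearSubgroup G Y C → NearSubgroup G O (C +ᵣ c)
  transfer {O} {Y} {C} {c} cl N = record { grp = grp ; bound = lin (1 ∷ 1 ∷ []) 7 (λ ou o yu y u C c → ou :+ ou :- o :≤ yu :+ yu :- y :+ c ∷ yu :+ yu :- y :- u :≤ C ∷ [] ⊢ ou :+ ou :- o :- u :≤ C :+ c) (cl unif) bound }
    where open NearSubgroup N

  weaken : ∀ {O C C'} → C ≤ᵣ C' → NearSubgroup G O C → NearSubgroup G O C'
  weaken p N = record { grp = NearSubgroup.grp N ; bound = ≤-trans (NearSubgroup.bound N) p }

  -- Side information has to be removed before a level set can be taken. With B = -A and Q = `T O`
  -- the fibres are X conditioned on the values of its side information, and on average they are
  -- close to O.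
  small-near : ∀ (O : Obj G) k → # 0 ≤ᵣ k → hh (O ⊞ O) -ᵣ hh O ≤ᵣ k → NearSubgroup G O (baseC m (# 4 *ᵣ k +ᵣ # 89) +ᵣ (# 4 *ᵣ k +ᵣ # 116))
  small-near O k k≥0 le = transfer {O} {fibre a⋆} (λ V → ≤-trans (close-via-diff O (fibre a⋆) V)
        (lin (1 ∷ []) 5 (λ x d o y k → con 2 :* d :+ (con 18 :- o) :- y :≤ con 4 :* k :+ con 80 ∷ [] ⊢ x :+ (d :+ d :- o :- y :+ con 54) :≤ x :+ (con 4 :* k :+ con 116)) p⋆))
      (plain-near (cond (μ O) F a⋆) (X O) (# 4 *ᵣ k +ᵣ # 89) (lin (4 ∷ []) 1 (λ k → con 0 :≤ k ∷ [] ⊢ con 0 :≤ con 4 :* k :+ con 89) k≥0)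
        (lin (1 ∷ 1 ∷ 1 ∷ []) 6 (λ yy o yo oy y k → yy :+ o :≤ yo :+ oy :+ con 27 ∷ yo :≤ oy ∷ con 2 :* oy :+ (con 18 :- o) :- y :≤ con 4 :* k :+ con 80 ∷ [] ⊢ yy :≤ y :+ (con 4 :* k :+ con 89))
          (triangle (fibre a⋆) O (neg (fibre a⋆)))
          (≤-reflexive (trans (sym (hh-neg (fibre a⋆ ⊟ O))) (hh-⇒ {A = neg (fibre a⋆ ⊟ O)} {B = O ⊟ fibre a⋆} (mk⇒ swap× (Law-swap (cond (μ O) F a⋆) (μ O))
            (λ p → trans (g-inv-∙ G _ _) (trans (g-comm G _ _) (cong (λ z → _∙_ G z (_⁻ G (X O (proj₁ p)))) (g-inv-inv G _)))) (λ e → let (s , t) = ,-inj e in cong₂ _,_ t s) (λ e → let (s , t) = ,-inj e in cong₂ _,_ t s)))))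
          p⋆))
    where
    open Fibre {G} (μ O) (X O) (λ a → _⁻ G (X O a)) (T O)
    whole⇒ : whole ⇒ O
    whole⇒ = mk⇒ id Law-id (λ _ → refl) (λ e → proj₂ (,-inj e)) (λ e → cong₂ _,_ (trans (g-invʳ G _) (sym (g-invʳ G _))) e)
    ψ : Ω O → R
    ψ a = # 2 *ᵣ hh (O ⊟ fibre a) +ᵣ (# 18 -ᵣ hh O) -ᵣ hh (fibre a)
    E-ψ : E (μ O) ψ ≤ᵣ # 4 *ᵣ k +ᵣ # 79
    E-ψ = ≤-trans (≤-reflexive (trans (E-sub (μ O) _ _) (cong (_-ᵣ E (μ O) (λ a → hh (fibre a))) (trans (E-+c (μ O) (# 18 -ᵣ hh O) _) (cong (_+ᵣ (# 18 -ᵣ hh O)) (E-* (μ O) (# 2) _))))))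
      (lin (2 ∷ 2 ∷ 1 ∷ 1 ∷ 2 ∷ 2 ∷ []) 8 (λ e w d f o w' o2 k → e :≤ w :+ con 3 ∷ w :≤ d ∷ w' :≤ f :+ con 1 ∷ o :≤ w' ∷ d :+ o :≤ o2 :+ o2 :+ con 27 ∷ (o2 :+ o2 :- o :- o :≤ k :+ k) ∷ [] ⊢ con 2 :* e :+ (con 18 :- o) :- f :≤ con 4 :* k :+ con 79)
        (fibre-diff O) (≤-reflexive (hh-⇒ (⇒-⊞ {A = O} {B = neg whole} ⇒-id (⇒-neg whole⇒)))) fibre-lower (≤-reflexive (sym (hh-⇒ whole⇒))) (sum-diff O)
        (lin (2 ∷ []) 3 (λ a b k → a :- b :≤ k ∷ [] ⊢ a :+ a :- b :- b :≤ k :+ k) le))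
    pick : ∃[ a ] (Supp (μ O) a × ψ a ≤ᵣ # 4 *ᵣ k +ᵣ # 80)
    pick = E-exists (μ O) ψ _ (≤-<-trans E-ψ (≰⇒> λ q → <⇒≱ (ι-pos 0) (lin (1 ∷ []) 1 (λ k → con 4 :* k :+ con 80 :≤ con 4 :* k :+ con 79 ∷ [] ⊢ con 1 :≤ con 0) q)))
    a⋆ : Ω O
    a⋆ = proj₁ pick
    p⋆ : ψ a⋆ ≤ᵣ # 4 *ᵣ k +ᵣ # 80
    p⋆ = proj₂ (proj₂ pick)

module Marton (G : Grp) (m : ℕ) (torsion : ∀ x → times G (suc (suc m)) x ≡ ε G) where
  open Decrement G m torsion

  -- `slope` is the movement C₁ D of a round relative to its gain D / N. The summand `slope` times 9
  -- in C₀ allows for a doubling as low as -9, which rounding permits.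
  c₀ C₀ slope : R
  c₀ = # 1300 *ᵣ (n *ᵣ n)
  slope = C₁ *ᵣ N
  C₀ = baseC (suc m) (# 4 *ᵣ (c₀ +ᵣ # 9) +ᵣ # 89) +ᵣ (# 4 *ᵣ (c₀ +ᵣ # 9) +ᵣ # 116) +ᵣ slope *ᵣ # 9

  slope≥0 : # 0 ≤ᵣ slope
  slope≥0 = *-≥0 C₁≥0 (<⇒≤ N-pos)

  c₀≥0 : # 0 ≤ᵣ c₀
  c₀≥0 = *-≥0 (#-≥0 1300) (≤-trans (#-≥0 1) n²≥1)

  -- A round costs at most `slope` times the decrease of the doubling, so a bound linear in the
  -- doubling survives the induction. Above the threshold the decrease is at least 13, hence one
  -- unit of fuel pays for a round.
  subgroup-near : ∀ fuel (O : Obj G) → Dbl O ≤ᵣ c₀ +ᵣ # fuel → NearSubgroup G O (slope *ᵣ Dbl O +ᵣ C₀)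
  small-case : ∀ (O : Obj G) → Dbl O ≤ᵣ c₀ → NearSubgroup G O (slope *ᵣ Dbl O +ᵣ C₀)
  small-case O le = weaken (suc m) torsion (s≤s z≤n) {O} (lin (1 ∷ []) 4 (λ b z s D → con 0 :≤ s :* (D :+ con 9) ∷ [] ⊢ b :+ z :≤ s :* D :+ (b :+ z :+ s :* con 9)) (*-≥0 slope≥0 (Dbl-≥ O)))
    (small-near (suc m) torsion (s≤s z≤n) O (c₀ +ᵣ # 9) (≤-trans c₀≥0 (lin [] 1 λ c → [] ⊢ c :≤ c :+ con 9)) (≤-trans (Dbl-lower O) (+-mono le ≤-refl)))
  subgroup-near zero O le = small-case O (≤-trans le (lin [] 1 λ c → [] ⊢ c :+ con 0 :≤ c))
  subgroup-near (suc fuel) O le = decide (c₀ ≤? Dbl O)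
    where
    decide : Dec (c₀ ≤ᵣ Dbl O) → NearSubgroup G O (slope *ᵣ Dbl O +ᵣ C₀)
    decide (no q) = small-case O (<⇒≤ (≰⇒> q))
    decide (yes q) = let (O' , better , close) = Step.decrement O q in
      weaken (suc m) torsion (s≤s z≤n) {O} (lin (1 ∷ []) 5 (λ C N D D' z → C :* (N :* D' :+ D) :≤ C :* (N :* D) ∷ [] ⊢ (C :* N) :* D' :+ z :+ C :* D :≤ (C :* N) :* D :+ z) (*-monoˡ C₁ C₁≥0 better))
        (transfer (suc m) torsion (s≤s z≤n) {O} {O'} close (subgroup-near fuel O' (smaller O' better)))
      where
      smaller : ∀ O' → N *ᵣ Dbl O' +ᵣ Dbl O ≤ᵣ N *ᵣ Dbl O → Dbl O' ≤ᵣ c₀ +ᵣ # fuel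
      smaller O' p = *-cancelˡ N N-pos (lin (1 ∷ 1 ∷ 1 ∷ 1200 ∷ []) 4 (λ k D D' f → con 100 :* k :* D' :+ D :≤ con 100 :* k :* D ∷ con 1300 :* k :≤ D ∷ (con 100 :* k) :* D :≤ (con 100 :* k) :* (con 1300 :* k :+ (con 1 :+ f)) ∷ con 0 :≤ k ∷ []
          ⊢ (con 100 :* k) :* D' :≤ (con 100 :* k) :* (con 1300 :* k :+ f))
        p q (*-monoˡ N (<⇒≤ N-pos) (subst (λ z → Dbl O ≤ᵣ c₀ +ᵣ z) (#-+ 1 fuel) le)) (≤-trans (#-≥0 1) n²≥1))

#-* : ∀ m n → # (m ℕ.* n) ≡ # m *ᵣ # n
#-* m n = trans (cong ι (ℤP.pos-* m n)) (ι-* (+ m) (+ n))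

h-pow2 : ∀ {x y} κ → # 0 <ᵣ x → x ≤ᵣ # 1 → # 0 <ᵣ y → y ≤ᵣ x *ᵣ pow2 κ → h x ≤ᵣ h y +ᵣ # κ
h-pow2 {x} {y} κ px x1 py le = ≤-trans (#-mono {hn x} {hn y ℕ.+ κ} (ℕP.≮⇒≥ λ lt → <⇒≱ (hn-hi py)
    (≤-trans (*-monoʳ (pow2 (suc (hn y))) (pow2-≥0 (suc (hn y))) le) (≤-trans (≤-reflexive (trans (*-assoc x _ _) (cong (x *ᵣ_) (trans (sym (pow2-+ κ (suc (hn y)))) (cong pow2 (ℕP.+-comm κ (suc (hn y))))))))
      (≤-trans (*-monoˡ x (<⇒≤ px) (pow2-mono {suc (hn y ℕ.+ κ)} lt)) (hn-lo x1)))))) (≤-reflexive (#-+ (hn y) κ))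

inv-≤1 : ∀ {A : Set} {xs : List A} {a} → a ∈ xs → inv (card# xs) ≤ᵣ # 1
inv-≤1 {xs = xs} m = ≤-trans (≤-reflexive (ring 1 λ x → [] ⊢ x := x :* con 1)) (≤-trans (*-monoˡ (inv (card# xs)) (inv-≥0 _) (one m)) (≤-reflexive (trans (*-comm _ _) (inv-r (card#-pos m)))))
  where
  one : ∀ {A : Set} {xs : List A} {a} → a ∈ xs → # 1 ≤ᵣ card# xs
  one {xs = x ∷ xs} _ = #-mono (s≤s z≤n)

inv-ratio : ∀ {x y k} → # 0 <ᵣ x → # 0 <ᵣ y → y ≤ᵣ x *ᵣ k → inv x ≤ᵣ inv y *ᵣ k
inv-ratio {x} {y} {k} px py le = ≤-trans (≤-reflexive (sym (*-cancel-1 (inv-r py)))) (≤-trans (≤-reflexive (trans (cong (inv x *ᵣ_) (*-comm y _)) (ring 3 λ x i y → [] ⊢ x :* (i :* y) := (x :* i) :* y)))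
  (≤-trans (*-monoˡ _ (*-≥0 (inv-≥0 _) (inv-≥0 _)) le) (≤-reflexive (trans (ring 4 λ i j x k → [] ⊢ (i :* j) :* (x :* k) := (j :* k) :* (x :* i)) (*-cancel-1 (inv-r px))))))

card#-filter : ∀ {A : Set} {P : A → Set} (p : ∀ a → Dec (P a)) xs → card# (List.filter p xs) ≡ ∑ xs (λ a → ind (p a))
card#-filter p [] = refl
card#-filter p (x ∷ xs) with p x
... | yes _ = trans (#-+ 1 _) (cong (# 1 +ᵣ_) (card#-filter p xs))
... | no _ = trans (card#-filter p xs) (sym (+-0ˡ _))

module SetMarton (G : Grp) (m : ℕ) (torsion : ∀ x → times G (suc (suc m)) x ≡ ε G) where
  open Marton G m torsion
  open Decrement G m torsion using (Dbl; n'; n'≥1; tl)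
  open Sets G
  private
    _+g_ : Car G → Car G → Car G
    _+g_ = _∙_ G
    -g_ : Car G → Car G
    -g_ = _⁻ G
    e₁ e₂ : ℕ
    e₁ = proj₁ (archimedean (slope *ᵣ n'))
    e₂ = proj₁ (archimedean (slope *ᵣ (# 17 *ᵣ n' +ᵣ # 3) +ᵣ C₀ +ᵣ # 10))

  inCoset? : ∀ H v a → Dec (a +g (-g v) ∈ els H)
  inCoset? H v a = a +g (-g v) ∈? els H

  slice : Subgroup → Car G → List (Car G) → List (Car G)
  slice H v A = List.filter (inCoset? H v) A

  -- The entropic bound is affine in κ; its constant part e₂ becomes linear because κ ≥ 1, and the
  -- extra 1 pays for the rounding in `level`.
  exponent : ℕ
  exponent = suc (e₁ ℕ.+ e₂)

  module _ (A : List (Car G)) (uA : Unique A) {a₀ : Car G} (a₀∈ : a₀ ∈ A) (κ : ℕ) (1≤κ : 1 ℕ.≤ κ) (small : card# (A ⊕ A) ≤ᵣ card# A *ᵣ pow2 κ) where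
    private
      μA : Dist (Car G)
      μA = uniform A a₀∈
      O : Obj G
      O = plain μA id

      hO : hh O ≡ h (inv (card# A))
      hO = trans (cH-const μA (rvg G id) ⊤ᵣ (λ _ _ → refl)) (H-uniform A a₀∈ (_≟g_ G) uA)

      hOO : hh (O ⊞ O) ≤ᵣ h (inv (card# A)) +ᵣ (# κ +ᵣ # 2)
      hOO = ≤-trans (≤-reflexive (cH-const (μA ⊗ μA) (Xr (O ⊞ O)) (⊤ᵣ ⊗ᵣ ⊤ᵣ) (λ _ _ → refl))) (≤-trans (H-card (μA ⊗ μA) (Xr (O ⊞ O)) (A ⊕ A) (⊕⁺ {A} {A} a₀∈ a₀∈)
          (λ s → let (s₁ , s₂) = Supp-bind μA (λ _ → μA) s in ⊕⁺ {A} {A} (Supp-uniform A a₀∈ s₁) (Supp-uniform A a₀∈ s₂)))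
        (lin (1 ∷ []) 3 (λ x y k → x :≤ y :+ k ∷ [] ⊢ x :+ con 2 :≤ y :+ (k :+ con 2))
          (h-pow2 κ (inv-pos pAA) (inv-≤1 a∈) (inv-pos pA) (inv-ratio pA pAA small))))
        where
        a∈ : a₀ +g a₀ ∈ A ⊕ A
        a∈ = ⊕⁺ {A} {A} a₀∈ a₀∈
        pAA : # 0 <ᵣ card# (A ⊕ A)
        pAA = card#-pos a∈
        pA : # 0 <ᵣ card# A
        pA = card#-pos a₀∈

      Dbl-upper : Dbl O ≤ᵣ n' *ᵣ (# κ +ᵣ # 17) +ᵣ # 3
      Dbl-upper = ≤-trans (lin (1 ∷ []) 4 (λ s o n x → s :≤ o :+ n :* x :+ con 3 ∷ [] ⊢ s :- o :≤ n :* x :+ con 3) (npow-upper O 0 (1 ∷ tl)))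
        (+-mono (*-monoˡ n' (≤-trans (#-≥0 1) n'≥1) (lin (1 ∷ 1 ∷ []) 4 (λ oo o a k → oo :≤ a :+ (k :+ con 2) ∷ a :≤ o ∷ [] ⊢ oo :- o :+ con 15 :≤ k :+ con 17) hOO (≤-reflexive (sym hO)))) ≤-refl)

      near : NearSubgroup G O (slope *ᵣ Dbl O +ᵣ C₀)
      near = let (f , le) = archimedean (Dbl O) in subgroup-near f O (≤-trans le (lin (1 ∷ []) 2 (λ f c → con 0 :≤ c ∷ [] ⊢ f :≤ c :+ f) c₀≥0))

      M : ℕ
      M = (e₁ ℕ.+ e₂) ℕ.* κ

      constant : slope *ᵣ Dbl O +ᵣ C₀ +ᵣ # 10 ≤ᵣ # M
      constant = ≤-trans (lin (1 ∷ 1 ∷ 1 ∷ 1 ∷ []) 7 (λ s D n k c x y → s :* D :≤ s :* (n :* (k :+ con 17) :+ con 3) ∷ s :* n :* k :≤ x :* k ∷ s :* (con 17 :* n :+ con 3) :+ c :+ con 10 :≤ y ∷ y :* con 1 :≤ y :* k ∷ []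
            ⊢ s :* D :+ c :+ con 10 :≤ x :* k :+ y :* k)
          (*-monoˡ slope slope≥0 Dbl-upper) (*-monoʳ (# κ) (#-≥0 κ) (proj₂ (archimedean (slope *ᵣ n')))) (proj₂ (archimedean (slope *ᵣ (# 17 *ᵣ n' +ᵣ # 3) +ᵣ C₀ +ᵣ # 10))) (*-monoˡ (# e₂) (#-≥0 e₂) (#-mono 1≤κ)))
        (≤-reflexive (trans (ring 3 λ x y k → [] ⊢ x :* k :+ y :* k := (x :+ y) :* k) (trans (cong (_*ᵣ # κ) (sym (#-+ e₁ e₂))) (sym (#-* (e₁ ℕ.+ e₂) κ)))))

      open NearSubgroup near
      N : R
      N = card# (els grp)
      Q : Obj G
      Q = O ⊞ unif
      ν : Dist (Car G × Car G)
      ν = μA ⊗ uniform (els grp) (has-ε grp)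
      hU : hh unif ≡ h (inv N)
      hU = trans (cH-const (uniform (els grp) (has-ε grp)) (rvg G id) ⊤ᵣ (λ _ _ → refl)) (H-uniform (els grp) (has-ε grp) (_≟g_ G) (uniq grp))
      hQ : hh Q ≡ E ν (λ ω → h (mass ν (Xr Q) ω))
      hQ = trans (cH-const ν (Xr Q) (⊤ᵣ ⊗ᵣ ⊤ᵣ) (λ _ _ → refl)) (H-def ν (Xr Q))

      pick : ∃[ ω ] (Supp ν ω × h (mass ν (Xr Q) ω) ≤ᵣ hh Q +ᵣ # 1)
      pick = E-exists ν (λ ω → h (mass ν (Xr Q) ω)) (hh Q +ᵣ # 1) (≤-<-trans (≤-reflexive (sym hQ)) (≰⇒> λ q → <⇒≱ (ι-pos 0) (lin (1 ∷ []) 1 (λ c → c :+ con 1 :≤ c ∷ [] ⊢ con 1 :≤ con 0) q)))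

      ω⋆ : Car G × Car G
      ω⋆ = proj₁ pick
      v : Car G
      v = X Q ω⋆

      -- If a + u = v with u in the subgroup, then a lies in the coset of v and u is determined, so
      -- the mass of v counts the points of A in that coset.
      mass-v : mass ν (Xr Q) ω⋆ ≤ᵣ (inv (card# A) *ᵣ inv N) *ᵣ card# (slice grp v A)
      mass-v = ≤-trans (≤-reflexive (trans (E-⊗ μA (uniform (els grp) (has-ε grp)) _) (trans (E-uniform A a₀∈ _) (cong (inv (card# A) *ᵣ_) (∑-cong A λ _ → E-uniform (els grp) (has-ε grp) _)))))
          (≤-trans (*-monoˡ (inv (card# A)) (inv-≥0 _) (≤-trans (≤-reflexive (∑-* A (inv N) _)) (*-monoˡ (inv N) (inv-≥0 _) (∑-mono A λ {a} _ → row a (inCoset? grp v a)))))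
            (≤-reflexive (trans (sym (*-assoc _ _ _)) (cong ((inv (card# A) *ᵣ inv N) *ᵣ_) (sym (card#-filter (inCoset? grp v) A))))))
        where
        row : ∀ a (d : Dec (a +g (-g v) ∈ els grp)) → ∑ (els grp) (λ u → ind (_≟g_ G v (a +g u))) ≤ᵣ ind d
        row a (yes _) = unique-ind (λ u → _≟g_ G v (a +g u)) (uniq grp) (λ _ _ e e' → g-cancelˡ G a (trans (sym e) e'))
        row a (no n) = ≤-trans (∑-mono (els grp) λ {u} mu → ≤-reflexive (ind-no (_≟g_ G v (a +g u)) λ e → n (subst (_∈ els grp)
          (trans (sym (trans (cong (_+g (-g u)) (g-invʳ G a)) (g-idˡ G _))) (trans (g-assoc G a (-g a) (-g u)) (cong (a +g_) (trans (sym (g-inv-∙ G a u)) (cong -g_ (sym e)))))) (closed⁻ grp mu)))) (≤-reflexive (∑-0 (els grp)))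

      extract : ∀ {x y} → # 0 <ᵣ x → # 0 <ᵣ y → inv x ≤ᵣ # 1 → hh Q +ᵣ # 1 ≤ᵣ h (inv x) +ᵣ # M → mass ν (Xr Q) ω⋆ ≤ᵣ (inv x *ᵣ inv y) *ᵣ card# (slice grp v A) → y ≤ᵣ pow2 (exponent ℕ.* κ) *ᵣ card# (slice grp v A)
      extract {x} {y} px py ix le mle = *-cancelˡ (inv x) (inv-pos px) (≤-trans (*-monoʳ y (<⇒≤ py) (≤-trans (level M (mass-pos ν (Xr Q) (proj₁ (proj₂ pick))) (inv-pos px) ix (≤-trans (proj₂ (proj₂ pick)) le))
          (*-monoʳ (pow2 (suc M)) (pow2-≥0 (suc M)) mle)))
        (≤-trans (≤-reflexive (trans (ring 5 λ i j s p y → [] ⊢ ((i :* j) :* s) :* p :* y := (i :* (p :* s)) :* (y :* j)) (*-cancel-1 (inv-r py))))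
          (*-monoˡ (inv x) (inv-≥0 _) (*-monoʳ _ (#-≥0 _) (pow2-mono {suc M} (ℕP.+-monoˡ-≤ M 1≤κ))))))

      hQ-A : hh Q +ᵣ # 1 ≤ᵣ h (inv (card# A)) +ᵣ # M
      hQ-A = lin (1 ∷ 1 ∷ 1 ∷ 1 ∷ []) 6 (λ q o u a C M → (q :+ q :- o :- u :≤ C) ∷ u :≤ q :+ con 9 ∷ C :+ con 10 :≤ M ∷ o :≤ a ∷ [] ⊢ q :+ con 1 :≤ a :+ M)
        bound (≤-trans (hh-⊞-mono unif O) (≤-reflexive (cong (_+ᵣ # 9) (hh-⇒ (⊞-comm {A = unif} {B = O}))))) constant (≤-reflexive hO)
      hQ-U : hh Q +ᵣ # 1 ≤ᵣ h (inv N) +ᵣ # M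
      hQ-U = lin (1 ∷ 1 ∷ 1 ∷ 1 ∷ []) 6 (λ q o u n C M → (q :+ q :- o :- u :≤ C) ∷ o :≤ q :+ con 9 ∷ C :+ con 10 :≤ M ∷ u :≤ n ∷ [] ⊢ q :+ con 1 :≤ n :+ M)
        bound (hh-⊞-mono O unif) constant (≤-reflexive hU)

    -- The distance bound keeps the entropy of the sum Q within M of that of either summand, so a
    -- value v of at least average weight has mass comparable with both 1/|A| and 1/|H|.
    dense-coset : ∃[ H ] ∃[ v ] (card# A ≤ᵣ pow2 (exponent ℕ.* κ) *ᵣ card# (slice H v A) × card# (els H) ≤ᵣ pow2 (exponent ℕ.* κ) *ᵣ card# (slice H v A))
    dense-coset = grp , v , extract {N} {card# A} (card#-pos (has-ε grp)) (card#-pos a₀∈) (inv-≤1 (has-ε grp)) hQ-U (≤-trans mass-v (≤-reflexive (cong (_*ᵣ card# (slice grp v A)) (*-comm _ _)))) ,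
      extract {card# A} {N} (card#-pos a₀∈) (card#-pos (has-ε grp)) (inv-≤1 a₀∈) hQ-A mass-v

-- Polynomials

module PolyLaws (𝔽 : FiniteField) where
  open FiniteField 𝔽
  open PolyRing 𝔽

  private
    ℛ : CommutativeRing _ _
    ℛ = record { isCommutativeRing = isCommutativeRing }
    module ℛ = CommutativeRing ℛ
    module ℛP = Algebra.Properties.Ring ℛ.ring
    module +S = Algebra.Properties.CommutativeSemigroup ℛ.+-commutativeSemigroup

  coeff : List F → ℕ → F
  coeff [] _ = 0#
  coeff (x ∷ xs) zero = x
  coeff (x ∷ xs) (suc n) = coeff xs n

  infix 9 _[_]
  _[_] : Poly → ℕ → F
  p [ n ] = coeff (coeffs p) n

  -- The reason for working coefficientwise: normalisation leaves coefficients unchanged, and by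
  -- `ext` they determine a polynomial.
  norm-at : ∀ xs n → norm xs [ n ] ≡ coeff xs n
  norm-at [] n = refl
  norm-at (x ∷ xs) n with norm xs | norm-at xs
  norm-at (x ∷ xs) (suc n) | mkPoly (y ∷ ys) p | e = e n
  norm-at (x ∷ xs) zero | mkPoly (y ∷ ys) p | e = refl
  norm-at (x ∷ xs) n | mkPoly [] p | e with x ≟ 0#
  norm-at (x ∷ xs) zero | mkPoly [] p | e | yes x0 = sym x0
  norm-at (x ∷ xs) (suc n) | mkPoly [] p | e | yes x0 = e n
  norm-at (x ∷ xs) zero | mkPoly [] p | e | no _ = refl
  norm-at (x ∷ xs) (suc n) | mkPoly [] p | e | no _ = e n

  Normal-tail : ∀ x xs → Normal (x ∷ xs) → Normal xs
  Normal-tail x [] _ = tt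
  Normal-tail x (y ∷ ys) p = p

  at-last : ∀ x xs → Normal (x ∷ xs) → coeff (x ∷ xs) (List.length xs) ≢ 0#
  at-last x [] p = p
  at-last x (y ∷ ys) p = at-last y ys p

  private
    ext-list : ∀ xs ys → .(Normal xs) → .(Normal ys) → (∀ n → coeff xs n ≡ coeff ys n) → xs ≡ ys
    ext-list [] [] _ _ _ = refl
    ext-list [] (y ∷ ys) _ q e = ⊥-elim-irr (at-last y ys q (sym (e (List.length ys))))
    ext-list (x ∷ xs) [] p _ e = ⊥-elim-irr (at-last x xs p (e (List.length xs)))
    ext-list (x ∷ xs) (y ∷ ys) p q e = cong₂ _∷_ (e 0) (ext-list xs ys (Normal-tail x xs p) (Normal-tail y ys q) (λ n → e (suc n)))

    mk-cong : ∀ {xs ys} .{p : Normal xs} .{q : Normal ys} → xs ≡ ys → mkPoly xs p ≡ mkPoly ys q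
    mk-cong refl = refl

  ext : ∀ {p q} → (∀ n → p [ n ] ≡ q [ n ]) → p ≡ q
  ext {mkPoly xs p} {mkPoly ys q} e = mk-cong (ext-list xs ys p q e)

  addL-at : ∀ xs ys n → coeff (addL xs ys) n ≡ coeff xs n + coeff ys n
  addL-at [] ys n = sym (ℛ.+-identityˡ _)
  addL-at (x ∷ xs) [] n = sym (ℛ.+-identityʳ _)
  addL-at (x ∷ xs) (y ∷ ys) zero = refl
  addL-at (x ∷ xs) (y ∷ ys) (suc n) = addL-at xs ys n

  scaleL-at : ∀ c xs n → coeff (scaleL c xs) n ≡ c * coeff xs n
  scaleL-at c [] n = sym (ℛ.zeroʳ c)
  scaleL-at c (x ∷ xs) zero = refl
  scaleL-at c (x ∷ xs) (suc n) = scaleL-at c xs n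

  +P-at : ∀ p q n → (p +P q) [ n ] ≡ p [ n ] + q [ n ]
  +P-at p q n = trans (norm-at (addL (coeffs p) (coeffs q)) n) (addL-at (coeffs p) (coeffs q) n)

  ·P-at : ∀ c p n → (c ·P p) [ n ] ≡ c * p [ n ]
  ·P-at c p n = trans (norm-at (scaleL c (coeffs p)) n) (scaleL-at c (coeffs p) n)

  -P-at : ∀ p n → (-P p) [ n ] ≡ - (p [ n ])
  -P-at p n = trans (·P-at (- 1#) p n) (ℛP.-1*x≈-x _)

  mulL-at : ∀ x xs ys n → coeff (mulL (x ∷ xs) ys) n ≡ x * coeff ys n + coeff (0# ∷ mulL xs ys) n
  mulL-at x xs ys n = trans (addL-at (scaleL x ys) (0# ∷ mulL xs ys) n) (cong (_+ coeff (0# ∷ mulL xs ys) n) (scaleL-at x ys n))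

  shift-cong : ∀ {xs ys} → (∀ n → coeff xs n ≡ coeff ys n) → ∀ n → coeff (0# ∷ xs) n ≡ coeff (0# ∷ ys) n
  shift-cong e zero = refl
  shift-cong e (suc n) = e n

  shift-0 : ∀ {xs} → (∀ n → coeff xs n ≡ 0#) → ∀ n → coeff (0# ∷ xs) n ≡ 0#
  shift-0 e zero = refl
  shift-0 e (suc n) = e n

  mulL-zero : ∀ xs ys → (∀ n → coeff xs n ≡ 0#) → ∀ n → coeff (mulL xs ys) n ≡ 0#
  mulL-zero [] ys e n = refl
  mulL-zero (x ∷ xs) ys e n = trans (mulL-at x xs ys n) (trans (cong₂ _+_ (trans (cong (_* coeff ys n) (e 0)) (ℛ.zeroˡ _)) (shift-0 {mulL xs ys} (mulL-zero xs ys (λ k → e (suc k))) n)) (ℛ.+-identityˡ 0#))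

  mulL-cong : ∀ xs xs' ys → (∀ n → coeff xs n ≡ coeff xs' n) → ∀ n → coeff (mulL xs ys) n ≡ coeff (mulL xs' ys) n
  mulL-cong [] xs' ys e n = sym (mulL-zero xs' ys (λ k → sym (e k)) n)
  mulL-cong (x ∷ xs) [] ys e n = mulL-zero (x ∷ xs) ys e n
  mulL-cong (x ∷ xs) (x' ∷ xs') ys e n = trans (mulL-at x xs ys n) (trans (cong₂ _+_ (cong (_* coeff ys n) (e 0)) (shift-cong {mulL xs ys} {mulL xs' ys} (mulL-cong xs xs' ys (λ k → e (suc k))) n)) (sym (mulL-at x' xs' ys n)))

  mulL-+ : ∀ xs xs' ys n → coeff (mulL (addL xs xs') ys) n ≡ coeff (mulL xs ys) n + coeff (mulL xs' ys) n
  mulL-+ [] xs' ys n = sym (ℛ.+-identityˡ _)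
  mulL-+ (x ∷ xs) [] ys n = sym (ℛ.+-identityʳ _)
  mulL-+ (x ∷ xs) (x' ∷ xs') ys n = trans (mulL-at (x + x') (addL xs xs') ys n) (trans (cong₂ _+_ (ℛ.distribʳ _ x x') (shifted n))
      (trans (+S.interchange _ _ _ _) (sym (cong₂ _+_ (mulL-at x xs ys n) (mulL-at x' xs' ys n)))))
    where
    shifted : ∀ n → coeff (0# ∷ mulL (addL xs xs') ys) n ≡ coeff (0# ∷ mulL xs ys) n + coeff (0# ∷ mulL xs' ys) n
    shifted zero = sym (ℛ.+-identityˡ 0#)
    shifted (suc n) = mulL-+ xs xs' ys n

  mulL-shift : ∀ xs ys n → coeff (mulL (0# ∷ xs) ys) n ≡ coeff (0# ∷ mulL xs ys) n
  mulL-shift xs ys n = trans (mulL-at 0# xs ys n) (trans (cong (_+ coeff (0# ∷ mulL xs ys) n) (ℛ.zeroˡ _)) (ℛ.+-identityˡ _))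

  mulL-const : ∀ c ys n → coeff (mulL (c ∷ []) ys) n ≡ c * coeff ys n
  mulL-const c ys n = trans (mulL-at c [] ys n) (trans (cong (λ z → c * coeff ys n + z) (shift-0 {[]} (λ _ → refl) n)) (ℛ.+-identityʳ _))

  *P-at : ∀ p q n → (p *P q) [ n ] ≡ coeff (mulL (coeffs p) (coeffs q)) n
  *P-at p q n = norm-at (mulL (coeffs p) (coeffs q)) n

  norm-*P : ∀ xs q n → (norm xs *P q) [ n ] ≡ coeff (mulL xs (coeffs q)) n
  norm-*P xs q n = trans (*P-at (norm xs) q n) (mulL-cong (coeffs (norm xs)) xs (coeffs q) (norm-at xs) n)

  tP-at : ∀ p n → (tP *P p) [ n ] ≡ coeff (0# ∷ coeffs p) n
  tP-at p n = trans (norm-*P (0# ∷ 1# ∷ []) p n) (trans (mulL-shift (1# ∷ []) (coeffs p) n) (shift-cong {mulL (1# ∷ []) (coeffs p)} {coeffs p} (λ k → trans (mulL-const 1# (coeffs p) k) (ℛ.*-identityˡ _)) n))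

  +P-assoc : ∀ p q r → (p +P q) +P r ≡ p +P (q +P r)
  +P-assoc p q r = ext λ n → trans (+P-at (p +P q) r n) (trans (cong (_+ r [ n ]) (+P-at p q n)) (trans (ℛ.+-assoc _ _ _) (sym (trans (+P-at p (q +P r) n) (cong (λ z → p [ n ] + z) (+P-at q r n))))))

  +P-comm : ∀ p q → p +P q ≡ q +P p
  +P-comm p q = ext λ n → trans (+P-at p q n) (trans (ℛ.+-comm _ _) (sym (+P-at q p n)))

  +P-idˡ : ∀ p → 0P +P p ≡ p
  +P-idˡ p = ext λ n → trans (+P-at 0P p n) (ℛ.+-identityˡ _)

  +P-invʳ : ∀ p → p -P p ≡ 0P
  +P-invʳ p = ext λ n → trans (+P-at p (-P p) n) (trans (cong (λ z → p [ n ] + z) (-P-at p n)) (ℛ.-‿inverseʳ _))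

  ·P-+P : ∀ c p q → c ·P (p +P q) ≡ (c ·P p) +P (c ·P q)
  ·P-+P c p q = ext λ n → trans (·P-at c (p +P q) n) (trans (cong (c *_) (+P-at p q n)) (trans (ℛ.distribˡ c _ _) (sym (trans (+P-at (c ·P p) (c ·P q) n) (cong₂ _+_ (·P-at c p n) (·P-at c q n))))))

  +-·P : ∀ c d p → (c + d) ·P p ≡ (c ·P p) +P (d ·P p)
  +-·P c d p = ext λ n → trans (·P-at (c + d) p n) (trans (ℛ.distribʳ _ c d) (sym (trans (+P-at (c ·P p) (d ·P p) n) (cong₂ _+_ (·P-at c p n) (·P-at d p n)))))

  *-·P : ∀ c d p → (c * d) ·P p ≡ c ·P (d ·P p)
  *-·P c d p = ext λ n → trans (·P-at (c * d) p n) (trans (ℛ.*-assoc c d _) (sym (trans (·P-at c (d ·P p) n) (cong (c *_) (·P-at d p n)))))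

  1-·P : ∀ p → 1# ·P p ≡ p
  1-·P p = ext λ n → trans (·P-at 1# p n) (ℛ.*-identityˡ _)

  0-·P : ∀ p → 0# ·P p ≡ 0P
  0-·P p = ext λ n → trans (·P-at 0# p n) (ℛ.zeroˡ _)

  ·P-0 : ∀ c → c ·P 0P ≡ 0P
  ·P-0 c = ext λ n → trans (·P-at c 0P n) (ℛ.zeroʳ c)

  ·P-comm : ∀ c d p → c ·P (d ·P p) ≡ d ·P (c ·P p)
  ·P-comm c d p = trans (sym (*-·P c d p)) (trans (cong (_·P p) (ℛ.*-comm c d)) (*-·P d c p))

  tP-+P : ∀ p q → tP *P (p +P q) ≡ (tP *P p) +P (tP *P q)
  tP-+P p q = ext λ n → trans (tP-at (p +P q) n) (trans (shifted n) (sym (trans (+P-at (tP *P p) (tP *P q) n) (cong₂ _+_ (tP-at p n) (tP-at q n)))))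
    where
    shifted : ∀ n → coeff (0# ∷ coeffs (p +P q)) n ≡ coeff (0# ∷ coeffs p) n + coeff (0# ∷ coeffs q) n
    shifted zero = sym (ℛ.+-identityˡ 0#)
    shifted (suc n) = +P-at p q n

  tP-·P : ∀ c p → tP *P (c ·P p) ≡ c ·P (tP *P p)
  tP-·P c p = ext λ n → trans (tP-at (c ·P p) n) (trans (shifted n) (sym (trans (·P-at c (tP *P p) n) (cong (c *_) (tP-at p n)))))
    where
    shifted : ∀ n → coeff (0# ∷ coeffs (c ·P p)) n ≡ c * coeff (0# ∷ coeffs p) n
    shifted zero = sym (ℛ.zeroʳ c)
    shifted (suc n) = ·P-at c p n

  +P-*P : ∀ a b x → (a +P b) *P x ≡ (a *P x) +P (b *P x)
  +P-*P a b x = ext λ n → trans (norm-*P (addL (coeffs a) (coeffs b)) x n) (trans (mulL-+ (coeffs a) (coeffs b) (coeffs x) n)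
    (sym (trans (+P-at (a *P x) (b *P x) n) (cong₂ _+_ (*P-at a x n) (*P-at b x n)))))

  tP-*P : ∀ a x → (tP *P a) *P x ≡ tP *P (a *P x)
  tP-*P a x = ext λ n → trans (*P-at (tP *P a) x n) (trans (mulL-cong (coeffs (tP *P a)) (0# ∷ coeffs a) (coeffs x) (tP-at a) n)
    (trans (mulL-shift (coeffs a) (coeffs x) n) (sym (trans (tP-at (a *P x) n) (shift-cong {coeffs (a *P x)} {mulL (coeffs a) (coeffs x)} (*P-at a x) n)))))

  constP : F → Poly
  constP c = norm (c ∷ [])

  const-*P : ∀ c x → constP c *P x ≡ c ·P x
  const-*P c x = ext λ n → trans (norm-*P (c ∷ []) x n) (trans (mulL-const c (coeffs x) n) (sym (·P-at c x n)))

  DegLt⁻ : ∀ p {n} → DegLt p n → ∀ k → p [ n ℕ.+ k ] ≡ 0#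
  DegLt⁻ p = go (coeffs p)
    where
    go : ∀ xs {n} → List.length xs ℕ.≤ n → ∀ k → coeff xs (n ℕ.+ k) ≡ 0#
    go [] _ k = refl
    go (x ∷ xs) (s≤s l) k = go xs l k

  DegLt⁺ : ∀ p n → (∀ k → p [ n ℕ.+ k ] ≡ 0#) → DegLt p n
  DegLt⁺ (mkPoly [] _) n z = z≤n
  DegLt⁺ (mkPoly (x ∷ xs) p) n z with suc (List.length xs) ℕ.≤? n
  ... | yes l = l
  ... | no l = ⊥-elim-irr (at-last x xs p (trans (cong (coeff (x ∷ xs)) (sym (ℕP.m+[n∸m]≡n (ℕP.≤-pred (ℕP.≰⇒> l))))) (z (List.length xs ℕ.∸ n))))

  DegLt-+P : ∀ p q n → DegLt p n → DegLt q n → DegLt (p +P q) n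
  DegLt-+P p q n l m = DegLt⁺ (p +P q) n λ k → trans (+P-at p q _) (trans (cong₂ _+_ (DegLt⁻ p l k) (DegLt⁻ q m k)) (ℛ.+-identityˡ 0#))

  DegLt-tP : ∀ p n → DegLt p n → DegLt (tP *P p) (suc n)
  DegLt-tP p n l = DegLt⁺ (tP *P p) (suc n) λ k → trans (tP-at p _) (DegLt⁻ p l k)

  DegLt-tP⁻ : ∀ p n → DegLt (tP *P p) n → DegLt p (ℕ.pred n)
  DegLt-tP⁻ p zero l = DegLt⁺ p 0 λ k → trans (sym (tP-at p (suc k))) (DegLt⁻ (tP *P p) l (suc k))
  DegLt-tP⁻ p (suc n) l = DegLt⁺ p n λ k → trans (sym (tP-at p (suc (n ℕ.+ k)))) (DegLt⁻ (tP *P p) l k)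

  DegLt-const : ∀ c n → DegLt (constP c) (suc n)
  DegLt-const c n = DegLt⁺ (constP c) (suc n) λ k → norm-at (c ∷ []) (suc (n ℕ.+ k))

  down : Poly → Poly
  down p = norm (List.drop 1 (coeffs p))

  down-at : ∀ p n → down p [ n ] ≡ p [ suc n ]
  down-at p n = trans (norm-at (List.drop 1 (coeffs p)) n) (drop-at (coeffs p))
    where
    drop-at : ∀ xs → coeff (List.drop 1 xs) n ≡ coeff xs (suc n)
    drop-at [] = refl
    drop-at (x ∷ xs) = refl

  split-const : ∀ p → p ≡ constP (p [ 0 ]) +P (tP *P down p)
  split-const p = ext λ n → sym (trans (+P-at (constP (p [ 0 ])) (tP *P down p) n) (trans (cong₂ _+_ (norm-at (p [ 0 ] ∷ []) n) (tP-at (down p) n)) (go n)))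
    where
    go : ∀ n → coeff (p [ 0 ] ∷ []) n + coeff (0# ∷ coeffs (down p)) n ≡ p [ n ]
    go zero = ℛ.+-identityʳ _
    go (suc n) = trans (ℛ.+-identityˡ _) (down-at p n)

  DegLt-down : ∀ p n → DegLt p (suc n) → DegLt (down p) n
  DegLt-down p n l = DegLt⁺ (down p) n λ k → trans (down-at p (n ℕ.+ k)) (DegLt⁻ p l k)

  DegLt-1 : ∀ p → DegLt p 1 → ∃[ c ] (p ≡ constP c)
  DegLt-1 p l = p [ 0 ] , ext λ { zero → sym (norm-at (p [ 0 ] ∷ []) 0) ; (suc n) → trans (DegLt⁻ p l n) (sym (norm-at (p [ 0 ] ∷ []) (suc n))) }

  private
    _×1 : ℕ → F
    zero ×1 = 0#
    suc n ×1 = 1# + n ×1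

    ×1-+ : ∀ m n → (m ℕ.+ n) ×1 ≡ m ×1 + n ×1
    ×1-+ zero n = sym (ℛ.+-identityˡ _)
    ×1-+ (suc m) n = trans (cong (λ z → 1# + z) (×1-+ m n)) (sym (ℛ.+-assoc _ _ _))

    index-inj : ∀ {x y} (i : x ∈ elements) (j : y ∈ elements) → Any.index i ≡ Any.index j → x ≡ y
    index-inj = ∈SP.index-injective (setoid F)

    repeat : ∃[ i ] ∃[ d ] ((i ℕ.+ suc d) ×1 ≡ i ×1)
    repeat with FinP.pigeonhole (ℕP.n<1+n (List.length elements)) (λ (i : Fin (suc (List.length elements))) → Any.index (complete (toℕ i ×1)))
    ... | i , j , i<j , e = toℕ i , toℕ j ℕ.∸ suc (toℕ i) , trans (cong _×1 (trans (ℕP.+-suc (toℕ i) _) (ℕP.m+[n∸m]≡n i<j))) (sym (index-inj (complete (toℕ i ×1)) (complete (toℕ j ×1)) e))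

  -- The pigeonhole principle on the multiples of 1 gives some d + 1 that vanishes. Its double is
  -- taken to have an exponent of the form m + 2; it is a multiple of the characteristic, not the
  -- characteristic itself.
  char : ∃[ m ] (suc (suc m) ×1 ≡ 0#)
  char with repeat
  ... | i , d , e = d ℕ.+ d , trans (cong _×1 (cong suc (sym (ℕP.+-suc d d)))) (trans (×1-+ (suc d) (suc d)) (trans (cong₂ _+_ z z) (ℛ.+-identityˡ 0#)))
    where
    z : suc d ×1 ≡ 0#
    z = ℛP.+-cancelˡ (i ×1) _ _ (trans (sym (×1-+ i (suc d))) (trans e (sym (ℛ.+-identityʳ _))))

  multiple : ℕ → Poly → Poly
  multiple zero p = 0P
  multiple (suc n) p = p +P multiple n p

  multiple-char : ∀ p → multiple (suc (suc (proj₁ char))) p ≡ 0P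
  multiple-char p = ext λ n → trans (multiple-at (suc (suc (proj₁ char))) n) (trans (cong (_* p [ n ]) (proj₂ char)) (ℛ.zeroˡ _))
    where
    multiple-at : ∀ m n → multiple m p [ n ] ≡ m ×1 * p [ n ]
    multiple-at zero n = sym (ℛ.zeroˡ _)
    multiple-at (suc m) n = trans (+P-at p (multiple m p) n) (trans (cong₂ _+_ (sym (ℛ.*-identityˡ _)) (multiple-at m n)) (sym (ℛ.distribʳ _ 1# (m ×1))))

-- Sums of a subgroup with its image.

module SumsetLift (G : Grp) (φ : Car G → Car G) (φ-∙ : ∀ x y → φ (_∙_ G x y) ≡ _∙_ G (φ x) (φ y)) where
  open Sets G
  private
    _+g_ : Car G → Car G → Car G
    _+g_ = _∙_ G
    -g_ : Car G → Car G
    -g_ = _⁻ G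

  module _ (H : Subgroup) (A₀ : List (Car G)) (uA₀ : Unique A₀) (v : Car G) (in-coset : ∀ {a} → a ∈ A₀ → a +g (-g v) ∈ els H) where
    private
      S : List (Car G)
      S = els H ⊕ List.map φ (els H)
      choice : ∀ z → Dec (z ∈ S) → Car G × Car G
      choice z (yes m) = let (h , _ , _ , m' , _) = ⊕⁻ (els H) (List.map φ (els H)) m ; (h' , _ , _) = ∈P.∈-map⁻ φ m' in h , h'
      choice z (no _) = ε G , ε G
      π π' : Car G → Car G
      π z = proj₁ (choice z (z ∈? S))
      π' z = proj₂ (choice z (z ∈? S))
      spec : ∀ z → z ∈ S → π z ∈ els H × π' z ∈ els H × z ≡ π z +g φ (π' z)
      spec z m = go (z ∈? S)
        where
        go : ∀ d → (let (h , h') = choice z d in h ∈ els H × h' ∈ els H × z ≡ h +g φ h')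
        go (no n) = ⊥-elim (n m)
        go (yes m) = let (h , _ , mh , m' , e) = ⊕⁻ (els H) (List.map φ (els H)) m ; (_ , mh' , e') = ∈P.∈-map⁻ φ m' in mh , mh' , trans e (cong (h +g_) e')

      f : Car G × (Car G × Car G) → (Car G × Car G) × Car G
      f (z , a , b) = (π z +g (a +g (-g v)) , π' z +g (b +g (-g v))) , a +g φ b

      recover : ∀ z a b → z ∈ S → (π z +g (a +g (-g v))) +g φ (π' z +g (b +g (-g v))) ≡ z +g ((a +g φ b) +g ((-g v) +g φ (-g v)))
      recover z a b m = trans (cong ((π z +g (a +g (-g v))) +g_) (trans (φ-∙ _ _) (cong (φ (π' z) +g_) (φ-∙ b _)))) (trans (g-mid G _ _ _ _) (cong₂ _+g_ (sym (proj₂ (proj₂ (spec z m)))) (g-mid G _ _ _ _)))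

      inj : ∀ z a b z' a' b' → z ∈ S → z' ∈ S → f (z , a , b) ≡ f (z' , a' , b') → (z , a , b) ≡ (z' , a' , b')
      inj z a b z' a' b' m m' e = go (g-cancelʳ G _ (trans (sym (recover z a b m)) (trans (cong₂ (λ p q → p +g φ q) e₁ e₂) (trans (recover z' a' b' m') (cong (λ w → z' +g (w +g ((-g v) +g φ (-g v)))) (sym e₃))))))
        where
        e₁ = proj₁ (,-inj (proj₁ (,-inj e)))
        e₂ = proj₂ (,-inj (proj₁ (,-inj e)))
        e₃ = proj₂ (,-inj e)
        go : z ≡ z' → (z , a , b) ≡ (z' , a' , b')
        go refl = cong₂ (λ a b → z , a , b) (g-cancelʳ G (-g v) (g-cancelˡ G (π z) e₁)) (g-cancelʳ G (-g v) (g-cancelˡ G (π' z) e₂))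

    -- Each z gets a fixed representation h + φ h'. The pair (h + a - v, h' + b - v) yields z plus a
    -- + φ b plus a constant, so together with a + φ b it determines z, then h and h', and finally a
    -- and b.
    sumset-lift : card# S *ᵣ (card# A₀ *ᵣ card# A₀) ≤ᵣ (card# (els H) *ᵣ card# (els H)) *ᵣ card# (A₀ ⊕ List.map φ A₀)
    sumset-lift = ≤-trans (≤-reflexive (sym (trans (card#-cart _,_ S AA) (cong (card# S *ᵣ_) (card#-cart _,_ A₀ A₀)))))
        (≤-trans (pigeonhole (pairDec (pairDec (_≟g_ G) (_≟g_ G)) (_≟g_ G)) f {ys = List.cartesianProduct HH (A₀ ⊕ List.map φ A₀)} (UniqueP.cartesianProduct⁺ (⊕-! (els H) _) (UniqueP.cartesianProduct⁺ uA₀ uA₀)) into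
            (λ { {z , a , b} {z' , a' , b'} m m' → inj z a b z' a' b' (proj₁ (∈P.∈-cartesianProduct⁻ S AA m)) (proj₁ (∈P.∈-cartesianProduct⁻ S AA m')) }))
          (≤-reflexive (trans (card#-cart _,_ HH _) (cong (_*ᵣ card# (A₀ ⊕ List.map φ A₀)) (card#-cart _,_ (els H) (els H))))))
      where
      AA HH : List (Car G × Car G)
      AA = List.cartesianProduct A₀ A₀
      HH = List.cartesianProduct (els H) (els H)
      into : ∀ {p} → p ∈ List.cartesianProduct S AA → f p ∈ List.cartesianProduct HH (A₀ ⊕ List.map φ A₀)
      into {z , a , b} m = let (mz , mab) = ∈P.∈-cartesianProduct⁻ S AA m ; (ma , mb) = ∈P.∈-cartesianProduct⁻ A₀ A₀ mab ; (mh , mh' , _) = spec z mz in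
        ∈P.∈-cartesianProduct⁺ (∈P.∈-cartesianProduct⁺ (closed H mh (in-coset ma)) (closed H mh' (in-coset mb))) (⊕⁺ {A₀} {List.map φ A₀} ma (∈P.∈-map⁺ φ mb))

infixr 8 _^ᵣ_
_^ᵣ_ : R → ℕ → R
x ^ᵣ zero = # 1
x ^ᵣ suc n = x *ᵣ x ^ᵣ n

-- Subspaces

record VectorSpace : Set₁ where
  no-eta-equality
  infixr 7 _·_
  field
    G : Grp
    F : Set
    elements : List F
    complete : ∀ c → c ∈ elements
    0f 1f -1f : F
    _+f_ _*f_ : F → F → F
    _·_ : F → Car G → Car G
    ·-+ : ∀ c x y → c · (_∙_ G x y) ≡ _∙_ G (c · x) (c · y)
    +-· : ∀ c d x → (c +f d) · x ≡ _∙_ G (c · x) (d · x)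
    *-· : ∀ c d x → (c *f d) · x ≡ c · (d · x)
    1-· : ∀ x → 1f · x ≡ x
    0-· : ∀ x → 0f · x ≡ ε G
    -1-· : ∀ x → -1f · x ≡ _⁻ G x
    ·-0 : ∀ c → c · ε G ≡ ε G

module Spaces (𝒱 : VectorSpace) where
  open VectorSpace 𝒱
  open Sets G
  private
    infixl 6 _+g_
    _+g_ : Car G → Car G → Car G
    _+g_ = _∙_ G
    -g_ : Car G → Car G
    -g_ = _⁻ G

  record Space : Set where
    field
      group : Subgroup
      closed-· : ∀ c {x} → x ∈ els group → c · x ∈ els group
  open Space public

  pts# : Space → List (Car G)
  pts# V = els (group V)

  spanL : List (Car G) → List (Car G)
  spanL [] = ε G ∷ []
  spanL (g ∷ gs) = List.cartesianProductWith (λ c s → (c · g) +g s) elements (spanL gs)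

  spanL⁺ : ∀ c g gs {s} → s ∈ spanL gs → (c · g) +g s ∈ spanL (g ∷ gs)
  spanL⁺ c g gs m = ∈P.∈-cartesianProductWith⁺ (λ c s → (c · g) +g s) (complete c) m

  spanL⁻ : ∀ g gs {x} → x ∈ spanL (g ∷ gs) → ∃[ c ] ∃[ s ] (s ∈ spanL gs × x ≡ (c · g) +g s)
  spanL⁻ g gs m = let (c , s , _ , ms , e) = ∈P.∈-cartesianProductWith⁻ (λ c s → (c · g) +g s) elements (spanL gs) m in c , s , ms , e

  spanL-ind : (Q : Car G → Set) → Q (ε G) → (∀ {x y} → Q x → Q y → Q (x +g y)) → ∀ gs → (∀ c {g} → g ∈ gs → Q (c · g)) → ∀ {x} → x ∈ spanL gs → Q x
  spanL-ind Q q0 q+ [] qg (here refl) = q0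
  spanL-ind Q q0 q+ (g ∷ gs) qg m = let (c , s , ms , e) = spanL⁻ g gs m in subst Q (sym e) (q+ (qg c (here refl)) (spanL-ind Q q0 q+ gs (λ c m → qg c (there m)) ms))

  spanL-0 : ∀ gs → ε G ∈ spanL gs
  spanL-0 [] = here refl
  spanL-0 (g ∷ gs) = subst (_∈ spanL (g ∷ gs)) (trans (cong (_+g (ε G)) (0-· g)) (g-idˡ G (ε G))) (spanL⁺ 0f g gs (spanL-0 gs))

  spanL-+ : ∀ gs {x y} → x ∈ spanL gs → y ∈ spanL gs → x +g y ∈ spanL gs
  spanL-+ [] (here refl) (here refl) = here (g-idˡ G (ε G))
  spanL-+ (g ∷ gs) m m' = let (c , s , ms , e) = spanL⁻ g gs m ; (c' , s' , ms' , e') = spanL⁻ g gs m' in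
    subst (_∈ spanL (g ∷ gs)) (trans (cong (_+g (s +g s')) (+-· c c' g)) (trans (g-mid G _ _ _ _) (sym (cong₂ _+g_ e e')))) (spanL⁺ _ g gs (spanL-+ gs ms ms'))

  spanL-· : ∀ d gs {x} → x ∈ spanL gs → d · x ∈ spanL gs
  spanL-· d [] (here refl) = here (·-0 d)
  spanL-· d (g ∷ gs) m = let (c , s , ms , e) = spanL⁻ g gs m in
    subst (_∈ spanL (g ∷ gs)) (trans (cong (_+g (d · s)) (*-· d c g)) (sym (trans (cong (d ·_) e) (·-+ d _ s)))) (spanL⁺ _ g gs (spanL-· d gs ms))

  spanL-gen : ∀ gs {g} → g ∈ gs → g ∈ spanL gs
  spanL-gen (g ∷ gs) (here refl) = subst (_∈ spanL (g ∷ gs)) (trans (g-idʳ G _) (1-· g)) (spanL⁺ 1f g gs (spanL-0 gs))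
  spanL-gen (g ∷ gs) (there {x = g} m) = subst (_∈ spanL (g ∷ gs)) (trans (cong (_+g _) (0-· g)) (g-idˡ G _)) (spanL⁺ 0f g gs (spanL-gen gs m))

  mkSpace : (L : List (Car G)) → ε G ∈ L → (∀ {x y} → x ∈ L → y ∈ L → x +g y ∈ L) → (∀ c {x} → x ∈ L → c · x ∈ L) → Space
  mkSpace L z p s = record { group = record { els = dd L ; uniq = dd-! L ; has-ε = dd⁺ z ; closed = λ m m' → dd⁺ (p (dd⁻ L m) (dd⁻ L m')) ; closed⁻ = λ {a} m → subst (_∈ dd L) (-1-· a) (dd⁺ (s -1f (dd⁻ L m))) }
    ; closed-· = λ c m → dd⁺ (s c (dd⁻ L m)) }

  span : List (Car G) → Space
  span gs = mkSpace (spanL gs) (spanL-0 gs) (spanL-+ gs) (λ c → spanL-· c gs)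

-- The span of a dense piece of A.

module Closure (𝒱 : VectorSpace) where
  open VectorSpace 𝒱
  open Sets G
  open Spaces 𝒱
  private
    infixl 6 _+g_
    _+g_ : Car G → Car G → Car G
    _+g_ = _∙_ G
    -g_ : Car G → Car G
    -g_ = _⁻ G

  module Within (A : List (Car G)) (A₀ : List (Car G)) (uA₀ : Unique A₀) {a₀ : Car G} (a₀∈ : a₀ ∈ A₀) (A₀⊆A : ∀ {a} → a ∈ A₀ → a ∈ A)
      (H : Subgroup) (v : Car G) (in-coset : ∀ {a} → a ∈ A₀ → a +g (-g v) ∈ els H)
      (β K₁ : R) (β≥0 : # 0 ≤ᵣ β) (K₁≥0 : # 0 ≤ᵣ K₁) (A-small : card# A ≤ᵣ β *ᵣ card# A₀) (H-small : card# (els H) ≤ᵣ β *ᵣ card# A₀)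
      (A-sum : card# (A ⊕ A) ≤ᵣ K₁ *ᵣ card# A) (A-dilate : ∀ c → card# (A ⊕ List.map (c ·_) A) ≤ᵣ K₁ *ᵣ card# A) where
    private
      α : R
      α = card# A₀
      α>0 : # 0 <ᵣ α
      α>0 = card#-pos a₀∈
      α≥0 : # 0 ≤ᵣ α
      α≥0 = #-≥0 _
      βα≥0 : # 0 ≤ᵣ β *ᵣ α
      βα≥0 = *-≥0 β≥0 α≥0
      α≤A : α ≤ᵣ card# A
      α≤A = pigeonhole (_≟g_ G) id uA₀ A₀⊆A (λ _ _ e → e)
      ⊕-mono : ∀ {X Y X' Y' : List (Car G)} → (∀ {x} → x ∈ X → x ∈ X') → (∀ {x} → x ∈ Y → x ∈ Y') → card# (X ⊕ Y) ≤ᵣ card# (X' ⊕ Y')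
      ⊕-mono {X} {Y} {X'} {Y'} i j = pigeonhole (_≟g_ G) id (⊕-! X Y) (λ m → let (x , y , mx , my , e) = ⊕⁻ X Y m in subst (_∈ X' ⊕ Y') (sym e) (⊕⁺ {X'} {Y'} (i mx) (j my))) (λ _ _ e → e)
      map-mono : ∀ (φ : Car G → Car G) {X Y} → (∀ {x} → x ∈ X → x ∈ Y) → ∀ {x} → x ∈ List.map φ X → x ∈ List.map φ Y
      map-mono φ i m = let (_ , mx , e) = ∈P.∈-map⁻ φ m in subst (_∈ _) (sym e) (∈P.∈-map⁺ φ (i mx))

      diff-H : ∀ {s s'} → s ∈ A₀ → s' ∈ A₀ → s' +g (-g s) ∈ els H
      diff-H {s} {s'} m m' = subst (_∈ els H) (trans (cong ((s' +g (-g v)) +g_) (trans (g-inv-∙ G s (-g v)) (trans (cong ((-g s) +g_) (g-inv-inv G v)) (g-comm G _ _)))) (cancel₁ s' v (-g s)))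
        (closed H (in-coset m') (closed⁻ H (in-coset m)))

      solve : ∀ {b s t s'} → b +g s ≡ t +g s' → b ≡ (s' +g (-g s)) +g t
      solve {b} {s} {t} {s'} e = trans (sym (add-sub b s)) (trans (cong (_+g (-g s)) e) (trans (g-assoc G t s' _) (g-comm G _ _)))

    -- Each λH is covered by at most B translates of H.
    B : R
    B = β *ᵣ β *ᵣ β *ᵣ K₁

    B≥0 : # 0 ≤ᵣ B
    B≥0 = *-≥0 (*-≥0 (*-≥0 β≥0 β≥0) β≥0) K₁≥0

    private
      -- `sumset-lift` turns the hypothesis on A + cA into a bound for H + cH, since A₀ is a dense
      -- part of a coset of H.
      dilate-H : ∀ c → card# (els H ⊕ List.map (c ·_) (els H)) ≤ᵣ B *ᵣ α
      dilate-H c = *-cancelˡ (α *ᵣ α) (*-pos α>0 α>0) (≤-trans (≤-reflexive (*-comm _ _)) (≤-trans (SumsetLift.sumset-lift G (c ·_) (·-+ c) H A₀ uA₀ v in-coset)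
        (≤-trans (*-mono (#-≥0 _) (*-≥0 βα≥0 βα≥0) (*-mono (#-≥0 _) βα≥0 H-small H-small) (≤-trans (⊕-mono A₀⊆A (map-mono (c ·_) A₀⊆A)) (≤-trans (A-dilate c) (*-monoˡ K₁ K₁≥0 A-small))))
          (≤-reflexive (ring 3 λ b a k → [] ⊢ ((b :* a) :* (b :* a)) :* (k :* (b :* a)) := (a :* a) :* (b :* b :* b :* k :* a))))))

      cov : ∀ c → Cover (List.map (c ·_) (els H)) A₀
      cov c = cover (List.map (c ·_) (els H)) A₀ (a₀ , a₀∈)

      cov-size : ∀ c → card# (Cover.T (cov c)) ≤ᵣ B
      cov-size c = *-cancelˡ α α>0 (≤-trans (≤-reflexive (*-comm _ _)) (≤-trans (Cover.size (cov c) uA₀) (≤-trans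
          (pigeonhole (_≟g_ G) (λ x → x +g (-g v)) {ys = els H ⊕ List.map (c ·_) (els H)} (⊕-! _ _) into (λ _ _ e → g-cancelʳ G (-g v) e))
          (≤-trans (dilate-H c) (≤-reflexive (*-comm _ _))))))
        where
        into : ∀ {x} → x ∈ List.map (c ·_) (els H) ⊕ A₀ → x +g (-g v) ∈ els H ⊕ List.map (c ·_) (els H)
        into m = let (y , a , my , ma , e) = ⊕⁻ (List.map (c ·_) (els H)) A₀ m in
          subst (_∈ els H ⊕ List.map (c ·_) (els H)) (trans (g-comm G _ y) (trans (sym (g-assoc G y a _)) (cong (_+g (-g v)) (sym e)))) (⊕⁺ {els H} {List.map (c ·_) (els H)} (in-coset ma) my)

      -- The sum of the sets cH over the listed scalars. With all scalars listed it is closed under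
      -- addition and contains every c h, hence it contains V.
      Z : List F → Car G → Set
      Z [] y = y ≡ ε G
      Z (c ∷ cs) y = ∃[ h ] ∃[ z ] (h ∈ els H × Z cs z × y ≡ (c · h) +g z)

      Z-0 : ∀ cs → Z cs (ε G)
      Z-0 [] = refl
      Z-0 (c ∷ cs) = ε G , ε G , has-ε H , Z-0 cs , sym (trans (cong (_+g ε G) (·-0 c)) (g-idˡ G (ε G)))

      Z-+ : ∀ cs {x y} → Z cs x → Z cs y → Z cs (x +g y)
      Z-+ [] refl refl = g-idˡ G (ε G)
      Z-+ (c ∷ cs) (h , z , mh , mz , e) (h' , z' , mh' , mz' , e') = h +g h' , z +g z' , closed H mh mh' , Z-+ cs mz mz' ,
        trans (cong₂ _+g_ e e') (trans (g-mid G (c · h) z (c · h') z') (cong (_+g (z +g z')) (sym (·-+ c h h'))))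

      Z-gen : ∀ {c cs h} → c ∈ cs → h ∈ els H → Z cs (c · h)
      Z-gen {c} {cs = _ ∷ cs} {h} (here refl) mh = h , ε G , mh , Z-0 cs , sym (g-idʳ G (c · h))
      Z-gen {c} {cs = d ∷ cs} {h} (there m) mh = ε G , c · h , has-ε H , Z-gen m mh , sym (trans (cong (_+g (c · h)) (·-0 d)) (g-idˡ G (c · h)))

      translates : List F → List (Car G)
      translates [] = ε G ∷ []
      translates (c ∷ cs) = List.cartesianProductWith _+g_ (Cover.T (cov c)) (translates cs)

      translates-size : ∀ cs → card# (translates cs) ≤ᵣ B ^ᵣ List.length cs
      translates-size [] = ≤-refl
      translates-size (c ∷ cs) = ≤-trans (≤-reflexive (card#-cart _+g_ (Cover.T (cov c)) (translates cs))) (*-mono (#-≥0 _) B≥0 (cov-size c) (translates-size cs))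

      Z-covered : ∀ cs {y} → Z cs y → ∃[ h ] ∃[ x ] (h ∈ els H × x ∈ translates cs × y ≡ h +g x)
      Z-covered [] e = ε G , ε G , has-ε H , here refl , trans e (sym (g-idˡ G (ε G)))
      Z-covered (c ∷ cs) (h , z , mh , mz , e) = let
          (h' , x' , mh' , mx' , e') = Z-covered cs mz
          (t , s , s' , mt , ms , ms' , eq) = Cover.covers (cov c) (∈P.∈-map⁺ (c ·_) mh)
        in (s' +g (-g s)) +g h' , t +g x' , closed H (diff-H ms ms') mh' , ∈P.∈-cartesianProductWith⁺ _+g_ mt mx' ,
          trans e (trans (cong₂ _+g_ (solve eq) e') (g-mid G _ t h' x'))

    -- Spanned by differences, which lie in H, rather than by A₀ itself, which lies only in a coset
    -- of H.
    V : Space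
    V = span (A₀ ⊝ A₀)

    -- One factor B for each listed scalar; the list belongs to the field, so this remains
    -- polynomial in K₁.
    Γ : R
    Γ = β *ᵣ B ^ᵣ List.length elements

    Γ≥0 : # 0 ≤ᵣ Γ
    Γ≥0 = *-≥0 β≥0 (pow≥0 (List.length elements))
      where
      pow≥0 : ∀ n → # 0 ≤ᵣ B ^ᵣ n
      pow≥0 zero = #-≥0 1
      pow≥0 (suc n) = *-≥0 B≥0 (pow≥0 n)

    V-diff : ∀ {s s'} → s ∈ A₀ → s' ∈ A₀ → s' +g (-g s) ∈ pts# V
    V-diff m m' = dd⁺ (spanL-gen (A₀ ⊝ A₀) (⊝⁺ {A₀} {A₀} m' m))

    V-ind : (Q : Car G → Set) → Q (ε G) → (∀ {x y} → Q x → Q y → Q (x +g y)) → (∀ c {a b} → a ∈ A₀ → b ∈ A₀ → Q (c · (a +g (-g b)))) → ∀ {x} → x ∈ pts# V → Q x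
    V-ind Q q0 q+ qg m = spanL-ind Q q0 q+ (A₀ ⊝ A₀) (λ c m → let (a , b , ma , mb , e) = ⊝⁻ A₀ A₀ m in subst (λ z → Q (c · z)) (sym e) (qg c ma mb)) (dd⁻ (spanL (A₀ ⊝ A₀)) m)

    V-size : card# (pts# V) ≤ᵣ Γ *ᵣ card# A₀
    V-size = ≤-trans (pigeonhole (_≟g_ G) id {ys = List.cartesianProductWith _+g_ (els H) (translates elements)} (uniq (group V)) into (λ _ _ e → e))
      (≤-trans (≤-reflexive (card#-cart _+g_ (els H) (translates elements))) (≤-trans (*-mono (#-≥0 _) βα≥0 H-small (translates-size elements))
        (≤-reflexive (ring 3 λ b a p → [] ⊢ (b :* a) :* p := (b :* p) :* a))))
      where
      into : ∀ {y} → y ∈ pts# V → y ∈ List.cartesianProductWith _+g_ (els H) (translates elements)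
      into {y} m = let (h , x , mh , mx , e) = Z-covered elements (V-ind (Z elements) (Z-0 elements) (λ {x} {y} → Z-+ elements {x} {y}) (λ c ma mb → Z-gen (complete c) (diff-H mb ma)) m) in
        subst (_∈ _) (sym e) (∈P.∈-cartesianProductWith⁺ _+g_ mh mx)

    V-size-A : card# (pts# V) ≤ᵣ Γ *ᵣ card# A
    V-size-A = ≤-trans V-size (*-monoˡ Γ Γ≥0 α≤A)

    A≤V : card# A₀ ≤ᵣ card# (pts# V)
    A≤V = pigeonhole (_≟g_ G) (λ x → x +g (-g a₀)) uA₀ (λ m → V-diff a₀∈ m) (λ _ _ e → g-cancelʳ G (-g a₀) e)

    A-covered : ∃[ X ] (card# X ≤ᵣ K₁ *ᵣ β × (∀ {a} → a ∈ A → ∃[ p ] ∃[ x ] (p ∈ pts# V × x ∈ X × a ≡ p +g x)))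
    A-covered = Cover.T C , *-cancelˡ α α>0 (≤-trans (≤-reflexive (*-comm _ _)) (≤-trans (Cover.size C uA₀) (≤-trans (⊕-mono {A} {A₀} {A} {A} id A₀⊆A) (≤-trans A-sum (≤-trans (*-monoˡ K₁ K₁≥0 A-small)
        (≤-reflexive (ring 3 λ k b a → [] ⊢ k :* (b :* a) := a :* (k :* b))))))))
      , λ m → let (t , s , s' , mt , ms , ms' , e) = Cover.covers C m in s' +g (-g s) , t , V-diff ms ms' , mt , solve e
      where
      C : Cover A A₀
      C = cover A A₀ (a₀ , a₀∈)

    V-covered : ∃[ X ] ((∀ {x} → x ∈ X → x ∈ pts# V) × card# X ≤ᵣ Γ × (∀ {p} → p ∈ pts# V → ∃[ a ] ∃[ b ] ∃[ x ] (a ∈ A × b ∈ A × x ∈ X × p ≡ (a +g (-g b)) +g x)))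
    V-covered = Cover.T C , Cover.T⊆ C , *-cancelˡ α α>0 (≤-trans (≤-reflexive (*-comm _ _)) (≤-trans (Cover.size C uA₀) (≤-trans
          (pigeonhole (_≟g_ G) (λ x → x +g (-g a₀)) {ys = pts# V} (⊕-! _ _) into (λ _ _ e → g-cancelʳ G (-g a₀) e)) (≤-trans V-size (≤-reflexive (*-comm _ _))))))
      , λ m → let (t , s , s' , mt , ms , ms' , e) = Cover.covers C m in s' , s , t , A₀⊆A ms' , A₀⊆A ms , mt , solve e
      where
      C : Cover (pts# V) A₀
      C = cover (pts# V) A₀ (a₀ , a₀∈)
      into : ∀ {x} → x ∈ pts# V ⊕ A₀ → x +g (-g a₀) ∈ pts# V
      into m = let (y , a , my , ma , e) = ⊕⁻ (pts# V) A₀ m in subst (_∈ pts# V) (trans (sym (g-assoc G y a _)) (cong (_+g (-g a₀)) (sym e))) (closed (group V) my (V-diff a₀∈ ma))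

    -- `sumset-lift` with V in place of H: V contains A₀ - a₀, so A₀ lies in a coset of V too. It
    -- will be used for multiplication by t.
    V-map : ∀ (φ : Car G → Car G) → (∀ x y → φ (x +g y) ≡ φ x +g φ y) → ∀ {K₂} → # 0 ≤ᵣ K₂ → card# (A ⊕ List.map φ A) ≤ᵣ K₂ *ᵣ card# A →
      card# (pts# V ⊕ List.map φ (pts# V)) ≤ᵣ card# (pts# V) *ᵣ (Γ *ᵣ K₂ *ᵣ β)
    V-map φ φ-+ {K₂} K₂≥0 small = *-cancelˡ (α *ᵣ α) (*-pos α>0 α>0) (≤-trans (≤-reflexive (*-comm _ _)) (≤-trans (SumsetLift.sumset-lift G φ φ-+ (group V) A₀ uA₀ a₀ (V-diff a₀∈))
      (≤-trans (*-mono (#-≥0 _) (*-≥0 (#-≥0 _) (*-≥0 Γ≥0 α≥0)) (*-monoˡ (card# (pts# V)) (#-≥0 _) V-size) (≤-trans (⊕-mono A₀⊆A (map-mono φ A₀⊆A)) (≤-trans small (*-monoˡ K₂ K₂≥0 A-small))))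
        (≤-reflexive (ring 5 λ w g a k b → [] ⊢ (w :* (g :* a)) :* (k :* (b :* a)) := (a :* a) :* (w :* (g :* k :* b)))))))

-- Subspaces as progressions.

module Kronecker (𝒱 : VectorSpace) (τ : Car (VectorSpace.G 𝒱) → Car (VectorSpace.G 𝒱)) where
  open VectorSpace 𝒱
  open Sets G
  open Spaces 𝒱
  private
    infixl 6 _+g_
    _+g_ : Car G → Car G → Car G
    _+g_ = _∙_ G
    -g_ : Car G → Car G
    -g_ = _⁻ G

  up : List (ℕ × Car G) → List (ℕ × Car G)
  up = List.map (λ (n , x) → suc n , x)

  Positive : List (ℕ × Car G) → Set
  Positive = All (λ (n , _) → 1 ℕ.≤ n)

  -- Progressions enter only through the effect on membership of adding a generator of length 1 and
  -- of raising all lengths by 1.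
  module _ (τ-+ : ∀ x y → τ (x +g y) ≡ τ x +g τ y) (τ-· : ∀ c x → τ (c · x) ≡ c · τ x)
      (ℓ : Car G → ℕ) (ℓ-ε : ℓ (ε G) ≡ 0) (ℓ-τ : ∀ x → x ≢ ε G → ℓ x ℕ.< ℓ (τ x))
      (GP : List (ℕ × Car G) → Car G → Set)
      (GP-[]⁺ : GP [] (ε G)) (GP-[]⁻ : ∀ {y} → GP [] y → y ≡ ε G)
      (GP-1⁺ : ∀ {gs} c x {z} → GP gs z → GP ((1 , x) ∷ gs) (c · x +g z))
      (GP-1⁻ : ∀ {gs x y} → GP ((1 , x) ∷ gs) y → ∃[ c ] ∃[ z ] (GP gs z × y ≡ c · x +g z))
      (GP-up⁺ : ∀ {gs y z} → GP gs y → GP gs z → GP (up gs) (y +g τ z))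
      (GP-up⁻ : ∀ {gs y} → Positive gs → GP (up gs) y → ∃[ z ] ∃[ w ] (GP gs z × GP gs w × y ≡ z +g τ w)) where

    record Describes (V : Space) (gs : List (ℕ × Car G)) : Set where
      field
        positive : Positive gs
        sound : ∀ {y} → y ∈ pts# V → GP gs y
        complete′ : ∀ {y} → GP gs y → y ∈ pts# V
    open Describes

    τ[_] : Space → List (Car G)
    τ[ V ] = List.map τ (pts# V)

    private
      stay? : ∀ V x → Dec (τ x ∈ pts# V)
      stay? V x = τ x ∈? pts# V

    preimage : Space → Space
    preimage V = record
      { group = record { els = List.filter (stay? V) (pts# V) ; uniq = UniqueP.filter⁺ (stay? V) (uniq (group V)) ; has-ε = ∈P.∈-filter⁺ (stay? V) (has-ε (group V)) (subst (_∈ pts# V) τ-ε (has-ε (group V)))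
          ; closed = λ {x} {y} m m' → let (mx , tx) = ∈P.∈-filter⁻ (stay? V) {xs = pts# V} m ; (my , ty) = ∈P.∈-filter⁻ (stay? V) {xs = pts# V} m' in
              ∈P.∈-filter⁺ (stay? V) (closed (group V) mx my) (subst (_∈ pts# V) (sym (τ-+ x y)) (closed (group V) tx ty))
          ; closed⁻ = λ {x} m → subst (_∈ List.filter (stay? V) (pts# V)) (-1-· x) (scale -1f m) }
      ; closed-· = λ c m → scale c m }
      where
      τ-ε : ε G ≡ τ (ε G)
      τ-ε = sym (trans (cong τ (sym (0-· (ε G)))) (trans (τ-· 0f (ε G)) (0-· (τ (ε G)))))
      scale : ∀ c {x} → x ∈ List.filter (stay? V) (pts# V) → c · x ∈ List.filter (stay? V) (pts# V)
      scale c {x} m = let (mx , tx) = ∈P.∈-filter⁻ (stay? V) {xs = pts# V} m in ∈P.∈-filter⁺ (stay? V) (closed-· V c mx) (subst (_∈ pts# V) (sym (τ-· c x)) (closed-· V c tx))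

    preimage⁻ : ∀ V {x} → x ∈ pts# (preimage V) → x ∈ pts# V × τ x ∈ pts# V
    preimage⁻ V m = ∈P.∈-filter⁻ (stay? V) {xs = pts# V} m

    -- rank–nullity for V × V → V + τV
    nullity : ∀ V → card# (pts# V) *ᵣ card# (pts# V) ≤ᵣ card# (pts# V ⊕ τ[ V ]) *ᵣ card# (pts# (preimage V))
    nullity V = ≤-trans (≤-reflexive (sym (card#-cart _,_ (pts# V) (pts# V)))) (≤-trans
        (pigeonhole (pairDec (_≟g_ G) (_≟g_ G)) f {ys = List.cartesianProduct S (pts# (preimage V))} (UniqueP.cartesianProduct⁺ (uniq (group V)) (uniq (group V)))
          (λ { {v , w} m → let (mv , mw) = ∈P.∈-cartesianProduct⁻ (pts# V) (pts# V) m in into v w mv mw }) (λ { {v , w} {v' , w'} _ _ e → inj v w v' w' (,-inj e) }))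
        (≤-reflexive (card#-cart _,_ S (pts# (preimage V)))))
      where
      S : List (Car G)
      S = pts# V ⊕ τ[ V ]
      choice : ∀ z → Dec (z ∈ S) → Car G
      choice z (yes m) = let (_ , _ , _ , m' , _) = ⊕⁻ (pts# V) τ[ V ] m in proj₁ (∈P.∈-map⁻ τ m')
      choice z (no _) = ε G
      π : Car G → Car G
      π z = choice z (z ∈? S)
      spec : ∀ z → z ∈ S → π z ∈ pts# V × ∃[ v ] (v ∈ pts# V × z ≡ v +g τ (π z))
      spec z m = go (z ∈? S)
        where
        go : ∀ d → choice z d ∈ pts# V × ∃[ v ] (v ∈ pts# V × z ≡ v +g τ (choice z d))
        go (no n) = ⊥-elim (n m)
        go (yes m) = let (v , _ , mv , m' , e) = ⊕⁻ (pts# V) τ[ V ] m ; (_ , mw , e') = ∈P.∈-map⁻ τ m' in mw , v , mv , trans e (cong (v +g_) e')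
      f : Car G × Car G → Car G × Car G
      f (v , w) = v +g τ w , w +g (-g π (v +g τ w))
      τ-neg : ∀ x → τ (-g x) ≡ -g τ x
      τ-neg x = trans (cong τ (sym (-1-· x))) (trans (τ-· -1f x) (-1-· (τ x)))
      into : ∀ v w → v ∈ pts# V → w ∈ pts# V → f (v , w) ∈ List.cartesianProduct S (pts# (preimage V))
      into v w mv mw = ∈P.∈-cartesianProduct⁺ mz (∈P.∈-filter⁺ (stay? V) (closed (group V) mw (closed⁻ (group V) (proj₁ sp))) (subst (_∈ pts# V) (sym eq) (closed (group V) (proj₁ (proj₂ (proj₂ sp))) (closed⁻ (group V) mv))))
        where
        z u : Car G
        z = v +g τ w
        mz : z ∈ S
        mz = ⊕⁺ {pts# V} {τ[ V ]} mv (∈P.∈-map⁺ τ mw)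
        sp = spec z mz
        u = proj₁ (proj₂ sp)
        eq : τ (w +g (-g π z)) ≡ u +g (-g v)
        eq = g-cancelʳ G (v +g τ (π z)) (trans (cong (_+g (v +g τ (π z))) (trans (τ-+ w _) (cong (τ w +g_) (τ-neg (π z)))))
          (trans (g-mid G (τ w) _ v _) (trans (cong₂ _+g_ (g-comm G (τ w) v) (trans (g-comm G _ _) (g-invʳ G (τ (π z)))))
            (trans (g-idʳ G z) (trans (proj₂ (proj₂ (proj₂ sp))) (sym (cancel₁ u v (τ (π z)))))))))
      inj : ∀ v w v' w' → (v +g τ w ≡ v' +g τ w') × (w +g (-g π (v +g τ w)) ≡ w' +g (-g π (v' +g τ w'))) → (v , w) ≡ (v' , w')
      inj v w v' w' (e , e') = go (g-cancelʳ G (-g π (v +g τ w)) (trans e' (cong (λ z → w' +g (-g π z)) (sym e)))) e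
        where
        go : w ≡ w' → v +g τ w ≡ v' +g τ w' → (v , w) ≡ (v' , w')
        go refl e = cong (_, w) (g-cancelʳ G (τ w) e)

    -- A nonzero element of maximal degree is moved outside V by τ.
    escape : ∀ V → (∀ {x} → x ∈ pts# V → τ x ∈ pts# V) → ∀ {x} → x ∈ pts# V → x ≡ ε G
    escape V stays {x} mx = decide (_≟g_ G x (ε G))
      where
      top : ∀ xs {x : Car G} → x ∈ xs → ∃[ t ] (t ∈ xs × (∀ {y} → y ∈ xs → ℓ y ℕ.≤ ℓ t))
      top (t ∷ []) _ = t , here refl , λ { (here refl) → ℕP.≤-refl }
      top (a ∷ b ∷ xs) _ = let (t , mt , big) = top (b ∷ xs) (here refl) in pick (ℕP.≤-total (ℓ a) (ℓ t)) mt big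
        where
        pick : ∀ {t} → (ℓ a ℕ.≤ ℓ t) ⊎ (ℓ t ℕ.≤ ℓ a) → t ∈ b ∷ xs → (∀ {y} → y ∈ b ∷ xs → ℓ y ℕ.≤ ℓ t) → ∃[ t ] (t ∈ a ∷ b ∷ xs × (∀ {y} → y ∈ a ∷ b ∷ xs → ℓ y ℕ.≤ ℓ t))
        pick {t} (inj₁ le) mt big = t , there mt , λ { (here refl) → le ; (there m) → big m }
        pick (inj₂ le) mt big = a , here refl , λ { (here refl) → ℕP.≤-refl ; (there m) → ℕP.≤-trans (big m) le }
      maximum : ∃[ t ] (t ∈ pts# V × (∀ {y} → y ∈ pts# V → ℓ y ℕ.≤ ℓ t))
      maximum = top (pts# V) mx
      t : Car G
      t = proj₁ maximum
      t-zero : t ≡ ε G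
      t-zero = go (_≟g_ G t (ε G))
        where
        go : Dec (t ≡ ε G) → t ≡ ε G
        go (yes e) = e
        go (no n) = ⊥-elim (ℕP.<⇒≱ (ℓ-τ t n) (proj₂ (proj₂ maximum) (stays (proj₁ (proj₂ maximum)))))
      decide : Dec (x ≡ ε G) → x ≡ ε G
      decide (yes e) = e
      decide (no n) = ⊥-elim (ℕP.n≮0 (ℕP.<-≤-trans (ℓ-τ x n) (ℕP.≤-trans (proj₂ (proj₂ maximum) (stays mx)) (ℕP.≤-reflexive (trans (cong ℓ t-zero) ℓ-ε)))))

    private
      adjoinL : Car G → Space → List (Car G)
      adjoinL y W = List.cartesianProductWith (λ c w → c · y +g w) elements (pts# W)
      adjoin⁺ : ∀ c y W {w} → w ∈ pts# W → c · y +g w ∈ adjoinL y W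
      adjoin⁺ c y W m = ∈P.∈-cartesianProductWith⁺ (λ c w → c · y +g w) (complete c) m
      adjoin⁻ : ∀ y W {x} → x ∈ adjoinL y W → ∃[ c ] ∃[ w ] (w ∈ pts# W × x ≡ c · y +g w)
      adjoin⁻ y W m = let (c , w , _ , mw , e) = ∈P.∈-cartesianProductWith⁻ (λ c w → c · y +g w) elements (pts# W) m in c , w , mw , e
      zero-coeff : ∀ y w → 0f · y +g w ≡ w
      zero-coeff y w = trans (cong (_+g w) (0-· y)) (g-idˡ G w)

    adjoin : Car G → Space → Space
    adjoin y W = mkSpace (adjoinL y W) (subst (_∈ adjoinL y W) (zero-coeff y (ε G)) (adjoin⁺ 0f y W (has-ε (group W))))
      (λ m m' → let (c , w , mw , e) = adjoin⁻ y W m ; (c' , w' , mw' , e') = adjoin⁻ y W m' in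
        subst (_∈ adjoinL y W) (trans (cong (_+g (w +g w')) (+-· c c' y)) (trans (g-mid G (c · y) (c' · y) w w') (sym (cong₂ _+g_ e e')))) (adjoin⁺ (c +f c') y W (closed (group W) mw mw')))
      (λ d m → let (c , w , mw , e) = adjoin⁻ y W m in
        subst (_∈ adjoinL y W) (trans (cong (_+g d · w) (*-· d c y)) (sym (trans (cong (d ·_) e) (·-+ d (c · y) w)))) (adjoin⁺ (d *f c) y W (closed-· W d mw)))

    -- W and y + W are disjoint parts of the larger space; the factor 2 already makes the rank
    -- logarithmic.
    adjoin-size : ∀ y W → ¬ (y ∈ pts# W) → # 2 *ᵣ card# (pts# W) ≤ᵣ card# (pts# (adjoin y W))
    adjoin-size y W ny = ≤-trans (≤-reflexive (sym (card#-cart _,_ (true ∷ false ∷ []) (pts# W)))) (pigeonhole (_≟g_ G) f (UniqueP.cartesianProduct⁺ {xs = true ∷ false ∷ []} (((λ ()) ∷ []) ∷ [] ∷ []) (uniq (group W)))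
        (λ { {b , w} m → into b w (proj₂ (∈P.∈-cartesianProduct⁻ (true ∷ false ∷ []) (pts# W) m)) })
        (λ { {b , w} {b' , w'} m m' e → inj b w b' w' (proj₂ (∈P.∈-cartesianProduct⁻ (true ∷ false ∷ []) (pts# W) m)) (proj₂ (∈P.∈-cartesianProduct⁻ (true ∷ false ∷ []) (pts# W) m')) e }))
      where
      f : Bool × Car G → Car G
      f (true , w) = w
      f (false , w) = y +g w
      into : ∀ b w → w ∈ pts# W → f (b , w) ∈ pts# (adjoin y W)
      into true w m = dd⁺ (subst (_∈ adjoinL y W) (zero-coeff y w) (adjoin⁺ 0f y W m))
      into false w m = dd⁺ (subst (_∈ adjoinL y W) (cong (_+g w) (1-· y)) (adjoin⁺ 1f y W m))
      outside : ∀ {w w'} → w ∈ pts# W → w' ∈ pts# W → y +g w ≡ w' → ⊥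
      outside {w} {w'} m m' e = ny (subst (_∈ pts# W) (trans (cong (_+g (-g w)) (sym e)) (add-sub y w)) (closed (group W) m' (closed⁻ (group W) m)))
      inj : ∀ b w b' w' → w ∈ pts# W → w' ∈ pts# W → f (b , w) ≡ f (b' , w') → (b , w) ≡ (b' , w')
      inj true w true w' _ _ e = cong (true ,_) e
      inj true w false w' m m' e = ⊥-elim (outside m' m (sym e))
      inj false w true w' m m' e = ⊥-elim (outside m m' e)
      inj false w false w' _ _ e = cong (false ,_) (g-cancelˡ G y e)

    adjoin-describes : ∀ y {W gs} → Describes W gs → Describes (adjoin y W) ((1 , y) ∷ gs)
    adjoin-describes y {W} {gs} D = record { positive = s≤s z≤n ∷ positive D
      ; sound = λ m → let (c , w , mw , e) = adjoin⁻ y W (dd⁻ (adjoinL y W) m) in subst (GP ((1 , y) ∷ gs)) (sym e) (GP-1⁺ {gs} c y (sound D mw))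
      ; complete′ = λ {x} p → let (c , z , pz , e) = GP-1⁻ {gs} {y} {x} p in dd⁺ (subst (_∈ adjoinL y W) (sym e) (adjoin⁺ c y W (complete′ D pz))) }

    -- The last component records that every new generator at least doubles the space, in a form
    -- that composes without subtracting lengths.
    Extension : Space → Space → List (Car G) → List (ℕ × Car G) → Set
    Extension V W ys gs = Σ Space λ W' → Σ (List (ℕ × Car G)) λ gs' → Describes W' gs' × (∀ {x} → x ∈ pts# W → x ∈ pts# W') × (∀ {x} → x ∈ ys → x ∈ pts# W') × (∀ {x} → x ∈ pts# W' → x ∈ pts# V)
      × (pow2 (List.length gs') *ᵣ card# (pts# W) ≤ᵣ pow2 (List.length gs) *ᵣ card# (pts# W'))

    extend : ∀ V ys → (∀ {y} → y ∈ ys → y ∈ pts# V) → ∀ W gs → Describes W gs → (∀ {x} → x ∈ pts# W → x ∈ pts# V) → Extension V W ys gs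
    extend V [] _ W gs D sub = W , gs , D , id , (λ ()) , sub , ≤-refl
    extend V (y ∷ ys) ys⊆ W gs D sub = decide (y ∈? pts# W)
      where
      decide : Dec (y ∈ pts# W) → Extension V W (y ∷ ys) gs
      decide (yes m) = let (W' , gs' , D' , i , c , s , b) = extend V ys (ys⊆ ∘ there) W gs D sub in W' , gs' , D' , i , (λ { (here refl) → i m ; (there m) → c m }) , s , b
      decide (no n) = let (W' , gs' , D' , i , c , s , b) = extend V ys (ys⊆ ∘ there) (adjoin y W) ((1 , y) ∷ gs) (adjoin-describes y {W} D)
                            (λ m → let (c , w , mw , e) = adjoin⁻ y W (dd⁻ (adjoinL y W) m) in subst (_∈ pts# V) (sym e) (closed (group V) (closed-· V c (ys⊆ (here refl))) (sub mw))) in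
        W' , gs' , D' , (λ {x} m → i (dd⁺ (subst (_∈ adjoinL y W) (zero-coeff y x) (adjoin⁺ 0f y W m)))) ,
        (λ { (here refl) → i (dd⁺ (subst (_∈ adjoinL y W) (trans (g-idʳ G _) (1-· y)) (adjoin⁺ 1f y W (has-ε (group W))))) ; (there m) → c m }) , s ,
        lin/ 2 (1 ∷ 1 ∷ []) 5 (λ p w a g x → p :* (con 2 :* w) :≤ p :* a ∷ p :* a :≤ (con 2 :* g) :* x ∷ [] ⊢ p :* w :≤ g :* x)
          (*-monoˡ (pow2 (List.length gs')) (pow2-≥0 (List.length gs')) (adjoin-size y W n)) b

    private
      sumL : Space → List (Car G)
      sumL V = pts# V ⊕ τ[ V ]

    thicken : Space → Space
    thicken V = record { group = record { els = sumL V ; uniq = ⊕-! (pts# V) τ[ V ] ; has-ε = subst (_∈ sumL V) (trans (cong (ε G +g_) τ-ε) (g-idˡ G (ε G))) (mem (has-ε (group V)) (has-ε (group V)))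
        ; closed = λ m m' → let (x , w , mx , mw , e) = mem⁻ m ; (x' , w' , mx' , mw' , e') = mem⁻ m' in
            subst (_∈ sumL V) (trans (cong ((x +g x') +g_) (τ-+ w w')) (trans (g-mid G x x' (τ w) (τ w')) (sym (cong₂ _+g_ e e')))) (mem (closed (group V) mx mx') (closed (group V) mw mw'))
        ; closed⁻ = λ {a} m → subst (_∈ sumL V) (-1-· a) (scale -1f m) } ; closed-· = λ c m → scale c m }
      where
      τ-ε : τ (ε G) ≡ ε G
      τ-ε = trans (cong τ (sym (0-· (ε G)))) (trans (τ-· 0f (ε G)) (0-· (τ (ε G))))
      mem : ∀ {x w} → x ∈ pts# V → w ∈ pts# V → x +g τ w ∈ sumL V
      mem mx mw = ⊕⁺ {pts# V} {τ[ V ]} mx (∈P.∈-map⁺ τ mw)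
      mem⁻ : ∀ {z} → z ∈ sumL V → ∃[ x ] ∃[ w ] (x ∈ pts# V × w ∈ pts# V × z ≡ x +g τ w)
      mem⁻ m = let (x , _ , mx , m' , e) = ⊕⁻ (pts# V) τ[ V ] m ; (w , mw , e') = ∈P.∈-map⁻ τ m' in x , w , mx , mw , trans e (cong (x +g_) e')
      scale : ∀ c {x} → x ∈ sumL V → c · x ∈ sumL V
      scale c m = let (x , w , mx , mw , e) = mem⁻ m in subst (_∈ sumL V) (trans (cong (c · x +g_) (τ-· c w)) (sym (trans (cong (c ·_) e) (·-+ c x (τ w))))) (mem (closed-· V c mx) (closed-· V c mw))

    thicken⁻ : ∀ V {z} → z ∈ pts# (thicken V) → ∃[ x ] ∃[ w ] (x ∈ pts# V × w ∈ pts# V × z ≡ x +g τ w)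
    thicken⁻ V m = let (x , _ , mx , m' , e) = ⊕⁻ (pts# V) τ[ V ] m ; (w , mw , e') = ∈P.∈-map⁻ τ m' in x , w , mx , mw , trans e (cong (x +g_) e')

    thicken-describes : ∀ {V gs} → Describes V gs → Describes (thicken V) (up gs)
    thicken-describes {V} {gs} D = record { positive = AllP.map⁺ (All.map (λ _ → s≤s z≤n) (positive D))
      ; sound = λ m → let (x , w , mx , mw , e) = thicken⁻ V m in subst (GP (up gs)) (sym e) (GP-up⁺ {gs} (sound D mx) (sound D mw))
      ; complete′ = λ {y} p → let (z , w , pz , pw , e) = GP-up⁻ {gs} {y} (positive D) p in subst (_∈ sumL V) (sym e) (⊕⁺ {pts# V} {τ[ V ]} (complete′ D pz) (∈P.∈-map⁺ τ (complete′ D pw))) }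

    Progression : Space → Set
    Progression V = Σ (List (ℕ × Car G)) λ gs → Describes V gs × (pow2 (List.length gs) *ᵣ card# (pts# V) ≤ᵣ card# (pts# V ⊕ τ[ V ]))

    progression : ∀ fuel V → List.length (pts# V) ℕ.≤ fuel → Progression V
    progression zero V le = ⊥-elim (empty (pts# V) le (has-ε (group V)))
      where
      empty : ∀ (xs : List (Car G)) {x} → List.length xs ℕ.≤ 0 → x ∈ xs → ⊥
      empty (_ ∷ _) () _
    progression (suc fuel) V le = decide (Any.any? (λ x → ¬? (stay? V x)) (pts# V))
      where
      decide : Dec (Any.Any (λ x → ¬ (τ x ∈ pts# V)) (pts# V)) → Progression V
      decide (no none) = [] , record { positive = [] ; sound = λ m → subst (GP []) (sym (zero! m)) GP-[]⁺ ; complete′ = λ p → subst (_∈ pts# V) (sym (GP-[]⁻ p)) (has-ε (group V)) } ,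
          ≤-trans (≤-reflexive (*-1ˡ _)) (pigeonhole (_≟g_ G) (_+g τ (ε G)) (uniq (group V)) (λ m → ⊕⁺ {pts# V} {τ[ V ]} m (∈P.∈-map⁺ τ (has-ε (group V)))) (λ _ _ e → g-cancelʳ G (τ (ε G)) e))
        where
        stays : ∀ {x} → x ∈ pts# V → τ x ∈ pts# V
        stays {x} m = go (stay? V x)
          where
          go : Dec (τ x ∈ pts# V) → τ x ∈ pts# V
          go (yes p) = p
          go (no n) = ⊥-elim (none (Any.map (λ { refl → n }) m))
        zero! : ∀ {x} → x ∈ pts# V → x ≡ ε G
        zero! = escape V stays
      decide (yes some) = let
          V' = preimage V
          (gs , D , b) = progression fuel V' (ℕP.≤-pred (ℕP.≤-trans (ListP.filter-notAll (stay? V) (pts# V) some) le))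
          (W , gs' , D' , _ , c , s , b') = extend V (pts# V) id (thicken V') (up gs) (thicken-describes {V'} D)
              (λ m → let (x , w , mx , mw , e) = thicken⁻ V' m in subst (_∈ pts# V) (sym e) (closed (group V) (proj₁ (preimage⁻ V mx)) (proj₂ (preimage⁻ V mw))))
        in gs' , record { positive = positive D' ; sound = λ m → sound D' (c m) ; complete′ = λ p → s (complete′ D' p) } ,
           combine (List.length gs') (List.length gs) (card#-pos (has-ε (group V'))) (#-≥0 _) (nullity V) b
             (≤-trans b' (≤-trans (≤-reflexive (cong (λ k → pow2 k *ᵣ card# (pts# W)) (ListP.length-map _ gs))) (*-monoˡ (pow2 (List.length gs)) (pow2-≥0 (List.length gs)) (pigeonhole (_≟g_ G) id (uniq (group W)) s (λ _ _ e → e)))))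
        where
        -- Here v, v', w and s are the sizes of V, V', V' + τV' and V + τV. The induction hypothesis
        -- 2^r v' ≤ w, the growth 2^l w ≤ 2^r v of the extension and the nullity bound v² ≤ s v'
        -- multiply up, and v' and 2^r cancel.
        combine : ∀ l r {v v' w s} → # 0 <ᵣ v' → # 0 ≤ᵣ v → v *ᵣ v ≤ᵣ s *ᵣ v' → pow2 r *ᵣ v' ≤ᵣ w → pow2 l *ᵣ w ≤ᵣ pow2 r *ᵣ v → pow2 l *ᵣ v ≤ᵣ s
        combine l r {v} {v'} {w} {s} pv' v≥0 n b b' = *-cancelˡ v' pv' (*-cancelˡ (pow2 r) (pow2-pos r) (lin (1 ∷ 1 ∷ 1 ∷ []) 6
          (λ l r v v' w s → r :* (v :* v) :≤ r :* (s :* v') ∷ (l :* v) :* (r :* v') :≤ (l :* v) :* w ∷ v :* (l :* w) :≤ v :* (r :* v) ∷ [] ⊢ r :* (v' :* (l :* v)) :≤ r :* (v' :* s))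
          (*-monoˡ (pow2 r) (pow2-≥0 r) n) (*-monoˡ (pow2 l *ᵣ v) (*-≥0 (pow2-≥0 l) v≥0) b) (*-monoˡ v v≥0 b')))

-- Polynomials as a vector space with multiplication by t.

module PolySpace (𝔽 : FiniteField) where
  open FiniteField 𝔽
  open PolyRing 𝔽
  open PolyLaws 𝔽

  polyGrp : Grp
  polyGrp = record { Car = Poly ; _≟g_ = _≟P_ ; _∙_ = _+P_ ; ε = 0P ; _⁻ = -P_ ; g-assoc = +P-assoc ; g-comm = +P-comm ; g-idˡ = +P-idˡ ; g-invʳ = +P-invʳ }

  polySpace : VectorSpace
  polySpace = record { G = polyGrp ; F = F ; elements = elements ; complete = complete ; 0f = 0# ; 1f = 1# ; -1f = - 1# ; _+f_ = _+_ ; _*f_ = _*_ ; _·_ = _·P_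
    ; ·-+ = ·P-+P ; +-· = +-·P ; *-· = *-·P ; 1-· = 1-·P ; 0-· = 0-·P ; -1-· = λ _ → refl ; ·-0 = ·P-0 }

  poly-torsion : ∀ p → times polyGrp (suc (suc (proj₁ char))) p ≡ 0P
  poly-torsion p = trans (go (suc (suc (proj₁ char)))) (multiple-char p)
    where
    go : ∀ k → times polyGrp k p ≡ multiple k p
    go zero = refl
    go (suc k) = cong (p +P_) (go k)

  private
    mid : ∀ a b c d → (a +P b) +P (c +P d) ≡ (a +P c) +P (b +P d)
    mid = g-mid polyGrp

    neg-+P : ∀ a b → -P (a +P b) ≡ (-P a) +P (-P b)
    neg-+P = g-inv-∙ polyGrp

    sub-+P : ∀ a b c d → (a +P b) -P (c +P d) ≡ (a -P c) +P (b -P d)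
    sub-+P a b c d = trans (cong ((a +P b) +P_) (neg-+P c d)) (mid a b (-P c) (-P d))

    sub-0 : ∀ a → a -P 0P ≡ a
    sub-0 a = trans (cong (a +P_) (·P-0 (- 1#))) (g-idʳ polyGrp a)

    tP-neg : ∀ p → tP *P (-P p) ≡ -P (tP *P p)
    tP-neg = tP-·P (- 1#)

    tP-0 : tP *P 0P ≡ 0P
    tP-0 = trans (cong (tP *P_) (sym (0-·P 0P))) (trans (tP-·P 0# 0P) (0-·P (tP *P 0P)))

    add-back : ∀ a b → (a -P b) +P b ≡ a
    add-back = Sets.sub-add polyGrp

    take-off : ∀ a b → (a +P b) -P b ≡ a
    take-off = Sets.add-sub polyGrp

  InSpan-0 : ∀ as → InSpan as 0P
  InSpan-0 [] = refl
  InSpan-0 (a ∷ as) = 0# , subst (InSpan as) (sym (trans (cong (λ z → 0P -P z) (0-·P a)) (+P-invʳ 0P))) (InSpan-0 as)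

  InSpan-+ : ∀ as {x y} → InSpan as x → InSpan as y → InSpan as (x +P y)
  InSpan-+ [] refl refl = +P-idˡ 0P
  InSpan-+ (a ∷ as) {x} {y} (c , s) (d , s') = c + d , subst (InSpan as) (sym (trans (cong (λ z → (x +P y) -P z) (+-·P c d a)) (sub-+P x y (c ·P a) (d ·P a)))) (InSpan-+ as s s')

  InSpan-· : ∀ e as {x} → InSpan as x → InSpan as (e ·P x)
  InSpan-· e [] refl = ·P-0 e
  InSpan-· e (a ∷ as) {x} (c , s) = e * c , subst (InSpan as) (trans (·P-+P e x (-P (c ·P a))) (cong ((e ·P x) +P_) (trans (·P-comm e (- 1#) (c ·P a)) (cong -P_ (sym (*-·P e c a)))))) (InSpan-· e as s)

  InSpan-∈ : ∀ as {a} → a ∈ as → InSpan as a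
  InSpan-∈ (a ∷ as) (here refl) = 1# , subst (InSpan as) (sym (trans (cong (λ z → a -P z) (1-·P a)) (+P-invʳ a))) (InSpan-0 as)
  InSpan-∈ (a' ∷ as) {a} (there m) = 0# , subst (InSpan as) (sym (trans (cong (λ z → a -P z) (0-·P a')) (sub-0 a))) (InSpan-∈ as m)

  -- Membership in a progression with base point 0, detached from the positivity proof that
  -- `GenProg` carries, so that it can be handled by recursion on the generators.
  Terms : List (ℕ × Poly) → Poly → Set
  Terms [] y = y ≡ 0P
  Terms ((n , x) ∷ gs) y = ∃[ a ] (DegLt a n × Terms gs (y -P (a *P x)))

  toGP : ∀ gs (pos : ∀ {n x} → (n , x) ∈ gs → 1 ℕ.≤ n) {y} → Terms gs y → y ∈GP genProg 0P gs pos
  toGP [] pos e = e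
  toGP (g ∷ gs) pos (a , l , p) = a , l , toGP gs (λ m → pos (there m)) p

  fromGP : ∀ gs (pos : ∀ {n x} → (n , x) ∈ gs → 1 ℕ.≤ n) {y} → y ∈GP genProg 0P gs pos → Terms gs y
  fromGP [] pos e = e
  fromGP (g ∷ gs) pos (a , l , p) = a , l , fromGP gs (λ m → pos (there m)) p

  open Kronecker polySpace (tP *P_)

  Terms-1⁺ : ∀ {gs} c x {z} → Terms gs z → Terms ((1 , x) ∷ gs) ((c ·P x) +P z)
  Terms-1⁺ {gs} c x {z} p = constP c , DegLt-const c 0 , subst (Terms gs) (sym (trans (cong₂ (λ u v → u -P v) (+P-comm (c ·P x) z) (const-*P c x)) (take-off z (c ·P x)))) p

  Terms-1⁻ : ∀ {gs x y} → Terms ((1 , x) ∷ gs) y → ∃[ c ] ∃[ z ] (Terms gs z × y ≡ (c ·P x) +P z)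
  Terms-1⁻ {gs} {x} {y} (a , l , p) = let (c , e) = DegLt-1 a l in c , y -P (a *P x) , p ,
    sym (trans (cong (_+P (y -P (a *P x))) (sym (trans (cong (_*P x) e) (const-*P c x)))) (trans (+P-comm (a *P x) (y -P (a *P x))) (add-back y (a *P x))))

  Terms-up⁺ : ∀ {gs y z} → Terms gs y → Terms gs z → Terms (up gs) (y +P (tP *P z))
  Terms-up⁺ {[]} refl refl = trans (+P-idˡ (tP *P 0P)) tP-0
  Terms-up⁺ {(n , x) ∷ gs} {y} {z} (a , l , p) (b , m , q) = a +P (tP *P b) , DegLt-+P a (tP *P b) (suc n) (ℕP.m≤n⇒m≤1+n l) (DegLt-tP b n m) ,
    subst (Terms (up gs)) (sym (trans (cong (λ w → (y +P (tP *P z)) -P w) (trans (+P-*P a (tP *P b) x) (cong ((a *P x) +P_) (tP-*P b x))))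
      (trans (sub-+P y (tP *P z) (a *P x) (tP *P (b *P x))) (cong ((y -P (a *P x)) +P_) (sym (trans (tP-+P z (-P (b *P x))) (cong ((tP *P z) +P_) (tP-neg (b *P x))))))))) (Terms-up⁺ {gs} p q)

  -- Each coefficient splits as a constant plus t times a polynomial of smaller degree. The constant
  -- must fit the old bound, which is where positive lengths enter.
  Terms-up⁻ : ∀ {gs y} → Positive gs → Terms (up gs) y → ∃[ z ] ∃[ w ] (Terms gs z × Terms gs w × y ≡ z +P (tP *P w))
  Terms-up⁻ {[]} _ refl = 0P , 0P , refl , refl , sym (trans (+P-idˡ (tP *P 0P)) tP-0)
  Terms-up⁻ {(suc n , x) ∷ gs} {y} (_ ∷ pos) (a , l , p) = let
      (z , w , pz , pw , e) = Terms-up⁻ {gs} pos p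
      c = constP (a [ 0 ])
      a' = down a
    in z +P (c *P x) , w +P (a' *P x) ,
      (c , DegLt-const (a [ 0 ]) n , subst (Terms gs) (sym (take-off z (c *P x))) pz) ,
      (a' , DegLt-down a (suc n) l , subst (Terms gs) (sym (take-off w (a' *P x))) pw) ,
      trans (sym (add-back y (a *P x))) (trans (cong₂ _+P_ e (trans (cong (_*P x) (split-const a)) (trans (+P-*P c (tP *P a') x) (cong ((c *P x) +P_) (tP-*P a' x)))))
        (trans (mid z (tP *P w) (c *P x) (tP *P (a' *P x))) (cong ((z +P (c *P x)) +P_) (sym (tP-+P w (a' *P x))))))

  degree : Poly → ℕ
  degree p = List.length (coeffs p)

  degree-t : ∀ p → p ≢ 0P → degree p ℕ.< degree (tP *P p)
  degree-t p nz = ℕP.≰⇒> λ le → nz (zero-degree (drop (degree p) (DegLt-tP⁻ p (degree p) le)))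
    where
    drop : ∀ n → n ℕ.≤ ℕ.pred n → n ≡ 0
    drop zero _ = refl
    drop (suc n) le = ⊥-elim (ℕP.<⇒≱ (ℕP.n<1+n n) le)
    zero-degree : degree p ≡ 0 → p ≡ 0P
    zero-degree e = ext λ n → DegLt⁻ p (ℕP.≤-reflexive e) n

  open Spaces polySpace

  t-progression : ∀ (V : Space) → Σ (List (ℕ × Poly)) λ gs → Positive gs × (∀ {y} → y ∈ pts# V → Terms gs y) × (∀ {y} → Terms gs y → y ∈ pts# V)
    × (pow2 (List.length gs) *ᵣ card# (pts# V) ≤ᵣ card# (Sets._⊕_ polyGrp (pts# V) (List.map (tP *P_) (pts# V))))
  t-progression V = let (gs , D , b) = progression tP-+P tP-·P degree refl degree-t Terms refl id (λ {gs} c x p → Terms-1⁺ {gs} c x p) (λ {gs} {x} {y} → Terms-1⁻ {gs} {x} {y}) (λ {gs} → Terms-up⁺ {gs}) (λ {gs} → Terms-up⁻ {gs}) (List.length (pts# V)) V ℕP.≤-refl in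
    gs , Describes.positive D , Describes.sound D , Describes.complete′ D , b

-- Constants

opaque
  unfolding R

  real : ℚ → R
  real x = x

  real-≤ : ∀ {x y} → x ℚ.≤ y → real x ≤ᵣ real y
  real-≤ p = p

  real-≤⁻ : ∀ {x y} → real x ≤ᵣ real y → x ℚ.≤ y
  real-≤⁻ p = p

  real-* : ∀ x y → real (x ℚ.* y) ≡ real x *ᵣ real y
  real-* x y = refl

  real-ℕ : ∀ n → real (ℕ→ℚ n) ≡ # n
  real-ℕ n = refl

real-^ : ∀ x n → real (x ^ℚ n) ≡ real x ^ᵣ n
real-^ x zero = real-ℕ 1
real-^ x (suc n) = trans (real-* x (x ^ℚ n)) (cong (real x *ᵣ_) (real-^ x n))

from-hyp : ∀ {m n K} → ℕ→ℚ m ℚ.≤ K ℚ.* ℕ→ℚ n → # m ≤ᵣ real K *ᵣ # n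
from-hyp {m} {n} {K} p = subst₂ _≤ᵣ_ (real-ℕ m) (trans (real-* K (ℕ→ℚ n)) (cong (real K *ᵣ_) (real-ℕ n))) (real-≤ p)

to-power : ∀ {m x C} → # m ≤ᵣ real x ^ᵣ C → ℕ→ℚ m ℚ.≤ x ^ℚ C
to-power {m} {x} {C} p = real-≤⁻ (subst₂ _≤ᵣ_ (sym (real-ℕ m)) (sym (real-^ x C)) p)

to-power-* : ∀ {m n x C} → # m ≤ᵣ real x ^ᵣ C *ᵣ # n → ℕ→ℚ m ℚ.≤ (x ^ℚ C) ℚ.* ℕ→ℚ n
to-power-* {m} {n} {x} {C} p = real-≤⁻ (subst₂ _≤ᵣ_ (sym (real-ℕ m)) (sym (trans (real-* (x ^ℚ C) (ℕ→ℚ n)) (cong₂ _*ᵣ_ (real-^ x C) (real-ℕ n)))) p)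

#-pow2 : ∀ n → # (2 ℕ.^ n) ≡ pow2 n
#-pow2 zero = refl
#-pow2 (suc n) = trans (#-* 2 (2 ℕ.^ n)) (cong (# 2 *ᵣ_) (#-pow2 n))

≥1⇒≥0 : ∀ {x} → # 1 ≤ᵣ x → # 0 ≤ᵣ x
≥1⇒≥0 = ≤-trans (#-≥0 1)

^-≥1 : ∀ {x} n → # 1 ≤ᵣ x → # 1 ≤ᵣ x ^ᵣ n
^-≥1 zero p = ≤-refl
^-≥1 (suc n) p = ≤-trans (≤-reflexive (sym (*-1ˡ _))) (*-mono (#-≥0 1) (≥1⇒≥0 p) p (^-≥1 n p))

^-+ : ∀ x m n → x ^ᵣ (m ℕ.+ n) ≡ x ^ᵣ m *ᵣ x ^ᵣ n
^-+ x zero n = sym (*-1ˡ _)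
^-+ x (suc m) n = trans (cong (x *ᵣ_) (^-+ x m n)) (sym (*-assoc x _ _))

^-^ : ∀ x m n → (x ^ᵣ m) ^ᵣ n ≡ x ^ᵣ (n ℕ.* m)
^-^ x m zero = refl
^-^ x m (suc n) = trans (cong (x ^ᵣ m *ᵣ_) (^-^ x m n)) (sym (^-+ x m (n ℕ.* m)))

^-monoˡ : ∀ {x y} n → # 0 ≤ᵣ x → x ≤ᵣ y → x ^ᵣ n ≤ᵣ y ^ᵣ n
^-monoˡ zero _ _ = ≤-refl
^-monoˡ {x} {y} (suc n) p q = *-mono (pow≥0 n) (≤-trans p q) q (^-monoˡ n p q)
  where
  pow≥0 : ∀ n → # 0 ≤ᵣ x ^ᵣ n
  pow≥0 zero = #-≥0 1
  pow≥0 (suc n) = *-≥0 p (pow≥0 n)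

^-monoʳ : ∀ {x m n} → # 1 ≤ᵣ x → m ℕ.≤ n → x ^ᵣ m ≤ᵣ x ^ᵣ n
^-monoʳ {n = n} p z≤n = ^-≥1 n p
^-monoʳ {x} p (s≤s l) = *-monoˡ x (≥1⇒≥0 p) (^-monoʳ p l)

-- κ is a binary logarithm of K rounded up; the last bound converts a power of 2^κ back into a power
-- of K with twice the exponent.
log₂-upper : ∀ K → # 2 ≤ᵣ K → ∃[ κ ] (1 ℕ.≤ κ × K ≤ᵣ pow2 κ × pow2 κ ≤ᵣ K *ᵣ K)
log₂-upper K two = let (n , le) = archimedean K in descend n (≤-trans le (≤-trans (#-mono (ℕP.n≤1+n n)) (pow2-lower n)))
  where
  descend : ∀ n → K ≤ᵣ pow2 n → ∃[ κ ] (1 ℕ.≤ κ × K ≤ᵣ pow2 κ × pow2 κ ≤ᵣ K *ᵣ K)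
  descend zero p = ⊥-elim (<⇒≱ (ι-pos 0) (lin (1 ∷ 1 ∷ []) 1 (λ k → con 2 :≤ k ∷ k :≤ con 1 ∷ [] ⊢ con 1 :≤ con 0) two p))
  descend (suc n) p = decide (K ≤? pow2 n)
    where
    decide : Dec (K ≤ᵣ pow2 n) → ∃[ κ ] (1 ℕ.≤ κ × K ≤ᵣ pow2 κ × pow2 κ ≤ᵣ K *ᵣ K)
    decide (yes q) = descend n q
    decide (no q) = suc n , s≤s z≤n , p , *-mono (pow2-≥0 n) (≤-trans (#-≥0 2) two) two (<⇒≤ (≰⇒> q))

pow2-≤-^ : ∀ {K κ} e → # 0 ≤ᵣ K → pow2 κ ≤ᵣ K *ᵣ K → pow2 (e ℕ.* κ) ≤ᵣ K ^ᵣ (e ℕ.* 2)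
pow2-≤-^ zero _ _ = ≤-refl
pow2-≤-^ {K} {κ} (suc e) p q = ≤-trans (≤-reflexive (pow2-+ κ (e ℕ.* κ))) (≤-trans (*-mono (pow2-≥0 (e ℕ.* κ)) (*-≥0 p p) q (pow2-≤-^ {K} {κ} e p q)) (≤-reflexive (*-assoc K K _)))

inhabited : ∀ {A : Set} (L : List A) {x p} → # 0 <ᵣ x → x ≤ᵣ p *ᵣ card# L → ∃[ a ] (a ∈ L)
inhabited (a ∷ L) _ _ = a , here refl
inhabited [] pos le = ⊥-elim (<⇒≱ pos (≤-trans le (lin [] 1 λ p → [] ⊢ p :* con 0 :≤ con 0)))

-- Bookkeeping in powers of K₁: β = 2^(e κ) is at most K₁^b, B = β³ K₁ is at most K₁^t, and Γ = β
-- B^q. The exponent C is chosen to cover every bound of the theorem.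
module Exponents (e q : ℕ) where
  b t C : ℕ
  b = e ℕ.* 2
  t = b ℕ.+ b ℕ.+ b ℕ.+ 1
  C = suc (b ℕ.+ q ℕ.* t ℕ.+ b)

  module _ {K₁ K₂ β : R} (K₁≥1 : # 1 ≤ᵣ K₁) (K₂≥1 : # 1 ≤ᵣ K₂) (β≥0 : # 0 ≤ᵣ β) (β≤ : β ≤ᵣ K₁ ^ᵣ b) where
    private
      P : ℕ → R
      P n = K₁ ^ᵣ n
      P≥0 : ∀ n → # 0 ≤ᵣ P n
      P≥0 n = ≥1⇒≥0 (^-≥1 n K₁≥1)
      K₁≥0 : # 0 ≤ᵣ K₁
      K₁≥0 = ≥1⇒≥0 K₁≥1
      K₂≥0 : # 0 ≤ᵣ K₂
      K₂≥0 = ≥1⇒≥0 K₂≥1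
      times-β : ∀ {x n} → # 0 ≤ᵣ x → x ≤ᵣ P n → x *ᵣ β ≤ᵣ P (n ℕ.+ b)
      times-β {n = n} p q = ≤-trans (*-mono β≥0 (P≥0 n) q β≤) (≤-reflexive (sym (^-+ K₁ n b)))
      B Γ : R
      B = β *ᵣ β *ᵣ β *ᵣ K₁
      Γ = β *ᵣ B ^ᵣ q
      ββ≥0 : # 0 ≤ᵣ β *ᵣ β
      ββ≥0 = *-≥0 β≥0 β≥0
      B≤ : B ≤ᵣ P t
      B≤ = ≤-trans (*-mono K₁≥0 (P≥0 (b ℕ.+ b ℕ.+ b)) (times-β {n = b ℕ.+ b} ββ≥0 (times-β {n = b} β≥0 β≤)) (≤-reflexive (ring 1 λ k → [] ⊢ k := k :* con 1))) (≤-reflexive (sym (^-+ K₁ (b ℕ.+ b ℕ.+ b) 1)))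
      B≥0 : # 0 ≤ᵣ B
      B≥0 = *-≥0 (*-≥0 ββ≥0 β≥0) K₁≥0
      B^q≥0 : # 0 ≤ᵣ B ^ᵣ q
      B^q≥0 = go q
        where
        go : ∀ n → # 0 ≤ᵣ B ^ᵣ n
        go zero = #-≥0 1
        go (suc n) = *-≥0 B≥0 (go n)
      Γ≤ : Γ ≤ᵣ P (b ℕ.+ q ℕ.* t)
      Γ≤ = ≤-trans (*-mono B^q≥0 (P≥0 b) β≤ (≤-trans (^-monoˡ q B≥0 B≤) (≤-reflexive (^-^ K₁ t q)))) (≤-reflexive (sym (^-+ K₁ b (q ℕ.* t))))
      Γ≥0 : # 0 ≤ᵣ Γ
      Γ≥0 = *-≥0 β≥0 B^q≥0
      K₁≤K : K₁ ≤ᵣ K₁ *ᵣ K₂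
      K₁≤K = ≤-trans (≤-reflexive (trans (sym (*-1ˡ K₁)) (*-comm (# 1) K₁))) (*-monoˡ K₁ K₁≥0 K₂≥1)
      K₂≤K : K₂ ≤ᵣ K₁ *ᵣ K₂
      K₂≤K = ≤-trans (≤-reflexive (sym (*-1ˡ K₂))) (*-monoʳ K₂ K₂≥0 K₁≥1)
      small : ∀ {n} → n ℕ.≤ C → P n ≤ᵣ (K₁ *ᵣ K₂) ^ᵣ C
      small {n} l = ≤-trans (^-monoʳ K₁≥1 l) (^-monoˡ C K₁≥0 K₁≤K)

    Γ-bound : Γ ≤ᵣ K₁ ^ᵣ C
    Γ-bound = ≤-trans Γ≤ (^-monoʳ K₁≥1 (ℕP.m≤n⇒m≤1+n (ℕP.m≤m+n (b ℕ.+ q ℕ.* t) b)))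

    β-bound : β ≤ᵣ (K₁ *ᵣ K₂) ^ᵣ C
    β-bound = ≤-trans β≤ (small (ℕP.m≤n⇒m≤1+n (ℕP.m≤n+m b (b ℕ.+ q ℕ.* t))))

    K₁β-bound : K₁ *ᵣ β ≤ᵣ (K₁ *ᵣ K₂) ^ᵣ C
    K₁β-bound = ≤-trans (*-monoˡ K₁ K₁≥0 β≤) (small {suc b} (s≤s (ℕP.m≤n+m b (b ℕ.+ q ℕ.* t))))

    rank-bound : Γ *ᵣ K₂ *ᵣ β ≤ᵣ (K₁ *ᵣ K₂) ^ᵣ C
    rank-bound = ≤-trans (≤-reflexive (ring 3 λ g k b → [] ⊢ g :* k :* b := k :* (g :* b))) (*-mono (*-≥0 Γ≥0 β≥0) (*-≥0 K₁≥0 K₂≥0) K₂≤K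
      (≤-trans (times-β {n = b ℕ.+ q ℕ.* t} Γ≥0 Γ≤) (^-monoˡ (b ℕ.+ q ℕ.* t ℕ.+ b) K₁≥0 K₁≤K)))

-- The theorem for finite sets of polynomials.

module Assembly (𝔽 : FiniteField) where
  open FiniteField 𝔽 using (F; elements; 1#; -_)
  open PolyRing 𝔽
  open PolyLaws 𝔽
  open PolySpace 𝔽
  open Kronecker polySpace (tP *P_) using (Positive)
  open Sets polyGrp
  open Spaces polySpace
  open SetMarton polyGrp (proj₁ char) poly-torsion
  open Exponents exponent (List.length elements) public using (C)
  private
    module X = Exponents exponent (List.length elements)

  card-dd : ∀ xs → # card xs ≡ card# (dd xs)
  card-dd xs = cong card# (sym (dd-def xs))

  ⊆-card : ∀ {xs ys} → Unique xs → (∀ {x} → x ∈ xs → x ∈ ys) → card# xs ≤ᵣ # card ys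
  ⊆-card {xs} {ys} u i = ≤-trans (pigeonhole _≟P_ id u (λ m → dd⁺ {ys} (i m)) (λ _ _ e → e)) (≤-reflexive (sym (card-dd ys)))

  card-≤-length : ∀ xs → # card xs ≤ᵣ card# xs
  card-≤-length xs = ≤-trans (≤-reflexive (card-dd xs)) (dd-len xs)

  card-unique : ∀ {xs} → Unique xs → card xs ≡ List.length xs
  card-unique {xs} u = ℕP.≤-antisym (#-reflect (card-≤-length xs)) (#-reflect (⊆-card u id))

  sum-card : ∀ A B (φ : Poly → Poly) → (∀ {a b} → a ∈ A → b ∈ A → a +P φ b ∈ B) → card# (dd A ⊕ List.map φ (dd A)) ≤ᵣ # card B
  sum-card A B φ i = ⊆-card (⊕-! (dd A) (List.map φ (dd A))) λ {x} m →
    let (a , _ , ma , m' , e) = ⊕⁻ (dd A) (List.map φ (dd A)) m ; (b , mb , e') = ∈P.∈-map⁻ φ m' in subst (_∈ B) (sym (trans e (cong (a +P_) e'))) (i (dd⁻ A ma) (dd⁻ A mb))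

  -- The logarithmic bound on the rank is expressed by 2^rank, which keeps the statement within the
  -- rationals.
  Conclusion : ℚ → ℚ → List Poly → Set
  Conclusion K₁ K₂ A = ∃[ P ] ∃[ m ] (HasCard P m
    × (∀ y → y ∈GP P → InSpan A y)
    × ℕ→ℚ (2 ℕ.^ rank P) ℚ.≤ (K₁ ℚ.* K₂) ^ℚ C
    × ℕ→ℚ (card A) ℚ.≤ ((K₁ ℚ.* K₂) ^ℚ C) ℚ.* ℕ→ℚ m
    × ℕ→ℚ m ℚ.≤ (K₁ ^ℚ C) ℚ.* ℕ→ℚ (card A)
    × (∃[ X ] (ℕ→ℚ (card X) ℚ.≤ (K₁ ℚ.* K₂) ^ℚ C × (∀ a → a ∈ A → ∃[ p ] ∃[ x ] (p ∈GP P × x ∈ X × a ≡ p +P x))))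
    × (∃[ X′ ] ((∀ x → x ∈ X′ → x ∈GP P) × ℕ→ℚ (card X′) ℚ.≤ K₁ ^ℚ C
        × (∀ p → p ∈GP P → ∃[ a ] ∃[ b ] ∃[ x ] (a ∈ A × b ∈ A × x ∈ X′ × p ≡ (a -P b) +P x)))))

  module _ (K₁ K₂ : ℚ) (two₁ : # 2 ≤ᵣ real K₁) (two₂ : # 2 ≤ᵣ real K₂) (A : List Poly) {a₀ : Poly} (a₀∈ : a₀ ∈ A)
      (dilates : ∀ c → card# (dd A ⊕ List.map (c ·P_) (dd A)) ≤ᵣ real K₁ *ᵣ card# (dd A))
      (t-dilate : card# (dd A ⊕ List.map (tP *P_) (dd A)) ≤ᵣ real K₂ *ᵣ card# (dd A)) where
    private
      k₁ k₂ : R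
      k₁ = real K₁
      k₂ = real K₂
      one₁ : # 1 ≤ᵣ k₁
      one₁ = ≤-trans (#-mono (s≤s z≤n)) two₁
      one₂ : # 1 ≤ᵣ k₂
      one₂ = ≤-trans (#-mono (s≤s z≤n)) two₂
      D : List Poly
      D = dd A
      uD : Unique D
      uD = dd-! A

      doubling : card# (D ⊕ D) ≤ᵣ k₁ *ᵣ card# D
      doubling = ≤-trans (pigeonhole _≟P_ id (⊕-! D D) (λ m → let (a , b , ma , mb , e) = ⊕⁻ D D m in
          subst (_∈ D ⊕ List.map (1# ·P_) D) (sym (trans e (cong (a +P_) (sym (1-·P b))))) (⊕⁺ {D} {List.map (1# ·P_) D} ma (∈P.∈-map⁺ (1# ·P_) mb))) (λ _ _ e → e)) (dilates 1#)

      scale : ∃[ κ ] (1 ℕ.≤ κ × k₁ ≤ᵣ pow2 κ × pow2 κ ≤ᵣ k₁ *ᵣ k₁)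
      scale = log₂-upper k₁ two₁
      κ : ℕ
      κ = proj₁ scale
      β : R
      β = pow2 (exponent ℕ.* κ)
      β≤ : β ≤ᵣ k₁ ^ᵣ X.b
      β≤ = pow2-≤-^ {k₁} {κ} exponent (≥1⇒≥0 one₁) (proj₂ (proj₂ (proj₂ scale)))

      coset : ∃[ H ] ∃[ v ] (card# D ≤ᵣ β *ᵣ card# (slice H v D) × card# (els H) ≤ᵣ β *ᵣ card# (slice H v D))
      coset = dense-coset D uD (dd⁺ a₀∈) κ (proj₁ (proj₂ scale)) (≤-trans doubling (≤-trans (≤-reflexive (*-comm _ _)) (*-monoˡ (card# D) (#-≥0 _) (proj₁ (proj₂ (proj₂ scale))))))
      𝓗 : Subgroup
      𝓗 = proj₁ coset
      v : Poly
      v = proj₁ (proj₂ coset)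
      D₀ : List Poly
      D₀ = slice 𝓗 v D
      some : ∃[ a ] (a ∈ D₀)
      some = inhabited D₀ {p = β} (card#-pos (dd⁺ a₀∈)) (proj₁ (proj₂ (proj₂ coset)))
      D₀⊆D : ∀ {a} → a ∈ D₀ → a ∈ D
      D₀⊆D m = proj₁ (∈P.∈-filter⁻ (inCoset? 𝓗 v) {xs = D} m)

      uD₀ : Unique D₀
      uD₀ = UniqueP.filter⁺ (inCoset? 𝓗 v) uD
      D₀-coset : ∀ {a} → a ∈ D₀ → a -P v ∈ els 𝓗
      D₀-coset m = proj₂ (∈P.∈-filter⁻ (inCoset? 𝓗 v) {xs = D} m)
      β≥0 : # 0 ≤ᵣ β
      β≥0 = pow2-≥0 (exponent ℕ.* κ)

    private
      module L = Closure.Within polySpace D D₀ uD₀ (proj₂ some) D₀⊆D 𝓗 v D₀-coset β k₁ β≥0 (≥1⇒≥0 one₁) (proj₁ (proj₂ (proj₂ coset))) (proj₂ (proj₂ (proj₂ coset))) doubling dilates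

      V : Space
      V = L.V

      gens-of : Σ (List (ℕ × Poly)) λ gs → Positive gs × (∀ {y} → y ∈ pts# V → Terms gs y) × (∀ {y} → Terms gs y → y ∈ pts# V) × (pow2 (List.length gs) *ᵣ card# (pts# V) ≤ᵣ card# (pts# V ⊕ List.map (tP *P_) (pts# V)))
      gens-of = t-progression V
      gs : List (ℕ × Poly)
      gs = proj₁ gens-of
      positive-gs : ∀ {n x} → (n , x) ∈ gs → 1 ℕ.≤ n
      positive-gs m = All.lookup (proj₁ (proj₂ gens-of)) m
      P : GenProg
      P = genProg 0P gs positive-gs
      P⁺ : ∀ {y} → y ∈ pts# V → y ∈GP P
      P⁺ m = toGP gs positive-gs (proj₁ (proj₂ (proj₂ gens-of)) m)
      P⁻ : ∀ {y} → y ∈GP P → y ∈ pts# V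
      P⁻ p = proj₁ (proj₂ (proj₂ (proj₂ gens-of))) (fromGP gs positive-gs p)
      uV : Unique (pts# V)
      uV = uniq (group V)
      V>0 : # 0 <ᵣ card# (pts# V)
      V>0 = card#-pos (has-ε (group V))

      real-K : real (K₁ ℚ.* K₂) ^ᵣ C ≡ (k₁ *ᵣ k₂) ^ᵣ C
      real-K = cong (_^ᵣ C) (real-* K₁ K₂)

      in-span : ∀ {y} → y ∈ pts# V → InSpan A y
      in-span = L.V-ind (InSpan A) (InSpan-0 A) (InSpan-+ A) λ c ma mb →
        InSpan-· c A (InSpan-+ A (InSpan-∈ A (dd⁻ A (D₀⊆D ma))) (InSpan-· (- 1#) A (InSpan-∈ A (dd⁻ A (D₀⊆D mb)))))

      -- |V + tV| is at least 2^rank |V| by the construction of the generators, and at most Γ K₂ β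
      -- |V| by the hypothesis on A + tA.
      rank-small : pow2 (List.length gs) ≤ᵣ L.Γ *ᵣ k₂ *ᵣ β
      rank-small = *-cancelˡ (card# (pts# V)) V>0 (≤-trans (≤-reflexive (*-comm _ _)) (≤-trans (proj₂ (proj₂ (proj₂ (proj₂ gens-of)))) (L.V-map (tP *P_) tP-+P (≥1⇒≥0 one₂) t-dilate)))

      A-lower : card# D ≤ᵣ (k₁ *ᵣ k₂) ^ᵣ C *ᵣ card# (pts# V)
      A-lower = ≤-trans (proj₁ (proj₂ (proj₂ coset))) (*-mono (#-≥0 _) (≤-trans β≥0 (X.β-bound one₁ one₂ β≥0 β≤)) (X.β-bound one₁ one₂ β≥0 β≤) L.A≤V)

    conclusion : Conclusion K₁ K₂ A
    conclusion = P , List.length (pts# V) , (pts# V , refl , (λ y → P⁺) , (λ y → P⁻) , card-unique uV) , (λ y p → in-span (P⁻ p)) ,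
      to-power {x = K₁ ℚ.* K₂} {C = C} (≤-trans (≤-reflexive (#-pow2 (List.length gs))) (≤-trans rank-small (≤-trans (X.rank-bound one₁ one₂ β≥0 β≤) (≤-reflexive (sym real-K))))) ,
      to-power-* {x = K₁ ℚ.* K₂} {C = C} (≤-trans (≤-reflexive (card-dd A)) (≤-trans A-lower (≤-reflexive (cong (_*ᵣ card# (pts# V)) (sym real-K))))) ,
      to-power-* {x = K₁} {C = C} (≤-trans L.V-size-A (*-mono (#-≥0 _) (≤-trans L.Γ≥0 (X.Γ-bound one₁ one₂ β≥0 β≤)) (X.Γ-bound one₁ one₂ β≥0 β≤) (≤-reflexive (sym (card-dd A))))) ,
      cover-A , cover-P
      where
      cover-A : ∃[ X ] (ℕ→ℚ (card X) ℚ.≤ (K₁ ℚ.* K₂) ^ℚ C × (∀ a → a ∈ A → ∃[ p ] ∃[ x ] (p ∈GP P × x ∈ X × a ≡ p +P x)))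
      cover-A = let (X , size , cov) = L.A-covered in X ,
        to-power {x = K₁ ℚ.* K₂} {C = C} (≤-trans (card-≤-length X) (≤-trans size (≤-trans (X.K₁β-bound one₁ one₂ β≥0 β≤) (≤-reflexive (sym real-K))))) ,
        (λ a m → let (p , x , mp , mx , e) = cov (dd⁺ m) in p , x , P⁺ mp , mx , e)
      cover-P : ∃[ X′ ] ((∀ x → x ∈ X′ → x ∈GP P) × ℕ→ℚ (card X′) ℚ.≤ K₁ ^ℚ C × (∀ p → p ∈GP P → ∃[ a ] ∃[ b ] ∃[ x ] (a ∈ A × b ∈ A × x ∈ X′ × p ≡ (a -P b) +P x)))
      cover-P = let (X′ , sub , size , cov) = L.V-covered in X′ , (λ x m → P⁺ (sub m)) , to-power {x = K₁} {C = C} (≤-trans (card-≤-length X′) (≤-trans size (X.Γ-bound one₁ one₂ β≥0 β≤))) ,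
        (λ p mp → let (a , b , x , ma , mb , mx , e) = cov (P⁻ mp) in a , b , x , dd⁻ A ma , dd⁻ A mb , mx , e)

  main : ∀ K₁ K₂ → ℕ→ℚ 2 ℚ.≤ K₁ → ℕ→ℚ 2 ℚ.≤ K₂ → ∀ A → ¬ (A ≡ []) → (∀ (c : F) → ℕ→ℚ (card (sumDil A c A)) ℚ.≤ K₁ ℚ.* ℕ→ℚ (card A)) →
    ℕ→ℚ (card (sumTDil A A)) ℚ.≤ K₂ ℚ.* ℕ→ℚ (card A) → Conclusion K₁ K₂ A
  main K₁ K₂ two₁ two₂ [] ne _ _ = ⊥-elim (ne refl)
  main K₁ K₂ two₁ two₂ A@(_ ∷ _) _ dil tdil = conclusion K₁ K₂ (subst (_≤ᵣ real K₁) (real-ℕ 2) (real-≤ two₁)) (subst (_≤ᵣ real K₂) (real-ℕ 2) (real-≤ two₂)) A (here refl)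
    (λ c → ≤-trans (sum-card A (sumDil A c A) (c ·P_) (∈P.∈-cartesianProductWith⁺ (λ a b → a +P (c ·P b)))) (≤-trans (from-hyp {K = K₁} (dil c)) (≤-reflexive (cong (real K₁ *ᵣ_) (card-dd A)))))
    (≤-trans (sum-card A (sumTDil A A) (tP *P_) (∈P.∈-cartesianProductWith⁺ (λ a b → a +P (tP *P b)))) (≤-trans (from-hyp {K = K₂} tdil) (≤-reflexive (cong (real K₂ *ᵣ_) (card-dd A)))))

open import Data.Nat using (_^_)
open import Data.Rational using (_≤_; _*_)

theorem3 : (𝔽 : FiniteField) →
    let open FiniteField 𝔽 using (F) in
    let open PolyRing 𝔽 in
    ∃[ C ] (1 Data.Nat.≤ C × (∀ (K₁ K₂ : ℚ) → ℕ→ℚ 2 ≤ K₁ → ℕ→ℚ 2 ≤ K₂ →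
    (A : List Poly) → ¬ (A ≡ []) →
    (∀ (c : F) → ℕ→ℚ (card (sumDil A c A)) ≤ K₁ * ℕ→ℚ (card A)) →
    ℕ→ℚ (card (sumTDil A A)) ≤ K₂ * ℕ→ℚ (card A) →
    ∃[ P ] ∃[ m ] (HasCard P m
    × (∀ y → y ∈GP P → InSpan A y)
    × ℕ→ℚ (2 ^ rank P) ≤ (K₁ * K₂) ^ℚ C
    × ℕ→ℚ (card A) ≤ ((K₁ * K₂) ^ℚ C) * ℕ→ℚ m
    × ℕ→ℚ m ≤ (K₁ ^ℚ C) * ℕ→ℚ (card A)
    × (∃[ X ] (ℕ→ℚ (card X) ≤ (K₁ * K₂) ^ℚ C
    × (∀ a → a ∈ A → ∃[ p ] ∃[ x ] (p ∈GP P × x ∈ X × a ≡ p +P x))))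
    × (∃[ X′ ] ((∀ x → x ∈ X′ → x ∈GP P)
    × ℕ→ℚ (card X′) ≤ K₁ ^ℚ C
    × (∀ p → p ∈GP P → ∃[ a ] ∃[ b ] ∃[ x ]
    (a ∈ A × b ∈ A × x ∈ X′ × p ≡ (a -P b) +P x)))))))
theorem3 𝔽 = Assembly.C 𝔽 , s≤s z≤n , Assembly.main 𝔽
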